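{- Assume $q>4$. Let $n$ be an effective divisor on the affine line over $\mathbb F_q$ (an ideal of $A=\mathbb F_q[t]$) and let $v$ be a point of the affine line (a prime of $A$) not in the support of $n$. Then for every prime $l$ not dividing $2q$, the homomorphism $$\alpha=(I,I\circ w_v):\overline{\Gamma_0(v)\cap\Gamma(n)}\to\overline{\Gamma(n)}\oplus\overline{\Gamma(n)}$$ is surjective modulo $l$, i.e. $\alpha\otimes\mathbb Z/l$ is surjective.
   Context: $A=\mathbb F_q[t]$. For an ideal $m$ of $A$: $\Gamma(m)=\{\gamma\in\mathrm{SL}(2,A):\gamma\equiv 1\bmod m\}$ and $\Gamma_0(m)=\{\gamma\in\mathrm{SL}(2,A):\gamma\equiv\begin{pmatrix}*&*\\0&*\end{pmatrix}\bmod m\}$. For a group $\Gamma$, $\bar\Gamma=\Gamma^{ab}/\mathrm{torsion}$. $I:\overline{\Gamma_0(v)\cap\Gamma(n)}\to\overline{\Gamma(n)}$ is the map induced by inclusion. Let $\pi_v\in A$ be the monic irreducible generator of $v$, $\tau_v=\begin{pmatrix}\pi_v&0\\0&1\end{pmatrix}$ and $S=\begin{pmatrix}0&1\\-1&0\end{pmatrix}$. The Atkin–Lehner involution $w_v$ of $\overline{\Gamma_0(v)\cap\Gamma(n)}$ is the automorphism obtained by composing the isomorphism $\overline{\Gamma_0(v)\cap\Gamma(n)}\to\overline{\Gamma^0(v)\cap\Gamma(n)}$ induced by conjugation by $\tau_v$ with the inverse of the isomorphism $\overline{\Gamma_0(v)\cap\Gamma(n)}\to\overline{\Gamma^0(v)\cap\Gamma(n)}$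 induced by conjugation by $S$, where $\Gamma^0(v)=\{\gamma\in\mathrm{SL}(2,A):\gamma\equiv\begin{pmatrix}*&0\\ *&*\end{pmatrix}\bmod v\}$. -}

module Defs where

open import Level using (0ℓ)
open import Data.Nat as ℕ using (ℕ; zero; suc)
open import Data.Fin using (Fin)
open import Data.List using (List; []; _∷_; map)
open import Data.List.Relation.Unary.All using (All)
open import Data.Product using (Σ; ∃; _×_; _,_)
open import Data.Sum using (_⊎_)
open import Relation.Binary.PropositionalEquality using (_≡_; _≢_)
open import Relation.Nullary using (¬_)
open import Algebra.Core using (Op₁; Op₂)
import Algebra.Structures as S

-- A finite field with q elements, realised on the carrier Fin q
-- (every finite field of order q is isomorphic to one of these).
record FiniteField (q : ℕ) : Set where
  field
    _+_ _*_ : Op₂ (Fin q)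
    -_      : Op₁ (Fin q)
    0# 1#   : Fin q
    isCommutativeRing : S.IsCommutativeRing (_≡_ {A = Fin q}) _+_ _*_ -_ 0# 1#
    0≢1     : 0# ≢ 1#
    inverse : ∀ x → x ≢ 0# → ∃ λ y → x * y ≡ 1#

module WithField {q : ℕ} (K : FiniteField q) where
  open FiniteField K renaming (_+_ to _+F_; _*_ to _*F_; -_ to -F_)

  F : Set
  F = Fin q

  -- A = F_q[t]: polynomials as coefficient lists (constant term first),
  -- compared coefficientwise (trailing zeros irrelevant).
  Poly : Set
  Poly = List F

  coeff : Poly → ℕ → F
  coeff []       _       = 0#
  coeff (x ∷ xs) zero    = x
  coeff (x ∷ xs) (suc i) = coeff xs i

  infix 4 _≈_
  _≈_ : Poly → Poly → Set
  p ≈ r = ∀ i → coeff p i ≡ coeff r i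

  0P 1P : Poly
  0P = []
  1P = 1# ∷ []

  infixl 6 _+P_ _-P_
  infixl 7 _*P_
  _+P_ : Poly → Poly → Poly
  []       +P ys       = ys
  (x ∷ xs) +P []       = x ∷ xs
  (x ∷ xs) +P (y ∷ ys) = (x +F y) ∷ (xs +P ys)

  -P_ : Poly → Poly
  -P_ = map -F_

  _-P_ : Poly → Poly → Poly
  p -P r = p +P (-P r)

  _*P_ : Poly → Poly → Poly
  []       *P ys = []
  (x ∷ xs) *P ys = map (x *F_) ys +P (0# ∷ (xs *P ys))

  _∣P_ : Poly → Poly → Set
  m ∣P p = ∃ λ k → p ≈ k *P m

  Unit : Poly → Set
  Unit p = ∃ λ u → p *P u ≈ 1P

  Monic : Poly → Set
  Monic p = ∃ λ d → coeff p d ≡ 1# × (∀ i → d ℕ.< i → coeff p i ≡ 0#)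

  Irreducible : Poly → Set
  Irreducible p = ¬ (p ≈ 0P) × ¬ Unit p ×
                  (∀ f g → p ≈ f *P g → Unit f ⊎ Unit g)

  record Mat : Set where
    constructor mat
    field a b c d : Poly
  open Mat public

  infix 4 _≈M_
  _≈M_ : Mat → Mat → Set
  g ≈M h = (a g ≈ a h) × (b g ≈ b h) × (c g ≈ c h) × (d g ≈ d h)

  infixl 7 _·_
  _·_ : Mat → Mat → Mat
  g · h = mat (a g *P a h +P b g *P c h) (a g *P b h +P b g *P d h)
              (c g *P a h +P d g *P c h) (c g *P b h +P d g *P d h)

  1M : Mat
  1M = mat 1P 0P 0P 1P

  -- inverse in SL(2,A) (adjugate)
  _⁻¹ : Mat → Mat
  g ⁻¹ = mat (d g) (-P b g) (-P c g) (a g)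

  _^_ : Mat → ℕ → Mat
  g ^ zero  = 1M
  g ^ suc k = g · (g ^ k)

  det : Mat → Poly
  det g = a g *P d g -P b g *P c g

  InSL2 : Mat → Set
  InSL2 g = det g ≈ 1P

  Γ : Poly → Mat → Set
  Γ m g = InSL2 g × m ∣P (a g -P 1P) × m ∣P b g × m ∣P c g × m ∣P (d g -P 1P)

  Γ₀∩Γ : Poly → Poly → Mat → Set
  Γ₀∩Γ π m g = Γ m g × π ∣P c g

  commProd : List (Mat × Mat) → Mat
  commProd []            = 1M
  commProd ((x , y) ∷ cs) = x · y · x ⁻¹ · y ⁻¹ · commProd cs

  InComm : (Mat → Set) → Mat → Set
  InComm G g = ∃ λ (cs : List (Mat × Mat)) →
                 All (λ xy → G (Data.Product.proj₁ xy) × G (Data.Product.proj₂ xy)) cs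
                 × g ≈M commProd cs

  -- g (in G) maps to 0 in Ḡ = G^ab / torsion  iff  g^N ∈ [G,G] for some N ≥ 1
  TrivialInBar : (Mat → Set) → Mat → Set
  TrivialInBar G g = ∃ λ N → InComm G (g ^ suc N)

  -- (I ∘ w_v)(γ) is represented by S⁻¹ τ_v γ τ_v⁻¹ S = (d , -c/π ; -π b , a);
  -- here c' is c/π (c ≈ π c').
  wv : Poly → Poly → Mat → Mat
  wv π c' g = mat (d g) (-P c') (-P (π *P b g)) (a g)

{-# OPTIONS --safe #-}
module Submission where

-- Let M be the cokernel of α ⊗ ℤ/l, computed with Γ(n)^ab instead of its torsion-free quotient.
-- The two summands give homomorphisms φ₁, φ₂ : Γ(n) → M with φ₁(γ) = −φ₂(w γ) on Γ₀(v) ∩ Γ(n),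
-- and both have to vanish.  Up to conjugation by S, the pair (−φ₂, φ₁) is linked by conjugation
-- with diag(π, 1).  Such a pair extends to a chain χ₀, χ₁, χ₂, … whose members χ₀ and χₖ are linked by
-- conjugation with diag(πᵏ, 1).  Since l ≠ p, every χᵢ kills unipotents and so depends on the first
-- column only; comparing χ₀ with χₖ where πᵏ ≡ 1 modulo two suitable elements shows that they are
-- invariant under elementary matrices, hence under SL₂(A).
--
-- An SL₂(A)-invariant χ : Γ(n) → M extends to Γ(n/ρ) for every prime ρ ∣ n.  If ρ² ∣ n, then
-- Γ(n/ρ)/Γ(n) is a p-group and χ(gᵖ)/p does it.  Otherwise the pushout of Γ(n/ρ) along χ is a central
-- extension by M of SL₂ of the finite field A/ρ, and it splits: units of a finite field are cyclic,
-- so the torus lifts, and the Bruhat normal forms become a complement of M.  At n = 1 the group is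
-- generated by elements of order p, so χ = 0.

open import Algebra using (AbelianGroup; CommutativeRing; Group; Monoid)
open import Data.Fin.Base as Fin using (Fin; toℕ; fromℕ<)
import Data.Fin.Properties as Fin
open import Data.List.Base using (List; []; _∷_; _++_; map)
open import Data.List.Relation.Unary.All using (All; []; _∷_)
open import Data.Nat.Base as ℕ using (ℕ; zero; suc)
import Data.Nat.Divisibility as ℕ
open import Data.Nat.Induction using (<-wellFounded)
open import Data.Nat.Primality using (Prime; prime⇒nonZero; prime⇒nonTrivial; prime[2])
import Data.Nat.Properties as ℕ
open import Data.Product using (∃; ∃₂; Σ; _×_; _,_; proj₁; proj₂)
open import Data.Sum using (_⊎_; inj₁; inj₂; [_,_]′)
open import Function using (_∘_)
open import Induction.WellFounded using (Acc; acc)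
open import Level using (0ℓ)
open import Relation.Binary.PropositionalEquality as ≡ using (_≡_; _≢_)
open import Relation.Nullary using (¬_; Dec; yes; no; contradiction)
open import Relation.Nullary.Decidable using (¬?; _×-dec_; map′)
import Algebra.Construct.DirectProduct
import Algebra.Properties.AbelianGroup
import Algebra.Properties.CommutativeMonoid.Mult
import Algebra.Properties.CommutativeSemigroup
import Algebra.Properties.Group
import Algebra.Properties.Monoid.Mult
import Algebra.Properties.Semiring.Mult
import Relation.Binary.Reasoning.Setoid
import Tactic.MonoidSolver as MonoidSolver
open import Defs

-- A linked pair amounts to a homomorphism on the principal congruence subgroup of level n in
-- SL₂(A[1/π]), which is the amalgam of two copies of Γ(n) along Γ₀(v) ∩ Γ(n). A single homomorphism
-- on Γ(n) has no reason to vanish, since A has only finitely many units. The pair brings in the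
-- unit π of infinite order, and the chain lets its powers act without leaving A. The comparison
-- needs πᵏ ≡ 1 modulo two elements of prescribed residue classes. Primes in these classes would
-- call for Dirichlet's theorem. Squarefree elements are enough if k has the form p^K - 1.
-- Squarefreeness can be read off from the derivative, and adding p-th powers does not change a
-- derivative, which leaves the freedom to find such elements. In the splitting, l ≠ p and l ≠ 2
-- have separate tasks: without p-torsion in M the lifts of unipotents are canonical, and without
-- 2-torsion so are suitably normalised lifts of the torus.

module Naturals where

  open import Data.Nat.Base
  open import Data.Nat.Properties
  open import Data.Nat.Combinatorics using (_C_; nCk≡n!/k![n-k]!; k![n∸k]!∣n!)
  open import Data.Nat.Coprimality using (Coprime; coprime-Bézout)
  open import Data.Nat.Divisibility
  open import Data.Nat.DivMod using (m/n*n≡m)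
  open import Data.Nat.GCD using (module Bézout)
  open import Data.Nat.Induction using (<-rec)
  open import Data.Nat.Primality
  open import Relation.Binary.PropositionalEquality

  prime∣!⇒≤ : ∀ {p} n → Prime p → p ∣ n ! → p ≤ n
  prime∣!⇒≤ {p} zero pr d = contradiction (∣1⇒≡1 d) (λ { refl → ¬prime[1] pr })
  prime∣!⇒≤ (suc n) pr d with euclidsLemma (suc n) (n !) pr d
  ... | inj₁ d′ = ∣⇒≤ d′
  ... | inj₂ d′ = m≤n⇒m≤1+n (prime∣!⇒≤ n pr d′)

  C-factorials : ∀ {n k} → k ≤ n → (n C k) * (k ! * (n ∸ k) !) ≡ n !
  C-factorials {n} {k} k≤n =
    trans (cong (_* (k ! * (n ∸ k) !)) (nCk≡n!/k![n-k]! k≤n))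
          (m/n*n≡m {{k !* (n ∸ k) !≢0}} (k![n∸k]!∣n! k≤n))

  n∣n! : ∀ n → .{{NonZero n}} → n ∣ n !
  n∣n! (suc n) = divides (n !) (*-comm (suc n) (n !))

  prime∣C : ∀ {p k} → Prime p → 0 < k → k < p → p ∣ p C k
  prime∣C {p} {k} pr 0<k k<p
    with euclidsLemma (p C k) (k ! * (p ∸ k) !) pr
           (subst (p ∣_) (sym (C-factorials (<⇒≤ k<p))) (n∣n! p {{prime⇒nonZero pr}}))
  ... | inj₁ d = d
  ... | inj₂ d with euclidsLemma (k !) ((p ∸ k) !) pr d
  ...   | inj₁ e = contradiction (prime∣!⇒≤ k pr e) (<⇒≱ k<p)
  ...   | inj₂ e = contradiction (prime∣!⇒≤ (p ∸ k) pr e) (<⇒≱ (∸-monoʳ-< 0<k (<⇒≤ k<p)))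

  ∤⇒coprime : ∀ {p n} → Prime p → ¬ (p ∣ n) → Coprime p n
  ∤⇒coprime {p} pr p∤n {d} (d∣p , d∣n) with prime⇒irreducible pr d∣p
  ... | inj₁ d≡1 = d≡1
  ... | inj₂ refl = contradiction d∣n p∤n

  prime-coprime : ∀ {p l} → Prime p → Prime l → p ≢ l → Coprime p l
  prime-coprime {p} {l} pr lr p≢l = ∤⇒coprime pr λ p∣l → case (prime⇒irreducible lr p∣l)
    where
    case : ¬ (p ≡ 1 ⊎ p ≡ l)
    case (inj₁ refl) = ¬prime[1] pr
    case (inj₂ p≡l) = p≢l p≡l

  extract-power : ∀ {l} → Prime l → ∀ n → 0 < n → ∃₂ λ e m → n ≡ m * l ^ e × ¬ (l ∣ m)
  extract-power {l} lr = <-rec _ go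
    where
    go : ∀ n → (∀ {m} → m < n → 0 < m → ∃₂ λ e m′ → m ≡ m′ * l ^ e × ¬ (l ∣ m′)) →
         0 < n → ∃₂ λ e m → n ≡ m * l ^ e × ¬ (l ∣ m)
    go n rec 0<n with l ∣? n
    ... | no  l∤n = 0 , n , sym (*-identityʳ n) , l∤n
    ... | yes (divides zero refl) = contradiction 0<n (λ ())
    ... | yes (divides k@(suc k′) refl)
      with rec {k} (m<m*n k l (nonTrivial⇒n>1 l {{prime⇒nonTrivial lr}})) (s≤s z≤n)
    ...   | e , m , eq , l∤m = suc e , m , trans (cong (_* l) eq) (trans (*-assoc m (l ^ e) l) (cong (m *_) (*-comm (l ^ e) l))) , l∤m

  module _ (M : Monoid 0ℓ 0ℓ) where
    open Monoid M renaming (refl to ≈-refl; sym to ≈-sym; trans to ≈-trans)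
    open import Algebra.Properties.Monoid.Mult M renaming (_×_ to _·_)

    n·ε≈ε : ∀ n → n · ε ≈ ε
    n·ε≈ε zero = ≈-refl
    n·ε≈ε (suc n) = ≈-trans (identityˡ _) (n·ε≈ε n)

    private
      multiple : ∀ {x} a b → b · x ≈ ε → (a * b) · x ≈ ε
      multiple {x} a b b·x≈ε = ≈-trans (≈-sym (×-assocˡ x a b)) (≈-trans (×-congʳ a b·x≈ε) (n·ε≈ε a))

    -- Bézout. Only multiples of the one element x occur, so commutativity is not involved and the
    -- lemma also serves for multiplicative orders.
    torsion-coprime : ∀ {a b x} → Coprime a b → a · x ≈ ε → b · x ≈ ε → x ≈ ε
    torsion-coprime {a} {b} {x} cop ax bx with coprime-Bézout cop
    ... | Bézout.+- u v eq =
      ≈-trans (≈-sym (identityʳ x)) (≈-trans (∙-congˡ (≈-sym (multiple v b bx)))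
        (≈-trans (×-congˡ eq) (multiple u a ax)))
    ... | Bézout.-+ u v eq =
      ≈-trans (≈-sym (identityʳ x)) (≈-trans (∙-congˡ (≈-sym (multiple u a ax)))
        (≈-trans (×-congˡ eq) (multiple v b bx)))

  module _ (M : AbelianGroup 0ℓ 0ℓ) where
    open AbelianGroup M renaming (refl to ≈-refl; sym to ≈-sym; trans to ≈-trans)
    open import Algebra.Properties.AbelianGroup M using (⁻¹-∙-comm; ε⁻¹≈ε; inverseˡ-unique)
    open import Algebra.Properties.Monoid.Mult monoid renaming (_×_ to _·_)

    ·-⁻¹ : ∀ n x → n · (x ⁻¹) ≈ (n · x) ⁻¹
    ·-⁻¹ zero    x = ≈-sym ε⁻¹≈ε
    ·-⁻¹ (suc n) x = ≈-trans (∙-congˡ (·-⁻¹ n x)) (⁻¹-∙-comm x (n · x))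

    coprime-divisible : ∀ {k n} → Coprime k n → (∀ x → n · x ≈ ε) → ∀ x → ∃ λ y → k · y ≈ x
    coprime-divisible {k} {n} cop nM≈ε x with coprime-Bézout cop
    ... | Bézout.+- u v eq = u · x , ≈-trans (×-assocˡ x k u) (≈-trans (×-congˡ (trans (*-comm k u) (sym eq)))
            (≈-trans (∙-congˡ (≈-trans (≈-sym (×-assocˡ x v n)) (≈-trans (×-congʳ v (nM≈ε x)) (n·ε≈ε monoid v)))) (identityʳ x)))
    ... | Bézout.-+ u v eq = (u · x) ⁻¹ , ≈-trans (·-⁻¹ k (u · x)) (≈-sym (inverseˡ-unique x _
            (≈-trans (∙-congˡ (×-assocˡ x k u)) (≈-trans (×-congˡ (trans (cong suc (*-comm k u)) eq))
              (≈-trans (≈-sym (×-assocˡ x v n)) (≈-trans (×-congʳ v (nM≈ε x)) (n·ε≈ε monoid v)))))))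

open Naturals

-- Identities and divisibility in commutative rings

module RingSolver (R : CommutativeRing 0ℓ 0ℓ) where

  open import Data.Integer.Base as ℤ using (ℤ; +_; -[1+_]; +0; +[1+_])
  import Data.Integer.Properties as ℤ
  open import Data.Maybe.Base using (just; nothing)
  open import Relation.Binary.Definitions using (WeaklyDecidable)
  open import Algebra.Solver.Ring.AlmostCommutativeRing

  open CommutativeRing R
  open import Algebra.Properties.Ring ring
  open import Algebra.Properties.AbelianGroup +-abelianGroup using (⁻¹-∙-comm; ⁻¹-involutive; ε⁻¹≈ε)
  open import Algebra.Properties.Semiring.Mult.TCOptimised semiring using (×-homo-+) renaming (_×_ to _·_)
  open import Relation.Binary.Reasoning.Setoid setoid

  private
    -- Integer coefficients let the solver cancel terms. The multiples used here satisfy 1 · x = x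
    -- by computation, so the constant 1 evaluates to `1#` itself.
    embed : ℤ → Carrier
    embed (+ n)    = n · 1#
    embed -[1+ n ] = - (suc n · 1#)

    shift : ∀ x y z → (z + x) + - (z + y) ≈ x + - y
    shift x y z = begin
      (z + x) + - (z + y)     ≈⟨ +-cong (+-comm z x) (sym (⁻¹-∙-comm z y)) ⟩
      (x + z) + (- z + - y)   ≈⟨ +-assoc x z _ ⟩
      x + (z + (- z + - y))   ≈⟨ +-congˡ (sym (+-assoc z _ _)) ⟩
      x + ((z + - z) + - y)   ≈⟨ +-congˡ (+-congʳ (-‿inverseʳ z)) ⟩
      x + (0# + - y)          ≈⟨ +-congˡ (+-identityˡ _) ⟩
      x + - y                 ∎

    1+· : ∀ n → suc n · 1# ≈ 1# + n · 1#
    1+· n = ×-homo-+ 1# 1 n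

    embed-⊖ : ∀ m n → embed (m ℤ.⊖ n) ≈ m · 1# + - (n · 1#)
    embed-⊖ zero zero = sym (-‿inverseʳ 0#)
    embed-⊖ zero (suc n) = sym (+-identityˡ _)
    embed-⊖ (suc m) zero = sym (trans (+-congˡ ε⁻¹≈ε) (+-identityʳ _))
    embed-⊖ (suc m) (suc n) = begin
      embed (suc m ℤ.⊖ suc n)              ≡⟨ ≡.cong embed (ℤ.[1+m]⊖[1+n]≡m⊖n m n) ⟩
      embed (m ℤ.⊖ n)                      ≈⟨ embed-⊖ m n ⟩
      m · 1# + - (n · 1#)                  ≈⟨ sym (shift _ _ 1#) ⟩
      (1# + m · 1#) + - (1# + n · 1#)      ≈⟨ +-cong (sym (1+· m)) (-‿cong (sym (1+· n))) ⟩
      suc m · 1# + - (suc n · 1#)          ∎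

    embed-+ : ∀ i j → embed (i ℤ.+ j) ≈ embed i + embed j
    embed-+ (+ m)    (+ n)    = ×-homo-+ 1# m n
    embed-+ (+ m)    -[1+ n ] = embed-⊖ m (suc n)
    embed-+ -[1+ m ] (+ n)    = trans (embed-⊖ n (suc m)) (+-comm _ _)
    embed-+ -[1+ m ] -[1+ n ] = begin
      - (suc (suc (m ℕ.+ n)) · 1#)          ≡⟨ ≡.cong (λ k → - (suc k · 1#)) (≡.sym (ℕ.+-suc m n)) ⟩
      - ((suc m ℕ.+ suc n) · 1#)            ≈⟨ -‿cong (×-homo-+ 1# (suc m) (suc n)) ⟩
      - (suc m · 1# + suc n · 1#)           ≈⟨ sym (⁻¹-∙-comm _ _) ⟩
      - (suc m · 1#) + - (suc n · 1#)       ∎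

    embed-neg : ∀ i → embed (ℤ.- i) ≈ - embed i
    embed-neg +0       = sym ε⁻¹≈ε
    embed-neg +[1+ n ] = refl
    embed-neg -[1+ n ] = sym (⁻¹-involutive _)

    ·1-* : ∀ m n → (m ℕ.* n) · 1# ≈ (m · 1#) * (n · 1#)
    ·1-* zero n = sym (zeroˡ _)
    ·1-* (suc m) n = begin
      (n ℕ.+ m ℕ.* n) · 1#                    ≈⟨ ×-homo-+ 1# n (m ℕ.* n) ⟩
      n · 1# + (m ℕ.* n) · 1#                 ≈⟨ +-cong (sym (*-identityˡ _)) (·1-* m n) ⟩
      1# * (n · 1#) + (m · 1#) * (n · 1#)     ≈⟨ sym (distribʳ _ _ _) ⟩
      (1# + m · 1#) * (n · 1#)                ≈⟨ *-congʳ (sym (1+· m)) ⟩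
      (suc m · 1#) * (n · 1#)                 ∎

    embed-*⁺ : ∀ m j → embed (+ m ℤ.* j) ≈ embed (+ m) * embed j
    embed-*⁺ m (+ n) = trans (reflexive (≡.cong embed (≡.sym (ℤ.pos-* m n)))) (·1-* m n)
    embed-*⁺ m -[1+ n ] = begin
      embed (+ m ℤ.* ℤ.- (+ suc n))      ≡⟨ ≡.cong embed (≡.sym (ℤ.neg-distribʳ-* (+ m) (+ suc n))) ⟩
      embed (ℤ.- (+ m ℤ.* + suc n))      ≈⟨ embed-neg (+ m ℤ.* + suc n) ⟩
      - embed (+ m ℤ.* + suc n)          ≈⟨ -‿cong (embed-*⁺ m (+ suc n)) ⟩
      - (embed (+ m) * embed (+ suc n))  ≈⟨ -‿distribʳ-* _ _ ⟩
      embed (+ m) * - embed (+ suc n)    ∎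

    embed-* : ∀ i j → embed (i ℤ.* j) ≈ embed i * embed j
    embed-* (+ m) j = embed-*⁺ m j
    embed-* -[1+ m ] j = begin
      embed (ℤ.- (+ suc m) ℤ.* j)        ≡⟨ ≡.cong embed (≡.sym (ℤ.neg-distribˡ-* (+ suc m) j)) ⟩
      embed (ℤ.- (+ suc m ℤ.* j))        ≈⟨ embed-neg (+ suc m ℤ.* j) ⟩
      - embed (+ suc m ℤ.* j)            ≈⟨ -‿cong (embed-*⁺ (suc m) j) ⟩
      - (embed (+ suc m) * embed j)      ≈⟨ -‿distribˡ-* _ _ ⟩
      - embed (+ suc m) * embed j        ∎

    ACR : AlmostCommutativeRing 0ℓ 0ℓ
    ACR = fromCommutativeRing R

    morphism : ℤ.+-*-rawRing -Raw-AlmostCommutative⟶ ACR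
    morphism = record
      { ⟦_⟧    = embed
      ; +-homo = embed-+
      ; *-homo = embed-*
      ; -‿homo = embed-neg
      ; 0-homo = refl
      ; 1-homo = refl
      }

    _≟_ : WeaklyDecidable (Induced-equivalence morphism)
    i ≟ j with i ℤ.≟ j
    ... | yes i≡j = just (reflexive (≡.cong embed i≡j))
    ... | no  _   = nothing

  open import Algebra.Solver.Ring ℤ.+-*-rawRing ACR morphism _≟_ public
    using (Polynomial; solve; _:=_; _:+_; _:*_; _:-_; :-_; con)

  :0 :1 : ∀ {n} → Polynomial n
  :0 = con (+ 0)
  :1 = con (+ 1)

module Divisibility (R : CommutativeRing 0ℓ 0ℓ) where

  open RingSolver R
  open CommutativeRing R
  open import Algebra.Properties.Ring ring using (-‿distribˡ-*)
  open import Algebra.Properties.CommutativeSemiring.Exp commutativeSemiring public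
    using (_^_; ^-congˡ; ^-homo-*; ^-assocʳ; ^-distrib-*)
  open import Relation.Binary.Reasoning.Setoid setoid

  module _ where
    private
      drop : ∀ {y l r} k → l ≈ r → y + k * (l - r) ≈ y
      drop {y} {l} {r} k l≈r = begin
        y + k * (l - r)  ≈⟨ +-congˡ (*-congˡ (+-congʳ l≈r)) ⟩
        y + k * (r - r)  ≈⟨ solve 3 (λ y k r → y :+ k :* (r :- r) := y) refl y k r ⟩
        y                ∎

    -- Certificates of ideal membership: an equation that follows from hypotheses `l ≈ r` becomes a
    -- polynomial identity once the difference of its sides is written as a combination of the
    -- `l - r`. The coefficients `k` in the calls are the cofactors.
    modulo₁ : ∀ {x y l r} k → l ≈ r → x ≈ y + k * (l - r) → x ≈ y
    modulo₁ k l≈r eq = trans eq (drop k l≈r)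

    modulo₂ : ∀ {x y l r l′ r′} k → l ≈ r → ∀ k′ → l′ ≈ r′ →
              x ≈ y + (k * (l - r) + k′ * (l′ - r′)) → x ≈ y
    modulo₂ k e k′ e′ eq = modulo₁ k e (modulo₁ k′ e′ (trans eq (sym (+-assoc _ _ _))))

    modulo₃ : ∀ {x y l r l′ r′ l″ r″} k → l ≈ r → ∀ k′ → l′ ≈ r′ → ∀ k″ → l″ ≈ r″ →
              x ≈ y + (k * (l - r) + (k′ * (l′ - r′) + k″ * (l″ - r″))) → x ≈ y
    modulo₃ k e k′ e′ k″ e″ eq = modulo₁ k e (modulo₂ k′ e′ k″ e″ (trans eq (sym (+-assoc _ _ _))))

    modulo₄ : ∀ {x y l r l′ r′ l″ r″ l‴ r‴} k → l ≈ r → ∀ k′ → l′ ≈ r′ → ∀ k″ → l″ ≈ r″ → ∀ k‴ → l‴ ≈ r‴ →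
              x ≈ y + (k * (l - r) + (k′ * (l′ - r′) + (k″ * (l″ - r″) + k‴ * (l‴ - r‴)))) → x ≈ y
    modulo₄ k e k′ e′ k″ e″ k‴ e‴ eq =
      modulo₁ k e (modulo₃ k′ e′ k″ e″ k‴ e‴ (trans eq (sym (+-assoc _ _ _))))

  infix 4 _∣_ _≡_[_]

  _∣_ : Carrier → Carrier → Set
  m ∣ x = ∃ λ k → x ≈ k * m

  _≡_[_] : Carrier → Carrier → Carrier → Set
  x ≡ y [ m ] = m ∣ x - y

  ∣-respʳ : ∀ {m x y} → x ≈ y → m ∣ x → m ∣ y
  ∣-respʳ x≈y (k , eq) = k , trans (sym x≈y) eq

  ∣-respˡ : ∀ {m n x} → m ≈ n → m ∣ x → n ∣ x
  ∣-respˡ m≈n (k , eq) = k , trans eq (*-congˡ m≈n)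

  ∣-refl : ∀ {m} → m ∣ m
  ∣-refl = 1# , sym (*-identityˡ _)

  ∣0 : ∀ {m} → m ∣ 0#
  ∣0 = 0# , sym (zeroˡ _)

  m∣km : ∀ {m} k → m ∣ k * m
  m∣km k = k , refl

  m∣mk : ∀ {m} k → m ∣ m * k
  m∣mk k = k , *-comm _ _

  ∣-trans : ∀ {l m n} → l ∣ m → m ∣ n → l ∣ n
  ∣-trans (k , e) (k′ , e′) = k′ * k , trans e′ (trans (*-congˡ e) (sym (*-assoc _ _ _)))

  ∣-*ˡ : ∀ {m x} k → m ∣ x → m ∣ k * x
  ∣-*ˡ k (j , e) = k * j , trans (*-congˡ e) (sym (*-assoc _ _ _))

  ∣-*ʳ : ∀ {m x} k → m ∣ x → m ∣ x * k
  ∣-*ʳ k m∣x = ∣-respʳ (*-comm _ _) (∣-*ˡ k m∣x)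

  ∣-+ : ∀ {m x y} → m ∣ x → m ∣ y → m ∣ x + y
  ∣-+ (k , e) (k′ , e′) = k + k′ , trans (+-cong e e′) (sym (distribʳ _ _ _))

  ∣-neg : ∀ {m x} → m ∣ x → m ∣ - x
  ∣-neg (k , e) = - k , trans (-‿cong e) (-‿distribˡ-* _ _)

  ∣-sub : ∀ {m x y} → m ∣ x → m ∣ y → m ∣ x - y
  ∣-sub p q = ∣-+ p (∣-neg q)

  ∣-* : ∀ {l m x y} → l ∣ x → m ∣ y → l * m ∣ x * y
  ∣-* {l} {m} (k , e) (k′ , e′) = k * k′ , trans (*-cong e e′) (solve 4 (λ k l k′ m → (k :* l) :* (k′ :* m) := (k :* k′) :* (l :* m)) refl k l k′ m)

  ∣-lin₁ : ∀ {m x y} k → x ≈ k * y → m ∣ y → m ∣ x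
  ∣-lin₁ k e m∣y = ∣-respʳ (sym e) (∣-*ˡ k m∣y)

  ∣-lin₂ : ∀ {m x y y′} k k′ → x ≈ k * y + k′ * y′ → m ∣ y → m ∣ y′ → m ∣ x
  ∣-lin₂ k k′ e p q = ∣-respʳ (sym e) (∣-+ (∣-*ˡ k p) (∣-*ˡ k′ q))

  ∣-lin₃ : ∀ {m x y y′ y″} k k′ k″ → x ≈ k * y + k′ * y′ + k″ * y″ → m ∣ y → m ∣ y′ → m ∣ y″ → m ∣ x
  ∣-lin₃ k k′ k″ e p q r = ∣-respʳ (sym e) (∣-+ (∣-+ (∣-*ˡ k p) (∣-*ˡ k′ q)) (∣-*ˡ k″ r))

  ≈⇒≡ : ∀ {m x y} → x ≈ y → x ≡ y [ m ]
  ≈⇒≡ {m} {x} {y} x≈y = 0# , modulo₁ 1# x≈y (solve 3 (λ x y m → x :- y := :0 :* m :+ (:1 :* (x :- y))) refl x y m)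

  ≡-sym : ∀ {m x y} → x ≡ y [ m ] → y ≡ x [ m ]
  ≡-sym {x = x} {y} = ∣-lin₁ (- 1#) (solve 2 (λ x y → y :- x := (:- :1) :* (x :- y)) refl x y)

  ≡-trans : ∀ {m x y z} → x ≡ y [ m ] → y ≡ z [ m ] → x ≡ z [ m ]
  ≡-trans {x = x} {y} {z} p q = ∣-respʳ (solve 3 (λ x y z → (x :- y) :+ (y :- z) := x :- z) refl x y z) (∣-+ p q)

  ≡-+ : ∀ {m x y z w} → x ≡ y [ m ] → z ≡ w [ m ] → x + z ≡ y + w [ m ]
  ≡-+ {x = x} {y} {z} {w} p q = ∣-respʳ (solve 4 (λ x y z w → (x :- y) :+ (z :- w) := (x :+ z) :- (y :+ w)) refl x y z w) (∣-+ p q)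

  ≡-* : ∀ {m x y z w} → x ≡ y [ m ] → z ≡ w [ m ] → x * z ≡ y * w [ m ]
  ≡-* {x = x} {y} {z} {w} = ∣-lin₂ z y (solve 4 (λ x y z w → x :* z :- y :* w := z :* (x :- y) :+ y :* (z :- w)) refl x y z w)

  ≡-^ : ∀ {m x y} k → x ≡ y [ m ] → x ^ k ≡ y ^ k [ m ]
  ≡-^ zero    p = ≈⇒≡ refl
  ≡-^ (suc k) p = ≡-* p (≡-^ k p)

  ≡⇒∣ : ∀ {m x y} → x ≡ y [ m ] → m ∣ y → m ∣ x
  ≡⇒∣ {x = x} {y} p q = ∣-respʳ (solve 2 (λ x y → (x :- y) :+ y := x) refl x y) (∣-+ p q)

  1^n : ∀ n → 1# ^ n ≈ 1#
  1^n zero = refl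
  1^n (suc n) = trans (*-identityˡ _) (1^n n)

  x∣x^1+n : ∀ {x} n → x ∣ x ^ suc n
  x∣x^1+n n = m∣mk _

  Coprime : Carrier → Carrier → Set
  Coprime a b = ∃₂ λ α β → α * a + β * b ≈ 1#

  coprime-sym : ∀ {a b} → Coprime a b → Coprime b a
  coprime-sym (α , β , e) = β , α , trans (+-comm _ _) e

  coprime-∣ : ∀ {a b c} → Coprime a b → c ∣ b → Coprime a c
  coprime-∣ {a} {b} {c} (α , β , e) (k , e′) = α , β * k ,
    (modulo₂ 1# e (- β) e′ (solve 6 (λ α β a b c k → α :* a :+ β :* k :* c := :1 :+ (:1 :* (α :* a :+ β :* b :- :1) :+ ((:- β) :* (b :- k :* c)))) refl α β a b c k))

  coprime-* : ∀ {a b c} → Coprime a b → Coprime a c → Coprime a (b * c)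
  coprime-* {a} {b} {c} (α , β , e) (γ , δ , e′) =
    α * γ * a + α * δ * c + β * γ * b , β * δ ,
    (modulo₂ (γ * a + δ * c) e 1# e′ (solve 7 (λ α β γ δ a b c → (α :* γ :* a :+ α :* δ :* c :+ β :* γ :* b) :* a :+ β :* δ :* (b :* c) := :1 :+ ((γ :* a :+ δ :* c) :* (α :* a :+ β :* b :- :1) :+ (:1 :* (γ :* a :+ δ :* c :- :1)))) refl α β γ δ a b c))

  coprime-^ : ∀ {a b} n → Coprime a b → Coprime a (b ^ n)
  coprime-^ {a} zero c = 0# , 1# , solve 1 (λ a → :0 :* a :+ :1 :* :1 := :1) refl a
  coprime-^ (suc n) c = coprime-* c (coprime-^ n c)

  coprime-≡ : ∀ {a a′ b} → a′ ≡ a [ b ] → Coprime a b → Coprime a′ b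
  coprime-≡ {a} {a′} {b} (k , e) (α , β , e′) = α , β - α * k ,
    (modulo₂ α e 1# e′ (solve 6 (λ a a′ b α β k → α :* a′ :+ (β :- α :* k) :* b := :1 :+ (α :* (a′ :- a :- k :* b) :+ (:1 :* (α :* a :+ β :* b :- :1)))) refl a a′ b α β k))

  coprime-cancel : ∀ {a b x} → Coprime a b → a ∣ b * x → a ∣ x
  coprime-cancel {a} {b} {x} (α , β , e) = ∣-lin₂ (x * α) β
    (modulo₁ (- x) e (solve 5 (λ a b x α β → x := x :* α :* a :+ β :* (b :* x) :+ ((:- x) :* (α :* a :+ β :* b :- :1))) refl a b x α β)) ∣-refl

  coprime-∣-* : ∀ {a b x} → Coprime a b → a ∣ x → b ∣ x → a * b ∣ x
  coprime-∣-* {a} {b} {x} (α , β , e) (k , e₁) (j , e₂) = α * j + β * k ,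
    (modulo₃ (- x) e (β * b) e₁ (α * a) e₂ (solve 7 (λ a b x α β k j → x := (α :* j :+ β :* k) :* (a :* b) :+ ((:- x) :* (α :* a :+ β :* b :- :1) :+ ((β :* b) :* (x :- k :* a) :+ ((α :* a) :* (x :- j :* b))))) refl a b x α β k j))

  coprime-inverse : ∀ {a b} → Coprime a b → ∃ λ α → α * a ≡ 1# [ b ]
  coprime-inverse {a} {b} (α , β , e) = α , - β , (modulo₁ 1# e (solve 4 (λ a b α β → α :* a :- :1 := :- β :* b :+ (:1 :* (α :* a :+ β :* b :- :1))) refl a b α β))

-- The Frobenius endomorphism in prime characteristic

module PrimeCharacteristic (R : CommutativeRing 0ℓ 0ℓ) where

  open import Data.Nat.Primality using (¬prime[0])
  open import Data.Nat.Combinatorics using (_C_; nCn≡1)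
  open import Data.Nat.Divisibility as ℕ using (divides)
  open import Data.Fin.Base as Fin using (Fin; zero; suc; toℕ; fromℕ; inject₁)
  open import Data.Fin.Properties using (toℕ-fromℕ; toℕ-inject₁; toℕ<n)
  open RingSolver R
  open Divisibility R
  open CommutativeRing R hiding (zero)
  open import Algebra.Properties.Semiring.Mult semiring renaming (_×_ to _·_)
  open import Algebra.Properties.Semiring.Sum semiring
  open import Algebra.Properties.CommutativeSemiring.Binomial commutativeSemiring
  open import Relation.Binary.Reasoning.Setoid setoid

  ×≈*1 : ∀ n x → n · x ≈ (n · 1#) * x
  ×≈*1 n x = sym (trans (×-assoc-* n 1# x) (×-congʳ n (*-identityˡ x)))

  private
    sum-zero : ∀ {n} (t : Fin n → Carrier) → (∀ i → t i ≈ 0#) → sum t ≈ 0#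
    sum-zero {n} t t≈0 = trans (sum-cong-≋ t≈0) (sum-replicate-zero n)

    freshman : ∀ {p} → Prime p → (∀ {n} x → p ℕ.∣ n → n · x ≈ 0#) →
               ∀ x y → (x + y) ^ p ≈ x ^ p + y ^ p
    freshman {zero} pr′ = contradiction pr′ ¬prime[0]
    freshman {suc p′} pr′ p∣ x y = begin
      (x + y) ^ suc p′                                 ≈⟨ theorem (suc p′) x y ⟩
      t zero + sum (t ∘ suc)                           ≈⟨ +-cong first (sum-init-last (t ∘ suc)) ⟩
      y ^ suc p′ + (sum (t ∘ suc ∘ inject₁) + t (fromℕ (suc p′)))
        ≈⟨ +-congˡ (+-cong (sum-zero (t ∘ suc ∘ inject₁) middle) last-term) ⟩
      y ^ suc p′ + (0# + x ^ suc p′)                   ≈⟨ solve 2 (λ u v → v :+ (:0 :+ u) := u :+ v) refl (x ^ suc p′) (y ^ suc p′) ⟩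
      x ^ suc p′ + y ^ suc p′                          ∎
      where
      t : Fin (suc (suc p′)) → Carrier
      t = binomialTerm x y (suc p′)
      first : t zero ≈ y ^ suc p′
      first = trans (+-identityʳ _) (*-identityˡ _)
      middle : ∀ (i : Fin p′) → t (suc (inject₁ i)) ≈ 0#
      middle i = p∣ _ (prime∣C pr′ (ℕ.s≤s ℕ.z≤n)
        (ℕ.s≤s (≡.subst (ℕ._< p′) (≡.sym (toℕ-inject₁ i)) (toℕ<n i))))
      last-term : t (fromℕ (suc p′)) ≈ x ^ suc p′
      last-term = begin
        (suc p′ C toℕ k) · (x ^ toℕ k * y ^ (suc p′ ℕ.∸ toℕ k))
          ≡⟨ ≡.cong (λ j → (suc p′ C j) · (x ^ j * y ^ (suc p′ ℕ.∸ j))) (toℕ-fromℕ (suc p′)) ⟩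
        (suc p′ C suc p′) · (x ^ suc p′ * y ^ (p′ ℕ.∸ p′))
          ≡⟨ ≡.cong₂ (λ a b → a · (x ^ suc p′ * y ^ b)) (nCn≡1 (suc p′)) (ℕ.n∸n≡0 p′) ⟩
        1 · (x ^ suc p′ * 1#)   ≈⟨ +-identityʳ _ ⟩
        x ^ suc p′ * 1#         ≈⟨ *-identityʳ _ ⟩
        x ^ suc p′              ∎
        where k = fromℕ (suc p′)

    x∣x^n : ∀ n → .{{ℕ.NonZero n}} → ∀ x → x ∣ x ^ n
    x∣x^n (suc n) x = x∣x^1+n n

    *-suc : ∀ k n → .{{ℕ.NonZero n}} → ∃ λ j → suc k ℕ.* n ≡.≡ suc j
    *-suc k (suc n) = _ , ≡.refl

  module Char (p : ℕ) (pr : Prime p) (p1≈0 : p · 1# ≈ 0#) where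

    p×≈0 : ∀ x → p · x ≈ 0#
    p×≈0 x = trans (×≈*1 p x) (trans (*-congʳ p1≈0) (zeroˡ x))

    private
      p∣×≈0 : ∀ {n} x → p ℕ.∣ n → n · x ≈ 0#
      p∣×≈0 x (divides k ≡.refl) = trans (sym (×-assocˡ x k p)) (trans (×-congʳ k (p×≈0 x)) (n·ε≈ε +-monoid k))

    ^p-+ : ∀ x y → (x + y) ^ p ≈ x ^ p + y ^ p
    ^p-+ = freshman pr p∣×≈0

    ^p-sub : ∀ x y → (x - y) ^ p ≈ x ^ p - y ^ p
    ^p-sub x y = begin
      (x - y) ^ p                        ≈⟨ solve 2 (λ a b → a := (a :+ b) :- b) refl ((x - y) ^ p) (y ^ p) ⟩
      ((x - y) ^ p + y ^ p) - y ^ p      ≈⟨ +-congʳ (sym (^p-+ (x - y) y)) ⟩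
      ((x - y) + y) ^ p - y ^ p          ≈⟨ +-congʳ (^-congˡ p (solve 2 (λ x y → (x :- y) :+ y := x) refl x y)) ⟩
      x ^ p - y ^ p                      ∎

    σ : ℕ → Carrier → Carrier
    σ zero    x = x
    σ (suc D) x = σ D x ^ p

    σ-cong : ∀ D {x y} → x ≈ y → σ D x ≈ σ D y
    σ-cong zero e = e
    σ-cong (suc D) e = ^-congˡ p (σ-cong D e)

    σ-sub : ∀ D x y → σ D (x - y) ≈ σ D x - σ D y
    σ-sub zero x y = refl
    σ-sub (suc D) x y = trans (^-congˡ p (σ-sub D x y)) (^p-sub (σ D x) (σ D y))

    σ-* : ∀ D x y → σ D (x * y) ≈ σ D x * σ D y
    σ-* zero x y = refl
    σ-* (suc D) x y = trans (^-congˡ p (σ-* D x y)) (^-distrib-* (σ D x) (σ D y) p)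

    σ-∘ : ∀ D E x → σ (D ℕ.+ E) x ≡.≡ σ D (σ E x)
    σ-∘ zero E x = ≡.refl
    σ-∘ (suc D) E x = ≡.cong (_^ p) (σ-∘ D E x)

    σ-∣ : ∀ D {m x} → m ∣ x → σ D m ∣ σ D x
    σ-∣ D {m} (k , e) = σ D k , trans (σ-cong D e) (σ-* D k m)

    x∣x^p : ∀ x → x ∣ x ^ p
    x∣x^p = x∣x^n p {{prime⇒nonZero pr}}

    ∣σ : ∀ D x → x ∣ σ D x
    ∣σ zero x = ∣-refl
    ∣σ (suc D) x = ∣-trans (∣σ D x) (x∣x^p (σ D x))

    -- The exponent is p^D; all that is used of it is that it is a successor.
    σ-power : ∀ D x → ∃ λ k → σ D x ≈ x ^ suc k
    σ-power zero x = 0 , sym (*-identityʳ x)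
    σ-power (suc D) x with σ-power D x
    ... | k , e with *-suc k p {{prime⇒nonZero pr}}
    ...   | j , eq = j , trans (^-congˡ p e) (trans (^-assocʳ x (suc k) p) (reflexive (≡.cong (x ^_) eq)))

-- The properties of F_q[t] that are used: a Euclidean domain of prime
-- characteristic with finite residue rings and a derivation ∂ with ∂ t = 1.
record Arithmetic : Set₁ where
  field
    commRing : CommutativeRing 0ℓ 0ℓ
  open CommutativeRing commRing
  open Algebra.Properties.Semiring.Mult semiring renaming (_×_ to _·_)
  field
    p        : ℕ
    p-prime  : Prime p
    p·1≈0    : p · 1# ≈ 0#
    0≉1      : ¬ 0# ≈ 1#
    _≟0      : ∀ x → Dec (x ≈ 0#)
    integral : ∀ x y → x * y ≈ 0# → x ≈ 0# ⊎ y ≈ 0#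
    deg      : Carrier → ℕ
    deg-cong : ∀ {x y} → x ≈ y → deg x ≡ deg y
    deg-*    : ∀ {x y} → ¬ x ≈ 0# → ¬ y ≈ 0# → deg (x * y) ≡ deg x ℕ.+ deg y
    division : ∀ a b → ¬ b ≈ 0# → ∃₂ λ q r → a ≈ q * b + r × (r ≈ 0# ⊎ deg r ℕ.< deg b)
    residues : ∀ D → ¬ D ≈ 0# → ∃ λ N → Σ (Fin N → Carrier) λ rep → Σ (Carrier → Fin N) λ index →
               ∀ x → Divisibility._≡_[_] commRing x (rep (index x)) D
    ∂        : Carrier → Carrier
    ∂-cong   : ∀ {x y} → x ≈ y → ∂ x ≈ ∂ y
    ∂-+      : ∀ x y → ∂ (x + y) ≈ ∂ x + ∂ y
    ∂-*      : ∀ x y → ∂ (x * y) ≈ ∂ x * y + x * ∂ y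
    t        : Carrier
    ∂t≈1     : ∂ t ≈ 1#

-- Euclidean arithmetic: gcd, squarefree elements, prime factors

module Arith (𝔸 : Arithmetic) where

  open Arithmetic 𝔸 public
  open CommutativeRing commRing public hiding (zero)
  open RingSolver commRing public
  open Divisibility commRing public hiding (_≡_[_])
  open Divisibility commRing public using (_≡_[_])
  open PrimeCharacteristic.Char commRing p p-prime p·1≈0 public
  open Algebra.Properties.Semiring.Mult semiring public renaming (_×_ to _·_) using (×-congʳ)
  open import Algebra.Properties.Ring ring using (x+x≈x⇒x≈0)
  open import Relation.Binary.Reasoning.Setoid setoid

  NonZ : Carrier → Set
  NonZ x = ¬ x ≈ 0#

  nz-* : ∀ {x y} → NonZ x → NonZ y → NonZ (x * y)
  nz-* x≉0 y≉0 xy≈0 with integral _ _ xy≈0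
  ... | inj₁ e = x≉0 e
  ... | inj₂ e = y≉0 e

  nz-1 : NonZ 1#
  nz-1 e = 0≉1 (sym e)

  nz-∣ : ∀ {x y} → x ∣ y → NonZ y → NonZ x
  nz-∣ (k , e) y≉0 x≈0 = y≉0 (trans e (trans (*-congˡ x≈0) (zeroʳ k)))

  opaque
    cancelʳ : ∀ {x y z} → NonZ z → x * z ≈ y * z → x ≈ y
    cancelʳ {x} {y} {z} z≉0 e = [ (λ e′ → modulo₁ 1# e′ (solve 2 (λ x y → x := y :+ (:1 :* (x :- y :- :0))) refl x y)) , (λ e′ → contradiction e′ z≉0) ]′
      (integral (x - y) z (modulo₁ 1# e (solve 3 (λ x y z → (x :- y) :* z := :0 :+ (:1 :* (x :* z :- y :* z))) refl x y z)))

  0∣⇒≈0 : ∀ {d x} → d ≈ 0# → d ∣ x → x ≈ 0#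
  0∣⇒≈0 d≈0 (k , e) = trans e (trans (*-congˡ d≈0) (zeroʳ k))

  opaque
    deg≡0⇒∣1 : ∀ {x} → NonZ x → deg x ≡ 0 → x ∣ 1#
    deg≡0⇒∣1 {x} x≉0 dx with division 1# x x≉0
    ... | q , r , e , inj₁ r≈0 = q , (modulo₂ 1# e 1# r≈0 (solve 3 (λ q r x → :1 := q :* x :+ (:1 :* (:1 :- (q :* x :+ r)) :+ (:1 :* (r :- :0)))) refl q r x))
    ... | q , r , e , inj₂ lt  = contradiction (≡.subst (deg r ℕ.<_) dx lt) (λ ())

  infix 4 _∣?_
  opaque
    _∣?_ : ∀ d x → Dec (d ∣ x)
    d ∣? x with d ≟0
    ... | yes d≈0 = map′ (λ x≈0 → 0# , trans x≈0 (sym (zeroˡ d))) (0∣⇒≈0 d≈0) (x ≟0)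
    ... | no  d≉0 with division x d d≉0
    ...   | q , r , e , small with r ≟0
    ...     | yes r≈0 = yes (q , (modulo₂ 1# e 1# r≈0 (solve 4 (λ q r d x → x := q :* d :+ (:1 :* (x :- (q :* d :+ r)) :+ (:1 :* (r :- :0)))) refl q r d x)))
    ...     | no  r≉0 with small
    ...       | inj₁ r≈0 = contradiction r≈0 r≉0
    ...       | inj₂ lt  = no λ { (k , e′) → absurd (k - q)
                  (modulo₂ (- 1#) e 1# e′ (solve 5 (λ k q r d x → r := (k :- q) :* d :+ ((:- :1) :* (x :- (q :* d :+ r)) :+ (:1 :* (x :- k :* d)))) refl k q r d x)) }
      where
      absurd : ∀ j → ¬ r ≈ j * d
      absurd j r≈jd = ℕ.<⇒≱ lt (≡.subst (deg d ℕ.≤_)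
        (≡.sym (≡.trans (deg-cong r≈jd) (deg-* (nz-∣ (d , *-comm j d) (λ z → r≉0 (trans r≈jd z))) d≉0)))
        (ℕ.m≤n+m (deg d) (deg j)))

  record Gcd (a b : Carrier) : Set where
    field
      d α β : Carrier
      d∣a : d ∣ a
      d∣b : d ∣ b
      bezout : d ≈ α * a + β * b

  private
    opaque
      gcd-acc : ∀ a b → Acc ℕ._<_ (deg b) → Gcd a b
      gcd-acc a b (acc rec) with b ≟0
      ... | yes b≈0 = record { d∣a = ∣-refl ; d∣b = 0# , trans b≈0 (sym (zeroˡ a))
                             ; bezout = solve 2 (λ a b → a := :1 :* a :+ :0 :* b) refl a b }
      ... | no  b≉0 with division a b b≉0
      ...   | q , r , e , inj₁ r≈0 = record
        { d∣a = q , (modulo₂ 1# e 1# r≈0 (solve 4 (λ q r a b → a := q :* b :+ (:1 :* (a :- (q :* b :+ r)) :+ (:1 :* (r :- :0)))) refl q r a b)) ; d∣b = ∣-refl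
        ; bezout = solve 2 (λ a b → b := :0 :* a :+ :1 :* b) refl a b }
      ...   | q , r , e , inj₂ lt = record
        { d∣a = ∣-lin₂ q 1# (trans e (+-congˡ (sym (*-identityˡ r)))) G.d∣a G.d∣b ; d∣b = G.d∣a
        ; bezout = bz (G.bezout) }
        where
        module G = Gcd (gcd-acc b r (rec lt))
        bz : ∀ {d α β} → d ≈ α * b + β * r → d ≈ β * a + (α - β * q) * b
        bz {d} {α} {β} e′ = modulo₂ 1# e′ (- β) e (solve 7 (λ d α β a b q r → d := β :* a :+ (α :- β :* q) :* b :+ (:1 :* (d :- (α :* b :+ β :* r)) :+ ((:- β) :* (a :- (q :* b :+ r))))) refl d α β a b q r)

  opaque
    gcd : ∀ a b → Gcd a b
    gcd a b = gcd-acc a b (<-wellFounded (deg b))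

  opaque
    coprime-if : ∀ {a b} → (∀ d → d ∣ a → d ∣ b → d ∣ 1#) → Coprime a b
    coprime-if {a} {b} h with h d d∣a d∣b
      where open Gcd (gcd a b)
    ... | k , e = k * α , k * β , (modulo₂ (- k) bezout (- 1#) e (solve 6 (λ k d α β a b → k :* α :* a :+ k :* β :* b := :1 :+ ((:- k) :* (d :- (α :* a :+ β :* b)) :+ ((:- :1) :* (:1 :- k :* d)))) refl k d α β a b))
      where open Gcd (gcd a b)

  opaque
    coprime⇒∣1 : ∀ {a b d} → Coprime a b → d ∣ a → d ∣ b → d ∣ 1#
    coprime⇒∣1 (α , β , e) = ∣-lin₂ α β (sym e)

  opaque
    coprime? : ∀ a b → Dec (Coprime a b)
    coprime? a b with Gcd.d (gcd a b) ∣? 1#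
    ... | yes d∣1 = yes (coprime-if λ d′ d′∣a d′∣b → ∣-trans (∣-lin₂ _ _ (Gcd.bezout (gcd a b)) d′∣a d′∣b) d∣1)
    ... | no  d∤1 = no λ c → d∤1 (coprime⇒∣1 c (Gcd.d∣a (gcd a b)) (Gcd.d∣b (gcd a b)))

  opaque
    pigeonhole : ∀ {D} → NonZ D → (f : ℕ → Carrier) → ∃₂ λ i d → f i ≡ f (i ℕ.+ suc d) [ D ]
    pigeonhole {D} D≉0 f with residues D D≉0
    ... | N , rep , index , ok with Fin.pigeonhole (ℕ.n<1+n N) (index ∘ f ∘ toℕ)
    ... | i , j , i<j , same with ℕ.m≤n⇒∃[o]m+o≡n i<j
    ...   | d , eq = toℕ i , d , ≡.subst (λ k → f (toℕ i) ≡ f k [ D ]) (≡.trans (≡.sym eq) (≡.sym (ℕ.+-suc (toℕ i) d)))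
              (≡-trans (ok _) (≡-sym (≡.subst (λ k → f (toℕ j) ≡ rep k [ D ]) (≡.sym same) (ok _))))

  opaque
    -- Iterating x^i ≡ x^(i+d) up to an exponent that is a multiple of d.
    idempotent-power : ∀ {D} → NonZ D → ∀ x → ∃ λ k → x ^ suc k * x ^ suc k ≡ x ^ suc k [ D ]
    idempotent-power {D} D≉0 x with pigeonhole D≉0 (x ^_)
    ... | i , d , p = d ℕ.+ i ℕ.* suc d , ≡-sym (≡-trans (shift (suc i) _ (ℕ.m≤n⇒m≤1+n (ℕ.≤-trans (ℕ.m≤m*n i (suc d)) (ℕ.m≤n+m _ d))))
        (≈⇒≡ (^-homo-* x (suc i ℕ.* suc d) (suc i ℕ.* suc d))))
      where
      shift₁ : ∀ m → i ℕ.≤ m → x ^ m ≡ x ^ (suc d ℕ.+ m) [ D ]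
      shift₁ m i≤m with ℕ.m≤n⇒∃[o]m+o≡n i≤m
      ... | o , ≡.refl = ≡-trans (≈⇒≡ (^-homo-* x i o)) (≡-trans (≡-* p (≈⇒≡ refl))
            (≈⇒≡ (trans (sym (^-homo-* x (i ℕ.+ suc d) o)) (reflexive (≡.cong (x ^_)
              (≡.trans (≡.cong (ℕ._+ o) (ℕ.+-comm i (suc d))) (ℕ.+-assoc (suc d) i o)))))))
      shift : ∀ j m → i ℕ.≤ m → x ^ m ≡ x ^ (j ℕ.* suc d ℕ.+ m) [ D ]
      shift zero    m i≤m = ≈⇒≡ refl
      shift (suc j) m i≤m = ≡-trans (shift j m i≤m) (≡-trans (shift₁ _ (ℕ.≤-trans i≤m (ℕ.m≤n+m m _)))
        (≈⇒≡ (reflexive (≡.cong (x ^_) (≡.sym (ℕ.+-assoc (suc d) (j ℕ.* suc d) m))))))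

  opaque
    -- With E an idempotent power of a modulo D, the choice s = 1 - E leaves a alone where a is
    -- invertible modulo D and adds m where a is nilpotent; no factorisation of D is involved. In
    -- detail, a common divisor d of a + m s and D divides E a, hence E, hence a + m. So a is
    -- invertible modulo d, while its power E vanishes there. That s is idempotent matters in
    -- `make-radical`.
    stable-range : ∀ {a m D} → Coprime a m → NonZ D →
                   ∃ λ s → s * s ≡ s [ D ] × Coprime (a + m * s) D
    stable-range {a} {m} {D} (α , β , ab) D≉0 with idempotent-power D≉0 a
    ... | k , idem = 1# - E
        , ∣-lin₁ 1# (solve 1 (λ E → (:1 :- E) :* (:1 :- E) :- (:1 :- E) := :1 :* (E :* E :- E)) refl E) idem
        , coprime-if unit
      where
      E : Carrier
      E = a ^ suc k
      unit : ∀ d → d ∣ a + m * (1# - E) → d ∣ D → d ∣ 1#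
      unit d d∣y d∣D = ∣-respʳ (1^n (suc k))
          (≡⇒∣ (≡-^ (suc k) 1≡) (∣-respʳ (sym (^-distrib-* (α - β) a (suc k))) (∣-*ˡ _ d∣E)))
        where
        d∣idem : d ∣ E * E - E
        d∣idem = ∣-trans d∣D idem
        d∣Ea : d ∣ E * a
        d∣Ea = ∣-lin₂ E m (solve 3 (λ E a m → E :* a := E :* (a :+ m :* (:1 :- E)) :+ m :* (E :* E :- E)) refl E a m) d∣y d∣idem
        d∣E : d ∣ E
        d∣E = ∣-lin₂ 1# (- 1#) (solve 1 (λ E → E := :1 :* (E :* E) :+ (:- :1) :* (E :* E :- E)) refl E)
          (∣-respʳ (solve 3 (λ E a u → E :* a :* u := E :* (a :* u)) refl E a (a ^ k)) (∣-*ʳ (a ^ k) d∣Ea)) d∣idem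
        d∣a+m : d ∣ a + m
        d∣a+m = ∣-lin₂ 1# m (solve 3 (λ E a m → a :+ m := :1 :* (a :+ m :* (:1 :- E)) :+ m :* E) refl E a m) d∣y d∣E
        1≡ : 1# ≡ (α - β) * a [ d ]
        1≡ = ∣-lin₁ β (modulo₁ (- 1#) ab (solve 4 (λ a m α β → :1 :- (α :- β) :* a := β :* (a :+ m) :+ ((:- :1) :* (α :* a :+ β :* m :- :1))) refl a m α β)) d∣a+m

  -- Squarefreeness, in the form that is applied to iterated Frobenius powers: it says that A/a is
  -- reduced.
  Radical : Carrier → Set
  Radical a = ∀ z k → a ∣ z ^ suc k → a ∣ z

  ∂0≈0 : ∂ 0# ≈ 0#
  ∂0≈0 = x+x≈x⇒x≈0 _ (trans (sym (∂-+ 0# 0#)) (∂-cong (+-identityʳ 0#)))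

  opaque
    ∂-^ : ∀ x n → ∂ (x ^ suc n) ≈ (suc n · 1#) * (x ^ n * ∂ x)
    ∂-^ x zero = trans (∂-cong (*-identityʳ x)) (solve 1 (λ u → u := (:1 :+ :0) :* (:1 :* u)) refl (∂ x))
    ∂-^ x (suc n) = begin
      ∂ (x * x ^ suc n)                                       ≈⟨ ∂-* x (x ^ suc n) ⟩
      ∂ x * x ^ suc n + x * ∂ (x ^ suc n)                     ≈⟨ +-congˡ (*-congˡ (∂-^ x n)) ⟩
      ∂ x * (x * x ^ n) + x * (c * (x ^ n * ∂ x))
        ≈⟨ solve 4 (λ x u v c → v :* (x :* u) :+ x :* (c :* (u :* v)) := (:1 :+ c) :* (x :* u :* v)) refl x (x ^ n) (∂ x) c ⟩
      (1# + c) * (x ^ suc n * ∂ x)                            ∎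
      where
      c : Carrier
      c = suc n · 1#

  opaque
    ∂^p≈0 : ∀ x → ∂ (x ^ p) ≈ 0#
    ∂^p≈0 x = go p {{prime⇒nonZero p-prime}} p·1≈0
      where
      go : ∀ n → .{{ℕ.NonZero n}} → n · 1# ≈ 0# → ∂ (x ^ n) ≈ 0#
      go (suc n) e = trans (∂-^ x n) (trans (*-congʳ e) (zeroˡ _))

  opaque
    -- If a ∣ z² and d = gcd(a, z), a = a₁ d, z = z₁ d, then a₁ is prime to z₁ and divides z₁² d, so
    -- a₁ ∣ d. Then a₁² divides a, so a₁ divides both a and `∂ a` and is a unit; hence a ∣ d ∣ z.
    separable⇒radical : ∀ {a} → Coprime a (∂ a) → Radical a
    separable⇒radical {a} cop = radical
      where
      a≉0 : NonZ a
      a≉0 a≈0 = nz-1 (0∣⇒≈0 refl (coprime⇒∣1 cop (∣-respʳ (sym a≈0) ∣0)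
                  (∣-respʳ (sym (trans (∂-cong a≈0) ∂0≈0)) ∣0)))
      square : ∀ z → a ∣ z * z → a ∣ z
      square z (k , zz≈ka) with Gcd.d∣a (gcd a z) | Gcd.d∣b (gcd a z)
      ... | a₁ , a≈ | z₁ , z≈ = ∣-trans (∣-lin₁ u (modulo₂ d 1≈ (- u) a≈ (solve 4 (λ u a₁ d a → d := u :* a :+ (d :* (:1 :- u :* a₁) :+ ((:- u) :* (a :- a₁ :* d)))) refl u a₁ d a)) ∣-refl) d∣b
        where
        open Gcd (gcd a z)
        d≉0 : NonZ d
        d≉0 = nz-∣ d∣a a≉0
        cop₁ : Coprime a₁ z₁
        cop₁ = α , β , cancelʳ d≉0 (modulo₃ (- 1#) bezout (- α) a≈ (- β) z≈ (solve 7 (λ a z d α β a₁ z₁ → (α :* a₁ :+ β :* z₁) :* d := :1 :* d :+ ((:- :1) :* (d :- (α :* a :+ β :* z)) :+ ((:- α) :* (a :- a₁ :* d) :+ ((:- β) :* (z :- z₁ :* d))))) refl a z d α β a₁ z₁))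
        a₁∣d : a₁ ∣ d
        a₁∣d = coprime-cancel (coprime-* cop₁ cop₁) (k , cancelʳ d≉0
          (modulo₃ (- (z + z₁ * d)) z≈ k a≈ 1# zz≈ka (solve 6 (λ a z d k a₁ z₁ → z₁ :* z₁ :* d :* d := k :* a₁ :* d :+ ((:- (z :+ z₁ :* d)) :* (z :- z₁ :* d) :+ (k :* (a :- a₁ :* d) :+ (:1 :* (z :* z :- k :* a))))) refl a z d k a₁ z₁)))
        e : Carrier
        e = proj₁ a₁∣d
        a₁∣∂a : a₁ ∣ ∂ a
        a₁∣∂a = ∂ e * a₁ + e * ∂ a₁ + e * ∂ a₁ , (begin
          ∂ a                                        ≈⟨ ∂-cong (trans a≈ (*-congˡ (proj₂ a₁∣d))) ⟩
          ∂ (a₁ * (e * a₁))                          ≈⟨ trans (∂-* a₁ _) (+-congˡ (*-congˡ (∂-* e a₁))) ⟩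
          ∂ a₁ * (e * a₁) + a₁ * (∂ e * a₁ + e * ∂ a₁)
            ≈⟨ solve 4 (λ e a₁ e' a' → a' :* (e :* a₁) :+ a₁ :* (e' :* a₁ :+ e :* a') := (e' :* a₁ :+ e :* a' :+ e :* a') :* a₁) refl e a₁ (∂ e) (∂ a₁) ⟩
          (∂ e * a₁ + e * ∂ a₁ + e * ∂ a₁) * a₁      ∎)
        unit : a₁ ∣ 1#
        unit = coprime⇒∣1 cop (d , trans a≈ (*-comm a₁ d)) a₁∣∂a
        u : Carrier
        u = proj₁ unit
        1≈ : 1# ≈ u * a₁
        1≈ = proj₂ unit
      radical : Radical a
      radical z zero    a∣ = ∣-respʳ (*-identityʳ z) a∣
      radical z (suc k) a∣ = radical z k (square (z ^ suc k) (∣-respʳ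
        (solve 2 (λ z u → z :* (z :* u) :* u := z :* u :* (z :* u)) refl z (z ^ k)) (∣-*ʳ (z ^ k) a∣)))

  private
    opaque
      -- One of a, a + m, a + t m works: if `∂` kills a and a + m, it kills m, and then
      -- `∂ (a + t * m)` is m.
      nonzero-derivative : ∀ a {m} → NonZ m → ∃ λ a′ → a′ ≡ a [ m ] × NonZ (∂ a′)
      nonzero-derivative a {m} m≉0 with ∂ a ≟0 | ∂ (a + m) ≟0
      ... | no  n | _ = a , ≈⇒≡ refl , n
      ... | yes e | no  n = a + m , (1# , (solve 2 (λ a m → (a :+ m) :- a := :1 :* m) refl a m)) , n
      ... | yes e | yes e′ = a + t * m , (t , (solve 3 (λ a m t → (a :+ t :* m) :- a := t :* m) refl a m t)) , λ z → m≉0 (m≈0 (trans (sym dt) z))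
        where
        dm : ∂ m ≈ 0#
        dm = modulo₂ 1# (trans (sym (∂-+ a m)) e′) (- 1#) e (solve 2 (λ u v → v := :0 :+ (:1 :* (u :+ v :- :0) :+ ((:- :1) :* (u :- :0)))) refl (∂ a) (∂ m))
        dt : ∂ (a + t * m) ≈ ∂ a + (∂ t * m + t * ∂ m)
        dt = trans (∂-+ a (t * m)) (+-congˡ (∂-* t m))
        m≈0 : ∂ a + (∂ t * m + t * ∂ m) ≈ 0# → m ≈ 0#
        m≈0 z = modulo₄ 1# z (- 1#) e (- t) dm (- m) ∂t≈1 (solve 5 (λ u v w t m → m := :0 :+ (:1 :* (u :+ (w :* m :+ t :* v) :- :0) :+ ((:- :1) :* (u :- :0) :+ ((:- t) :* (v :- :0) :+ ((:- m) :* (w :- :1)))))) refl (∂ a) (∂ m) (∂ t) t m)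

    opaque
      idempotent-^ : ∀ {D s} n → .{{ℕ.NonZero n}} → s * s ≡ s [ D ] → s ^ n ≡ s [ D ]
      idempotent-^ (suc zero) i = ≈⇒≡ (*-identityʳ _)
      idempotent-^ (suc (suc n)) i = ≡-trans (≡-* (≈⇒≡ refl) (idempotent-^ (suc n) i)) i

  opaque
    -- Adding a p-th power does not change the derivative, so it suffices to make
    -- a prime to its derivative by adding p-th powers of multiples of m.
    make-radical : ∀ {a m} → Coprime a m → NonZ m → ∃ λ a′ → a′ ≡ a [ m ] × Radical a′
    make-radical {a} {m} cop m≉0 =
      let a₀ , a₀≡a , ∂≉0 = nonzero-derivative a m≉0
          s , idem , cop′ = stable-range (coprime-^ p (coprime-≡ a₀≡a cop)) ∂≉0
      -- `stable-range` was applied with modulus m^p, so it treats a₀ + m^p s. This agrees with a₀ +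
      -- (m s)^p modulo `∂ a₀`, because s is idempotent there.
      in a₀ + (m * s) ^ p
        , ≡-trans (∣-respʳ (solve 2 (λ a₀ u → u := (a₀ :+ u) :- a₀) refl a₀ ((m * s) ^ p)) (∣-trans (m∣mk s) (x∣x^p (m * s)))) a₀≡a
        , separable⇒radical (swap a₀ s (coprime-≡ (≡-+ (≈⇒≡ refl) (≡-trans (≈⇒≡ (^-distrib-* m s p))
               (≡-* (≈⇒≡ refl) (idempotent-^ p {{prime⇒nonZero p-prime}} idem)))) cop′))
      where
      swap : ∀ a₀ s → Coprime (a₀ + (m * s) ^ p) (∂ a₀) → Coprime (a₀ + (m * s) ^ p) (∂ (a₀ + (m * s) ^ p))
      swap a₀ s (α , β , e) = α , β , trans (+-congˡ (*-congˡ
        (trans (∂-+ _ _) (trans (+-congˡ (∂^p≈0 (m * s))) (+-identityʳ _))))) e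

  -- Primality as a dichotomy: `split` yields the inverses in the residue field A/ρ as well as the
  -- distinction between ρ dividing the remaining level or being prime to it.
  record IsPrime (ρ : Carrier) : Set where
    field
      ρ≉0 : NonZ ρ
      ρ∤1 : ¬ ρ ∣ 1#
      split : ∀ x → ρ ∣ x ⊎ Coprime x ρ

  data Factored (n : Carrier) : Set where
    unit  : n ∣ 1# → Factored n
    _∷_by_ : ∀ {ρ n′} → IsPrime ρ → Factored n′ → n ≈ ρ * n′ → Factored n

  private
    opaque
      proper-factor : ∀ {n d e} → NonZ n → n ≈ e * d → ¬ e ∣ 1# → deg d ℕ.< deg n
      proper-factor {n} {d} {e} n≉0 eq e∤1 = ≡.subst (deg d ℕ.<_) (≡.sym (≡.trans (deg-cong eq) (deg-* e≉0 d≉0)))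
          (ℕ.m<n+m (deg d) (ℕ.n≢0⇒n>0 (e∤1 ∘ deg≡0⇒∣1 e≉0)))
        where
        e≉0 : NonZ e
        e≉0 = nz-∣ (d , trans eq (*-comm e d)) n≉0
        d≉0 : NonZ d
        d≉0 = nz-∣ (e , eq) n≉0

    opaque
      -- A search through the residues modulo n for one that is neither 0 nor prime to n. If there
      -- is none, n itself is prime; otherwise the gcd with n is a non-unit of smaller degree.
      prime-divisor : ∀ n → NonZ n → ¬ n ∣ 1# → Acc ℕ._<_ (deg n) → ∃ λ ρ → IsPrime ρ × ρ ∣ n
      prime-divisor n n≉0 n∤1 (acc rec) with residues n n≉0
      ... | N , rep , index , ok with Fin.any? (λ i → ¬? (n ∣? rep i) ×-dec ¬? (coprime? (rep i) n))
      ...   | no none = n , record { ρ≉0 = n≉0 ; ρ∤1 = n∤1 ; split = split } , ∣-refl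
        where
        split : ∀ x → n ∣ x ⊎ Coprime x n
        split x with n ∣? rep (index x) | coprime? (rep (index x)) n
        ... | yes y | _ = inj₁ (≡⇒∣ (ok x) y)
        ... | no  _ | yes y = inj₂ (coprime-≡ (ok x) y)
        ... | no  a | no  b = contradiction (index x , a , b) none
      ...   | yes (i , n∤r , ¬cop) with Gcd.d∣b (gcd (rep i) n)
      ...     | e , eq with prime-divisor d (nz-∣ d∣b n≉0) d∤1 (rec (proper-factor n≉0 eq e∤1))
        where
        open Gcd (gcd (rep i) n)
        d∤1 : ¬ d ∣ 1#
        d∤1 d∣1 = ¬cop (coprime-if λ d′ d′∣a d′∣b → ∣-trans (∣-lin₂ _ _ bezout d′∣a d′∣b) d∣1)
        e∤1 : ¬ e ∣ 1#
        e∤1 (u , 1≈) = n∤r (∣-trans (u , (modulo₂ d 1≈ (- u) eq (solve 4 (λ u e d n → d := u :* n :+ (d :* (:1 :- u :* e) :+ ((:- u) :* (n :- e :* d)))) refl u e d n))) d∣a)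
      ...       | ρ , ρ-prime , ρ∣d = ρ , ρ-prime , ∣-trans ρ∣d (e , eq)

    opaque
      factor-acc : ∀ n → NonZ n → Acc ℕ._<_ (deg n) → Factored n
      factor-acc n n≉0 (acc rec) with n ∣? 1#
      ... | yes n∣1 = unit n∣1
      ... | no  n∤1 with prime-divisor n n≉0 n∤1 (<-wellFounded (deg n))
      ...   | ρ , ρ-prime , n′ , eq = ρ-prime ∷ factor-acc n′ (nz-∣ (ρ , eq′) n≉0)
                (rec (proper-factor n≉0 eq′ (IsPrime.ρ∤1 ρ-prime))) by eq′
        where
            eq′ : n ≈ ρ * n′
            eq′ = trans eq (*-comm n′ ρ)

  opaque
    factor : ∀ n → NonZ n → Factored n
    factor n n≉0 = factor-acc n n≉0 (<-wellFounded (deg n))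

-- The congruence subgroups Γ(n) and their homomorphisms to an l-torsion group

module SpecialLinearGroup (R : CommutativeRing 0ℓ 0ℓ) where

  open CommutativeRing R hiding (zero)
  open RingSolver R
  open Divisibility R using (modulo₁; modulo₂)

  infix 4 _≋_
  infixl 7 _⊙_

  record SL : Set where
    constructor sl
    field
      a b c d : Carrier
      det : a * d - b * c ≈ 1#

  record _≋_ (g h : SL) : Set where
    constructor mk≋
    private
      module g = SL g
      module h = SL h
    field
      a≈ : g.a ≈ h.a
      b≈ : g.b ≈ h.b
      c≈ : g.c ≈ h.c
      d≈ : g.d ≈ h.d

  opaque
    ⊙-det : ∀ {a b c d a′ b′ c′ d′} → a * d - b * c ≈ 1# → a′ * d′ - b′ * c′ ≈ 1# →
            (a * a′ + b * c′) * (c * b′ + d * d′) - (a * b′ + b * d′) * (c * a′ + d * c′) ≈ 1#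
    ⊙-det {a} {b} {c} {d} {a′} {b′} {c′} {d′} e e′ = modulo₂ (a′ * d′ - b′ * c′) e 1# e′ (solve 8 (λ a b c d a′ b′ c′ d′ → (a :* a′ :+ b :* c′) :* (c :* b′ :+ d :* d′) :- (a :* b′ :+ b :* d′) :* (c :* a′ :+ d :* c′) := :1 :+ ((a′ :* d′ :- b′ :* c′) :* (a :* d :- b :* c :- :1) :+ (:1 :* (a′ :* d′ :- b′ :* c′ :- :1)))) refl a b c d a′ b′ c′ d′)

  opaque
    inv-det : ∀ {a b c d} → a * d - b * c ≈ 1# → d * a - (- b) * (- c) ≈ 1#
    inv-det {a} {b} {c} {d} e = modulo₁ 1# e (solve 4 (λ a b c d → d :* a :- (:- b) :* (:- c) := :1 :+ (:1 :* (a :* d :- b :* c :- :1))) refl a b c d)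

  opaque
    upper-det : ∀ s → 1# * 1# - s * 0# ≈ 1#
    upper-det s = solve 1 (λ s → :1 :* :1 :- s :* :0 := :1) refl s

  opaque
    lower-det : ∀ s → 1# * 1# - 0# * s ≈ 1#
    lower-det s = solve 1 (λ s → :1 :* :1 :- :0 :* s := :1) refl s

  _⊙_ : SL → SL → SL
  sl a b c d e ⊙ sl a′ b′ c′ d′ e′ =
    sl (a * a′ + b * c′) (a * b′ + b * d′) (c * a′ + d * c′) (c * b′ + d * d′) (⊙-det e e′)

  1SL : SL
  1SL = sl 1# 0# 0# 1# (upper-det 0#)

  inv : SL → SL
  inv (sl a b c d e) = sl d (- b) (- c) a (inv-det e)

  SLGroup : Group 0ℓ 0ℓ
  SLGroup = record
    { Carrier = SL ; _≈_ = _≋_ ; _∙_ = _⊙_ ; ε = 1SL ; _⁻¹ = inv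
    ; isGroup = record
      { isMonoid = record
        { isSemigroup = record
          { isMagma = record
            { isEquivalence = record
              { refl  = mk≋ refl refl refl refl
              ; sym   = λ (mk≋ p q r s) → mk≋ (sym p) (sym q) (sym r) (sym s)
              ; trans = λ (mk≋ p q r s) (mk≋ p′ q′ r′ s′) → mk≋ (trans p p′) (trans q q′) (trans r r′) (trans s s′)
              }
            ; ∙-cong = λ (mk≋ p q r s) (mk≋ p′ q′ r′ s′) → mk≋
                (+-cong (*-cong p p′) (*-cong q r′)) (+-cong (*-cong p q′) (*-cong q s′))
                (+-cong (*-cong r p′) (*-cong s r′)) (+-cong (*-cong r q′) (*-cong s s′))
            }
          ; assoc = assoc }
        ; identity = identityˡ , identityʳ }
      ; inverse = inverseˡ , inverseʳ
      ; ⁻¹-cong = λ (mk≋ p q r s) → mk≋ s (-‿cong q) (-‿cong r) p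
      }
    }
    where
    assoc : ∀ g h k → (g ⊙ h) ⊙ k ≋ g ⊙ (h ⊙ k)
    assoc (sl a b c d _) (sl a′ b′ c′ d′ _) (sl a″ b″ c″ d″ _) =
      mk≋ (law a b a′ b′ c′ d′ a″ c″) (law a b a′ b′ c′ d′ b″ d″) (law c d a′ b′ c′ d′ a″ c″) (law c d a′ b′ c′ d′ b″ d″)
      where
      law : ∀ a b a′ b′ c′ d′ x y → (a * a′ + b * c′) * x + (a * b′ + b * d′) * y ≈ a * (a′ * x + b′ * y) + b * (c′ * x + d′ * y)
      law a b a′ b′ c′ d′ x y =
        solve 8 (λ a b a′ b′ c′ d′ x y → (a :* a′ :+ b :* c′) :* x :+ (a :* b′ :+ b :* d′) :* y := a :* (a′ :* x :+ b′ :* y) :+ b :* (c′ :* x :+ d′ :* y)) refl a b a′ b′ c′ d′ x y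
    row₁ : ∀ x y → 1# * x + 0# * y ≈ x
    row₁ x y = solve 2 (λ x y → :1 :* x :+ :0 :* y := x) refl x y
    row₂ : ∀ x y → 0# * x + 1# * y ≈ y
    row₂ x y = solve 2 (λ x y → :0 :* x :+ :1 :* y := y) refl x y
    identityˡ : ∀ g → 1SL ⊙ g ≋ g
    identityˡ (sl a b c d _) = mk≋ (row₁ a c) (row₁ b d) (row₂ a c) (row₂ b d)
    col₁ : ∀ x y → x * 1# + y * 0# ≈ x
    col₁ x y = solve 2 (λ x y → x :* :1 :+ y :* :0 := x) refl x y
    col₂ : ∀ x y → x * 0# + y * 1# ≈ y
    col₂ x y = solve 2 (λ x y → x :* :0 :+ y :* :1 := y) refl x y
    identityʳ : ∀ g → g ⊙ 1SL ≋ g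
    identityʳ (sl a b c d _) = mk≋ (col₁ a b) (col₂ a b) (col₁ c d) (col₂ c d)
    inverseˡ : ∀ g → inv g ⊙ g ≋ 1SL
    inverseˡ (sl a b c d e) = mk≋
      (modulo₁ 1# e (solve 4 (λ a b c d → d :* a :+ (:- b) :* c := :1 :+ (:1 :* (a :* d :- b :* c :- :1))) refl a b c d))
      (solve 2 (λ b d → d :* b :+ (:- b) :* d := :0) refl b d) (solve 2 (λ a c → (:- c) :* a :+ a :* c := :0) refl a c)
      (modulo₁ 1# e (solve 4 (λ a b c d → (:- c) :* b :+ a :* d := :1 :+ (:1 :* (a :* d :- b :* c :- :1))) refl a b c d))
    inverseʳ : ∀ g → g ⊙ inv g ≋ 1SL
    inverseʳ (sl a b c d e) = mk≋
      (modulo₁ 1# e (solve 4 (λ a b c d → a :* d :+ b :* (:- c) := :1 :+ (:1 :* (a :* d :- b :* c :- :1))) refl a b c d))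
      (solve 2 (λ a b → a :* (:- b) :+ b :* a := :0) refl a b) (solve 2 (λ c d → c :* d :+ d :* (:- c) := :0) refl c d)
      (modulo₁ 1# e (solve 4 (λ a b c d → c :* (:- b) :+ d :* a := :1 :+ (:1 :* (a :* d :- b :* c :- :1))) refl a b c d))

  E₁₂ E₂₁ : Carrier → SL
  E₁₂ s = sl 1# s 0# 1# (upper-det s)
  E₂₁ s = sl 1# 0# s 1# (lower-det s)

module SpecialLinear (𝔸 : Arithmetic) where

  open Arith 𝔸 hiding (unit)
  open SpecialLinearGroup commRing public

  record Γ (n : Carrier) : Set where
    constructor γ
    field
      el : SL
    open SL el public
    field
      a≡1 : n ∣ a - 1#
      n∣b : n ∣ b
      n∣c : n ∣ c
      d≡1 : n ∣ d - 1#

  module _ {n : Carrier} where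

    private
      4-∣ : ∀ {x y z w} i j k m → n ∣ x → n ∣ y → n ∣ z → n ∣ w → n ∣ i * x + j * y + (k * z + m * w)
      4-∣ i j k m p q r s = ∣-+ (∣-+ (∣-*ˡ i p) (∣-*ˡ j q)) (∣-+ (∣-*ˡ k r) (∣-*ˡ m s))

    opaque
      ∙-congruent : (g h : Γ n) → let open SL (Γ.el g ⊙ Γ.el h) in
                    (n ∣ a - 1#) × (n ∣ b) × (n ∣ c) × (n ∣ d - 1#)
      ∙-congruent (γ (sl a b c d _) p q r s) (γ (sl a′ b′ c′ d′ _) p′ q′ r′ s′) =
          ∣-lin₃ a′ c′ 1# (solve 4 (λ a b a′ c′ → a :* a′ :+ b :* c′ :- :1 := a′ :* (a :- :1) :+ c′ :* b :+ :1 :* (a′ :- :1)) refl a b a′ c′) p q p′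
        , ∣-lin₂ a d′ (solve 4 (λ a b b′ d′ → a :* b′ :+ b :* d′ := a :* b′ :+ d′ :* b) refl a b b′ d′) q′ q
        , ∣-lin₂ a′ d (solve 4 (λ c d a′ c′ → c :* a′ :+ d :* c′ := a′ :* c :+ d :* c′) refl c d a′ c′) r r′
        , ∣-lin₃ b′ d′ 1# (solve 4 (λ c d b′ d′ → c :* b′ :+ d :* d′ :- :1 := b′ :* c :+ d′ :* (d :- :1) :+ :1 :* (d′ :- :1)) refl c d b′ d′) r s s′

    opaque
      conj-congruent : (h : SL) (g : Γ n) → let open SL (h ⊙ Γ.el g ⊙ inv h) in
                       (n ∣ a - 1#) × (n ∣ b) × (n ∣ c) × (n ∣ d - 1#)
      conj-congruent (sl x y z w e) (γ (sl a b c d _) p q r s) =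
          ∣-respʳ (modulo₁ (- 1#) e (solve 8 (λ x y z w a b c d → x :* w :* (a :- :1) :+ (:- (x :* z)) :* b :+ (y :* w :* c :+ (:- (y :* z)) :* (d :- :1)) := (x :* a :+ y :* c) :* w :+ (x :* b :+ y :* d) :* (:- z) :- :1 :+ ((:- :1) :* (x :* w :- y :* z :- :1))) refl x y z w a b c d))
          (4-∣ _ _ _ _ p q r s)
        , ∣-respʳ (solve 6 (λ x y a b c d → (:- (x :* y)) :* (a :- :1) :+ x :* x :* b :+ ((:- (y :* y)) :* c :+ x :* y :* (d :- :1)) := (x :* a :+ y :* c) :* (:- y) :+ (x :* b :+ y :* d) :* x) refl x y a b c d)
          (4-∣ _ _ _ _ p q r s)
        , ∣-respʳ (solve 6 (λ z w a b c d → z :* w :* (a :- :1) :+ (:- (z :* z)) :* b :+ (w :* w :* c :+ (:- (z :* w)) :* (d :- :1)) := (z :* a :+ w :* c) :* w :+ (z :* b :+ w :* d) :* (:- z)) refl z w a b c d)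
          (4-∣ _ _ _ _ p q r s)
        , ∣-respʳ (modulo₁ (- 1#) e (solve 8 (λ x y z w a b c d → (:- (z :* y)) :* (a :- :1) :+ x :* z :* b :+ ((:- (y :* w)) :* c :+ x :* w :* (d :- :1)) := (z :* a :+ w :* c) :* (:- y) :+ (z :* b :+ w :* d) :* x :- :1 :+ ((:- :1) :* (x :* w :- y :* z :- :1))) refl x y z w a b c d))
          (4-∣ _ _ _ _ p q r s)

    opaque
      inv-congruent : (g : Γ n) → (n ∣ Γ.d g - 1#) × (n ∣ - Γ.b g) × (n ∣ - Γ.c g) × (n ∣ Γ.a g - 1#)
      inv-congruent (γ g p q r s) = s , ∣-neg q , ∣-neg r , p

    opaque
      1-congruent : (n ∣ 1# - 1#) × (n ∣ 0#)
      1-congruent = ≈⇒≡ refl , ∣0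

    mkΓ : (g : SL) → let open SL g in (n ∣ a - 1#) × (n ∣ b) × (n ∣ c) × (n ∣ d - 1#) → Γ n
    mkΓ g (p , q , r , s) = γ g p q r s

    infixl 7 _∙Γ_

    _∙Γ_ : Γ n → Γ n → Γ n
    g ∙Γ h = mkΓ (Γ.el g ⊙ Γ.el h) (∙-congruent g h)

    1Γ : Γ n
    1Γ = γ 1SL (proj₁ 1-congruent) (proj₂ 1-congruent) (proj₂ 1-congruent) (proj₁ 1-congruent)

    invΓ : Γ n → Γ n
    invΓ g = mkΓ (inv (Γ.el g)) (inv-congruent g)

    conj : SL → Γ n → Γ n
    conj h g = mkΓ (h ⊙ Γ.el g ⊙ inv h) (conj-congruent h g)

  ΓGroup : Carrier → Group 0ℓ 0ℓ
  ΓGroup n = record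
    { Carrier = Γ n ; _≈_ = λ g h → Γ.el g ≋ Γ.el h ; _∙_ = _∙Γ_ ; ε = 1Γ ; _⁻¹ = invΓ
    ; isGroup = record
      { isMonoid = record
        { isSemigroup = record
          { isMagma = record
            { isEquivalence = record { refl = S.refl ; sym = S.sym ; trans = S.trans }
            ; ∙-cong = S.∙-cong }
          ; assoc = λ g h k → S.assoc (Γ.el g) (Γ.el h) (Γ.el k) }
        ; identity = (λ g → S.identityˡ (Γ.el g)) , (λ g → S.identityʳ (Γ.el g)) }
      ; inverse = (λ g → S.inverseˡ (Γ.el g)) , (λ g → S.inverseʳ (Γ.el g))
      ; ⁻¹-cong = S.⁻¹-cong }
    }
    where module S = Group SLGroup

  opaque
    unipotent-det : ∀ {x y z} → x * x + y * z ≈ 0# → (1# + x) * (1# - x) - y * z ≈ 1#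
    unipotent-det {x} {y} {z} e = modulo₁ (- 1#) e (solve 3 (λ x y z → (:1 :+ x) :* (:1 :- x) :- y :* z := :1 :+ ((:- :1) :* (x :* x :+ y :* z :- :0))) refl x y z)

  opaque
    unipotent-congruent : ∀ {n x} → n ∣ x → (n ∣ 1# + x - 1#) × (n ∣ 1# - x - 1#)
    unipotent-congruent {n} {x} p = ∣-lin₁ 1# (solve 1 (λ x → :1 :+ x :- :1 := :1 :* x) refl x) p
      , ∣-lin₁ (- 1#) (solve 1 (λ x → :1 :- x :- :1 := (:- :1) :* x) refl x) p

  opaque
    nilpotent-scale : ∀ {x y z} k → x * x + y * z ≈ 0# → (k * x) * (k * x) + (k * y) * (k * z) ≈ 0#
    nilpotent-scale {x} {y} {z} k e = modulo₁ (k * k) e (solve 4 (λ k x y z → (k :* x) :* (k :* x) :+ (k :* y) :* (k :* z) := :0 :+ ((k :* k) :* (x :* x :+ y :* z :- :0))) refl k x y z)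

  -- The unipotent matrix 1 + X, X = (x y; z −x), X² = 0.
  unipotent : ∀ {n} x y z → x * x + y * z ≈ 0# → n ∣ x → n ∣ y → n ∣ z → Γ n
  unipotent x y z e p q r = γ (sl (1# + x) y z (1# - x) (unipotent-det e))
    (proj₁ (unipotent-congruent p)) q r (proj₂ (unipotent-congruent p))

  record Column (n : Carrier) : Set where
    constructor column
    field
      a c : Carrier
      a≡1 : n ∣ a - 1#
      n∣c : n ∣ c
      coprime : Coprime a c

  opaque
    fill-det : ∀ {a c α β} → α * a + β * c ≈ 1# → a * (α + β * c) - β * (a - 1#) * c ≈ 1#
    fill-det {a} {c} {α} {β} e = modulo₁ 1# e (solve 4 (λ a c α β → a :* (α :+ β :* c) :- β :* (a :- :1) :* c := :1 :+ (:1 :* (α :* a :+ β :* c :- :1))) refl a c α β)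

  opaque
    fill-congruent : ∀ {n a c α β} → α * a + β * c ≈ 1# → n ∣ a - 1# → n ∣ α + β * c - 1#
    fill-congruent {n} {a} {c} {α} {β} e p =
      ∣-lin₁ (- α) (modulo₁ 1# e (solve 4 (λ a c α β → α :+ β :* c :- :1 := (:- α) :* (a :- :1) :+ (:1 :* (α :* a :+ β :* c :- :1))) refl a c α β)) p

  -- From α a + β c = 1 the obvious completion has second column (-β, α). Adding β times the first
  -- column to it gives (β(a - 1), α + β c), which is congruent to (0, 1) modulo n.
  fill : ∀ {n} → Column n → Γ n
  fill (column a c p q (α , β , e)) =
    γ (sl a (β * (a - 1#)) c (α + β * c) (fill-det e)) p (∣-*ˡ β p) q (fill-congruent e p)

  opaque
    column-coprime : ∀ {a b c d} → a * d - b * c ≈ 1# → Coprime a c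
    column-coprime {a} {b} {c} {d} e = d , - b , (modulo₁ 1# e (solve 4 (λ a b c d → d :* a :+ (:- b) :* c := :1 :+ (:1 :* (a :* d :- b :* c :- :1))) refl a b c d))

  column-of : ∀ {n} → Γ n → Column n
  column-of (γ (sl a b c d e) p q r s) = column a c p r (column-coprime {d = d} e)

module Coefficients
  (𝔸 : Arithmetic) (M : AbelianGroup 0ℓ 0ℓ) (l : ℕ) (l-prime : Prime l)
  (l≢2 : l ≢ 2) (p≢l : Arithmetic.p 𝔸 ≢ l)
  (lM≈0 : ∀ m → AbelianGroup._≈_ M
                  (Algebra.Properties.Monoid.Mult._×_ (AbelianGroup.monoid M) l m) (AbelianGroup.ε M))
  where

  open Arith 𝔸 hiding (unit)
  open SpecialLinear 𝔸 public
  module M = AbelianGroup M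
  open M public using () renaming (Carrier to |M|; _≈_ to _≈ᴹ_; _∙_ to _⊞_; ε to 0ᴹ; _⁻¹ to ⊟_)
  open Algebra.Properties.Monoid.Mult M.monoid public using () renaming (_×_ to _⊡_)
  open Algebra.Properties.Group M.group public using (identityˡ-unique; inverseˡ-unique; inverseʳ-unique; ε⁻¹≈ε)

  p-torsion-free : ∀ {m} → p ⊡ m ≈ᴹ 0ᴹ → m ≈ᴹ 0ᴹ
  p-torsion-free {m} e = torsion-coprime M.monoid (prime-coprime p-prime l-prime p≢l) e (lM≈0 m)

  record Hom (n : Carrier) : Set where
    field
      ⟦_⟧  : Γ n → |M|
      cong : ∀ {g h} → Γ.el g ≋ Γ.el h → ⟦ g ⟧ ≈ᴹ ⟦ h ⟧
      homo : ∀ g h → ⟦ g ∙Γ h ⟧ ≈ᴹ ⟦ g ⟧ ⊞ ⟦ h ⟧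

    homo-1 : ⟦ 1Γ ⟧ ≈ᴹ 0ᴹ
    homo-1 = identityˡ-unique _ _ (M.trans (M.sym (homo 1Γ 1Γ)) (cong (G.identityˡ 1Γ)))
      where module G = Group (ΓGroup n)

    homo-inv : ∀ g → ⟦ invΓ g ⟧ ≈ᴹ ⊟ ⟦ g ⟧
    homo-inv g = inverseˡ-unique _ _ (M.trans (M.sym (homo (invΓ g) g)) (M.trans (cong (G.inverseˡ g)) homo-1))
      where module G = Group (ΓGroup n)

    -- Since X² = 0, the matrices 1 + k X multiply by adding k, so 1 + X has p-th power 1, and M has
    -- no p-torsion.
    homo-unipotent : ∀ x y z e p q r → ⟦ unipotent x y z e p q r ⟧ ≈ᴹ 0ᴹ
    homo-unipotent x y z e ∣x ∣y ∣z = p-torsion-free (M.trans (multiple p) (M.trans (cong {U (p · 1#)} {1Γ} vanish) homo-1))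
      where
      U : Carrier → Γ n
      U k = unipotent (k * x) (k * y) (k * z) (nilpotent-scale k e) (∣-*ˡ k ∣x) (∣-*ˡ k ∣y) (∣-*ˡ k ∣z)
      u : Γ n
      u = unipotent x y z e ∣x ∣y ∣z
      step : ∀ k k′ → k′ ≈ 1# + k → Γ.el (u ∙Γ U k) ≋ Γ.el (U k′)
      step k k′ e′ = mk≋
        (modulo₂ k e (- x) e′ (solve 5 (λ k k′ x y z → (:1 :+ x) :* (:1 :+ k :* x) :+ y :* (k :* z) := :1 :+ k′ :* x :+ (k :* (x :* x :+ y :* z :- :0) :+ ((:- x) :* (k′ :- (:1 :+ k))))) refl k k′ x y z))
        (modulo₁ (- y) e′ (solve 4 (λ k k′ x y → (:1 :+ x) :* (k :* y) :+ y :* (:1 :- k :* x) := k′ :* y :+ ((:- y) :* (k′ :- (:1 :+ k)))) refl k k′ x y))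
        (modulo₁ (- z) e′ (solve 4 (λ k k′ x z → z :* (:1 :+ k :* x) :+ (:1 :- x) :* (k :* z) := k′ :* z :+ ((:- z) :* (k′ :- (:1 :+ k)))) refl k k′ x z))
        (modulo₂ k e x e′ (solve 5 (λ k k′ x y z → z :* (k :* y) :+ (:1 :- x) :* (:1 :- k :* x) := :1 :- k′ :* x :+ (k :* (x :* x :+ y :* z :- :0) :+ (x :* (k′ :- (:1 :+ k))))) refl k k′ x y z))
      multiple : ∀ k → k ⊡ ⟦ u ⟧ ≈ᴹ ⟦ U (k · 1#) ⟧
      multiple zero = M.sym (M.trans (cong {U (0 · 1#)} {1Γ} (mk≋
        (solve 1 (λ x → :1 :+ :0 :* x := :1) refl x) (zeroˡ y) (zeroˡ z) (solve 1 (λ x → :1 :- :0 :* x := :1) refl x))) homo-1)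
      multiple (suc k) = M.trans (M.∙-congˡ (multiple k)) (M.trans (M.sym (homo u (U (k · 1#)))) (cong {u ∙Γ U (k · 1#)} {U (suc k · 1#)} (step (k · 1#) (suc k · 1#) refl)))
      vanish : Γ.el (U (p · 1#)) ≋ 1SL
      vanish = mk≋ (modulo₁ x p·1≈0 (solve 2 (λ k x → :1 :+ k :* x := :1 :+ (x :* (k :- :0))) refl (p · 1#) x))
        (trans (*-congʳ p·1≈0) (zeroˡ y)) (trans (*-congʳ p·1≈0) (zeroˡ z))
        (modulo₁ (- x) p·1≈0 (solve 2 (λ k x → :1 :- k :* x := :1 :+ ((:- x) :* (k :- :0))) refl (p · 1#) x))

    unipotent-∙ : ∀ x y z e p q r g → ⟦ unipotent x y z e p q r ∙Γ g ⟧ ≈ᴹ ⟦ g ⟧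
    unipotent-∙ x y z e p q r g = M.trans (homo _ g)
      (M.trans (M.∙-congʳ (homo-unipotent x y z e p q r)) (M.identityˡ _))

    -- Two elements of Γ(n) with the same first column differ by a unipotent on the right.
    first-column : ∀ g h → Γ.a g ≈ Γ.a h → Γ.c g ≈ Γ.c h → ⟦ g ⟧ ≈ᴹ ⟦ h ⟧
    first-column g@(γ (sl a b c d e) _ q _ _) h@(γ (sl a′ b′ c′ d′ e′) _ q′ _ _) a≈ c≈ = M.sym (M.trans
      (cong {g = h} {h = g ∙Γ U} (mk≋
        (modulo₁ (- 1#) a≈ (solve 8 (λ a b c d a′ b′ c′ d′ → a′ := a :* (:1 :+ :0) :+ b :* :0 :+ ((:- :1) :* (a :- a′))) refl a b c d a′ b′ c′ d′))
        (modulo₄ (- b′) e b e′ (b * d′) a≈ (- (b * b′)) c≈ (solve 8 (λ a b c d a′ b′ c′ d′ → b′ := a :* (d :* b′ :- b :* d′) :+ b :* (:1 :- :0) :+ ((:- b′) :* (a :* d :- b :* c :- :1) :+ (b :* (a′ :* d′ :- b′ :* c′ :- :1) :+ ((b :* d′) :* (a :- a′) :+ ((:- (b :* b′)) :* (c :- c′)))))) refl a b c d a′ b′ c′ d′))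
        (modulo₁ (- 1#) c≈ (solve 8 (λ a b c d a′ b′ c′ d′ → c′ := c :* (:1 :+ :0) :+ d :* :0 :+ ((:- :1) :* (c :- c′))) refl a b c d a′ b′ c′ d′))
        (modulo₄ (- d′) e d e′ (d * d′) a≈ (- (d * b′)) c≈ (solve 8 (λ a b c d a′ b′ c′ d′ → d′ := c :* (d :* b′ :- b :* d′) :+ d :* (:1 :- :0) :+ ((:- d′) :* (a :* d :- b :* c :- :1) :+ (d :* (a′ :* d′ :- b′ :* c′ :- :1) :+ ((d :* d′) :* (a :- a′) :+ ((:- (d :* b′)) :* (c :- c′)))))) refl a b c d a′ b′ c′ d′))))
      (M.trans (homo g U) (M.trans (M.∙-congˡ (homo-unipotent _ _ _ _ _ _ _)) (M.identityʳ _))))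
      where
      U : Γ n
      U = unipotent 0# (d * b′ - b * d′) 0# (solve 1 (λ u → :0 :* :0 :+ u :* :0 := :0) refl (d * b′ - b * d′))
            ∣0 (∣-lin₂ d (- d′) (solve 4 (λ b d b′ d′ → d :* b′ :- b :* d′ := d :* b′ :+ (:- d′) :* b) refl b d b′ d′) q′ q) ∣0

    -- A relative of the Mennicke symbol: the value of the homomorphism as a function [a; c] of the
    -- first column.
    symbol : Column n → |M|
    symbol v = ⟦ fill v ⟧

    symbol-column : ∀ g → ⟦ g ⟧ ≈ᴹ symbol (column-of g)
    symbol-column g = first-column g (fill (column-of g)) refl refl

    symbol-cong : ∀ v w → Column.a v ≈ Column.a w → Column.c v ≈ Column.c w → symbol v ≈ᴹ symbol w
    symbol-cong v w = first-column (fill v) (fill w)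

    symbol-unipotent : ∀ x y z → x * x + y * z ≈ 0# → n ∣ x → n ∣ y → n ∣ z → ∀ v w →
      Column.a w ≈ Column.a v + x * Column.a v + y * Column.c v →
      Column.c w ≈ Column.c v + z * Column.a v - x * Column.c v → symbol v ≈ᴹ symbol w
    symbol-unipotent x y z e p q r v@(column a c _ _ _) w ea ec = M.trans (M.sym (unipotent-∙ x y z e p q r (fill v)))
      (first-column (unipotent x y z e p q r ∙Γ fill v) (fill w)
        (trans (solve 4 (λ x y a c → (:1 :+ x) :* a :+ y :* c := a :+ x :* a :+ y :* c) refl x y a c) (sym ea))
        (trans (solve 4 (λ x z a c → z :* a :+ (:1 :- x) :* c := c :+ z :* a :- x :* c) refl x z a c) (sym ec)))

    symbol-E₁₂ : ∀ y → n ∣ y → ∀ v w → Column.a w ≈ Column.a v + y * Column.c v → Column.c w ≈ Column.c v → symbol v ≈ᴹ symbol w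
    symbol-E₁₂ y n∣y v@(column a c _ _ _) w ea ec = symbol-unipotent 0# y 0# (solve 1 (λ y → :0 :* :0 :+ y :* :0 := :0) refl y) ∣0 n∣y ∣0 v w
      (trans ea (solve 3 (λ y a c → a :+ y :* c := a :+ :0 :* a :+ y :* c) refl y a c)) (trans ec (solve 2 (λ a c → c := c :+ :0 :* a :- :0 :* c) refl a c))

    symbol-E₂₁ : ∀ z → n ∣ z → ∀ v w → Column.a w ≈ Column.a v → Column.c w ≈ Column.c v + z * Column.a v → symbol v ≈ᴹ symbol w
    symbol-E₂₁ z n∣z v@(column a c _ _ _) w ea ec = symbol-unipotent 0# 0# z (solve 1 (λ z → :0 :* :0 :+ :0 :* z := :0) refl z) ∣0 ∣0 n∣z v w
      (trans ea (solve 2 (λ a c → a := a :+ :0 :* a :+ :0 :* c) refl a c)) (trans ec (solve 3 (λ z a c → c :+ z :* a := c :+ z :* a :- :0 :* c) refl z a c))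

-- Linked homomorphisms

module Frobenius (𝔸 : Arithmetic) where

  open Arith 𝔸 hiding (unit) renaming (_≡_[_] to _≡_⟨mod_⟩)

  module _ (n π : Carrier) (n≉0 : NonZ n) (π⊥n : Coprime π n) (π∤1 : ¬ π ∣ 1#) (π≉0 : NonZ π) where

    -- This is π^(p^D) - π, that is π(πᵏ - 1) with k = p^D - 1.
    T : ℕ → Carrier
    T D = σ D π - π

    private
      T-+ : ∀ D E → T (D ℕ.+ E) ≈ σ D (T E) + T D
      T-+ D E = trans (+-congʳ (reflexive (σ-∘ D E π))) (trans
        (solve 3 (λ u v w → u :- w := (u :- v) :+ (v :- w)) refl (σ D (σ E π)) (σ D π) π)
        (+-congʳ (sym (σ-sub D (σ E π) π))))

      T∣T : ∀ D k → T D ∣ T (k ℕ.* D)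
      T∣T D zero    = ∣-respʳ (sym (-‿inverseʳ π)) ∣0
      T∣T D (suc k) = ∣-respʳ (sym (T-+ D (k ℕ.* D)))
        (∣-+ (∣-trans (T∣T D k) (∣σ D (T (k ℕ.* D)))) ∣-refl)

      x^p-split : ∀ x → ∃ λ k → x ^ p ≈ x * x ^ suc k
      x^p-split x = go p {{prime⇒nonTrivial p-prime}}
        where
        go : ∀ j → .{{ℕ.NonTrivial j}} → ∃ λ k → x ^ j ≈ x * x ^ suc k
        go (suc (suc j)) = j , refl

    T-nonzero : ∀ D → NonZ (T (suc D))
    T-nonzero D T≈0 = [ π≉0 , (λ e → π∤1 (unit-power k e)) ]′ (integral π (π ^ suc k - 1#) (trans (solve 2 (λ u v → u :* (v :- :1) := u :* v :- u) refl π (π ^ suc k))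
        (trans (+-congʳ (sym eq)) T≈0)))
      where
      split : ∃ λ k → σ (suc D) π ≈ π * π ^ suc k
      split =
        let j , e = σ-power D π
            i , e′ = x^p-split (σ D π)
        in i ℕ.+ j ℕ.* suc i ℕ.+ j , trans e′ (trans (*-cong e (^-congˡ (suc i) e)) (trans (*-congˡ (^-assocʳ π (suc j) (suc i)))
             (trans (*-assoc π (π ^ j) _) (*-congˡ (trans (sym (^-homo-* π j _))
               (reflexive (≡.cong (π ^_) (ℕ.+-comm j (suc j ℕ.* suc i)))))))))
      k = proj₁ split
      eq = proj₂ split
      unit-power : ∀ k → π ^ suc k - 1# ≈ 0# → π ∣ 1#
      unit-power k e = π ^ k , (modulo₁ (- 1#) e (solve 2 (λ u v → :1 := v :* u :+ ((:- :1) :* (u :* v :- :1 :- :0))) refl π (π ^ k)))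

    -- The condition gives `T (suc J * suc D)` = g e with e ≡ 1 modulo n for every J, where g =
    -- `T (suc D)`. So g is fixed once and for all. This is essential: columns are first made
    -- divisible by g², the two squarefree elements depend on the columns, and the exponent of π
    -- depends on these elements.
    record Period : Set where
      field
        D : ℕ
        h : Carrier
        σT : σ (suc D) (T (suc D)) ≈ T (suc D) * h
        n∣h : n ∣ h

    opaque
      period : Period
      period =
        let i , d , i≡ = pigeonhole n≉0 (λ k → σ k π)
            -- A multiple of the period `suc d` that exceeds i. Then `σ` iterated this often
            -- contains the p-th power of `σ i g`. As p ≥ 2, one factor `σ i g` accounts for g and
            -- another one for n. The field `D` is one less than this number.
            D = suc i ℕ.* suc d
            g = T D
            n∣σT = ∣-lin₁ {m = n} (- 1#) (trans (σ-sub i (σ (suc d) π) π)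
                     (trans (+-congʳ (reflexive (≡.sym (σ-∘ i (suc d) π))))
                       (solve 2 (λ u v → v :- u := (:- :1) :* (u :- v)) refl (σ i π) (σ (i ℕ.+ suc d) π)))) i≡
            n∣σg = ∣-trans n∣σT (σ-∣ i (T∣T (suc d) (suc i)))
            k , e = x^p-split (σ i g)
            j , e′ = ∣σ i g
            o , eq = ℕ.m≤n⇒∃[o]m+o≡n (ℕ.m≤m*n (suc i) (suc d))
            f , e″ = ∣σ o g
            h = j * σ i g ^ suc k * σ (suc i) f
        in record
          { D = d ℕ.+ i ℕ.* suc d
          ; h = h
          ; σT = trans (reflexive (≡.cong (λ m → σ m g) (≡.sym eq))) (trans (reflexive (σ-∘ (suc i) o g))
              (trans (σ-cong (suc i) e″) (trans (σ-* (suc i) f g) (trans (*-congˡ (trans e (*-congʳ e′)))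
                (solve 4 (λ u j g w → u :* (j :* g :* w) := g :* (j :* w :* u)) refl (σ (suc i) f) j g (σ i g ^ suc k))))))
          ; n∣h = ∣-*ʳ (σ (suc i) f) (∣-*ˡ j (∣-*ʳ (σ i g ^ k) n∣σg)) }

    open Period period

    g : Carrier
    g = T (suc D)

    g≉0 : NonZ g
    g≉0 = T-nonzero D

    π∣g : π ∣ g
    π∣g = ∣-sub (∣σ (suc D) π) ∣-refl

    private
      -- `T-+` turns T at the next multiple into σ(g e) + g = g(h σ(e) + 1), and n divides h.
      quotient : ∀ J → ∃ λ e → T (suc J ℕ.* suc D) ≈ g * e × n ∣ e - 1#
      quotient zero = 1# , trans (reflexive (≡.cong T (ℕ.+-identityʳ (suc D)))) (sym (*-identityʳ g)) , ≈⇒≡ refl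
      quotient (suc J) =
        let e , T≈ , n∣e-1 = quotient J
            e′ = 1# + h * σ (suc D) e
        in e′
          , trans (T-+ (suc D) (suc J ℕ.* suc D)) (trans (+-congʳ (trans (σ-cong (suc D) T≈)
              (trans (σ-* (suc D) g e) (*-congʳ σT)))) (solve 3 (λ g h s → g :* h :* s :+ g := g :* (:1 :+ h :* s)) refl g h (σ (suc D) e)))
          , ∣-respʳ (solve 1 (λ u → u := :1 :+ u :- :1) refl (h * σ (suc D) e)) (∣-*ʳ (σ (suc D) e) n∣h)

      -- The iterates of π under Frobenius are eventually periodic modulo a. Frobenius has no kernel
      -- on the reduced ring A/a, so the preperiod can be cancelled.
      radical∣T : ∀ {a} → Radical a → Coprime a π → ∃ λ J → a ∣ T (suc J ℕ.* suc D)
      radical∣T {a} rad cop =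
        let i , d , i≡ = pigeonhole a≉0 (λ k → σ (k ℕ.* suc D) π)
            I = i ℕ.* suc D
            K = suc d ℕ.* suc D
            k , e = σ-power I (T K)
            a∣ = ∣-lin₁ {m = a} (- 1#) (trans (sym e) (trans (σ-sub I (σ K π) π)
                   (trans (+-congʳ (trans (reflexive (≡.sym (σ-∘ I K π)))
                     (reflexive (≡.cong (λ m → σ m π) (≡.sym (ℕ.*-distribʳ-+ (suc D) i (suc d)))))))
                   (solve 2 (λ u v → v :- u := (:- :1) :* (u :- v)) refl (σ I π) (σ ((i ℕ.+ suc d) ℕ.* suc D) π))))) i≡
        in d , rad (T K) k a∣
        where
        a≉0 : NonZ a
        a≉0 a≈0 = π∤1 (coprime⇒∣1 cop (∣-respʳ (sym a≈0) ∣0) ∣-refl)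

    opaque
      -- A common multiple of the two Frobenius exponents serves both moduli. The factor π of `T` is
      -- cancelled because the moduli are prime to π.
      common-exponent : ∀ {a a′} → Radical a → Coprime a π → Radical a′ → Coprime a′ π →
        ∃₂ λ k e → π * (π ^ k - 1#) ≈ g * e × n ∣ e - 1# × a ∣ π ^ k - 1# × a′ ∣ π ^ k - 1#
      common-exponent {a} {a′} r c r′ c′ =
        let J , a∣ = radical∣T r c
            J′ , a′∣ = radical∣T r′ c′
            K = suc J′ ℕ.* (suc J ℕ.* suc D)
            K′ = suc J ℕ.* (suc J′ ℕ.* suc D)
            K≡K′ = ≡.trans (≡.sym (ℕ.*-assoc (suc J′) (suc J) (suc D))) (≡.trans (≡.cong (ℕ._* suc D) (ℕ.*-comm (suc J′) (suc J))) (ℕ.*-assoc (suc J) (suc J′) (suc D)))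
            k , pow = σ-power K π
            T≈ = trans (+-congʳ pow) (solve 2 (λ u v → u :* v :- u := u :* (v :- :1)) refl π (π ^ k))
            a∣T = ∣-trans a∣ (T∣T (suc J ℕ.* suc D) (suc J′))
            a′∣T = ≡.subst (λ m → a′ ∣ T m) (≡.sym K≡K′) (∣-trans a′∣ (T∣T (suc J′ ℕ.* suc D) (suc J)))
            e , Te , n∣e = quotient (J ℕ.+ J′ ℕ.* suc J)
        in k , e , trans (sym T≈) (trans (reflexive (≡.cong T (≡.sym (ℕ.*-assoc (suc J′) (suc J) (suc D))))) Te) , n∣e
          , coprime-cancel c (∣-respʳ T≈ a∣T) , coprime-cancel c′ (∣-respʳ T≈ a′∣T)

module Chains
  (𝔸 : Arithmetic) (M : AbelianGroup 0ℓ 0ℓ) (l : ℕ) (l-prime : Prime l)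
  (l≢2 : l ≢ 2) (p≢l : Arithmetic.p 𝔸 ≢ l)
  (lM≈0 : ∀ m → AbelianGroup._≈_ M
                  (Algebra.Properties.Monoid.Mult._×_ (AbelianGroup.monoid M) l m) (AbelianGroup.ε M))
  where

  open Arith 𝔸 hiding (unit) renaming (_≡_[_] to _≡_⟨mod_⟩)
  open Coefficients 𝔸 M l l-prime l≢2 p≢l lM≈0

  -- Conjugation by diag(κ, 1) carries g = (a b; κc d) to h = (a κb; c d).
  record Slide {n} (κ : Carrier) (g h : Γ n) : Set where
    constructor slide
    field
      a≈ : Γ.a g ≈ Γ.a h
      b≈ : Γ.b h ≈ κ * Γ.b g
      c≈ : Γ.c g ≈ κ * Γ.c h
      d≈ : Γ.d g ≈ Γ.d h

  Linked : ∀ {n} → Carrier → Hom n → Hom n → Set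
  Linked κ χ₀ χ₁ = ∀ g h → Slide κ g h → Hom.⟦_⟧ χ₁ g ≈ᴹ Hom.⟦_⟧ χ₀ h

  conj-⊙ : ∀ s g h → s ⊙ (g ⊙ h) ⊙ inv s ≋ s ⊙ g ⊙ inv s ⊙ (s ⊙ h ⊙ inv s)
  conj-⊙ s g h = begin
    s ⊙ (g ⊙ h) ⊙ inv s                      ≈⟨ G.∙-congʳ (G.assoc s g h) ⟨
    s ⊙ g ⊙ h ⊙ inv s                        ≈⟨ G.∙-congʳ (G.∙-congʳ (G.identityʳ (s ⊙ g))) ⟨
    s ⊙ g ⊙ 1SL ⊙ h ⊙ inv s                  ≈⟨ G.∙-congʳ (G.∙-congʳ (G.∙-congˡ (G.inverseˡ s))) ⟨
    s ⊙ g ⊙ (inv s ⊙ s) ⊙ h ⊙ inv s          ≈⟨ G.∙-congʳ (G.∙-congʳ (G.assoc (s ⊙ g) (inv s) s)) ⟨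
    s ⊙ g ⊙ inv s ⊙ s ⊙ h ⊙ inv s            ≈⟨ G.∙-congʳ (G.assoc (s ⊙ g ⊙ inv s) s h) ⟩
    s ⊙ g ⊙ inv s ⊙ (s ⊙ h) ⊙ inv s          ≈⟨ G.assoc (s ⊙ g ⊙ inv s) (s ⊙ h) (inv s) ⟩
    s ⊙ g ⊙ inv s ⊙ (s ⊙ h ⊙ inv s)          ∎
    where
    module G = Group SLGroup
    open import Relation.Binary.Reasoning.Setoid G.setoid

  Twist : ∀ {n} → SL → Hom n → Hom n
  Twist {n} s χ = record
    { ⟦_⟧  = λ g → ⟦ conj s g ⟧
    ; cong = λ {g} {h} e → cong {conj s g} {conj s h} (G.∙-congʳ (G.∙-congˡ e))
    ; homo = λ g h → M.trans (cong {conj s (g ∙Γ h)} {conj s g ∙Γ conj s h} (conj-⊙ s (Γ.el g) (Γ.el h))) (homo (conj s g) (conj s h))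
    }
    where
    open Hom χ
    module G = Group SLGroup

  module _ {n π : Carrier} (n≉0 : NonZ n) (π⊥n : Coprime π n) (π∤1 : ¬ π ∣ 1#) (π≉0 : NonZ π) where

    private
      module Swap (α β : Carrier) (bez : α * π + β * (n * n) ≈ 1#) where

        -- Determined by (π α)² = (1 - β n²)² = 1 + n s.
        s : Carrier
        s = n * (β * β * (n * n) - β - β)

        opaque
          δ-det : (π * α) * (π * α) - n * s ≈ 1#
          δ-det = modulo₁ (α * π + 1# - β * (n * n)) bez (solve 4 (λ n π α β → (π :* α) :* (π :* α) :- n :* (n :* (β :* β :* (n :* n) :- β :- β)) := :1 :+ ((α :* π :+ :1 :- β :* (n :* n)) :* (α :* π :+ β :* (n :* n) :- :1))) refl n π α β)

        opaque
          ε-det : (π * π * α) * α - n * s ≈ 1#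
          ε-det = trans (solve 3 (λ π α u → (π :* π :* α) :* α :- u := (π :* α) :* (π :* α) :- u) refl π α (n * s)) δ-det

        opaque
          δ-congruent : (n ∣ π * α - 1#) × (n ∣ s)
          δ-congruent = ∣-lin₁ (- (β * n)) (modulo₁ 1# bez (solve 4 (λ n π α β → π :* α :- :1 := :- (β :* n) :* n :+ (:1 :* (α :* π :+ β :* (n :* n) :- :1))) refl n π α β)) ∣-refl
            , m∣mk _

        -- δ is congruent to an antidiagonal matrix mod π, so it swaps Γ₀(π) and Γ⁰(π).
        δ : Γ n
        δ = γ (sl (π * α) n s (π * α) δ-det) (proj₁ δ-congruent) ∣-refl (proj₂ δ-congruent) (proj₁ δ-congruent)

        -- With t = diag(π, 1), this is t `δ` t divided by its common factor π. Hence h = t g t⁻¹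
        -- implies ε g ε⁻¹ = t (δ h δ⁻¹) t⁻¹, which is `swap`.
        ε : SL
        ε = sl (π * π * α) n s α ε-det

        opaque
          swap : ∀ g h → Slide π g h → Slide π (δ ∙Γ h ∙Γ invΓ δ) (conj ε g)
          swap (γ (sl a b c d _) _ _ _ _) (γ (sl a′ b′ c′ d′ _) _ _ _ _) (slide a≈ b≈ c≈ d≈) = slide
            (modulo₄ (- (π * α * π * α)) a≈ (- (π * α * s)) b≈ (- (n * α)) c≈ (n * s) d≈ (solve 12 (λ a b c d a′ b′ c′ d′ π α n s → (π :* α :* a′ :+ n :* c′) :* (π :* α) :+ (π :* α :* b′ :+ n :* d′) :* (:- s) := (π :* π :* α :* a :+ n :* c) :* α :+ (π :* π :* α :* b :+ n :* d) :* (:- s) :+ ((:- (π :* α :* π :* α)) :* (a :- a′) :+ ((:- (π :* α :* s)) :* (b′ :- π :* b) :+ ((:- (n :* α)) :* (c :- π :* c′) :+ ((n :* s) :* (d :- d′)))))) refl a b c d a′ b′ c′ d′ π α n s))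
            (modulo₄ (- (n * π * π * α)) a≈ (- (π * π * α * π * α)) b≈ (- (n * n)) c≈ (n * π * π * α) d≈ (solve 12 (λ a b c d a′ b′ c′ d′ π α n s → (π :* π :* α :* a :+ n :* c) :* (:- n) :+ (π :* π :* α :* b :+ n :* d) :* (π :* π :* α) := π :* ((π :* α :* a′ :+ n :* c′) :* (:- n) :+ (π :* α :* b′ :+ n :* d′) :* (π :* α)) :+ ((:- (n :* π :* π :* α)) :* (a :- a′) :+ ((:- (π :* π :* α :* π :* α)) :* (b′ :- π :* b) :+ ((:- (n :* n)) :* (c :- π :* c′) :+ ((n :* π :* π :* α) :* (d :- d′)))))) refl a b c d a′ b′ c′ d′ π α n s))
            (modulo₄ (- (π * α * s)) a≈ (- (s * s)) b≈ (- (π * α * α)) c≈ (π * α * s) d≈ (solve 12 (λ a b c d a′ b′ c′ d′ π α n s → (s :* a′ :+ π :* α :* c′) :* (π :* α) :+ (s :* b′ :+ π :* α :* d′) :* (:- s) := π :* ((s :* a :+ α :* c) :* α :+ (s :* b :+ α :* d) :* (:- s)) :+ ((:- (π :* α :* s)) :* (a :- a′) :+ ((:- (s :* s)) :* (b′ :- π :* b) :+ ((:- (π :* α :* α)) :* (c :- π :* c′) :+ ((π :* α :* s) :* (d :- d′)))))) refl a b c d a′ b′ c′ d′ π α n s))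
            (modulo₄ (s * n) a≈ (s * π * α) b≈ (n * α) c≈ (- (α * α * π * π)) d≈ (solve 12 (λ a b c d a′ b′ c′ d′ π α n s → (s :* a′ :+ π :* α :* c′) :* (:- n) :+ (s :* b′ :+ π :* α :* d′) :* (π :* α) := (s :* a :+ α :* c) :* (:- n) :+ (s :* b :+ α :* d) :* (π :* π :* α) :+ ((s :* n) :* (a :- a′) :+ ((s :* π :* α) :* (b′ :- π :* b) :+ ((n :* α) :* (c :- π :* c′) :+ ((:- (α :* α :* π :* π)) :* (d :- d′)))))) refl a b c d a′ b′ c′ d′ π α n s))

    -- χ₂(g) = χ₀(ε g ε⁻¹) = χ₁(δ h δ⁻¹) = χ₁(h). The last step holds because δ lies in Γ(n) and M
    -- is abelian; ε is only in SL₂(A), so χ₂ may differ from χ₀.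
    extend : ∀ {χ₀ χ₁ : Hom n} → Linked π χ₀ χ₁ → ∃ λ χ₂ → Linked π χ₁ χ₂
    extend {χ₀} {χ₁} link =
      let α , β , bez = coprime-* π⊥n π⊥n
          open Swap α β bez
      in Twist ε χ₀ , λ g h sl → M.trans (M.sym (link _ _ (swap g h sl))) (inner δ h)
      where
      open Hom χ₁
      inner : ∀ δ h → ⟦ δ ∙Γ h ∙Γ invΓ δ ⟧ ≈ᴹ ⟦ h ⟧
      inner δ h = M.trans (homo (δ ∙Γ h) (invΓ δ)) (M.trans (M.∙-cong (homo δ h) (homo-inv δ)) (xyx⁻¹≈y _ _))
        where open import Algebra.Properties.AbelianGroup M using (xyx⁻¹≈y)

    -- The recursion moves the initial pair from (χ₀, χ₁) to (χ₁, χ₂). A slide by π^(k+1) factors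
    -- through `middle`, which lies in Γ(n) because its off-diagonal entries are multiples of those
    -- of g and h.
    chain : ∀ k {χ₀ χ₁ : Hom n} → Linked π χ₀ χ₁ → ∃ λ χ → Linked (π ^ k) χ₀ χ
    chain zero {χ₀} link = χ₀ , λ g h (slide a≈ b≈ c≈ d≈) →
      Hom.cong χ₀ {g} {h} (mk≋ a≈ (sym (trans b≈ (*-identityˡ _))) (trans c≈ (*-identityˡ _)) d≈)
    chain (suc k) {χ₀} {χ₁} link =
      let χ₂ , link₁ = extend {χ₀} {χ₁} link
          χ , linkₖ = chain k {χ₁} {χ₂} link₁
      in χ , λ g h s → M.trans (linkₖ g (middle g h s) (first g h s)) (link (middle g h s) h (second g h s))
      where
      opaque
        middle-det : ∀ (g h : Γ n) → Slide (π * π ^ k) g h → Γ.a g * Γ.d g - π ^ k * Γ.b g * (π * Γ.c h) ≈ 1#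
        middle-det (γ (sl a b c d e) _ _ _ _) (γ (sl a′ b′ c′ d′ _) _ _ _ _) (slide a≈ b≈ c≈ d≈) =
          modulo₂ 1# e b c≈ (solve 7 (λ a b c d c′ π x → a :* d :- x :* b :* (π :* c′) := :1 :+ (:1 :* (a :* d :- b :* c :- :1) :+ (b :* (c :- π :* x :* c′)))) refl a b c d c′ π (π ^ k))

      middle : ∀ (g h : Γ n) → Slide (π * π ^ k) g h → Γ n
      middle g h s = γ (sl (Γ.a g) (π ^ k * Γ.b g) (π * Γ.c h) (Γ.d g) (middle-det g h s))
        (Γ.a≡1 g) (∣-*ˡ (π ^ k) (Γ.n∣b g)) (∣-*ˡ π (Γ.n∣c h)) (Γ.d≡1 g)
      first : ∀ g h s → Slide (π ^ k) g (middle g h s)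
      first g h (slide a≈ b≈ c≈ d≈) = slide refl refl (trans c≈ (trans (*-congʳ (*-comm π (π ^ k))) (*-assoc _ _ _))) refl
      second : ∀ g h s → Slide π (middle g h s) h
      second g h (slide a≈ b≈ c≈ d≈) = slide a≈ (trans b≈ (*-assoc _ _ _)) refl d≈

  link-symbol : ∀ {n κ} {χ₀ χ₁ : Hom n} → Linked κ χ₀ χ₁ → ∀ v w → Column.a v ≈ Column.a w →
    Column.c v ≈ κ * Column.c w → Hom.symbol χ₁ v ≈ᴹ Hom.symbol χ₀ w
  link-symbol {n} {κ} {χ₀} {χ₁} link v w a≈ c≈ = M.trans (link (fill v) h (slide a≈ refl c≈ refl))
      (Hom.first-column χ₀ h (fill w) refl refl)
    where
    b d : Carrier
    b = Γ.b (fill v)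
    d = Γ.d (fill v)
    opaque
      h-det : Column.a w * d - κ * b * Column.c w ≈ 1#
      h-det = modulo₃ 1# (Γ.det (fill v)) (- d) a≈ b c≈ (solve 7 (λ a a′ b c c′ d κ → a′ :* d :- κ :* b :* c′ := :1 :+ (:1 :* (a :* d :- b :* c :- :1) :+ ((:- d) :* (a :- a′) :+ (b :* (c :- κ :* c′))))) refl (Column.a v) (Column.a w) b (Column.c v) (Column.c w) d κ)

    h : Γ n
    h = γ (sl (Column.a w) (κ * b) (Column.c w) d h-det) (Column.a≡1 w) (∣-*ˡ κ (Γ.n∣b (fill v))) (Column.n∣c w) (Γ.d≡1 (fill v))

  module _ {n π : Carrier} (n≉0 : NonZ n) (π⊥n : Coprime π n) (π∤1 : ¬ π ∣ 1#) (π≉0 : NonZ π)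
           {χ₀ χ₁ : Hom n} (link : Linked π χ₀ χ₁) where

    private
      module F = Frobenius 𝔸
      g : Carrier
      g = F.g n π n≉0 π⊥n π∤1 π≉0
      g≉0 : NonZ g
      g≉0 = F.g≉0 n π n≉0 π⊥n π∤1 π≉0
      π∣g : π ∣ g
      π∣g = F.π∣g n π n≉0 π⊥n π∤1 π≉0
      open Hom χ₀ using (symbol; symbol-E₁₂; symbol-E₂₁; symbol-cong; symbol-unipotent)

      -- With y = πxngc₁ and U = π^k, U ≡ 1 modulo a₁ ≡ a − y and a₂ ≡ a, the chain
      -- [a + xc; c] = [a₁ + Uy; c] = [a₁ + Uy; Uc]ₖ = [a₁ + y; c]ₖ = [a₂; c]ₖ = [a₂; Uc]ₖ = [a₂; c] = [a; c]
      -- compares the values of χ₀ and of the k-th term of the chain of homomorphisms.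
      module Shift (v w : Column n) (x c₁ : Carrier)
        (c≈ : Column.c v ≈ n * g * g * c₁) (a⊥g : Coprime (Column.a v) g)
        (wa≈ : Column.a w ≈ Column.a v + x * Column.c v) (wc≈ : Column.c w ≈ Column.c v) where

        a c y m : Carrier
        a = Column.a v
        c = Column.c v
        y = π * x * n * g * c₁
        m = n * c * π

        a⊥c : Coprime a c
        a⊥c = Column.coprime v

        opaque
          a⊥π : Coprime a π
          a⊥π = coprime-∣ a⊥g π∣g

        opaque
          a-y⊥m : Coprime (a - y) m
          a-y⊥m = coprime-* (coprime-* (coprime-∣ ⊥c (Column.n∣c v)) ⊥c)
              (coprime-≡ (∣-lin₁ (- (x * n * g * c₁)) (solve 6 (λ a x n g c₁ π → a :- π :* x :* n :* g :* c₁ :- a := (:- (x :* n :* g :* c₁)) :* π) refl a x n g c₁ π) ∣-refl) a⊥π)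
            where
            r : Carrier
            r = n * g * c₁
            r∣c : r ∣ c
            r∣c = g , trans c≈ (solve 3 (λ n g c₁ → n :* g :* g :* c₁ := g :* (n :* g :* c₁)) refl n g c₁)
            ⊥r : Coprime (a - y) r
            ⊥r = coprime-≡ (- (π * x) , (solve 6 (λ a x n g c₁ π → a :- π :* x :* n :* g :* c₁ :- a := (:- (π :* x)) :* (n :* g :* c₁)) refl a x n g c₁ π)) (coprime-∣ a⊥c r∣c)
            ⊥c : Coprime (a - y) c
            ⊥c = coprime-∣ (coprime-* ⊥r ⊥r)
              (n * c₁ , (modulo₁ (- (n * c₁)) c≈ (solve 4 (λ n g c₁ c → n :* g :* c₁ :* (n :* g :* c₁) := n :* c₁ :* c :+ ((:- (n :* c₁)) :* (c :- n :* g :* g :* c₁))) refl n g c₁ c)))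

        module Exponents
          (a₁ a₂ : Carrier) (a₁≡ : a₁ ≡ a - y ⟨mod m ⟩) (a₂≡ : a₂ ≡ a ⟨mod m ⟩)
          (k : ℕ) (e : Carrier) (Ue : π * (π ^ k - 1#) ≈ g * e) (n∣e-1 : n ∣ e - 1#)
          (a₁∣ : a₁ ∣ π ^ k - 1#) (a₂∣ : a₂ ∣ π ^ k - 1#)
          (χ : Hom n) (linkₖ : Linked (π ^ k) χ₀ χ) where

          module χ = Hom χ

          U ρ₁ ρ₂ j₁ j₂ ν κ : Carrier
          U = π ^ k
          ρ₁ = proj₁ a₁∣
          ρ₂ = proj₁ a₂∣
          j₁ = proj₁ a₁≡
          j₂ = proj₁ a₂≡
          ν = proj₁ n∣e-1
          κ = π * π * x * x * n * c₁

          U₁ : U - 1# ≈ ρ₁ * a₁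
          U₁ = proj₂ a₁∣
          U₂ : U - 1# ≈ ρ₂ * a₂
          U₂ = proj₂ a₂∣
          e≈ : e - 1# ≈ ν * n
          e≈ = proj₂ n∣e-1
          a₁≈ : a₁ - (a - y) ≈ j₁ * m
          a₁≈ = proj₂ a₁≡
          a₂≈ : a₂ - a ≈ j₂ * m
          a₂≈ = proj₂ a₂≡

          opaque
            κc≈yy : κ * c ≈ y * y
            κc≈yy = modulo₁ (π * π * x * x * n * c₁) c≈ (solve 6 (λ π x n g c₁ c → π :* π :* x :* x :* n :* c₁ :* c := π :* x :* n :* g :* c₁ :* (π :* x :* n :* g :* c₁) :+ ((π :* π :* x :* x :* n :* c₁) :* (c :- n :* g :* g :* c₁))) refl π x n g c₁ c)

          opaque
            -- This dictates the shapes of y and c: π(U - 1) = g e turns (U - 1) y into e x n g² c₁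
            -- = e x c. Since e ≡ 1 modulo n, the entry a₁ + U y agrees with a + x c modulo n c, a
            -- discrepancy that `symbol-E₁₂` absorbs.
            Uy≈ : (U - 1#) * y ≈ e * (x * c)
            Uy≈ = modulo₂ (x * n * g * c₁) Ue (- (e * x)) c≈ (solve 8 (λ π x n g c₁ c e u → (u :- :1) :* (π :* x :* n :* g :* c₁) := e :* (x :* c) :+ ((x :* n :* g :* c₁) :* (π :* (u :- :1) :- g :* e) :+ ((:- (e :* x)) :* (c :- n :* g :* g :* c₁)))) refl π x n g c₁ c e U)

          opaque
            n∣y : n ∣ y
            n∣y = ∣-lin₁ (π * x * g * c₁) (solve 5 (λ π x n g c₁ → π :* x :* n :* g :* c₁ := π :* x :* g :* c₁ :* n) refl π x n g c₁) ∣-refl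

          opaque
            a₁+Uy≈ : a₁ + U * y ≈ Column.a w + (ν * x + j₁ * π) * n * c
            a₁+Uy≈ = modulo₄ 1# a₁≈ 1# Uy≈ (x * c) e≈ (- 1#) wa≈ (solve 12 (λ a c a₁ x y e ν n π j₁ u z → a₁ :+ u :* y := z :+ (ν :* x :+ j₁ :* π) :* n :* c :+ (:1 :* (a₁ :- (a :- y) :- j₁ :* (n :* c :* π)) :+ (:1 :* ((u :- :1) :* y :- e :* (x :* c)) :+ ((x :* c) :* (e :- :1 :- ν :* n) :+ ((:- :1) :* (z :- (a :+ x :* c))))))) refl a c a₁ x y e ν n π j₁ U (Column.a w))

          opaque
            a₁+y≡a : a₁ + y ≡ a ⟨mod m ⟩
            a₁+y≡a = j₁ , (modulo₁ 1# a₁≈ (solve 5 (λ a a₁ y m j₁ → a₁ :+ y :- a := j₁ :* m :+ (:1 :* (a₁ :- (a :- y) :- j₁ :* m))) refl a a₁ y m j₁))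

          n∣m : n ∣ m
          n∣m = ∣-trans (m∣mk c) (m∣mk π)

          c∣m : c ∣ m
          c∣m = ∣-trans (m∣km n) (m∣mk π)

          opaque
            a₁⊥U : Coprime a₁ U
            a₁⊥U = - ρ₁ , 1# , (modulo₁ 1# U₁ (solve 3 (λ a₁ ρ₁ u → :- ρ₁ :* a₁ :+ :1 :* u := :1 :+ (:1 :* (u :- :1 :- ρ₁ :* a₁))) refl a₁ ρ₁ U))

          opaque
            a₂⊥U : Coprime a₂ U
            a₂⊥U = - ρ₂ , 1# , (modulo₁ 1# U₂ (solve 3 (λ a₂ ρ₂ u → :- ρ₂ :* a₂ :+ :1 :* u := :1 :+ (:1 :* (u :- :1 :- ρ₂ :* a₂))) refl a₂ ρ₂ U))

          opaque
            proofs₁ : n ∣ a₁ + U * y - 1# × Coprime (a₁ + U * y) c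
            proofs₁ = ∣-respʳ (sym (trans (+-congʳ a₁+Uy≈) (solve 2 (λ z u → z :+ u :- :1 := (z :- :1) :+ u) refl (Column.a w) ((ν * x + j₁ * π) * n * c))))
                  (∣-+ (Column.a≡1 w) (∣-*ˡ _ (Column.n∣c v)))
              , coprime-≡ ((ν * x + j₁ * π) * n , trans (+-congʳ a₁+Uy≈) (solve 2 (λ z u → z :+ u :- z := u) refl (Column.a w) ((ν * x + j₁ * π) * n * c)))
                  (coprime-∣ (Column.coprime w) (∣-respʳ (sym wc≈) ∣-refl))

          opaque
            proofs₂ : n ∣ a₁ + y - 1# × Coprime (a₁ + y) c
            proofs₂ = ∣-respʳ (solve 2 (λ z a → z :- a :+ (a :- :1) := z :- :1) refl (a₁ + y) a) (∣-+ (∣-trans n∣m a₁+y≡a) (Column.a≡1 v))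
              , coprime-≡ (∣-trans c∣m a₁+y≡a) a⊥c

          opaque
            proofs₃ : n ∣ a₂ - 1# × Coprime a₂ c
            proofs₃ = ∣-respʳ (solve 2 (λ a₂ a → a₂ :- a :+ (a :- :1) := a₂ :- :1) refl a₂ a) (∣-+ (∣-trans n∣m a₂≡) (Column.a≡1 v))
              , coprime-≡ (∣-trans c∣m a₂≡) a⊥c

          opaque
            a₁+Uy⊥Uc : Coprime (a₁ + U * y) (U * c)
            a₁+Uy⊥Uc = coprime-* (coprime-≡ (∣-lin₁ y (solve 3 (λ a₁ y u → a₁ :+ u :* y :- a₁ := y :* u) refl a₁ y U) ∣-refl) a₁⊥U) (proj₂ proofs₁)

          V₁ V₁′ V₂ V₃ V₄ : Column n
          V₁  = column (a₁ + U * y) c (proj₁ proofs₁) (Column.n∣c v) (proj₂ proofs₁)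
          V₁′ = column (a₁ + U * y) (U * c) (proj₁ proofs₁) (∣-*ˡ U (Column.n∣c v)) a₁+Uy⊥Uc
          V₂  = column (a₁ + y) c (proj₁ proofs₂) (Column.n∣c v) (proj₂ proofs₂)
          V₃  = column a₂ c (proj₁ proofs₃) (Column.n∣c v) (proj₂ proofs₃)
          V₄  = column a₂ (U * c) (proj₁ proofs₃) (∣-*ˡ U (Column.n∣c v)) (coprime-* a₂⊥U (proj₂ proofs₃))

          step₁ : symbol w ≈ᴹ symbol V₁
          step₁ = symbol-E₁₂ ((ν * x + j₁ * π) * n) (m∣km _) w V₁ (trans a₁+Uy≈ (+-congˡ (*-congˡ (sym wc≈)))) (sym wc≈)

          step₂ : χ.symbol V₁′ ≈ᴹ symbol V₁
          step₂ = link-symbol {κ = U} {χ₀} {χ} linkₖ V₁′ V₁ refl refl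

          -- The unipotent 1 + X fixes the vector (y, c), since κ c = y², and X sends (a₁, 0) to -ρ₁
          -- a₁ (y, c) = -(U - 1)(y, c). So it carries (a₁, 0) + U (y, c) to (a₁, 0) + (y, c).
          step₃ : χ.symbol V₁′ ≈ᴹ χ.symbol V₂
          step₃ = χ.symbol-unipotent (- (ρ₁ * y)) (ρ₁ * κ) (- (ρ₁ * c))
            (modulo₁ (- (ρ₁ * ρ₁)) κc≈yy (solve 4 (λ ρ₁ y c κ → (:- (ρ₁ :* y)) :* (:- (ρ₁ :* y)) :+ ρ₁ :* κ :* (:- (ρ₁ :* c)) := :0 :+ ((:- (ρ₁ :* ρ₁)) :* (κ :* c :- y :* y))) refl ρ₁ y c κ))
            (∣-neg (∣-*ˡ ρ₁ n∣y)) (∣-*ˡ ρ₁ (∣-lin₁ (π * π * x * x * c₁) (solve 4 (λ π x n c₁ → π :* π :* x :* x :* n :* c₁ := π :* π :* x :* x :* c₁ :* n) refl π x n c₁) ∣-refl))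
            (∣-neg (∣-*ˡ ρ₁ (Column.n∣c v))) V₁′ V₂
            (modulo₂ (- y) U₁ (- (ρ₁ * U)) κc≈yy (solve 6 (λ a₁ y c u ρ₁ κ → a₁ :+ y := a₁ :+ u :* y :+ (:- (ρ₁ :* y)) :* (a₁ :+ u :* y) :+ ρ₁ :* κ :* (u :* c) :+ ((:- y) :* (u :- :1 :- ρ₁ :* a₁) :+ ((:- (ρ₁ :* u)) :* (κ :* c :- y :* y)))) refl a₁ y c U ρ₁ κ))
            (modulo₁ (- c) U₁ (solve 5 (λ a₁ y c u ρ₁ → c := u :* c :+ (:- (ρ₁ :* c)) :* (a₁ :+ u :* y) :- (:- (ρ₁ :* y)) :* (u :* c) :+ ((:- c) :* (u :- :1 :- ρ₁ :* a₁))) refl a₁ y c U ρ₁))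

          step₄ : χ.symbol V₂ ≈ᴹ χ.symbol V₃
          step₄ = χ.symbol-E₁₂ ((j₂ - j₁) * π * n) (m∣km _) V₂ V₃
            (modulo₂ (- 1#) a₁≈ 1# a₂≈ (solve 9 (λ a a₁ a₂ y n c π j₁ j₂ → a₂ := a₁ :+ y :+ (j₂ :- j₁) :* π :* n :* c :+ ((:- :1) :* (a₁ :- (a :- y) :- j₁ :* (n :* c :* π)) :+ (:1 :* (a₂ :- a :- j₂ :* (n :* c :* π))))) refl a a₁ a₂ y n c π j₁ j₂)) refl

          step₅ : χ.symbol V₃ ≈ᴹ χ.symbol V₄
          step₅ = χ.symbol-E₂₁ (ρ₂ * c) (∣-*ˡ ρ₂ (Column.n∣c v)) V₃ V₄ refl
            (modulo₁ c U₂ (solve 4 (λ a₂ c u ρ₂ → u :* c := c :+ ρ₂ :* c :* a₂ :+ (c :* (u :- :1 :- ρ₂ :* a₂))) refl a₂ c U ρ₂))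

          step₆ : χ.symbol V₄ ≈ᴹ symbol V₃
          step₆ = link-symbol {κ = U} {χ₀} {χ} linkₖ V₄ V₃ refl refl

          step₇ : symbol v ≈ᴹ symbol V₃
          step₇ = symbol-E₁₂ (j₂ * π * n) (m∣km _) v V₃
            (modulo₁ 1# a₂≈ (solve 6 (λ a a₂ n c π j₂ → a₂ := a :+ j₂ :* π :* n :* c :+ (:1 :* (a₂ :- a :- j₂ :* (n :* c :* π)))) refl a a₂ n c π j₂)) refl

          shifted : symbol v ≈ᴹ symbol w
          shifted = M.trans step₇ (M.trans (M.sym step₆) (M.trans (M.sym step₅) (M.trans (M.sym step₄)
            (M.trans (M.sym step₃) (M.trans step₂ (M.sym step₁))))))

      opaque
        shift : ∀ v w x c₁ → NonZ (Column.c v) → Column.c v ≈ n * g * g * c₁ → Coprime (Column.a v) g →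
                Column.a w ≈ Column.a v + x * Column.c v → Column.c w ≈ Column.c v → symbol v ≈ᴹ symbol w
        shift v w x c₁ c≉0 c≈ a⊥g wa≈ wc≈ =
          let module S = Shift v w x c₁ c≈ a⊥g wa≈ wc≈
              m≉0 = nz-* (nz-* n≉0 c≉0) π≉0
              a₁ , a₁≡ , rad₁ = make-radical S.a-y⊥m m≉0
              a₂ , a₂≡ , rad₂ = make-radical (a⊥m v S.a⊥π) m≉0
              k , e , Ue , n∣e , a₁∣ , a₂∣ = F.common-exponent n π n≉0 π⊥n π∤1 π≉0 rad₁
                (coprime-∣ (coprime-≡ a₁≡ S.a-y⊥m) (m∣km _)) rad₂ (coprime-∣ (coprime-≡ a₂≡ (a⊥m v S.a⊥π)) (m∣km _))
              χ , linkₖ = chain n≉0 π⊥n π∤1 π≉0 k {χ₀} {χ₁} link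
          in S.Exponents.shifted a₁ a₂ a₁≡ a₂≡ k e Ue n∣e a₁∣ a₂∣ χ linkₖ
          where
          a⊥m : ∀ (v : Column n) → Coprime (Column.a v) π → Coprime (Column.a v) (n * Column.c v * π)
          a⊥m v a⊥π = coprime-* (coprime-* (coprime-∣ (Column.coprime v) (Column.n∣c v)) (Column.coprime v)) a⊥π

      -- Brings a column into the shape required by `shift`. Adding a multiple of n c makes the
      -- first entry a′ prime to g. With α inverse to a′ modulo g², the second entry c = c₀ n is
      -- then replaced by c₀ n (1 - α a′), a multiple of n g². The second column of the pair is
      -- moved in parallel.
      module Normalise (v w : Column n) (x : Carrier)
        (wa≈ : Column.a w ≈ Column.a v + x * Column.c v) (wc≈ : Column.c w ≈ Column.c v)
        (s : Carrier) (⊥g : Coprime (Column.a v + n * Column.c v * s) g)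
        (α j : Carrier) (α≈ : α * (Column.a v + n * Column.c v * s) - 1# ≈ j * (g * g)) where

        a c c₀ a′ z c′ : Carrier
        a = Column.a v
        c = Column.c v
        c₀ = proj₁ (Column.n∣c v)
        a′ = a + n * c * s
        z = - (α * c₀) * n
        c′ = c + z * a′

        c≈ : c ≈ c₀ * n
        c≈ = proj₂ (Column.n∣c v)

        opaque
          n∣z : n ∣ z
          n∣z = m∣km _

        opaque
          c′≈ : c′ ≈ n * g * g * (- (j * c₀))
          c′≈ = modulo₂ 1# c≈ (- (c₀ * n)) α≈ (solve 7 (λ c c₀ n α g j u → c :+ :- (α :* c₀) :* n :* u := n :* g :* g :* (:- (j :* c₀)) :+ (:1 :* (c :- c₀ :* n) :+ ((:- (c₀ :* n)) :* (α :* u :- :1 :- j :* (g :* g))))) refl c c₀ n α g j a′)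

        opaque
          ≡a′ : n ∣ a′ - 1#
          ≡a′ = ∣-lin₂ 1# (c * s) (solve 4 (λ a n c s → a :+ n :* c :* s :- :1 := :1 :* (a :- :1) :+ c :* s :* n) refl a n c s) (Column.a≡1 v) ∣-refl

        opaque
          n∣c′ : n ∣ c′
          n∣c′ = ∣-+ (Column.n∣c v) (∣-*ʳ a′ n∣z)

        opaque
          a′⊥c : Coprime a′ c
          a′⊥c = coprime-≡ (∣-lin₁ (n * s) (solve 4 (λ a n c s → a :+ n :* c :* s :- a := n :* s :* c) refl a n c s) ∣-refl) (Column.coprime v)

        opaque
          a′⊥c′ : Coprime a′ c′
          a′⊥c′ = coprime-sym (coprime-≡ (∣-lin₁ z (solve 3 (λ c z u → c :+ z :* u :- c := z :* u) refl c z a′) ∣-refl) (coprime-sym a′⊥c))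

        opaque
          w″-proofs : n ∣ a′ + x * c′ - 1# × Coprime (a′ + x * c′) c′
          w″-proofs = ∣-lin₂ 1# x (solve 3 (λ u x d → u :+ x :* d :- :1 := :1 :* (u :- :1) :+ x :* d) refl a′ x c′) ≡a′ n∣c′
            , coprime-≡ (∣-lin₁ x (solve 3 (λ u x d → u :+ x :* d :- u := x :* d) refl a′ x c′) ∣-refl) a′⊥c′

        opaque
          w′-proofs : n ∣ a′ + x * c - 1# × Coprime (a′ + x * c) c
          w′-proofs = ∣-lin₂ 1# x (solve 3 (λ u x c → u :+ x :* c :- :1 := :1 :* (u :- :1) :+ x :* c) refl a′ x c) ≡a′ (Column.n∣c v)
            , coprime-≡ (∣-lin₁ x (solve 3 (λ u x c → u :+ x :* c :- u := x :* c) refl a′ x c) ∣-refl) a′⊥c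

        v′ w′ v″ w″ : Column n
        v′ = column a′ c ≡a′ (Column.n∣c v) a′⊥c
        w′ = column (a′ + x * c) c (proj₁ w′-proofs) (Column.n∣c v) (proj₂ w′-proofs)
        v″ = column a′ c′ ≡a′ n∣c′ a′⊥c′
        w″ = column (a′ + x * c′) c′ (proj₁ w″-proofs) n∣c′ (proj₂ w″-proofs)

        v≈v″ : symbol v ≈ᴹ symbol v″
        v≈v″ = M.trans (symbol-E₁₂ (s * n) (m∣km s) v v′ (solve 4 (λ a n c s → a :+ n :* c :* s := a :+ s :* n :* c) refl a n c s) refl)
          (symbol-E₂₁ z n∣z v′ v″ refl refl)

        w≈w″ : symbol w ≈ᴹ symbol w″
        w≈w″ = M.trans (symbol-E₁₂ (s * n) (m∣km s) w w′
            (modulo₂ (- 1#) wa≈ (- (s * n)) wc≈ (solve 7 (λ a n c s x u d → a :+ n :* c :* s :+ x :* c := u :+ s :* n :* d :+ ((:- :1) :* (u :- (a :+ x :* c)) :+ ((:- (s :* n)) :* (d :- c)))) refl a n c s x (Column.a w) (Column.c w))) (sym wc≈))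
          -- The conjugate `E₁₂ x ⊙ E₂₁ z ⊙ E₁₂ (- x)`: it does to the shifted column what `E₂₁ z`
          -- does to the original one.
          (symbol-unipotent (x * z) (- (x * x * z)) z (solve 2 (λ x z → x :* z :* (x :* z) :+ (:- (x :* x :* z)) :* z := :0) refl x z)
            (∣-*ˡ x n∣z) (∣-neg (∣-*ˡ (x * x) n∣z)) n∣z w′ w″
            (solve 4 (λ u x z c → u :+ x :* (c :+ z :* u) := u :+ x :* c :+ x :* z :* (u :+ x :* c) :+ (:- (x :* x :* z)) :* c) refl a′ x z c)
            (solve 4 (λ u x z c → c :+ z :* u := c :+ z :* (u :+ x :* c) :- x :* z :* c) refl a′ x z c))

        v″≈w″ : symbol v″ ≈ᴹ symbol w″
        v″≈w″ with c′ ≟0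
        ... | yes c′≈0 = symbol-cong v″ w″ (sym (trans (+-congˡ (trans (*-congˡ c′≈0) (zeroʳ x))) (+-identityʳ _))) refl
        ... | no  c′≉0 = shift v″ w″ x (- (j * c₀)) c′≉0 c′≈ ⊥g refl refl

    E₁₂-invariant : ∀ x v w → Column.a w ≈ Column.a v + x * Column.c v → Column.c w ≈ Column.c v →
                    Hom.symbol χ₀ v ≈ᴹ Hom.symbol χ₀ w
    E₁₂-invariant x v w wa≈ wc≈ =
      let s , _ , ⊥g = stable-range (coprime-* (coprime-∣ (Column.coprime v) (Column.n∣c v)) (Column.coprime v)) g≉0
          α , j , α≈ = coprime-inverse (coprime-* ⊥g ⊥g)
          open Normalise v w x wa≈ wc≈ s ⊥g α j α≈
      in M.trans v≈v″ (M.trans v″≈w″ (M.sym w≈w″))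

-- Generation of SL₂(A) by elementary matrices

module Generation (𝔸 : Arithmetic) where

  open Arith 𝔸 hiding (unit)
  open SpecialLinear 𝔸
  private module G = Group SLGroup

  module _ (P : SL → Set) (resp : ∀ {g h} → g ≋ h → P g → P h) (P-1 : P 1SL)
           (P-E₁₂ : ∀ x g → P g → P (E₁₂ x ⊙ g)) (P-E₂₁ : ∀ x g → P g → P (E₂₁ x ⊙ g)) where

    private
      triangular : ∀ g → SL.c g ≈ 0# → P g
      -- As a d = 1, diag(a, d) is E₂₁(d - 1) E₁₂(1) E₂₁(a - 1) E₁₂(-d); the factor E₁₂(a b) in
      -- front restores the upper right entry, because a b d = b.
      triangular (sl a b c d e) c≈0 = resp eq
          (P-E₁₂ (a * b) _ (P-E₂₁ (d - 1#) _ (P-E₁₂ 1# _ (P-E₂₁ (a - 1#) _ (P-E₁₂ (- d) _ P-1)))))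
        where
        ad≈1 : a * d ≈ 1#
        ad≈1 = modulo₂ 1# e b c≈0 (solve 4 (λ a b c d → a :* d := :1 :+ (:1 :* (a :* d :- b :* c :- :1) :+ (b :* (c :- :0)))) refl a b c d)
        diag : E₂₁ (d - 1#) ⊙ (E₁₂ 1# ⊙ (E₂₁ (a - 1#) ⊙ (E₁₂ (- d) ⊙ 1SL))) ≋ sl a 0# 0# d (trans (solve 2 (λ a d → a :* d :- :0 :* :0 := a :* d) refl a d) ad≈1)
        diag = mk≋
          (solve 2 (λ a d → :1 :* (:1 :* (:1 :* (:1 :* :1 :+ (:- d) :* :0) :+ :0 :* (:0 :* :1 :+ :1 :* :0)) :+ :1 :* ((a :- :1) :* (:1 :* :1 :+ (:- d) :* :0) :+ :1 :* (:0 :* :1 :+ :1 :* :0))) :+ :0 :* (:0 :* (:1 :* (:1 :* :1 :+ (:- d) :* :0) :+ :0 :* (:0 :* :1 :+ :1 :* :0)) :+ :1 :* ((a :- :1) :* (:1 :* :1 :+ (:- d) :* :0) :+ :1 :* (:0 :* :1 :+ :1 :* :0))) := a) refl a d)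
          (modulo₁ (- 1#) ad≈1 (solve 2 (λ a d → :1 :* (:1 :* (:1 :* (:1 :* :0 :+ (:- d) :* :1) :+ :0 :* (:0 :* :0 :+ :1 :* :1)) :+ :1 :* ((a :- :1) :* (:1 :* :0 :+ (:- d) :* :1) :+ :1 :* (:0 :* :0 :+ :1 :* :1))) :+ :0 :* (:0 :* (:1 :* (:1 :* :0 :+ (:- d) :* :1) :+ :0 :* (:0 :* :0 :+ :1 :* :1)) :+ :1 :* ((a :- :1) :* (:1 :* :0 :+ (:- d) :* :1) :+ :1 :* (:0 :* :0 :+ :1 :* :1))) := :0 :+ ((:- :1) :* (a :* d :- :1))) refl a d))
          (modulo₁ 1# ad≈1 (solve 2 (λ a d → (d :- :1) :* (:1 :* (:1 :* (:1 :* :1 :+ (:- d) :* :0) :+ :0 :* (:0 :* :1 :+ :1 :* :0)) :+ :1 :* ((a :- :1) :* (:1 :* :1 :+ (:- d) :* :0) :+ :1 :* (:0 :* :1 :+ :1 :* :0))) :+ :1 :* (:0 :* (:1 :* (:1 :* :1 :+ (:- d) :* :0) :+ :0 :* (:0 :* :1 :+ :1 :* :0)) :+ :1 :* ((a :- :1) :* (:1 :* :1 :+ (:- d) :* :0) :+ :1 :* (:0 :* :1 :+ :1 :* :0))) := :0 :+ (:1 :* (a :* d :- :1))) refl a d))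
          (modulo₁ (- d) ad≈1 (solve 2 (λ a d → (d :- :1) :* (:1 :* (:1 :* (:1 :* :0 :+ (:- d) :* :1) :+ :0 :* (:0 :* :0 :+ :1 :* :1)) :+ :1 :* ((a :- :1) :* (:1 :* :0 :+ (:- d) :* :1) :+ :1 :* (:0 :* :0 :+ :1 :* :1))) :+ :1 :* (:0 :* (:1 :* (:1 :* :0 :+ (:- d) :* :1) :+ :0 :* (:0 :* :0 :+ :1 :* :1)) :+ :1 :* ((a :- :1) :* (:1 :* :0 :+ (:- d) :* :1) :+ :1 :* (:0 :* :0 :+ :1 :* :1))) := d :+ ((:- d) :* (a :* d :- :1))) refl a d))
        eq : E₁₂ (a * b) ⊙ (E₂₁ (d - 1#) ⊙ (E₁₂ 1# ⊙ (E₂₁ (a - 1#) ⊙ (E₁₂ (- d) ⊙ 1SL)))) ≋ sl a b c d e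
        eq = G.trans (G.∙-congˡ diag) (mk≋ (solve 2 (λ a b → :1 :* a :+ a :* b :* :0 := a) refl a b)
          (modulo₁ b ad≈1 (solve 3 (λ a b d → :1 :* :0 :+ a :* b :* d := b :+ (b :* (a :* d :- :1))) refl a b d))
          (trans (solve 1 (λ a → :0 :* a :+ :1 :* :0 := :0) refl a) (sym c≈0)) (solve 1 (λ d → :0 :* :0 :+ :1 :* d := d) refl d))

      euclid : ∀ g → Acc ℕ._<_ (deg (SL.c g)) → P g
      euclid g@(sl a b c d e) (acc rec) with c ≟0
      ... | yes c≈0 = triangular g c≈0
      ... | no  c≉0 = continue (division a c c≉0)
        where
        continue : (∃₂ λ q r → a ≈ q * c + r × (r ≈ 0# ⊎ deg r ℕ.< deg c)) → P g
        -- E₁₂(1) E₂₁(-1) E₁₂(1) is the rotation (0 1; -1 0). It exchanges the rows, up to a sign,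
        -- after q times the second row has been subtracted from the first, so that the remainder r
        -- becomes the lower left entry.
        continue (q , r , eq , small) = resp back (P-E₁₂ q _ (P-E₁₂ 1# _ (P-E₂₁ (- 1#) _ (P-E₁₂ 1# _ (reduced small)))))
          where
          det′ : (- c) * (b - q * d) - (- d) * r ≈ 1#
          det′ = modulo₂ 1# e (- d) eq (solve 6 (λ a b c d q r → (:- c) :* (b :- q :* d) :- (:- d) :* r := :1 :+ (:1 :* (a :* d :- b :* c :- :1) :+ ((:- d) :* (a :- (q :* c :+ r))))) refl a b c d q r)
          g′ : SL
          g′ = sl (- c) (- d) r (b - q * d) det′
          back : E₁₂ q ⊙ (E₁₂ 1# ⊙ (E₂₁ (- 1#) ⊙ (E₁₂ 1# ⊙ g′))) ≋ g
          back = G.trans (G.∙-congˡ (mk≋ (rot₁ (- c) r) (rot₁ (- d) (b - q * d)) (rot₂ (- c) r) (rot₂ (- d) (b - q * d)))) (mk≋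
              {g = E₁₂ q ⊙ sl r (b - q * d) (- (- c)) (- (- d)) (trans (solve 4 (λ c d r u → r :* (:- (:- d)) :- u :* (:- (:- c)) := (:- c) :* u :- (:- d) :* r) refl c d r (b - q * d)) det′)} {h = g}
              (modulo₁ (- 1#) eq (solve 4 (λ a c q r → :1 :* r :+ q :* (:- (:- c)) := a :+ ((:- :1) :* (a :- (q :* c :+ r)))) refl a c q r))
              (solve 3 (λ b d q → :1 :* (b :- q :* d) :+ q :* (:- (:- d)) := b) refl b d q)
              (solve 2 (λ r c → :0 :* r :+ :1 :* (:- (:- c)) := c) refl r c) (solve 2 (λ u d → :0 :* u :+ :1 :* (:- (:- d)) := d) refl (b - q * d) d))
            where
            rot₁ : ∀ x y → 1# * (1# * (1# * x + 1# * y) + 0# * (0# * x + 1# * y)) + 1# * ((- 1#) * (1# * x + 1# * y) + 1# * (0# * x + 1# * y)) ≈ y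
            rot₁ x y = solve 2 (λ x y → :1 :* (:1 :* (:1 :* x :+ :1 :* y) :+ :0 :* (:0 :* x :+ :1 :* y)) :+ :1 :* ((:- :1) :* (:1 :* x :+ :1 :* y) :+ :1 :* (:0 :* x :+ :1 :* y)) := y) refl x y
            rot₂ : ∀ x y → 0# * (1# * (1# * x + 1# * y) + 0# * (0# * x + 1# * y)) + 1# * ((- 1#) * (1# * x + 1# * y) + 1# * (0# * x + 1# * y)) ≈ - x
            rot₂ x y = solve 2 (λ x y → :0 :* (:1 :* (:1 :* x :+ :1 :* y) :+ :0 :* (:0 :* x :+ :1 :* y)) :+ :1 :* ((:- :1) :* (:1 :* x :+ :1 :* y) :+ :1 :* (:0 :* x :+ :1 :* y)) := :- x) refl x y
          reduced : r ≈ 0# ⊎ deg r ℕ.< deg c → P g′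
          reduced (inj₁ r≈0) = triangular g′ r≈0
          reduced (inj₂ lt)  = euclid g′ (rec lt)

    opaque
      elementary-generation : ∀ g → P g
      elementary-generation g = euclid g (<-wellFounded (deg (SL.c g)))

-- Invariance of linked homomorphisms under SL₂(A)

module Invariance
  (𝔸 : Arithmetic) (M : AbelianGroup 0ℓ 0ℓ) (l : ℕ) (l-prime : Prime l)
  (l≢2 : l ≢ 2) (p≢l : Arithmetic.p 𝔸 ≢ l)
  (lM≈0 : ∀ m → AbelianGroup._≈_ M
                  (Algebra.Properties.Monoid.Mult._×_ (AbelianGroup.monoid M) l m) (AbelianGroup.ε M))
  where

  open Arith 𝔸 hiding (unit) renaming (_≡_[_] to _≡_⟨mod_⟩)
  open Coefficients 𝔸 M l l-prime l≢2 p≢l lM≈0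
  open Chains 𝔸 M l l-prime l≢2 p≢l lM≈0
  open Generation 𝔸
  private module G = Group SLGroup
  open import Algebra.Properties.Group SLGroup using (⁻¹-anti-homo-∙)

  FixedBy : ∀ {n} → Hom n → SL → Set
  FixedBy {n} χ s = ∀ (g : Γ n) → Hom.⟦_⟧ χ (conj s g) ≈ᴹ Hom.⟦_⟧ χ g

  Invariant : ∀ {n} → Hom n → Set
  Invariant χ = ∀ s → FixedBy χ s

  conj-∘ : ∀ {n} s s′ (g : Γ n) → Γ.el (conj (s ⊙ s′) g) ≋ Γ.el (conj s (conj s′ g))
  conj-∘ s s′ g = G.trans (G.∙-cong (G.assoc s s′ (Γ.el g)) (⁻¹-anti-homo-∙ s s′))
    (G.trans (G.sym (G.assoc (s ⊙ (s′ ⊙ Γ.el g)) (inv s′) (inv s))) (G.∙-congʳ (G.assoc s (s′ ⊙ Γ.el g) (inv s′))))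

  conj-congˡ : ∀ {n s s′} (g : Γ n) → s ≋ s′ → Γ.el (conj s g) ≋ Γ.el (conj s′ g)
  conj-congˡ g e = G.∙-cong (G.∙-congʳ e) (G.⁻¹-cong e)

  fixed-resp : ∀ {n s s′} (χ : Hom n) → s ≋ s′ → FixedBy χ s → FixedBy χ s′
  fixed-resp {s = s} {s′} χ e fix g = M.trans (M.sym (Hom.cong χ {conj s g} {conj s′ g} (conj-congˡ g e))) (fix g)

  fixed-⊙ : ∀ {n s s′} (χ : Hom n) → FixedBy χ s → FixedBy χ s′ → FixedBy χ (s ⊙ s′)
  fixed-⊙ {s = s} {s′} χ fix fix′ g =
    M.trans (Hom.cong χ {conj (s ⊙ s′) g} {conj s (conj s′ g)} (conj-∘ s s′ g)) (M.trans (fix (conj s′ g)) (fix′ g))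

  fixed-1 : ∀ {n} (χ : Hom n) → FixedBy χ 1SL
  fixed-1 χ g = Hom.cong χ {conj 1SL g} {g} (G.trans (G.∙-congʳ (G.identityˡ _)) (G.trans (G.∙-congˡ ε⁻¹≈ε′) (G.identityʳ _)))
    where open import Algebra.Properties.Group SLGroup using () renaming (ε⁻¹≈ε to ε⁻¹≈ε′)

  elementary⇒invariant : ∀ {n} (χ : Hom n) → (∀ x → FixedBy χ (E₁₂ x)) → (∀ x → FixedBy χ (E₂₁ x)) → Invariant χ
  elementary⇒invariant χ f₁₂ f₂₁ = elementary-generation (FixedBy χ) (fixed-resp χ) (fixed-1 χ)
    (λ x g → fixed-⊙ {s = E₁₂ x} {g} χ (f₁₂ x)) (λ x g → fixed-⊙ {s = E₂₁ x} {g} χ (f₂₁ x))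

  S : SL
  S = sl 0# 1# (- 1#) 0# (solve 0 (:0 :* :0 :- :1 :* (:- :1) := :1) refl)

  S-entries : ∀ {n} (g : Γ n) → let open SL (S ⊙ Γ.el g ⊙ inv S) in
    (a ≈ Γ.d g) × (b ≈ - Γ.c g) × (c ≈ - Γ.b g) × (d ≈ Γ.a g)
  S-entries (γ (sl a b c d _) _ _ _ _) =
      (solve 4 (λ a b c d → (:0 :* a :+ :1 :* c) :* :0 :+ (:0 :* b :+ :1 :* d) :* (:- (:- :1)) := d) refl a b c d)
    , (solve 4 (λ a b c d → (:0 :* a :+ :1 :* c) :* (:- :1) :+ (:0 :* b :+ :1 :* d) :* :0 := :- c) refl a b c d)
    , (solve 4 (λ a b c d → ((:- :1) :* a :+ :0 :* c) :* :0 :+ ((:- :1) :* b :+ :0 :* d) :* (:- (:- :1)) := :- b) refl a b c d)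
    , (solve 4 (λ a b c d → ((:- :1) :* a :+ :0 :* c) :* (:- :1) :+ ((:- :1) :* b :+ :0 :* d) :* :0 := a) refl a b c d)

  -- Conjugation by S exchanges the roles of the two off-diagonal entries, so it reverses the
  -- direction of a slide and with it the order of the pair.
  S-linked : ∀ {n κ} {χ₀ χ₁ : Hom n} → Linked κ χ₀ χ₁ → Linked κ (Twist S χ₁) (Twist S χ₀)
  S-linked {κ = κ} link g h (slide a≈ b≈ c≈ d≈) = M.sym (link (conj S h) (conj S g)
      (slide (trans ha (trans (sym d≈) (sym ga)))
        (trans gb (modulo₂ (- 1#) c≈ (- κ) hb (solve 4 (λ c c′ κ z → :- c := κ :* z :+ ((:- :1) :* (c :- κ :* c′) :+ ((:- κ) :* (z :- (:- c′))))) refl (Γ.c g) (Γ.c h) κ (Γ.b (conj S h)))))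
        (trans hc (modulo₂ (- 1#) b≈ (- κ) gc (solve 4 (λ b b′ κ z → :- b′ := κ :* z :+ ((:- :1) :* (b′ :- κ :* b) :+ ((:- κ) :* (z :- (:- b))))) refl (Γ.b g) (Γ.b h) κ (Γ.c (conj S g)))))
        (trans hd (trans (sym a≈) (sym gd)))))
    where
    ga = proj₁ (S-entries g)
    gb = proj₁ (proj₂ (S-entries g))
    gc = proj₁ (proj₂ (proj₂ (S-entries g)))
    gd = proj₂ (proj₂ (proj₂ (S-entries g)))
    ha = proj₁ (S-entries h)
    hb = proj₁ (proj₂ (S-entries h))
    hc = proj₁ (proj₂ (proj₂ (S-entries h)))
    hd = proj₂ (proj₂ (proj₂ (S-entries h)))

  module _ {n π : Carrier} (n≉0 : NonZ n) (π⊥n : Coprime π n) (π∤1 : ¬ π ∣ 1#) (π≉0 : NonZ π) where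

    fixed-E₁₂ : ∀ {χ₀ χ₁ : Hom n} → Linked π χ₀ χ₁ → ∀ x → FixedBy χ₀ (E₁₂ x)
    fixed-E₁₂ {χ₀} {χ₁} link x g@(γ (sl a b c d _) _ _ _ _) = M.trans (symbol-column (conj (E₁₂ x) g)) (M.trans (M.sym
        (E₁₂-invariant n≉0 π⊥n π∤1 π≉0 {χ₀} {χ₁} link x (column-of g) (column-of (conj (E₁₂ x) g))
          (solve 5 (λ a b c d x → (:1 :* a :+ x :* c) :* :1 :+ (:1 :* b :+ x :* d) :* (:- :0) := a :+ x :* c) refl a b c d x)
          (solve 5 (λ a b c d x → (:0 :* a :+ :1 :* c) :* :1 :+ (:0 :* b :+ :1 :* d) :* (:- :0) := c) refl a b c d x)))
        (M.sym (symbol-column g)))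
      where open Hom χ₀

    -- Invariance under the E₁₂ is available for the first member of a linked pair. The middle term
    -- χ₁ is a first member twice: of (χ₁, χ₂) and, after reversal by S, of the twisted pair (χ₁,
    -- χ₀). The latter gives invariance under the E₂₁, which are conjugates by S of the E₁₂.
    linked⇒invariant : ∀ {χ₀ χ₁ : Hom n} → Linked π χ₀ χ₁ → Invariant χ₁
    linked⇒invariant {χ₀} {χ₁} link = elementary⇒invariant χ₁ (fixed-E₁₂ {χ₁} {proj₁ next} (proj₂ next)) fixed-E₂₁
      where
      next : ∃ λ χ₂ → Linked π χ₁ χ₂
      next = extend n≉0 π⊥n π∤1 π≉0 {χ₀} {χ₁} link
      fixed-E₂₁ : ∀ x → FixedBy χ₁ (E₂₁ x)
      fixed-E₂₁ x g = M.trans (Hom.cong χ₁ {conj (E₂₁ x) g} {conj S (conj (E₁₂ (- x)) (conj (inv S) g))}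
          (G.trans (conj-congˡ g rotate) (G.trans (conj-∘ S (E₁₂ (- x) ⊙ inv S) g) (G.∙-congʳ (G.∙-congˡ (conj-∘ (E₁₂ (- x)) (inv S) g))))))
        (M.trans (fixed-E₁₂ {Twist S χ₁} {Twist S χ₀} (S-linked {χ₀ = χ₀} {χ₁} link) (- x) (conj (inv S) g))
          (Hom.cong χ₁ {conj S (conj (inv S) g)} {g} (G.trans (G.sym (conj-∘ S (inv S) g)) (G.trans (conj-congˡ g (G.inverseʳ S))
            (G.trans (G.∙-congʳ (G.identityˡ _)) (G.trans (G.∙-congˡ ε⁻¹≈ε′) (G.identityʳ _)))))))
        where
        open import Algebra.Properties.Group SLGroup using () renaming (ε⁻¹≈ε to ε⁻¹≈ε′)
        rotate : E₂₁ x ≋ S ⊙ (E₁₂ (- x) ⊙ inv S)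
        rotate = mk≋
          (solve 1 (λ x → :1 := :0 :* (:1 :* :0 :+ (:- x) :* (:- (:- :1))) :+ :1 :* (:0 :* :0 :+ :1 :* (:- (:- :1)))) refl x)
          (solve 1 (λ x → :0 := :0 :* (:1 :* (:- :1) :+ (:- x) :* :0) :+ :1 :* (:0 :* (:- :1) :+ :1 :* :0)) refl x)
          (solve 1 (λ x → x := (:- :1) :* (:1 :* :0 :+ (:- x) :* (:- (:- :1))) :+ :0 :* (:0 :* :0 :+ :1 :* (:- (:- :1)))) refl x)
          (solve 1 (λ x → :1 := (:- :1) :* (:1 :* (:- :1) :+ (:- x) :* :0) :+ :0 :* (:0 :* (:- :1) :+ :1 :* :0)) refl x)

-- Central extensions of SL₂ of a finite field

record Field : Set₁ where
  field
    commRing : CommutativeRing 0ℓ 0ℓ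
  open CommutativeRing commRing
  open Algebra.Properties.Semiring.Mult semiring renaming (_×_ to _·_)
  field
    p       : ℕ
    p-prime : Prime p
    p·1≈0   : p · 1# ≈ 0#
    0≉1     : ¬ 0# ≈ 1#
    _≟_     : ∀ x y → Dec (x ≈ y)
    invert  : ∀ x → ¬ x ≈ 0# → ∃ λ y → x * y ≈ 1#
    periodic : ∀ (f : ℕ → Carrier) → ∃₂ λ i d → f i ≈ f (i ℕ.+ suc d)

-- The l-part of the unit group of a finite field is cyclic

module Roots (K : Field) (l : ℕ) (l-prime : Prime l) (p≢l : Field.p K ≢ l) where

  open Field K
  open CommutativeRing commRing hiding (zero)
  open RingSolver commRing
  open Divisibility commRing
  open Algebra.Properties.Semiring.Mult semiring renaming (_×_ to _·_) using ()
  open import Relation.Binary.Reasoning.Setoid setoid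

  private
    Σ< : ℕ → (ℕ → Carrier) → Carrier
    Σ< zero    f = 0#
    Σ< (suc N) f = Σ< N f + f N

    Σ-zero : ∀ N f → (∀ i → i ℕ.< N → f i ≈ 0#) → Σ< N f ≈ 0#
    Σ-zero zero    f e = refl
    Σ-zero (suc N) f e = trans (+-cong (Σ-zero N f (λ i lt → e i (ℕ.m<n⇒m<1+n lt))) (e N (ℕ.n<1+n N))) (+-identityˡ 0#)

    Σ-cong : ∀ N {f g} → (∀ i → f i ≈ g i) → Σ< N f ≈ Σ< N g
    Σ-cong zero    e = refl
    Σ-cong (suc N) e = +-cong (Σ-cong N e) (e N)

    Σ-+ : ∀ N f g → Σ< N (λ i → f i + g i) ≈ Σ< N f + Σ< N g
    Σ-+ zero    f g = sym (+-identityˡ 0#)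
    Σ-+ (suc N) f g = trans (+-congʳ (Σ-+ N f g))
      (solve 4 (λ a b c d → (a :+ b) :+ (c :+ d) := (a :+ c) :+ (b :+ d)) refl (Σ< N f) (Σ< N g) (f N) (g N))

    Σ-swap : ∀ N N′ (f : ℕ → ℕ → Carrier) → Σ< N (λ i → Σ< N′ (f i)) ≈ Σ< N′ (λ j → Σ< N (λ i → f i j))
    Σ-swap zero    N′ f = sym (Σ-zero N′ _ (λ _ _ → refl))
    Σ-swap (suc N) N′ f = trans (+-congʳ (Σ-swap N N′ f)) (sym (Σ-+ N′ (λ j → Σ< N (λ i → f i j)) (f N)))

    Σ-* : ∀ N c f → Σ< N (λ i → c * f i) ≈ c * Σ< N f
    Σ-* zero    c f = sym (zeroʳ c)
    Σ-* (suc N) c f = trans (+-congʳ (Σ-* N c f)) (sym (distribˡ c _ _))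

    Σ-first : ∀ N f → (∀ i → 0 ℕ.< i → i ℕ.< suc N → f i ≈ 0#) → Σ< (suc N) f ≈ f 0
    Σ-first zero    f e = +-identityˡ _
    Σ-first (suc N) f e = trans (+-cong (Σ-first N f (λ i 0<i lt → e i 0<i (ℕ.m<n⇒m<1+n lt)))
      (e (suc N) (ℕ.s≤s ℕ.z≤n) (ℕ.n<1+n (suc N)))) (+-identityʳ _)

    Σ-one : ∀ N → Σ< N (λ _ → 1#) ≈ N · 1#
    Σ-one zero    = refl
    Σ-one (suc N) = trans (+-comm _ _) (+-congˡ (Σ-one N))

    geometric : ∀ N w → (w - 1#) * Σ< N (w ^_) ≈ w ^ N - 1#
    geometric zero    w = solve 1 (λ w → (w :- :1) :* :0 := :1 :- :1) refl w
    geometric (suc N) w = modulo₁ 1# (geometric N w) (solve 3 (λ w s u → (w :- :1) :* (s :+ u) := w :* u :- :1 :+ (:1 :* ((w :- :1) :* s :- (u :- :1)))) refl w (Σ< N (w ^_)) (w ^ N))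

  zero-divisor-free : ∀ {x y} → ¬ x ≈ 0# → x * y ≈ 0# → y ≈ 0#
  zero-divisor-free {x} {y} x≉0 xy≈0 with invert x x≉0
  ... | x⁻¹ , e = modulo₂ (- y) e x⁻¹ xy≈0 (solve 3 (λ x y z → y := :0 :+ ((:- y) :* (x :* z :- :1) :+ (z :* (x :* y :- :0)))) refl x y x⁻¹)

  private
    geometric-zero : ∀ {w} → w ^ l ≈ 1# → ¬ w ≈ 1# → Σ< l (w ^_) ≈ 0#
    geometric-zero {w} w^l≈1 w≉1 = zero-divisor-free {w - 1#} (λ e → w≉1 (modulo₁ 1# e (solve 1 (λ w → w := :1 :+ (:1 :* (w :- :1 :- :0))) refl w)))
      (trans (geometric l w) (modulo₁ 1# w^l≈1 (solve 1 (λ u → u :- :1 := :0 :+ (:1 :* (u :- :1))) refl (w ^ l))))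

    power-one : ∀ {x} m n → x ^ m ≈ 1# → x ^ (m ℕ.* n) ≈ 1#
    power-one {x} m n e = trans (sym (^-assocʳ x m n)) (trans (^-congˡ n e) (1^n n))

    l·1≉0 : ¬ l · 1# ≈ 0#
    l·1≉0 e = 0≉1 (sym (torsion-coprime +-monoid (prime-coprime p-prime l-prime p≢l) p·1≈0 e))

  order-divides : ∀ {ζ i} → ζ ^ l ≈ 1# → ¬ ζ ≈ 1# → ζ ^ i ≈ 1# → l ℕ.∣ i
  order-divides {ζ} {i} ζ^l≈1 ζ≉1 ζ^i≈1 with l ℕ.∣? i
  ... | yes l∣i = l∣i
  ... | no  l∤i = contradiction (torsion-coprime *-monoid (∤⇒coprime l-prime l∤i) ζ^l≈1 ζ^i≈1) ζ≉1

  -- If z were not a power of ζ, then Σⱼ Σᵢ (z ζʲ)ⁱ would vanish; summing over j first gives l.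
  root-of-unity : ∀ {z ζ} → z ^ l ≈ 1# → ζ ^ l ≈ 1# → ¬ ζ ≈ 1# → ∃ λ j → z ≈ ζ ^ j
  root-of-unity {z} {ζ} z^l≈1 ζ^l≈1 ζ≉1 with Fin.any? (λ j → (z * ζ ^ toℕ {l} j) ≟ 1#)
  ... | yes (j , e) = inverse-exponent l {{prime⇒nonZero l-prime}} ζ^l≈1 (toℕ j) e
    where
    inverse-exponent : ∀ l → .{{ℕ.NonZero l}} → ζ ^ l ≈ 1# → ∀ j → z * ζ ^ j ≈ 1# → ∃ λ i → z ≈ ζ ^ i
    inverse-exponent (suc l′) ζ^l≈1 j e = l′ ℕ.* j , (modulo₂ (- z) xy≈1 (ζ ^ (l′ ℕ.* j)) e (solve 3 (λ z x y → z := y :+ ((:- z) :* (x :* y :- :1) :+ (y :* (z :* x :- :1)))) refl z (ζ ^ j) (ζ ^ (l′ ℕ.* j))))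
      where
      xy≈1 : ζ ^ j * ζ ^ (l′ ℕ.* j) ≈ 1#
      xy≈1 = trans (sym (^-homo-* ζ j (l′ ℕ.* j))) (power-one (suc l′) j ζ^l≈1)
  ... | no none = contradiction (trans (sym l≈) total≈0) l·1≉0
    where
    f : ℕ → ℕ → Carrier
    f j i = (z * ζ ^ j) ^ i
    total≈0 : Σ< l (λ j → Σ< l (f j)) ≈ 0#
    total≈0 = Σ-zero l _ λ j j<l → geometric-zero
      (trans (^-distrib-* z (ζ ^ j) l) (trans (*-cong z^l≈1 (trans (^-assocʳ ζ j l) (trans (reflexive (≡.cong (ζ ^_) (ℕ.*-comm j l))) (power-one l j ζ^l≈1)))) (*-identityˡ 1#)))
      (λ e → none (fromℕ< j<l , trans (*-congˡ (reflexive (≡.cong (ζ ^_) (Fin.toℕ-fromℕ< j<l)))) e))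
    column : ∀ i → Σ< l (λ j → f j i) ≈ z ^ i * Σ< l ((ζ ^ i) ^_)
    column i = trans (Σ-cong l (λ j → trans (^-distrib-* z (ζ ^ j) i) (*-congˡ (trans (^-assocʳ ζ j i)
      (trans (reflexive (≡.cong (ζ ^_) (ℕ.*-comm j i))) (sym (^-assocʳ ζ i j))))))) (Σ-* l (z ^ i) ((ζ ^ i) ^_))
    off-diagonal : ∀ i → 0 ℕ.< i → i ℕ.< l → Σ< l (λ j → f j i) ≈ 0#
    off-diagonal i 0<i i<l = trans (column i) (trans (*-congˡ (geometric-zero
        (trans (^-assocʳ ζ i l) (trans (reflexive (≡.cong (ζ ^_) (ℕ.*-comm i l))) (power-one l i ζ^l≈1)))
        (λ e → ℕ.<⇒≱ i<l (ℕ.∣⇒≤ {{ℕ.>-nonZero 0<i}} (order-divides ζ^l≈1 ζ≉1 e))))) (zeroʳ _))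
    collapse : ∀ n → .{{ℕ.NonZero n}} → (g : ℕ → Carrier) → (∀ i → 0 ℕ.< i → i ℕ.< n → g i ≈ 0#) → Σ< n g ≈ g 0
    collapse (suc n) g e = Σ-first n g e
    l≈ : Σ< l (λ j → Σ< l (f j)) ≈ l · 1#
    l≈ = trans (Σ-swap l l f) (trans (collapse l {{prime⇒nonZero l-prime}} _ off-diagonal)
      (Σ-one l))

  private
    l^ : ℕ → ℕ
    l^ e = l ℕ.^ e

    -- Here v has exact order l^(e+1). By induction u^l = v^i; raising to the power l^e shows that
    -- v^(l^e), a root of unity of exact order l, has i-th power 1, so i = l i′. Then u v^(-i′) is
    -- an l-th root of unity, hence a power of v^(l^e).
    generated : ∀ {v} e → ¬ v ^ l^ e ≈ 1# → v ^ l^ (suc e) ≈ 1# →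
                ∀ f u → f ℕ.≤ suc e → u ^ l^ f ≈ 1# → ∃ λ i → u ≈ v ^ i
    generated {v} e v≉ v≈ zero u _ u≈1 = 0 , trans (sym (*-identityʳ u)) u≈1
    generated {v} e v≉ v≈ (suc f) u f≤e u≈1 with generated e v≉ v≈ f (u ^ l) (ℕ.<⇒≤ f≤e) (trans (^-assocʳ u l (l^ f)) u≈1)
    ... | i , u^l≈ with order-divides {v ^ l^ e} {i} ζ^l≈1 v≉ ζ^i≈1
      where
      ζ^l≈1 : (v ^ l^ e) ^ l ≈ 1#
      ζ^l≈1 = trans (^-assocʳ v (l^ e) l) (trans (reflexive (≡.cong (v ^_) (ℕ.*-comm (l^ e) l))) v≈)
      u^big : u ^ l^ (suc e) ≈ 1#
      u^big with ℕ.m≤n⇒∃[o]m+o≡n f≤e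
      ... | o , eq = trans (reflexive (≡.cong (u ^_) (≡.trans (≡.cong l^ (≡.sym eq)) (ℕ.^-distribˡ-+-* l (suc f) o)))) (power-one (l^ (suc f)) (l^ o) u≈1)
      ζ^i≈1 : (v ^ l^ e) ^ i ≈ 1#
      ζ^i≈1 = begin
        (v ^ l^ e) ^ i    ≈⟨ ^-assocʳ v (l^ e) i ⟩
        v ^ (l^ e ℕ.* i)  ≡⟨ ≡.cong (v ^_) (ℕ.*-comm (l^ e) i) ⟩
        v ^ (i ℕ.* l^ e)  ≈⟨ ^-assocʳ v i (l^ e) ⟨
        (v ^ i) ^ l^ e    ≈⟨ ^-congˡ (l^ e) u^l≈ ⟨
        (u ^ l) ^ l^ e    ≈⟨ ^-assocʳ u l (l^ e) ⟩
        u ^ l^ (suc e)    ≈⟨ u^big ⟩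
        1#                ∎
    ...   | ℕ.divides i′ ≡.refl with root-of-unity {u * w} {v ^ l^ e} z^l≈1 (trans (^-assocʳ v (l^ e) l) (trans (reflexive (≡.cong (v ^_) (ℕ.*-comm (l^ e) l))) v≈)) v≉
      where
      -- The inverse of v^i′, written as a power with natural exponent.
      w : Carrier
      w = v ^ (ℕ.pred (l^ (suc e)) ℕ.* i′)
      wv≈1 : w * v ^ i′ ≈ 1#
      wv≈1 = begin
        v ^ (ℕ.pred N ℕ.* i′) * v ^ i′   ≈⟨ ^-homo-* v (ℕ.pred N ℕ.* i′) i′ ⟨
        v ^ (ℕ.pred N ℕ.* i′ ℕ.+ i′)     ≡⟨ ≡.cong (v ^_) (≡.trans (ℕ.+-comm _ i′) (≡.cong (ℕ._* i′) (ℕ.suc-pred N {{ℕ.m^n≢0 l (suc e) {{prime⇒nonZero l-prime}}}}))) ⟩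
        v ^ (N ℕ.* i′)                   ≈⟨ power-one N i′ v≈ ⟩
        1#                               ∎
        where N = l^ (suc e)
      z^l≈1 : (u * w) ^ l ≈ 1#
      z^l≈1 = begin
        (u * w) ^ l              ≈⟨ ^-distrib-* u w l ⟩
        u ^ l * w ^ l            ≈⟨ *-congʳ (trans u^l≈ (sym (^-assocʳ v i′ l))) ⟩
        (v ^ i′) ^ l * w ^ l     ≈⟨ ^-distrib-* (v ^ i′) w l ⟨
        (v ^ i′ * w) ^ l         ≈⟨ ^-congˡ l (trans (*-comm _ _) wv≈1) ⟩
        1# ^ l                   ≈⟨ 1^n l ⟩
        1#                       ∎
    ...     | j , z≈ = l^ e ℕ.* j ℕ.+ i′ , (begin
        u                                  ≈⟨ *-identityʳ u ⟨
        u * 1#                             ≈⟨ *-congˡ (trans (sym (power-one N i′ v≈)) (trans (reflexive (≡.cong (v ^_) (≡.trans (≡.sym (≡.cong (ℕ._* i′) (ℕ.suc-pred N {{ℕ.m^n≢0 l (suc e) {{prime⇒nonZero l-prime}}}}))) (ℕ.+-comm i′ _)))) (^-homo-* v (ℕ.pred N ℕ.* i′) i′))) ⟩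
        u * (v ^ (ℕ.pred N ℕ.* i′) * v ^ i′) ≈⟨ *-assoc _ _ _ ⟨
        u * v ^ (ℕ.pred N ℕ.* i′) * v ^ i′ ≈⟨ *-congʳ z≈ ⟩
        (v ^ l^ e) ^ j * v ^ i′            ≈⟨ *-congʳ (^-assocʳ v (l^ e) j) ⟩
        v ^ (l^ e ℕ.* j) * v ^ i′          ≈⟨ ^-homo-* v (l^ e ℕ.* j) i′ ⟨
        v ^ (l^ e ℕ.* j ℕ.+ i′)            ∎)
      where N = l^ (suc e)

    -- Lower e until one of the two is no longer killed by l^e; that one generates the other.
    comparable : ∀ e u v → u ^ l^ e ≈ 1# → v ^ l^ e ≈ 1# → (∃ λ i → u ≈ v ^ i) ⊎ (∃ λ i → v ≈ u ^ i)
    comparable zero u v u≈ v≈ = inj₁ (0 , trans (sym (*-identityʳ u)) u≈)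
    comparable (suc e) u v u≈ v≈ with (u ^ l^ e) ≟ 1# | (v ^ l^ e) ≟ 1#
    ... | yes u≈′ | yes v≈′ = comparable e u v u≈′ v≈′
    ... | _       | no  v≉  = inj₁ (generated e v≉ v≈ (suc e) u ℕ.≤-refl u≈)
    ... | no  u≉  | yes _   = inj₂ (generated e u≉ u≈ (suc e) v ℕ.≤-refl v≈)

    order : ∀ {u u⁻¹} → u * u⁻¹ ≈ 1# → ∃ λ d → u ^ suc d ≈ 1#
    order {u} {u⁻¹} e with periodic (u ^_)
    ... | i , d , p = d , (begin
      u ^ suc d                              ≈⟨ *-identityˡ _ ⟨
      1# * u ^ suc d                         ≈⟨ *-congʳ (trans (^-congˡ i e) (1^n i)) ⟨
      (u * u⁻¹) ^ i * u ^ suc d              ≈⟨ *-congʳ (^-distrib-* u u⁻¹ i) ⟩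
      u ^ i * u⁻¹ ^ i * u ^ suc d            ≈⟨ solve 3 (λ x y z → x :* y :* z := y :* (x :* z)) refl (u ^ i) (u⁻¹ ^ i) (u ^ suc d) ⟩
      u⁻¹ ^ i * (u ^ i * u ^ suc d)          ≈⟨ *-congˡ (trans (sym (^-homo-* u i (suc d))) (sym p)) ⟩
      u⁻¹ ^ i * u ^ i                        ≈⟨ *-comm _ _ ⟩
      u ^ i * u⁻¹ ^ i                        ≈⟨ ^-distrib-* u u⁻¹ i ⟨
      (u * u⁻¹) ^ i                          ≈⟨ trans (^-congˡ i e) (1^n i) ⟩
      1#                                     ∎)

  opaque
    -- Here m is the part prime to l of the product of the two orders, so m-th powers have l-power
    -- order. No generator is chosen: this weak form of cyclicity is all that a pairing with values
    -- in an l-torsion group can detect.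
    units-cyclic : ∀ {u u⁻¹ v v⁻¹} → u * u⁻¹ ≈ 1# → v * v⁻¹ ≈ 1# →
      ∃ λ m → ¬ l ℕ.∣ m × ((∃ λ i → u ^ m ≈ v ^ i) ⊎ (∃ λ i → v ^ m ≈ u ^ i))
    units-cyclic {u} {u⁻¹} {v} {v⁻¹} eu ev =
      let d , u≈ = order eu
          d′ , v≈ = order ev
          e , m , E≡ , l∤m = extract-power l-prime (suc d ℕ.* suc d′) (ℕ.s≤s ℕ.z≤n)
          u^m≈ = trans (^-assocʳ u m (l^ e)) (trans (reflexive (≡.cong (u ^_) (≡.sym E≡))) (power-one (suc d) (suc d′) u≈))
          v^m≈ = trans (^-assocʳ v m (l^ e)) (trans (reflexive (≡.cong (v ^_) (≡.trans (≡.sym E≡) (ℕ.*-comm (suc d) (suc d′))))) (power-one (suc d′) (suc d) v≈))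
      in m , l∤m , collect m (comparable e (u ^ m) (v ^ m) u^m≈ v^m≈)
      where
      collect : ∀ m → (∃ λ i → u ^ m ≈ (v ^ m) ^ i) ⊎ (∃ λ i → v ^ m ≈ (u ^ m) ^ i) →
                (∃ λ i → u ^ m ≈ v ^ i) ⊎ (∃ λ i → v ^ m ≈ u ^ i)
      collect m (inj₁ (i , e)) = inj₁ (m ℕ.* i , trans e (^-assocʳ v m i))
      collect m (inj₂ (i , e)) = inj₂ (m ℕ.* i , trans e (^-assocʳ u m i))

-- A central extension E of a subgroup of SL₂(K) by M, with lifts x, y of the
-- elementary matrices that are homomorphisms.
record CentralExtension (K : Field) (M : AbelianGroup 0ℓ 0ℓ) : Set₁ where
  open CommutativeRing (Field.commRing K) using () renaming (Carrier to |K|; _≈_ to _≈ᴷ_; _+_ to _+ᴷ_)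
  open SpecialLinearGroup (Field.commRing K)
  private module M = AbelianGroup M
  field
    group : Group 0ℓ 0ℓ
  open Group group
  field
    ι           : M.Carrier → Carrier
    ι-cong      : ∀ {m n} → m M.≈ n → ι m ≈ ι n
    ι-homo      : ∀ m n → ι (m M.∙ n) ≈ ι m ∙ ι n
    ι-injective : ∀ {m} → ι m ≈ ε → m M.≈ M.ε
    ι-central   : ∀ m e → ι m ∙ e ≈ e ∙ ι m
    μ           : Carrier → SL
    μ-cong      : ∀ {e f} → e ≈ f → μ e ≋ μ f
    μ-homo      : ∀ e f → μ (e ∙ f) ≋ μ e ⊙ μ f
    μ-ι         : ∀ m → μ (ι m) ≋ 1SL
    kernel      : ∀ e → μ e ≋ 1SL → ∃ λ m → e ≈ ι m
    x y         : |K| → Carrier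
    x-cong      : ∀ {s s′} → s ≈ᴷ s′ → x s ≈ x s′
    y-cong      : ∀ {s s′} → s ≈ᴷ s′ → y s ≈ y s′
    x-homo      : ∀ s s′ → x (s +ᴷ s′) ≈ x s ∙ x s′
    y-homo      : ∀ s s′ → y (s +ᴷ s′) ≈ y s ∙ y s′
    μ-x         : ∀ s → μ (x s) ≋ E₁₂ s
    μ-y         : ∀ s → μ (y s) ≋ E₂₁ s

-- Splitting of a central extension of SL₂ of a finite field

module Splitting
  (K : Field) (M : AbelianGroup 0ℓ 0ℓ) (l : ℕ) (l-prime : Prime l)
  (l≢2 : l ≢ 2) (p≢l : Field.p K ≢ l)
  (lM≈0 : ∀ m → AbelianGroup._≈_ M
                  (Algebra.Properties.Monoid.Mult._×_ (AbelianGroup.monoid M) l m) (AbelianGroup.ε M))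
  (X : CentralExtension K M) where

  open Field K using (p; p-prime; p·1≈0; 0≉1; _≟_; invert; periodic)
  module K = CommutativeRing (Field.commRing K)
  open K using (_+_; _*_; -_; _-_; 0#; 1#) renaming (Carrier to |K|; _≈_ to _≈ᴷ_)
  open RingSolver (Field.commRing K)
  open Divisibility (Field.commRing K) hiding (_∣_)
  open Algebra.Properties.Semiring.Mult K.semiring using () renaming (_×_ to _·_)
  open SpecialLinearGroup (Field.commRing K)
  module S = Group SLGroup
  module M = AbelianGroup M
  open M using () renaming (Carrier to |M|; _≈_ to _≈ᴹ_; _∙_ to _⊞_; ε to 0ᴹ; _⁻¹ to ⊟_)
  open Algebra.Properties.Monoid.Mult M.monoid using () renaming (_×_ to _⊡_)
  open CentralExtension X
  open Group group hiding (_-_) renaming (refl to ≈-refl; sym to ≈-sym; trans to ≈-trans)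
  open Algebra.Properties.Group group using (∙-cancelˡ; identityˡ-unique; inverseˡ-unique)
  open Algebra.Properties.Monoid.Mult monoid using () renaming (_×_ to _✶_)
  open Relation.Binary.Reasoning.Setoid setoid
  module MP = Algebra.Properties.AbelianGroup M
  open K using (refl)

  private
    p-free : ∀ {m} → p ⊡ m ≈ᴹ 0ᴹ → m ≈ᴹ 0ᴹ
    p-free e = torsion-coprime M.monoid (prime-coprime p-prime l-prime p≢l) e (lM≈0 _)

    2-free : ∀ {m} → m ⊞ m ≈ᴹ 0ᴹ → m ≈ᴹ 0ᴹ
    2-free e = torsion-coprime M.monoid (prime-coprime prime[2] l-prime (λ 2≡l → l≢2 (≡.sym 2≡l)))
      (M.trans (M.∙-congˡ (M.identityʳ _)) e) (lM≈0 _)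

    2-cancel : ∀ {m n} → m ⊞ m ≈ᴹ n ⊞ n → m ≈ᴹ n
    2-cancel {m} {n} e = MP.x∙y⁻¹≈ε⇒x≈y m n (2-free (R.begin
      (m ⊞ ⊟ n) ⊞ (m ⊞ ⊟ n)     R.≈⟨ MonoidSolver.solve M.monoid ⟩
      m ⊞ (⊟ n ⊞ m) ⊞ ⊟ n       R.≈⟨ M.∙-congʳ (M.∙-congˡ (M.comm (⊟ n) m)) ⟩
      m ⊞ (m ⊞ ⊟ n) ⊞ ⊟ n       R.≈⟨ MonoidSolver.solve M.monoid ⟩
      (m ⊞ m) ⊞ (⊟ n ⊞ ⊟ n)     R.≈⟨ M.∙-cong e (MP.⁻¹-∙-comm n n) ⟩
      (n ⊞ n) ⊞ ⊟ (n ⊞ n)       R.≈⟨ M.inverseʳ _ ⟩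
      0ᴹ                        R.∎))
      where module R = Relation.Binary.Reasoning.Setoid M.setoid

    ι-0 : ι 0ᴹ ≈ ε
    ι-0 = identityˡ-unique _ _ (≈-trans (≈-sym (ι-homo 0ᴹ 0ᴹ)) (ι-cong (M.identityˡ 0ᴹ)))

  infix 4 _≈[_]_
  -- Equality up to a recorded central factor. By `shift-unique` the factor is determined, so two
  -- computations of one element yield an equation in M.
  _≈[_]_ : Carrier → |M| → Carrier → Set
  e ≈[ m ] f = e ≈ f ∙ ι m

  private
    exact : ∀ {e f} → e ≈ f → e ≈[ 0ᴹ ] f
    exact e≈f = ≈-trans e≈f (≈-trans (≈-sym (identityʳ _)) (∙-congˡ (≈-sym ι-0)))

    shift-trans : ∀ {e f g m n} → e ≈[ m ] f → f ≈[ n ] g → e ≈[ n ⊞ m ] g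
    shift-trans {e} {f} {g} {m} {n} p q = begin
      e                ≈⟨ p ⟩
      f ∙ ι m          ≈⟨ ∙-congʳ q ⟩
      g ∙ ι n ∙ ι m    ≈⟨ assoc _ _ _ ⟩
      g ∙ (ι n ∙ ι m)  ≈⟨ ∙-congˡ (ι-homo n m) ⟨
      g ∙ ι (n ⊞ m)    ∎

    shift-cong : ∀ {e f e′ f′ m n} → e ≈[ m ] f → e′ ≈[ n ] f′ → e ∙ e′ ≈[ m ⊞ n ] f ∙ f′
    shift-cong {e} {f} {e′} {f′} {m} {n} p q = begin
      e ∙ e′                     ≈⟨ ∙-cong p q ⟩
      f ∙ ι m ∙ (f′ ∙ ι n)       ≈⟨ MonoidSolver.solve monoid ⟩
      f ∙ (ι m ∙ f′) ∙ ι n       ≈⟨ ∙-congʳ (∙-congˡ (ι-central m f′)) ⟩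
      f ∙ (f′ ∙ ι m) ∙ ι n       ≈⟨ MonoidSolver.solve monoid ⟩
      f ∙ f′ ∙ (ι m ∙ ι n)       ≈⟨ ∙-congˡ (ι-homo m n) ⟨
      f ∙ f′ ∙ ι (m ⊞ n)         ∎

    congʳ[] : ∀ {e f g m} → e ≈[ m ] f → e ∙ g ≈[ m ] f ∙ g
    congʳ[] {e} {f} {g} {m} p = begin
      e ∙ g            ≈⟨ ∙-congʳ p ⟩
      f ∙ ι m ∙ g      ≈⟨ assoc _ _ _ ⟩
      f ∙ (ι m ∙ g)    ≈⟨ ∙-congˡ (ι-central m g) ⟩
      f ∙ (g ∙ ι m)    ≈⟨ assoc _ _ _ ⟨
      f ∙ g ∙ ι m      ∎

    congˡ[] : ∀ {e f g m} → e ≈[ m ] f → g ∙ e ≈[ m ] g ∙ f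
    congˡ[] p = ≈-trans (∙-congˡ p) (≈-sym (assoc _ _ _))

    ι-inj : ∀ {m n} → ι m ≈ ι n → m ≈ᴹ n
    ι-inj {m} {n} e = MP.x∙y⁻¹≈ε⇒x≈y m n (ι-injective (begin
      ι (m ⊞ ⊟ n)      ≈⟨ ι-homo m (⊟ n) ⟩
      ι m ∙ ι (⊟ n)    ≈⟨ ∙-congʳ e ⟩
      ι n ∙ ι (⊟ n)    ≈⟨ ι-homo n (⊟ n) ⟨
      ι (n ⊞ ⊟ n)      ≈⟨ ι-cong (M.inverseʳ n) ⟩
      ι 0ᴹ             ≈⟨ ι-0 ⟩
      ε                ∎))

    shift-unique : ∀ {e f m n} → e ≈[ m ] f → e ≈[ n ] f → m ≈ᴹ n
    shift-unique p q = ι-inj (∙-cancelˡ _ _ _ (≈-trans (≈-sym p) q))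

    same-matrix : ∀ {e f} → μ e ≋ μ f → ∃ λ m → e ≈[ m ] f
    same-matrix {e} {f} q =
      let m , e≈ = kernel (f ⁻¹ ∙ e) (S.trans (μ-homo (f ⁻¹) e) (S.trans (S.∙-congˡ q)
                     (S.trans (S.sym (μ-homo (f ⁻¹) f)) (S.trans (μ-cong (inverseˡ f)) μ-ε))))
      in m , (begin
        e                  ≈⟨ identityˡ e ⟨
        ε ∙ e              ≈⟨ ∙-congʳ (inverseʳ f) ⟨
        f ∙ f ⁻¹ ∙ e       ≈⟨ assoc _ _ _ ⟩
        f ∙ (f ⁻¹ ∙ e)     ≈⟨ ∙-congˡ e≈ ⟩
        f ∙ ι m            ∎)
      where
      μ-ε : μ ε ≋ 1SL
      μ-ε = S.trans (μ-cong (≈-sym ι-0)) (μ-ι 0ᴹ)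

    μ-shift : ∀ {e f m} → e ≈[ m ] f → μ e ≋ μ f
    μ-shift {e} {f} {m} q = S.trans (μ-cong q) (S.trans (μ-homo f (ι m)) (S.trans (S.∙-congˡ (μ-ι m)) (S.identityʳ _)))

    μ-inv : ∀ e → μ (e ⁻¹) ≋ inv (μ e)
    μ-inv e = SP.inverseˡ-unique _ _ (S.trans (S.sym (μ-homo (e ⁻¹) e)) (S.trans (μ-cong (inverseˡ e)) (S.trans (μ-cong (≈-sym ι-0)) (μ-ι 0ᴹ))))
      where module SP = Algebra.Properties.Group SLGroup

    ✶-shift : ∀ k {e f m} → e ≈[ m ] f → k ✶ e ≈[ k ⊡ m ] k ✶ f
    ✶-shift zero    q = exact ≈-refl
    ✶-shift (suc k) q = shift-cong q (✶-shift k q)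

  Torsion : Carrier → Set
  Torsion e = p ✶ e ≈ ε

  private
    -- The two differ by some `ι m`; comparing p-th powers gives p m = 0, hence m = 0.
    torsion-unique : ∀ {e f} → Torsion e → Torsion f → μ e ≋ μ f → e ≈ f
    torsion-unique {e} {f} te tf q =
      let m , e≈ = same-matrix q
          m≈0 = p-free (shift-unique {ε} {ε} (≈-trans (≈-sym te) (≈-trans (✶-shift p e≈) (∙-congʳ tf))) (exact ≈-refl))
      in ≈-trans e≈ (≈-trans (∙-congˡ (≈-trans (ι-cong m≈0) ι-0)) (identityʳ f))

    conjugate : Carrier → Carrier → Carrier
    conjugate e f = e ∙ f ∙ e ⁻¹

    torsion-conjugate : ∀ {e f} → Torsion f → Torsion (conjugate e f)
    torsion-conjugate {e} {f} tf = ≈-trans (go p) (≈-trans (∙-congʳ (∙-congˡ tf)) (≈-trans (∙-congʳ (identityʳ e)) (inverseʳ e)))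
      where
      go : ∀ k → k ✶ conjugate e f ≈ conjugate e (k ✶ f)
      go zero    = ≈-sym (≈-trans (∙-congʳ (identityʳ e)) (inverseʳ e))
      go (suc k) = begin
        e ∙ f ∙ e ⁻¹ ∙ (k ✶ conjugate e f)       ≈⟨ ∙-congˡ (go k) ⟩
        e ∙ f ∙ e ⁻¹ ∙ (e ∙ (k ✶ f) ∙ e ⁻¹)      ≈⟨ MonoidSolver.solve monoid ⟩
        e ∙ f ∙ (e ⁻¹ ∙ e) ∙ (k ✶ f) ∙ e ⁻¹      ≈⟨ ∙-congʳ (∙-congʳ (∙-congˡ (inverseˡ e))) ⟩
        e ∙ f ∙ ε ∙ (k ✶ f) ∙ e ⁻¹               ≈⟨ MonoidSolver.solve monoid ⟩
        e ∙ (f ∙ (k ✶ f)) ∙ e ⁻¹                 ∎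

    p×≈0 : ∀ s → p · s ≈ᴷ 0#
    p×≈0 = PrimeCharacteristic.Char.p×≈0 (Field.commRing K) p p-prime p·1≈0

    torsion-homo : (z : |K| → Carrier) → (∀ {s s′} → s ≈ᴷ s′ → z s ≈ z s′) →
                   (∀ s s′ → z (s + s′) ≈ z s ∙ z s′) → ∀ s → Torsion (z s)
    torsion-homo z z-cong z-homo s = ≈-trans (go p) (≈-trans (z-cong (p×≈0 s)) z-0)
      where
      z-0 : z 0# ≈ ε
      z-0 = identityˡ-unique _ _ (≈-trans (≈-sym (z-homo 0# 0#)) (z-cong (K.+-identityˡ 0#)))
      go : ∀ k → k ✶ z s ≈ z (k · s)
      go zero    = ≈-sym z-0
      go (suc k) = ≈-trans (∙-congˡ (go k)) (≈-sym (z-homo s (k · s)))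

    x-torsion : ∀ s → Torsion (x s)
    x-torsion = torsion-homo x x-cong x-homo

    y-torsion : ∀ s → Torsion (y s)
    y-torsion = torsion-homo y y-cong y-homo

    x-0 : x 0# ≈ ε
    x-0 = identityˡ-unique _ _ (≈-trans (≈-sym (x-homo 0# 0#)) (x-cong (K.+-identityˡ 0#)))

    -- Relations e f = f′ e between an element and p-torsion elements hold as soon as they hold for matrices.
    commute-torsion : ∀ {e f f′} → Torsion f → Torsion f′ → μ e ⊙ μ f ≋ μ f′ ⊙ μ e → e ∙ f ≈ f′ ∙ e
    commute-torsion {e} {f} {f′} tf tf′ q = begin
      e ∙ f                  ≈⟨ identityʳ _ ⟨
      e ∙ f ∙ ε              ≈⟨ ∙-congˡ (inverseˡ e) ⟨
      e ∙ f ∙ (e ⁻¹ ∙ e)     ≈⟨ assoc _ _ _ ⟨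
      conjugate e f ∙ e      ≈⟨ ∙-congʳ (torsion-unique (torsion-conjugate {e} tf) tf′ matrices) ⟩
      f′ ∙ e                 ∎
      where
      matrices : μ (conjugate e f) ≋ μ f′
      matrices = S.trans (μ-homo (e ∙ f) (e ⁻¹)) (S.trans (S.∙-cong (S.trans (μ-homo e f) q) (μ-inv e))
        (S.trans (S.assoc _ _ _) (S.trans (S.∙-congˡ (S.inverseʳ _)) (S.identityʳ _))))

  record Unit : Set where
    constructor unit
    field
      val recip : |K|
      eq : val * recip ≈ᴷ 1#
  open Unit

  opaque
    *ᵘ-eq : ∀ {u u′ v v′} → u * u′ ≈ᴷ 1# → v * v′ ≈ᴷ 1# → u * v * (u′ * v′) ≈ᴷ 1#
    *ᵘ-eq {u} {u′} {v} {v′} e e′ = modulo₂ (v * v′) e 1# e′ (solve 4 (λ u u′ v v′ → u :* v :* (u′ :* v′) := :1 :+ ((v :* v′) :* (u :* u′ :- :1) :+ (:1 :* (v :* v′ :- :1)))) refl u u′ v v′)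

  opaque
    -ᵘ-eq : ∀ {u u′} → u * u′ ≈ᴷ 1# → (- u) * (- u′) ≈ᴷ 1#
    -ᵘ-eq {u} {u′} e = modulo₁ 1# e (solve 2 (λ u u′ → (:- u) :* (:- u′) := :1 :+ (:1 :* (u :* u′ :- :1))) refl u u′)

  opaque
    diag-det : ∀ {u u′} → u * u′ ≈ᴷ 1# → u * u′ - 0# * 0# ≈ᴷ 1#
    diag-det {u} {u′} e = modulo₁ 1# e (solve 2 (λ u u′ → u :* u′ :- :0 :* :0 := :1 :+ (:1 :* (u :* u′ :- :1))) refl u u′)

  opaque
    weyl-det : ∀ {u u′} → u * u′ ≈ᴷ 1# → 0# * 0# - u * (- u′) ≈ᴷ 1#
    weyl-det {u} {u′} e = modulo₁ 1# e (solve 2 (λ u u′ → :0 :* :0 :- u :* (:- u′) := :1 :+ (:1 :* (u :* u′ :- :1))) refl u u′)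

  opaque
    recip-eq : ∀ {u u′} → u * u′ ≈ᴷ 1# → u′ * u ≈ᴷ 1#
    recip-eq e = K.trans (K.*-comm _ _) e

  infixl 7 _*ᵘ_
  _*ᵘ_ : Unit → Unit → Unit
  unit u u′ e *ᵘ unit v v′ e′ = unit (u * v) (u′ * v′) (*ᵘ-eq e e′)

  1ᵘ : Unit
  1ᵘ = unit 1# 1# (K.*-identityˡ 1#)

  recipᵘ : Unit → Unit
  recipᵘ (unit u u′ e) = unit u′ u (recip-eq e)

  -ᵘ_ : Unit → Unit
  -ᵘ unit u u′ e = unit (- u) (- u′) (-ᵘ-eq e)

  unitᵘ : ∀ z → ¬ z ≈ᴷ 0# → Unit
  unitᵘ z z≉0 = unit z (proj₁ (invert z z≉0)) (proj₂ (invert z z≉0))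

  recip-cong : ∀ {u v} → val u ≈ᴷ val v → recip u ≈ᴷ recip v
  recip-cong {unit u u′ e} {unit v v′ e′} q =
    modulo₃ v′ e (- u′) e′ (- (u′ * v′)) q (solve 4 (λ u u′ v v′ → u′ := v′ :+ (v′ :* (u :* u′ :- :1) :+ ((:- u′) :* (v :* v′ :- :1) :+ ((:- (u′ :* v′)) :* (u :- v))))) refl u u′ v v′)

  diag : Unit → SL
  diag (unit u u′ e) = sl u 0# 0# u′ (diag-det e)

  weyl : Unit → SL
  weyl (unit u u′ e) = sl 0# u (- u′) 0# (weyl-det e)

  -- Steinberg's element w(u), a lift of (0 u; -1/u 0).
  W : Unit → Carrier
  W u = x (val u) ∙ (y (- recip u) ∙ x (val u))

  w : Carrier
  w = W 1ᵘ

  private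
    diag-cong : ∀ {u v} → val u ≈ᴷ val v → diag u ≋ diag v
    diag-cong {u} {v} q = mk≋ q refl refl (recip-cong {u} {v} q)

    diag-* : ∀ u v → diag u ⊙ diag v ≋ diag (u *ᵘ v)
    diag-* (unit u u′ _) (unit v v′ _) = mk≋
      (solve 2 (λ u v → u :* v :+ :0 :* :0 := u :* v) refl u v) (solve 2 (λ u v′ → u :* :0 :+ :0 :* v′ := :0) refl u v′)
      (solve 2 (λ u′ v → :0 :* v :+ u′ :* :0 := :0) refl u′ v) (solve 2 (λ u′ v′ → :0 :* :0 :+ u′ :* v′ := u′ :* v′) refl u′ v′)

    μ-W : ∀ u → μ (W u) ≋ weyl u
    μ-W u@(unit a a′ e) = S.trans (S.trans (μ-homo _ _) (S.∙-cong (μ-x a) (S.trans (μ-homo _ _) (S.∙-cong (μ-y _) (μ-x a))))) (mk≋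
      (modulo₁ (- 1#) e (solve 2 (λ a a′ → :1 :* (:1 :* :1 :+ :0 :* :0) :+ a :* ((:- a′) :* :1 :+ :1 :* :0) := :0 :+ ((:- :1) :* (a :* a′ :- :1))) refl a a′))
      (modulo₁ (- a) e (solve 2 (λ a a′ → :1 :* (:1 :* a :+ :0 :* :1) :+ a :* ((:- a′) :* a :+ :1 :* :1) := a :+ ((:- a) :* (a :* a′ :- :1))) refl a a′))
      (solve 1 (λ a′ → :0 :* (:1 :* :1 :+ :0 :* :0) :+ :1 :* ((:- a′) :* :1 :+ :1 :* :0) := :- a′) refl a′)
      (modulo₁ (- 1#) e (solve 2 (λ a a′ → :0 :* (:1 :* a :+ :0 :* :1) :+ :1 :* ((:- a′) :* a :+ :1 :* :1) := :0 :+ ((:- :1) :* (a :* a′ :- :1))) refl a a′)))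

    W-cong : ∀ {u v} → val u ≈ᴷ val v → W u ≈ W v
    W-cong {u} {v} q = ∙-cong (x-cong q) (∙-cong (y-cong (K.-‿cong (recip-cong {u} {v} q))) (x-cong q))

    μ-w-via : ∀ {e} u → μ e ≋ diag u → μ (e ∙ w) ≋ weyl u
    μ-w-via {e} (unit u u′ _) q = S.trans (μ-homo e w) (S.trans (S.∙-cong q (μ-W 1ᵘ)) (mk≋
      (solve 1 (λ u → u :* :0 :+ :0 :* (:- :1) := :0) refl u) (solve 1 (λ u → u :* :1 :+ :0 :* :0 := u) refl u)
      (solve 1 (λ u′ → :0 :* :0 :+ u′ :* (:- :1) := :- u′) refl u′) (solve 1 (λ u′ → :0 :* :1 :+ u′ :* :0 := :0) refl u′)))

    diag-x : ∀ {t} u → μ t ≋ diag u → ∀ s → t ∙ x s ≈ x (val u * val u * s) ∙ t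
    diag-x {t} (unit u u′ e) q s = commute-torsion (x-torsion s) (x-torsion _)
      (S.trans (S.∙-cong q (μ-x s)) (S.trans (mk≋
        (solve 2 (λ u s → u :* :1 :+ :0 :* :0 := :1 :* u :+ u :* u :* s :* :0) refl u s)
        (modulo₁ (- (u * s)) e (solve 3 (λ u u′ s → u :* s :+ :0 :* :1 := :1 :* :0 :+ u :* u :* s :* u′ :+ ((:- (u :* s)) :* (u :* u′ :- :1))) refl u u′ s))
        (solve 2 (λ u u′ → :0 :* :1 :+ u′ :* :0 := :0 :* u :+ :1 :* :0) refl u u′)
        (solve 2 (λ u′ s → :0 :* s :+ u′ :* :1 := :0 :* :0 :+ :1 :* u′) refl u′ s)) (S.sym (S.∙-cong (μ-x (u * u * s)) q))))

    diag-y : ∀ {t} u → μ t ≋ diag u → ∀ s → t ∙ y s ≈ y (recip u * recip u * s) ∙ t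
    diag-y {t} (unit u u′ e) q s = commute-torsion (y-torsion s) (y-torsion _)
      (S.trans (S.∙-cong q (μ-y s)) (S.trans (mk≋
        (solve 2 (λ u s → u :* :1 :+ :0 :* s := :1 :* u :+ :0 :* :0) refl u s)
        (solve 2 (λ u u′ → u :* :0 :+ :0 :* :1 := :1 :* :0 :+ :0 :* u′) refl u u′)
        (modulo₁ (- (u′ * s)) e (solve 3 (λ u u′ s → :0 :* :1 :+ u′ :* s := u′ :* u′ :* s :* u :+ :1 :* :0 :+ ((:- (u′ :* s)) :* (u :* u′ :- :1))) refl u u′ s))
        (solve 2 (λ u′ s → :0 :* :0 :+ u′ :* :1 := u′ :* u′ :* s :* :0 :+ :1 :* u′) refl u′ s)) (S.sym (S.∙-cong (μ-y (u′ * u′ * s)) q))))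

    W-x : ∀ u s → W u ∙ x s ≈ y (- (recip u * recip u * s)) ∙ W u
    W-x u@(unit a a′ e) s = commute-torsion (x-torsion s) (y-torsion _)
      (S.trans (S.∙-cong (μ-W u) (μ-x s)) (S.trans (mk≋
        (solve 2 (λ a a′ → :0 :* :1 :+ a :* :0 := :1 :* :0 :+ :0 :* (:- a′)) refl a a′)
        (solve 2 (λ a s → :0 :* s :+ a :* :1 := :1 :* a :+ :0 :* :0) refl a s)
        (solve 2 (λ a′ s → (:- a′) :* :1 :+ :0 :* :0 := (:- (a′ :* a′ :* s)) :* :0 :+ :1 :* (:- a′)) refl a′ s)
        (modulo₁ (a′ * s) e (solve 3 (λ a a′ s → (:- a′) :* s :+ :0 :* :1 := (:- (a′ :* a′ :* s)) :* a :+ :1 :* :0 :+ ((a′ :* s) :* (a :* a′ :- :1))) refl a a′ s)))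
        (S.sym (S.∙-cong (μ-y _) (μ-W u)))))

    powᵘ : ℕ → Unit → Unit
    powᵘ zero    u = 1ᵘ
    powᵘ (suc k) u = u *ᵘ powᵘ k u

    val-pow : ∀ k u → val (powᵘ k u) ≈ᴷ val u ^ k
    val-pow zero    u = refl
    val-pow (suc k) u = K.*-congˡ (val-pow k u)

    μ-✶ : ∀ k {t} u → μ t ≋ diag u → μ (k ✶ t) ≋ diag (powᵘ k u)
    μ-✶ zero    u q = S.trans (μ-cong (≈-sym ι-0)) (S.trans (μ-ι 0ᴹ) (mk≋ refl refl refl refl))
    μ-✶ (suc k) u q = S.trans (μ-homo _ _) (S.trans (S.∙-cong q (μ-✶ k u q)) (diag-* u (powᵘ k u)))

    commute-✶ : ∀ k {t t′} → t ∙ t′ ≈ t′ ∙ t → (k ✶ t) ∙ t′ ≈ t′ ∙ (k ✶ t)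
    commute-✶ zero    q = ≈-trans (identityˡ _) (≈-sym (identityʳ _))
    commute-✶ (suc k) {t} {t′} q = begin
      t ∙ (k ✶ t) ∙ t′       ≈⟨ assoc _ _ _ ⟩
      t ∙ ((k ✶ t) ∙ t′)     ≈⟨ ∙-congˡ (commute-✶ k q) ⟩
      t ∙ (t′ ∙ (k ✶ t))     ≈⟨ assoc _ _ _ ⟨
      t ∙ t′ ∙ (k ✶ t)       ≈⟨ ∙-congʳ q ⟩
      t′ ∙ t ∙ (k ✶ t)       ≈⟨ assoc _ _ _ ⟩
      t′ ∙ (t ∙ (k ✶ t))     ∎

    commutator-✶ : ∀ k {t t′ b} → t ∙ t′ ≈[ b ] t′ ∙ t → (k ✶ t) ∙ t′ ≈[ k ⊡ b ] t′ ∙ (k ✶ t)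
    commutator-✶ zero    q = exact (≈-trans (identityˡ _) (≈-sym (identityʳ _)))
    commutator-✶ (suc k) {t} {t′} {b} q = ≈-trans (assoc _ _ _) (≈-trans (shift-trans (congˡ[] (commutator-✶ k q))
      (≈-trans (≈-sym (assoc _ _ _)) (≈-trans (congʳ[] q) (∙-congʳ (assoc _ _ _))))) ≈-refl)

    commutator-sym : ∀ {t t′ b} → t ∙ t′ ≈[ b ] t′ ∙ t → t′ ∙ t ≈[ ⊟ b ] t ∙ t′
    commutator-sym {t} {t′} {b} q = begin
      t′ ∙ t                     ≈⟨ identityʳ _ ⟨
      t′ ∙ t ∙ ε                 ≈⟨ ∙-congˡ (≈-trans (≈-sym (ι-homo b (⊟ b))) (≈-trans (ι-cong (M.inverseʳ b)) ι-0)) ⟨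
      t′ ∙ t ∙ (ι b ∙ ι (⊟ b))   ≈⟨ assoc _ _ _ ⟨
      t′ ∙ t ∙ ι b ∙ ι (⊟ b)     ≈⟨ ∙-congʳ q ⟨
      t ∙ t′ ∙ ι (⊟ b)           ∎

  module R = Roots K l l-prime p≢l

  -- Modulo l-th powers, one of two units of the finite field K is a power of the other,
  -- and an alternating pairing into the l-torsion group M must vanish on them.
  opaque
    torus-commutes : ∀ {t t′} u v → μ t ≋ diag u → μ t′ ≋ diag v → t ∙ t′ ≈ t′ ∙ t
    torus-commutes {t} {t′} u v qt qt′ =
      let m , l∤m , cyc = R.units-cyclic (eq u) (eq v)
          b , tt′ = same-matrix {t ∙ t′} {t′ ∙ t} (S.trans (μ-homo t t′) (S.trans (S.∙-cong qt qt′) (S.trans (diag-* u v) (S.trans (diag-cong {u *ᵘ v} {v *ᵘ u} (K.*-comm _ _))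
            (S.sym (S.trans (μ-homo t′ t) (S.trans (S.∙-cong qt′ qt) (diag-* v u))))))))
          b≈0 = torsion-coprime M.monoid (∤⇒coprime l-prime l∤m) (lM≈0 b) (vanish m b tt′ cyc)
      in ≈-trans tt′ (≈-trans (∙-congˡ (≈-trans (ι-cong b≈0) ι-0)) (identityʳ _))
      where
      power-commutes : ∀ m i {t t′} u v → μ t ≋ diag u → μ t′ ≋ diag v → val u ^ m ≈ᴷ val v ^ i → (m ✶ t) ∙ t′ ≈ t′ ∙ (m ✶ t)
      power-commutes m i {t} {t′} u v qt qt′ e =
        let z , q = same-matrix {m ✶ t} {i ✶ t′} (S.trans (μ-✶ m u qt) (S.trans (diag-cong {powᵘ m u} {powᵘ i v}
                      (K.trans (val-pow m u) (K.trans e (K.sym (val-pow i v))))) (S.sym (μ-✶ i v qt′))))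
        in begin
          (m ✶ t) ∙ t′             ≈⟨ ∙-congʳ q ⟩
          (i ✶ t′) ∙ ι z ∙ t′      ≈⟨ assoc _ _ _ ⟩
          (i ✶ t′) ∙ (ι z ∙ t′)    ≈⟨ ∙-congˡ (ι-central z t′) ⟩
          (i ✶ t′) ∙ (t′ ∙ ι z)    ≈⟨ assoc _ _ _ ⟨
          (i ✶ t′) ∙ t′ ∙ ι z      ≈⟨ ∙-congʳ (commute-✶ i ≈-refl) ⟩
          t′ ∙ (i ✶ t′) ∙ ι z      ≈⟨ assoc _ _ _ ⟩
          t′ ∙ ((i ✶ t′) ∙ ι z)    ≈⟨ ∙-congˡ q ⟨
          t′ ∙ (m ✶ t)             ∎
      ⊡-⊟ : ∀ k b → k ⊡ (⊟ b) ≈ᴹ 0ᴹ → k ⊡ b ≈ᴹ 0ᴹ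
      ⊡-⊟ k b e = MP.⁻¹-injective (M.trans (M.sym (·-⁻¹ M k b)) (M.trans e (M.sym MP.ε⁻¹≈ε)))
      vanish : ∀ m b → t ∙ t′ ≈[ b ] t′ ∙ t →
               (∃ λ i → val u ^ m ≈ᴷ val v ^ i) ⊎ (∃ λ i → val v ^ m ≈ᴷ val u ^ i) → m ⊡ b ≈ᴹ 0ᴹ
      vanish m b tt′ (inj₁ (i , e)) = shift-unique (commutator-✶ m tt′) (exact (power-commutes m i u v qt qt′ e))
      vanish m b tt′ (inj₂ (i , e)) = ⊡-⊟ m b (shift-unique (commutator-✶ m (commutator-sym tt′)) (exact (power-commutes m i v u qt′ qt e)))

  private
    halve : ∀ m → ∃ λ h → h ⊞ h ≈ᴹ m
    halve m = let h , e = coprime-divisible M (prime-coprime prime[2] l-prime (λ 2≡l → l≢2 (≡.sym 2≡l))) lM≈0 m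
              in h , M.trans (M.∙-congˡ (M.sym (M.identityʳ h))) e

  -- The lift of diag u that is inverted by w; it is unique because M has no 2-torsion.
  record Inverted (t : Carrier) (u : Unit) : Set where
    constructor inverted
    field
      matrix : μ t ≋ diag u
      flip   : t ∙ (w ∙ t) ≈ w
  open Inverted

  private
    inverted-unique : ∀ {t t′ u v} → Inverted t u → Inverted t′ v → val u ≈ᴷ val v → t ≈ t′
    inverted-unique {t} {t′} {u} {v} i j e =
      let m , q = same-matrix {t} {t′} (S.trans (matrix i) (S.trans (diag-cong {u} {v} e) (S.sym (matrix j))))
          m≈0 = 2-free (shift-unique {w} {w} (≈-trans (≈-sym (flip i)) (≈-trans (shift-cong q (congˡ[] q)) (∙-congʳ (flip j)))) (exact ≈-refl))
      in ≈-trans q (≈-trans (∙-congˡ (≈-trans (ι-cong m≈0) ι-0)) (identityʳ _))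

    -- Any lift t₀ satisfies t₀ w t₀ = w `ι θ` for some θ. A central correction of t₀ enters twice,
    -- so -θ/2 is the right one; 2 is invertible on M.
    inverted-exists : ∀ u → ∃ λ t → Inverted t u
    inverted-exists u@(unit a a′ e) =
      let θ , q = same-matrix {t₀ ∙ (w ∙ t₀)} {w} flipped
          h , h+h = halve θ
          t≈ : t₀ ∙ ι (⊟ h) ≈[ ⊟ h ] t₀
          t≈ = ≈-refl
      in t₀ ∙ ι (⊟ h) , inverted (S.trans (μ-shift t≈) diagonal)
        (≈-trans (shift-trans (shift-cong t≈ (congˡ[] t≈)) q) (≈-trans (∙-congˡ (≈-trans (ι-cong
          (M.trans (M.∙-cong (M.sym h+h) (MP.⁻¹-∙-comm h h)) (M.inverseʳ _))) ι-0)) (identityʳ w)))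
      where
      t₀ : Carrier
      t₀ = W u ∙ w ⁻¹
      diagonal : μ t₀ ≋ diag u
      diagonal = S.trans (μ-homo _ _) (S.trans (S.∙-cong (μ-W u) (S.trans (μ-inv w) (S.⁻¹-cong (μ-W 1ᵘ)))) (mk≋
        (solve 1 (λ a → :0 :* :0 :+ a :* (:- (:- :1)) := a) refl a) (solve 1 (λ a → :0 :* (:- :1) :+ a :* :0 := :0) refl a)
        (solve 1 (λ a′ → (:- a′) :* :0 :+ :0 :* (:- (:- :1)) := :0) refl a′) (solve 1 (λ a′ → (:- a′) :* (:- :1) :+ :0 :* :0 := a′) refl a′)))
      flipped : μ (t₀ ∙ (w ∙ t₀)) ≋ μ w
      flipped = S.trans (S.trans (μ-homo _ _) (S.∙-cong diagonal (S.trans (μ-homo _ _) (S.∙-cong (μ-W 1ᵘ) diagonal))))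
        (S.trans (mk≋
          (solve 2 (λ a a′ → a :* (:0 :* a :+ :1 :* :0) :+ :0 :* ((:- :1) :* a :+ :0 :* :0) := :0) refl a a′)
          (modulo₁ 1# e (solve 2 (λ a a′ → a :* (:0 :* :0 :+ :1 :* a′) :+ :0 :* ((:- :1) :* :0 :+ :0 :* a′) := :1 :+ (:1 :* (a :* a′ :- :1))) refl a a′))
          (modulo₁ (- 1#) e (solve 2 (λ a a′ → :0 :* (:0 :* a :+ :1 :* :0) :+ a′ :* ((:- :1) :* a :+ :0 :* :0) := :- :1 :+ ((:- :1) :* (a :* a′ :- :1))) refl a a′))
          (solve 2 (λ a a′ → :0 :* (:0 :* :0 :+ :1 :* a′) :+ a′ :* ((:- :1) :* :0 :+ :0 :* a′) := :0) refl a a′)) (S.sym (μ-W 1ᵘ)))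

  opaque
    h : Unit → Carrier
    h u = proj₁ (inverted-exists u)
    h-inverted : ∀ u → Inverted (h u) u
    h-inverted u = proj₂ (inverted-exists u)

  private
    h-cong : ∀ {u v} → val u ≈ᴷ val v → h u ≈ h v
    h-cong {u} {v} = inverted-unique (h-inverted u) (h-inverted v)

    -- The product of two lifts inverted by w is again inverted by w, provided the lifts commute.
    -- Uniqueness does the rest, so the torus lifts to a subgroup.
    h-h : ∀ u v → h u ∙ h v ≈ h (u *ᵘ v)
    h-h u v = inverted-unique {u = u *ᵘ v} {u *ᵘ v} (inverted
        (S.trans (μ-homo _ _) (S.trans (S.∙-cong (matrix (h-inverted u)) (matrix (h-inverted v))) (diag-* u v)))
        (begin
          h u ∙ h v ∙ (w ∙ (h u ∙ h v))   ≈⟨ ∙-congʳ (torus-commutes u v (matrix (h-inverted u)) (matrix (h-inverted v))) ⟩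
          h v ∙ h u ∙ (w ∙ (h u ∙ h v))   ≈⟨ MonoidSolver.solve monoid ⟩
          h v ∙ (h u ∙ (w ∙ h u) ∙ h v)   ≈⟨ ∙-congˡ (∙-congʳ (flip (h-inverted u))) ⟩
          h v ∙ (w ∙ h v)                 ≈⟨ flip (h-inverted v) ⟩
          w                               ∎))
      (h-inverted (u *ᵘ v)) refl

    h-1 : ∀ {u} → val u ≈ᴷ 1# → h u ≈ ε
    h-1 {u} e = inverted-unique {v = 1ᵘ} (h-inverted u) (inverted (S.trans (μ-cong (≈-sym ι-0)) (S.trans (μ-ι 0ᴹ) (mk≋ refl refl refl refl)))
      (≈-trans (identityˡ _) (identityʳ w))) e

    h-w : ∀ u → h u ∙ w ≈ w ∙ h (recipᵘ u)
    h-w u = begin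
      h u ∙ w                                 ≈⟨ identityʳ _ ⟨
      h u ∙ w ∙ ε                             ≈⟨ ∙-congˡ (≈-trans (h-h u (recipᵘ u)) (h-1 {u *ᵘ recipᵘ u} (eq u))) ⟨
      h u ∙ w ∙ (h u ∙ h (recipᵘ u))          ≈⟨ MonoidSolver.solve monoid ⟩
      h u ∙ (w ∙ h u) ∙ h (recipᵘ u)          ≈⟨ ∙-congʳ (flip (h-inverted u)) ⟩
      w ∙ h (recipᵘ u)                        ∎

    w-h : ∀ u → w ∙ h u ≈ h (recipᵘ u) ∙ w
    w-h u = ≈-sym (≈-trans (h-w (recipᵘ u)) (∙-congˡ (h-cong {recipᵘ (recipᵘ u)} {u} refl)))

    h-x : ∀ u s → h u ∙ x s ≈ x (val u * val u * s) ∙ h u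
    h-x u = diag-x u (matrix (h-inverted u))

    x-h : ∀ u s → x s ∙ h u ≈ h u ∙ x (recip u * recip u * s)
    x-h u@(unit a a′ e) s = ≈-sym (≈-trans (h-x u (a′ * a′ * s)) (∙-congʳ (x-cong
      (modulo₁ ((a * a′ + 1#) * s) e (solve 3 (λ a a′ s → a :* a :* (a′ :* a′ :* s) := s :+ (((a :* a′ :+ :1) :* s) :* (a :* a′ :- :1))) refl a a′ s)))))

    W-decomposition : ∀ u → ∃ λ m → W u ≈[ m ] h u ∙ w
    W-decomposition u = same-matrix {W u} {h u ∙ w} (S.trans (μ-W u) (S.sym (μ-w-via u (matrix (h-inverted u)))))

  opaque
    -- Measures how far the homomorphic torus lift `h u` is from Steinberg's w(u) w(1)⁻¹. It is the
    -- only obstruction to closing the Bruhat normal forms under multiplication.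
    defect : Unit → |M|
    defect u = proj₁ (W-decomposition u)
    W≈ : ∀ u → W u ≈[ defect u ] h u ∙ w
    W≈ u = proj₂ (W-decomposition u)

  private
    defect-cong : ∀ {u v} → val u ≈ᴷ val v → defect u ≈ᴹ defect v
    defect-cong {u} {v} e = shift-unique (W≈ u) (≈-trans (W-cong {u} {v} e) (≈-trans (W≈ v) (∙-congʳ (∙-congʳ (h-cong {v} {u} (K.sym e))))))

    defect-1 : ∀ {u} → val u ≈ᴷ 1# → defect u ≈ᴹ 0ᴹ
    defect-1 {u} e = shift-unique (W≈ u) (exact (≈-trans (W-cong {u} {1ᵘ} e) (≈-sym (≈-trans (∙-congʳ (h-1 {u} e)) (identityˡ w)))))

    -- Conjugation by `h t` carries `W u` to W(t² u), since it scales x by t² and y by t⁻². Moving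
    -- `h t` through w on the right leaves h(t u) w on both sides.
    defect-square : ∀ t u → defect (t *ᵘ t *ᵘ u) ≈ᴹ defect u
    defect-square t@(unit a a′ e) u = shift-unique {h t ∙ W u} {h (t *ᵘ u) ∙ w}
      (≈-trans moved (≈-trans (congʳ[] (W≈ (t *ᵘ t *ᵘ u))) (∙-congʳ (begin
        h (t *ᵘ t *ᵘ u) ∙ w ∙ h t              ≈⟨ assoc _ _ _ ⟩
        h (t *ᵘ t *ᵘ u) ∙ (w ∙ h t)            ≈⟨ ∙-congˡ (w-h t) ⟩
        h (t *ᵘ t *ᵘ u) ∙ (h (recipᵘ t) ∙ w)   ≈⟨ assoc _ _ _ ⟨
        h (t *ᵘ t *ᵘ u) ∙ h (recipᵘ t) ∙ w     ≈⟨ ∙-congʳ (≈-trans (h-h _ _) (h-cong {t *ᵘ t *ᵘ u *ᵘ recipᵘ t} {t *ᵘ u}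
            (modulo₁ (a * (val u)) e (solve 3 (λ a a′ b → a :* a :* b :* a′ := a :* b :+ ((a :* b) :* (a :* a′ :- :1))) refl a a′ (val u))))) ⟩
        h (t *ᵘ u) ∙ w                         ∎))))
      (≈-trans (congˡ[] (W≈ u)) (∙-congʳ (≈-trans (≈-sym (assoc _ _ _)) (∙-congʳ (h-h t u)))))
      where
      moved : h t ∙ W u ≈ W (t *ᵘ t *ᵘ u) ∙ h t
      moved = begin
        h t ∙ (x b ∙ (y (- b′) ∙ x b))                             ≈⟨ assoc _ _ _ ⟨
        h t ∙ x b ∙ (y (- b′) ∙ x b)                               ≈⟨ ∙-congʳ (h-x t b) ⟩
        x (a * a * b) ∙ h t ∙ (y (- b′) ∙ x b)                     ≈⟨ MonoidSolver.solve monoid ⟩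
        x (a * a * b) ∙ (h t ∙ y (- b′) ∙ x b)                     ≈⟨ ∙-congˡ (∙-congʳ (diag-y t (matrix (h-inverted t)) (- b′))) ⟩
        x (a * a * b) ∙ (y (a′ * a′ * (- b′)) ∙ h t ∙ x b)         ≈⟨ MonoidSolver.solve monoid ⟩
        x (a * a * b) ∙ (y (a′ * a′ * (- b′)) ∙ (h t ∙ x b))       ≈⟨ ∙-congˡ (∙-cong (y-cong (solve 2 (λ a′ b′ → a′ :* a′ :* (:- b′) := :- (a′ :* a′ :* b′)) refl a′ b′)) (h-x t b)) ⟩
        x (a * a * b) ∙ (y (- (a′ * a′ * b′)) ∙ (x (a * a * b) ∙ h t)) ≈⟨ MonoidSolver.solve monoid ⟩
        x (a * a * b) ∙ (y (- (a′ * a′ * b′)) ∙ x (a * a * b)) ∙ h t ∎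
        where
        b b′ : |K|
        b = val u
        b′ = recip u

    x-cancel : ∀ {s s′} → s + s′ ≈ᴷ 0# → x s ∙ x s′ ≈ ε
    x-cancel e = ≈-trans (≈-sym (x-homo _ _)) (≈-trans (x-cong e) x-0)

    W-W : ∀ u v → W u ∙ W v ≈[ defect u ⊞ defect v ] h (u *ᵘ recipᵘ v) ∙ (w ∙ w)
    W-W u v = ≈-trans (shift-cong (W≈ u) (W≈ v)) (∙-congʳ (begin
      h u ∙ w ∙ (h v ∙ w)                  ≈⟨ MonoidSolver.solve monoid ⟩
      h u ∙ (w ∙ h v) ∙ w                  ≈⟨ ∙-congʳ (∙-congˡ (w-h v)) ⟩
      h u ∙ (h (recipᵘ v) ∙ w) ∙ w         ≈⟨ MonoidSolver.solve monoid ⟩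
      h u ∙ h (recipᵘ v) ∙ (w ∙ w)         ≈⟨ ∙-congʳ (h-h u (recipᵘ v)) ⟩
      h (u *ᵘ recipᵘ v) ∙ (w ∙ w)          ∎))

    -1ᵘ : Unit
    -1ᵘ = -ᵘ 1ᵘ

    W-inverse : ∀ u → ε ≈[ defect u ⊞ defect (-ᵘ u) ] h -1ᵘ ∙ (w ∙ w)
    W-inverse u@(unit a a′ e) = ≈-trans (≈-sym inverse′) (≈-trans (W-W u (-ᵘ u)) (∙-congʳ (∙-congʳ (h-cong {u *ᵘ recipᵘ (-ᵘ u)} { -1ᵘ}
        (modulo₁ (- 1#) e (solve 2 (λ a a′ → a :* (:- a′) := :- :1 :+ ((:- :1) :* (a :* a′ :- :1))) refl a a′))))))
      where
      inverse′ : W u ∙ W (-ᵘ u) ≈ ε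
      inverse′ = begin
        x a ∙ (y (- a′) ∙ x a) ∙ (x (- a) ∙ (y (- (- a′)) ∙ x (- a)))   ≈⟨ MonoidSolver.solve monoid ⟩
        x a ∙ (y (- a′) ∙ (x a ∙ x (- a)) ∙ y (- (- a′))) ∙ x (- a)     ≈⟨ ∙-congʳ (∙-congˡ (∙-congʳ (∙-congˡ (x-cancel (K.-‿inverseʳ a))))) ⟩
        x a ∙ (y (- a′) ∙ ε ∙ y (- (- a′))) ∙ x (- a)                   ≈⟨ ∙-congʳ (∙-congˡ (≈-trans (∙-congʳ (identityʳ _)) (≈-trans (≈-sym (y-homo _ _)) (y-cong (K.-‿inverseʳ (- a′)))))) ⟩
        x a ∙ y 0# ∙ x (- a)                                            ≈⟨ ∙-congʳ (∙-congˡ (identityˡ-unique _ _ (≈-trans (≈-sym (y-homo 0# 0#)) (y-cong (K.+-identityˡ 0#))))) ⟩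
        x a ∙ ε ∙ x (- a)                                               ≈⟨ ∙-congʳ (identityʳ _) ⟩
        x a ∙ x (- a)                                                   ≈⟨ x-cancel (K.-‿inverseʳ a) ⟩
        ε                                                               ∎

    δ₋₁ : |M|
    δ₋₁ = defect -1ᵘ

    -- W(u) W(-u) = 1, while moving torus elements through w writes this product as h(-1) w² times
    -- the sum of the defects. The sum is therefore independent of u, and u = 1 gives its value.
    defect-neg : ∀ u → defect u ⊞ defect (-ᵘ u) ≈ᴹ δ₋₁
    defect-neg u = M.trans (shift-unique (W-inverse u) (W-inverse 1ᵘ)) (M.trans (M.∙-congʳ (defect-1 {1ᵘ} refl)) (M.identityˡ _))

    h-1h-1 : h -1ᵘ ∙ h -1ᵘ ≈ ε
    h-1h-1 = ≈-trans (h-h -1ᵘ -1ᵘ) (h-1 { -1ᵘ *ᵘ -1ᵘ} (solve 0 ((:- :1) :* (:- :1) := :1) refl))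

    w-w : h -1ᵘ ≈[ δ₋₁ ] w ∙ w
    w-w = begin
      h -1ᵘ                                    ≈⟨ identityʳ _ ⟨
      h -1ᵘ ∙ ε                                ≈⟨ congˡ[] (W-inverse 1ᵘ) ⟩
      h -1ᵘ ∙ (h -1ᵘ ∙ (w ∙ w)) ∙ ι (defect 1ᵘ ⊞ δ₋₁)  ≈⟨ ∙-cong (≈-trans (≈-sym (assoc _ _ _)) (≈-trans (∙-congʳ h-1h-1) (identityˡ _))) (ι-cong (M.trans (M.∙-congʳ (defect-1 {1ᵘ} refl)) (M.identityˡ _))) ⟩
      w ∙ w ∙ ι δ₋₁                            ∎

    NF : |K| → Unit → |K| → Carrier
    NF s τ s′ = x s ∙ (h τ ∙ (w ∙ x s′))

    μ-NF : ∀ s τ s′ → let N = μ (NF s τ s′) in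
           (SL.a N ≈ᴷ - (s * recip τ)) × (SL.c N ≈ᴷ - recip τ) × (SL.d N ≈ᴷ - (recip τ * s′))
    μ-NF s τ@(unit a a′ e) s′ = K.trans (S≈.a≈) (solve 3 (λ s a a′ → :1 :* (a :* (:0 :* :1 :+ :1 :* :0) :+ :0 :* ((:- :1) :* :1 :+ :0 :* :0)) :+ s :* (:0 :* (:0 :* :1 :+ :1 :* :0) :+ a′ :* ((:- :1) :* :1 :+ :0 :* :0)) := :- (s :* a′)) refl s a a′)
      , K.trans (S≈.c≈) (solve 3 (λ s a a′ → :0 :* (a :* (:0 :* :1 :+ :1 :* :0) :+ :0 :* ((:- :1) :* :1 :+ :0 :* :0)) :+ :1 :* (:0 :* (:0 :* :1 :+ :1 :* :0) :+ a′ :* ((:- :1) :* :1 :+ :0 :* :0)) := :- a′) refl s a a′)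
      , K.trans (S≈.d≈) (solve 4 (λ s s′ a a′ → :0 :* (a :* (:0 :* s′ :+ :1 :* :1) :+ :0 :* ((:- :1) :* s′ :+ :0 :* :1)) :+ :1 :* (:0 :* (:0 :* s′ :+ :1 :* :1) :+ a′ :* ((:- :1) :* s′ :+ :0 :* :1)) := :- (a′ :* s′)) refl s s′ a a′)
      where
      S≈ : μ (NF s τ s′) ≋ E₁₂ s ⊙ (diag τ ⊙ (weyl 1ᵘ ⊙ E₁₂ s′))
      S≈ = S.trans (μ-homo _ _) (S.∙-cong (μ-x s) (S.trans (μ-homo _ _) (S.∙-cong (matrix (h-inverted τ)) (S.trans (μ-homo _ _) (S.∙-cong (μ-W 1ᵘ) (μ-x s′))))))
      module S≈ = _≋_ S≈

    -- The matrix determines all three parameters. Two computations of one element can thus be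
    -- compared without matching their parameters by hand.
    NF-cong : ∀ {s τ s′ s₁ τ₁ s₁′} → μ (NF s τ s′) ≋ μ (NF s₁ τ₁ s₁′) → NF s τ s′ ≈ NF s₁ τ₁ s₁′
    NF-cong {s} {τ@(unit a a′ e)} {s′} {s₁} {τ₁@(unit b b′ e′)} {s₁′} (mk≋ qa _ qc qd) =
      let na , nc , nd = μ-NF s τ s′
          ma , mc , md = μ-NF s₁ τ₁ s₁′
          a′≈b′ : a′ ≈ᴷ b′
          a′≈b′ = MK.⁻¹-injective (K.trans (K.sym nc) (K.trans qc mc))
          sa : s * a′ ≈ᴷ s₁ * b′
          sa = MK.⁻¹-injective (K.trans (K.sym na) (K.trans qa ma))
          as : a′ * s′ ≈ᴷ b′ * s₁′
          as = MK.⁻¹-injective (K.trans (K.sym nd) (K.trans qd md))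
      in ∙-cong (x-cong (modulo₃ a sa (- (a * s₁)) a′≈b′ (- s + s₁) e (solve 6 (λ a a′ b b′ s s₁ → s := s₁ :+ (a :* (s :* a′ :- s₁ :* b′) :+ ((:- (a :* s₁)) :* (a′ :- b′) :+ ((:- s :+ s₁) :* (a :* a′ :- :1))))) refl a a′ b b′ s s₁)))
        (∙-cong (h-cong {τ} {τ₁} (recip-cong {recipᵘ τ} {recipᵘ τ₁} a′≈b′))
          (∙-congˡ (x-cong (modulo₃ a as (- (a * s₁′)) a′≈b′ (- s′ + s₁′) e (solve 6 (λ a a′ b b′ t t₁ → t := t₁ :+ (a :* (a′ :* t :- b′ :* t₁) :+ ((:- (a :* t₁)) :* (a′ :- b′) :+ ((:- t :+ t₁) :* (a :* a′ :- :1))))) refl a a′ b b′ s′ s₁′)))))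
      where module MK = Algebra.Properties.AbelianGroup K.+-abelianGroup

    y-W : ∀ r → y (- recip r) ≈ x (- val r) ∙ (W r ∙ x (- val r))
    y-W r = ≈-sym (begin
      x (- v) ∙ (x v ∙ (y (- recip r) ∙ x v) ∙ x (- v))     ≈⟨ MonoidSolver.solve monoid ⟩
      x (- v) ∙ x v ∙ (y (- recip r) ∙ (x v ∙ x (- v)))     ≈⟨ ∙-cong (x-cancel (K.-‿inverseˡ v)) (∙-congˡ (x-cancel (K.-‿inverseʳ v))) ⟩
      ε ∙ (y (- recip r) ∙ ε)                               ≈⟨ ≈-trans (identityˡ _) (identityʳ _) ⟩
      y (- recip r)                                         ∎)
      where
      v : |K|
      v = val r

    -- Steinberg's relation w(u) x(−u−v) w(v) = x(u−t) w(t) x(v−t), 1/t = 1/u + 1/v, read off in normal form.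
    module Steinberg (u v s : Unit) (s≈ : val s ≈ᴷ val u + val v) where

      t r Q : Unit
      -- Moving x(-s) across `W u` turns it into y(s/u²) = y(-1/r), which determines r. Q = -u/v is
      -- the torus part of `W u ∙ W v`, where w² contributes the sign through h(-1).
      t = u *ᵘ v *ᵘ recipᵘ s
      r = u *ᵘ u *ᵘ recipᵘ (-ᵘ s)
      Q = u *ᵘ recipᵘ v *ᵘ -1ᵘ

      left : W u ∙ (x (- val s) ∙ W v) ≈ x (- val r) ∙ (W r ∙ (x (- val r) ∙ (W u ∙ W v)))
      left = begin
        W u ∙ (x (- val s) ∙ W v)                                        ≈⟨ assoc _ _ _ ⟨
        W u ∙ x (- val s) ∙ W v                                          ≈⟨ ∙-congʳ (W-x u (- val s)) ⟩
        y (- recip r) ∙ W u ∙ W v                                        ≈⟨ ∙-congʳ (∙-congʳ (y-W r)) ⟩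
        x (- val r) ∙ (W r ∙ x (- val r)) ∙ W u ∙ W v                    ≈⟨ MonoidSolver.solve monoid ⟩
        x (- val r) ∙ (W r ∙ (x (- val r) ∙ (W u ∙ W v)))                ∎

      ρ : |K|
      ρ = recip Q * recip Q * (- val r)

      WuWv : W u ∙ W v ∙ ι δ₋₁ ≈[ defect u ⊞ defect v ] h Q
      WuWv = begin
        W u ∙ W v ∙ ι δ₋₁                                           ≈⟨ ∙-congʳ (W-W u v) ⟩
        h (u *ᵘ recipᵘ v) ∙ (w ∙ w) ∙ ι m ∙ ι δ₋₁                   ≈⟨ ≈-trans (assoc _ _ _) (≈-trans (∙-congˡ (ι-central m (ι δ₋₁))) (≈-sym (assoc _ _ _))) ⟩
        h (u *ᵘ recipᵘ v) ∙ (w ∙ w) ∙ ι δ₋₁ ∙ ι m                   ≈⟨ ∙-congʳ (≈-trans (assoc _ _ _) (∙-congˡ (≈-sym w-w))) ⟩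
        h (u *ᵘ recipᵘ v) ∙ h -1ᵘ ∙ ι m                             ≈⟨ ∙-congʳ (h-h _ _) ⟩
        h Q ∙ ι m                                                   ∎
        where
        m : |M|
        m = defect u ⊞ defect v

      left-NF : W u ∙ (x (- val s) ∙ W v) ∙ ι δ₋₁ ≈[ defect r ⊞ (defect u ⊞ defect v) ] NF (- val r) (r *ᵘ recipᵘ Q) ρ
      left-NF = begin
        W u ∙ (x (- val s) ∙ W v) ∙ ι δ₋₁                                          ≈⟨ ∙-congʳ left ⟩
        x (- val r) ∙ (W r ∙ (x (- val r) ∙ (W u ∙ W v))) ∙ ι δ₋₁                  ≈⟨ MonoidSolver.solve monoid ⟩
        x (- val r) ∙ (W r ∙ (x (- val r) ∙ (W u ∙ W v ∙ ι δ₋₁)))                  ≈⟨ congˡ[] (shift-cong (W≈ r) (congˡ[] WuWv)) ⟩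
        x (- val r) ∙ (h r ∙ w ∙ (x (- val r) ∙ h Q)) ∙ ι m                        ≈⟨ ∙-congʳ (∙-congˡ (∙-congˡ (x-h Q (- val r)))) ⟩
        x (- val r) ∙ (h r ∙ w ∙ (h Q ∙ x ρ)) ∙ ι m                                ≈⟨ MonoidSolver.solve monoid ⟩
        x (- val r) ∙ (h r ∙ (w ∙ h Q) ∙ x ρ) ∙ ι m                                ≈⟨ ∙-congʳ (∙-congˡ (∙-congʳ (∙-congˡ (w-h Q)))) ⟩
        x (- val r) ∙ (h r ∙ (h (recipᵘ Q) ∙ w) ∙ x ρ) ∙ ι m                       ≈⟨ MonoidSolver.solve monoid ⟩
        x (- val r) ∙ (h r ∙ h (recipᵘ Q) ∙ (w ∙ x ρ)) ∙ ι m                       ≈⟨ ∙-congʳ (∙-congˡ (∙-congʳ (h-h r (recipᵘ Q)))) ⟩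
        NF (- val r) (r *ᵘ recipᵘ Q) ρ ∙ ι m                                       ∎
        where
        m : |M|
        m = defect r ⊞ (defect u ⊞ defect v)

      right : W u ∙ (x (- val s) ∙ W v) ≈ x (val u - val t) ∙ (W t ∙ x (val v - val t))
      right = begin
        x a ∙ (y (- recip u) ∙ x a) ∙ (x (- val s) ∙ (x b ∙ (y (- recip v) ∙ x b)))   ≈⟨ MonoidSolver.solve monoid ⟩
        x a ∙ (y (- recip u) ∙ (x a ∙ x (- val s) ∙ x b) ∙ y (- recip v)) ∙ x b       ≈⟨ ∙-congʳ (∙-congˡ (∙-congʳ (∙-congˡ middle))) ⟩
        x a ∙ (y (- recip u) ∙ ε ∙ y (- recip v)) ∙ x b                               ≈⟨ ∙-congʳ (∙-congˡ (≈-trans (∙-congʳ (identityʳ _)) (≈-trans (≈-sym (y-homo _ _)) (y-cong recips)))) ⟩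
        x a ∙ y (- recip t) ∙ x b                                                     ≈⟨ ∙-congʳ (∙-congˡ (y-W t)) ⟩
        x a ∙ (x (- val t) ∙ (W t ∙ x (- val t))) ∙ x b                               ≈⟨ MonoidSolver.solve monoid ⟩
        x a ∙ x (- val t) ∙ (W t ∙ (x (- val t) ∙ x b))                               ≈⟨ ∙-cong (≈-sym (x-homo _ _)) (∙-congˡ (≈-trans (≈-sym (x-homo _ _)) (x-cong (K.+-comm _ _)))) ⟩
        x (a - val t) ∙ (W t ∙ x (b - val t))                                         ∎
        where
        a b : |K|
        a = val u
        b = val v
        middle : x a ∙ x (- val s) ∙ x b ≈ ε
        middle = ≈-trans (∙-congʳ (≈-sym (x-homo _ _))) (x-cancel (modulo₁ (- 1#) s≈ (solve 3 (λ a b s → a :- s :+ b := :0 :+ ((:- :1) :* (s :- (a :+ b)))) refl a b (val s))))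
        recips : - recip u + - recip v ≈ᴷ - recip t
        recips = modulo₃ ((recip u) * (recip v)) s≈ (recip v) (eq u) (recip u) (eq v) (solve 5 (λ a b s a′ b′ → :- a′ :+ :- b′ := :- (a′ :* b′ :* s) :+ ((a′ :* b′) :* (s :- (a :+ b)) :+ (b′ :* (a :* a′ :- :1) :+ (a′ :* (b :* b′ :- :1))))) refl a b (val s) (recip u) (recip v))

      right-NF : W u ∙ (x (- val s) ∙ W v) ∙ ι δ₋₁ ≈[ δ₋₁ ⊞ defect t ] NF (val u - val t) t (val v - val t)
      right-NF = ≈-trans (∙-congʳ (≈-trans right (congˡ[] (congʳ[] (W≈ t))))) (≈-trans (assoc _ _ _)
        (∙-cong (∙-congˡ (assoc _ _ _)) (≈-trans (≈-sym (ι-homo _ _)) (ι-cong (M.comm _ _)))))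

      balance : defect r ⊞ (defect u ⊞ defect v) ≈ᴹ δ₋₁ ⊞ defect t
      balance = shift-unique left-NF (≈-trans right-NF (∙-congʳ (≈-sym (NF-cong
        { - val r} {r *ᵘ recipᵘ Q} {ρ} {val u - val t} {t} {val v - val t} (S.trans (S.sym (μ-shift left-NF)) (μ-shift right-NF))))))

      defect-r : defect r ≈ᴹ defect (-ᵘ s)
      defect-r = M.trans (defect-cong {r} {q *ᵘ q *ᵘ -ᵘ s} (modulo₁ ((val u) * (val u) * (recip s)) (eq s) (solve 3 (λ a s s′ → a :* a :* (:- s′) := a :* (:- s′) :* (a :* (:- s′)) :* (:- s) :+ ((a :* a :* s′) :* (s :* s′ :- :1))) refl (val u) (val s) (recip s)))) (defect-square q (-ᵘ s))
        where
        q : Unit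
        q = u *ᵘ recipᵘ (-ᵘ s)

      defect-t : defect t ≈ᴹ defect (u *ᵘ v *ᵘ s)
      defect-t = M.trans (defect-cong {t} {recipᵘ s *ᵘ recipᵘ s *ᵘ (u *ᵘ v *ᵘ s)} (modulo₁ (- ((val u) * (val v) * (recip s))) (eq s) (solve 4 (λ a b s s′ → a :* b :* s′ := s′ :* s′ :* (a :* b :* s) :+ ((:- (a :* b :* s′)) :* (s :* s′ :- :1))) refl (val u) (val v) (val s) (recip s)))) (defect-square (recipᵘ s) (u *ᵘ v *ᵘ s))

      -- Up to squares, r is -s and t is u v s. In `balance` the term of -s combines with `δ₋₁` =
      -- defect(s) + defect(-s), leaving that of s.
      steinberg : defect u ⊞ defect v ≈ᴹ defect s ⊞ defect (u *ᵘ v *ᵘ s)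
      steinberg = R′.begin
        defect u ⊞ defect v                                             R′.≈⟨ MP.\\-leftDividesʳ (defect r) _ ⟨
        ⊟ defect r ⊞ (defect r ⊞ (defect u ⊞ defect v))                 R′.≈⟨ M.∙-congˡ balance ⟩
        ⊟ defect r ⊞ (δ₋₁ ⊞ defect t)                                   R′.≈⟨ M.assoc _ _ _ ⟨
        ⊟ defect r ⊞ δ₋₁ ⊞ defect t                                     R′.≈⟨ M.∙-cong (M.∙-cong (M.⁻¹-cong defect-r) (M.trans (M.sym (defect-neg s)) (M.comm _ _))) defect-t ⟩
        ⊟ defect (-ᵘ s) ⊞ (defect (-ᵘ s) ⊞ defect s) ⊞ defect (u *ᵘ v *ᵘ s) R′.≈⟨ M.∙-congʳ (MP.\\-leftDividesʳ (defect (-ᵘ s)) (defect s)) ⟩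
        defect s ⊞ defect (u *ᵘ v *ᵘ s)                                 R′.∎
        where module R′ = Relation.Binary.Reasoning.Setoid M.setoid

  -- The elements i with defect (i x) = defect x for all x form, with 0, a subfield
  -- containing all squares, hence all of K.
  private
    data Good (z : |K|) : Set where
      good-zero : z ≈ᴷ 0# → Good z
      good-unit : ∀ i → val i ≈ᴷ z → (∀ u → defect (i *ᵘ u) ≈ᴹ defect u) → Good z

    good-resp : ∀ {z z′} → z ≈ᴷ z′ → Good z → Good z′
    good-resp q (good-zero e)     = good-zero (K.trans (K.sym q) e)
    good-resp q (good-unit i e g) = good-unit i (K.trans e q) g

    good-+ : ∀ {z z′} → Good z → Good z′ → Good (z + z′)
    good-+ {z} {z′} (good-zero e) g = good-resp (modulo₁ (- 1#) e (solve 2 (λ z z′ → z′ := z :+ z′ :+ ((:- :1) :* (z :- :0))) refl z z′)) g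
    good-+ {z} {z′} g (good-zero e) = good-resp (modulo₁ (- 1#) e (solve 2 (λ z z′ → z := z :+ z′ :+ ((:- :1) :* (z′ :- :0))) refl z z′)) g
    good-+ {z} {z′} (good-unit i ei gi) (good-unit j ej gj) with (z + z′) ≟ 0#
    ... | yes e = good-zero e
    ... | no  n = good-unit s refl same
      where
      s : Unit
      s = unitᵘ (z + z′) n
      same : ∀ u → defect (s *ᵘ u) ≈ᴹ defect u
      same u = M.sym (2-cancel (M.trans (M.∙-cong (M.sym (gi u)) (M.sym (gj u))) (M.trans
        (Steinberg.steinberg (i *ᵘ u) (j *ᵘ u) (s *ᵘ u) (modulo₂ (- (val u)) ei (- (val u)) ej (solve 5 (λ z z′ a b u → (z :+ z′) :* u := a :* u :+ b :* u :+ ((:- u) :* (a :- z) :+ ((:- u) :* (b :- z′)))) refl z z′ (val i) (val j) (val u))))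
        (M.∙-congˡ (M.trans (defect-cong {i *ᵘ u *ᵘ (j *ᵘ u) *ᵘ (s *ᵘ u)} {i *ᵘ (j *ᵘ (u *ᵘ u *ᵘ (s *ᵘ u)))}
            (solve 4 (λ a b u s → a :* u :* (b :* u) :* (s :* u) := a :* (b :* (u :* u :* (s :* u)))) refl (val i) (val j) (val u) (z + z′)))
          (M.trans (gi (j *ᵘ (u *ᵘ u *ᵘ (s *ᵘ u)))) (M.trans (gj (u *ᵘ u *ᵘ (s *ᵘ u))) (defect-square u (s *ᵘ u)))))))))

    good-* : ∀ {z z′} → Good z → Good z′ → Good (z * z′)
    good-* {z} {z′} (good-zero e) g = good-zero (modulo₁ z′ e (solve 2 (λ z z′ → z :* z′ := :0 :+ (z′ :* (z :- :0))) refl z z′))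
    good-* {z} {z′} g (good-zero e) = good-zero (modulo₁ z e (solve 2 (λ z z′ → z :* z′ := :0 :+ (z :* (z′ :- :0))) refl z z′))
    good-* {z} {z′} (good-unit i ei gi) (good-unit j ej gj) = good-unit (i *ᵘ j) (K.*-cong ei ej) λ u →
      M.trans (defect-cong {i *ᵘ j *ᵘ u} {i *ᵘ (j *ᵘ u)} (K.*-assoc _ _ _)) (M.trans (gi (j *ᵘ u)) (gj u))

    good-square : ∀ z → Good (z * z)
    good-square z with z ≟ 0#
    ... | yes e = good-zero (modulo₁ z e (solve 1 (λ z → z :* z := :0 :+ (z :* (z :- :0))) refl z))
    ... | no  n = good-unit (unitᵘ z n *ᵘ unitᵘ z n) refl (defect-square (unitᵘ z n))

    good-ℕ : ∀ k → Good (k · 1#)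
    good-ℕ zero    = good-zero refl
    good-ℕ (suc k) = good-+ (good-resp (K.*-identityˡ 1#) (good-square 1#)) (good-ℕ k)

    good-minus-one : Good (- 1#)
    good-minus-one = go p {{prime⇒nonZero p-prime}} p·1≈0
      where
      go : ∀ n → .{{ℕ.NonZero n}} → n · 1# ≈ᴷ 0# → Good (- 1#)
      go (suc n) e = good-resp (modulo₁ 1# e (solve 1 (λ k → k := :- :1 :+ (:1 :* (:1 :+ k :- :0))) refl (n · 1#))) (good-ℕ n)

    module Ch = PrimeCharacteristic.Char (Field.commRing K) p p-prime p·1≈0

    -- The Frobenius iterates of z repeat, and Frobenius is injective, so z is itself an iterate of
    -- positive index and hence a p-th power.
    square-root : p ≡ 2 → ∀ z → ∃ λ r → z ≈ᴷ r * r
    square-root p≡2 z =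
      let i , d , e = periodic (λ k → Ch.σ k z)
          k , pow = Ch.σ-power i (z - Ch.σ (suc d) z)
          z≈ = no-nilpotents k (K.trans (K.sym pow) (K.trans (Ch.σ-sub i z (Ch.σ (suc d) z)) (K.trans (K.+-congʳ e)
                 (K.trans (K.+-congʳ (K.reflexive (Ch.σ-∘ i (suc d) z))) (K.-‿inverseʳ _)))))
      in Ch.σ d z , K.trans (modulo₁ 1# z≈ (solve 2 (λ z s → z := s :+ (:1 :* (z :- s :- :0))) refl z (Ch.σ (suc d) z)))
           (K.trans (K.reflexive (≡.cong (Ch.σ d z ^_) p≡2)) (K.*-congˡ (K.*-identityʳ _)))
      where
      no-nilpotents : ∀ {a} k → a ^ suc k ≈ᴷ 0# → a ≈ᴷ 0#
      no-nilpotents zero e = K.trans (K.sym (K.*-identityʳ _)) e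
      no-nilpotents {a} (suc k) e with a ≟ 0#
      ... | yes a≈0 = a≈0
      ... | no  a≉0 = no-nilpotents k (R.zero-divisor-free a≉0 e)

    all-good : ∀ z → Good z
    all-good z with p ℕ.≟ 2
    ... | yes p≡2 = let r , e = square-root p≡2 z in good-resp (K.sym e) (good-square r)
    -- z = ((z + 1)/2)² - ((z - 1)/2)², and -1 is good because it is a sum of ones.
    ... | no  p≢2 = good-resp
        (modulo₁ (z * ((1# + 1#) * (recip two) + 1#)) (eq two) (solve 2 (λ z t → (z :+ :1) :* t :* ((z :+ :1) :* t) :+ (:- :1) :* ((z :- :1) :* t :* ((z :- :1) :* t)) := z :+ ((z :* ((:1 :+ :1) :* t :+ :1)) :* ((:1 :+ :1) :* t :- :1))) refl z (recip two)))
        (good-+ (good-square _) (good-* good-minus-one (good-square _)))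
      where
      2≉0 : ¬ 1# + 1# ≈ᴷ 0#
      2≉0 e = 0≉1 (K.sym (torsion-coprime K.+-monoid (prime-coprime p-prime prime[2] p≢2) p·1≈0
        (K.trans (K.+-congˡ (K.+-identityʳ 1#)) e)))
      two : Unit
      two = unitᵘ (1# + 1#) 2≉0

  opaque
    defect≈0 : ∀ u → defect u ≈ᴹ 0ᴹ
    defect≈0 u with all-good (val u)
    ... | good-zero e     = contradiction (modulo₂ 1# (eq u) (- (recip u)) e (solve 2 (λ u u′ → :0 := :1 :+ (:1 :* (u :* u′ :- :1) :+ ((:- u′) :* (u :- :0)))) refl (val u) (recip u))) 0≉1
    ... | good-unit i e g = M.trans (defect-cong {u} {i *ᵘ 1ᵘ} (K.trans (K.sym e) (K.sym (K.*-identityʳ _)))) (M.trans (g 1ᵘ) (defect-1 {1ᵘ} refl))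

  private
    drop-ι : ∀ {e f m} → m ≈ᴹ 0ᴹ → e ≈[ m ] f → e ≈ f
    drop-ι m≈0 q = ≈-trans q (≈-trans (∙-congˡ (≈-trans (ι-cong m≈0) ι-0)) (identityʳ _))

    W-h : ∀ u → W u ≈ h u ∙ w
    W-h u = drop-ι (defect≈0 u) (W≈ u)

    ww : w ∙ w ≈ h -1ᵘ
    ww = ≈-sym (drop-ι (defect≈0 -1ᵘ) w-w)

  -- The Bruhat normal forms; they form a subgroup that meets M trivially.
  data Normal (e : Carrier) : Set where
    borel : ∀ s τ → e ≈ x s ∙ h τ → Normal e
    big   : ∀ s τ s′ → e ≈ NF s τ s′ → Normal e

  private
    normal-resp : ∀ {e f} → e ≈ f → Normal e → Normal f
    normal-resp q (borel s τ e)  = borel s τ (≈-trans (≈-sym q) e)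
    normal-resp q (big s τ s′ e) = big s τ s′ (≈-trans (≈-sym q) e)

    normal-x : ∀ r {e} → Normal e → Normal (x r ∙ e)
    normal-x r (borel s τ e)  = borel (r + s) τ (≈-trans (∙-congˡ e) (≈-trans (≈-sym (assoc _ _ _)) (∙-congʳ (≈-sym (x-homo r s)))))
    normal-x r (big s τ s′ e) = big (r + s) τ s′ (≈-trans (∙-congˡ e) (≈-trans (≈-sym (assoc _ _ _)) (∙-congʳ (≈-sym (x-homo r s)))))

    normal-h : ∀ u {e} → Normal e → Normal (h u ∙ e)
    normal-h u (borel s τ e) = borel (val u * val u * s) (u *ᵘ τ) (≈-trans (∙-congˡ e) (begin
      h u ∙ (x s ∙ h τ)                       ≈⟨ assoc _ _ _ ⟨
      h u ∙ x s ∙ h τ                         ≈⟨ ∙-congʳ (h-x u s) ⟩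
      x (val u * val u * s) ∙ h u ∙ h τ       ≈⟨ assoc _ _ _ ⟩
      x (val u * val u * s) ∙ (h u ∙ h τ)     ≈⟨ ∙-congˡ (h-h u τ) ⟩
      x (val u * val u * s) ∙ h (u *ᵘ τ)      ∎))
    normal-h u (big s τ s′ e) = big (val u * val u * s) (u *ᵘ τ) s′ (≈-trans (∙-congˡ e) (begin
      h u ∙ (x s ∙ (h τ ∙ (w ∙ x s′)))                     ≈⟨ MonoidSolver.solve monoid ⟩
      h u ∙ x s ∙ (h τ ∙ (w ∙ x s′))                       ≈⟨ ∙-congʳ (h-x u s) ⟩
      x (val u * val u * s) ∙ h u ∙ (h τ ∙ (w ∙ x s′))     ≈⟨ MonoidSolver.solve monoid ⟩
      x (val u * val u * s) ∙ (h u ∙ h τ ∙ (w ∙ x s′))     ≈⟨ ∙-congˡ (∙-congʳ (h-h u τ)) ⟩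
      x (val u * val u * s) ∙ (h (u *ᵘ τ) ∙ (w ∙ x s′))    ∎))

    w-xh : ∀ s τ → w ∙ (x s ∙ h τ) ≈ NF 0# (recipᵘ τ) (recip τ * recip τ * s)
    w-xh s τ = begin
      w ∙ (x s ∙ h τ)                      ≈⟨ ∙-congˡ (x-h τ s) ⟩
      w ∙ (h τ ∙ x s₁)                     ≈⟨ assoc _ _ _ ⟨
      w ∙ h τ ∙ x s₁                       ≈⟨ ∙-congʳ (w-h τ) ⟩
      h (recipᵘ τ) ∙ w ∙ x s₁              ≈⟨ assoc _ _ _ ⟩
      h (recipᵘ τ) ∙ (w ∙ x s₁)            ≈⟨ ≈-trans (∙-congʳ x-0) (identityˡ _) ⟨
      x 0# ∙ (h (recipᵘ τ) ∙ (w ∙ x s₁))   ∎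
      where
      s₁ : |K|
      s₁ = recip τ * recip τ * s

    -- The one substantial product is w x(s) with s ≠ 0. It equals y(-s) w, and with v = 1/s the
    -- identity y(-s) = x(-v) W(v) x(-v) leads back to the big cell. Both W(v) = h(v) w and w² =
    -- h(-1) rest on the vanishing of the defect.
    normal-w : ∀ {e} → Normal e → Normal (w ∙ e)
    normal-w (borel s τ e) = big _ _ _ (≈-trans (∙-congˡ e) (w-xh s τ))
    normal-w (big s τ s′ e) with s ≟ 0#
    ... | yes s≈0 = normal-resp (≈-sym (≈-trans (∙-congˡ e) (begin
        w ∙ (x s ∙ (h τ ∙ (w ∙ x s′)))              ≈⟨ ∙-congˡ (≈-trans (∙-congʳ (≈-trans (x-cong s≈0) x-0)) (identityˡ _)) ⟩
        w ∙ (h τ ∙ (w ∙ x s′))                      ≈⟨ assoc _ _ _ ⟨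
        w ∙ h τ ∙ (w ∙ x s′)                        ≈⟨ ∙-congʳ (w-h τ) ⟩
        h (recipᵘ τ) ∙ w ∙ (w ∙ x s′)               ≈⟨ MonoidSolver.solve monoid ⟩
        h (recipᵘ τ) ∙ (w ∙ w ∙ x s′)               ≈⟨ ∙-congˡ (∙-congʳ ww) ⟩
        h (recipᵘ τ) ∙ (h -1ᵘ ∙ x s′)               ≈⟨ ∙-congˡ (h-x -1ᵘ s′) ⟩
        h (recipᵘ τ) ∙ (x (- 1# * - 1# * s′) ∙ h -1ᵘ) ∎)))
      (normal-h (recipᵘ τ) (borel (- 1# * - 1# * s′) -1ᵘ ≈-refl))
    ... | no  s≉0 = normal-resp (≈-sym (≈-trans (∙-congˡ e) (begin
        w ∙ (x s ∙ (h τ ∙ (w ∙ x s′)))                                   ≈⟨ assoc _ _ _ ⟨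
        w ∙ x s ∙ (h τ ∙ (w ∙ x s′))                                     ≈⟨ ∙-congʳ (W-x 1ᵘ s) ⟩
        y (- (1# * 1# * s)) ∙ w ∙ (h τ ∙ (w ∙ x s′))                     ≈⟨ ∙-congʳ (∙-congʳ (≈-trans (y-cong (solve 1 (λ s → :- (:1 :* :1 :* s) := :- s) refl s)) (y-W v))) ⟩
        x (- val v) ∙ (W v ∙ x (- val v)) ∙ w ∙ (h τ ∙ (w ∙ x s′))       ≈⟨ ∙-congʳ (∙-congʳ (∙-congˡ (∙-congʳ (W-h v)))) ⟩
        x (- val v) ∙ (h v ∙ w ∙ x (- val v)) ∙ w ∙ (h τ ∙ (w ∙ x s′))   ≈⟨ MonoidSolver.solve monoid ⟩
        x (- val v) ∙ (h v ∙ (w ∙ (x (- val v) ∙ (w ∙ h τ ∙ w ∙ x s′)))) ≈⟨ ∙-congˡ (∙-congˡ (∙-congˡ (∙-congˡ (∙-congʳ collapse)))) ⟩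
        x (- val v) ∙ (h v ∙ (w ∙ (x (- val v) ∙ (h q ∙ x s′))))         ≈⟨ ∙-congˡ (∙-congˡ (∙-congˡ (≈-trans (≈-sym (assoc _ _ _)) (∙-congʳ (x-h q (- val v)))))) ⟩
        x (- val v) ∙ (h v ∙ (w ∙ (h q ∙ x s₁ ∙ x s′)))                  ≈⟨ MonoidSolver.solve monoid ⟩
        x (- val v) ∙ (h v ∙ (w ∙ h q ∙ (x s₁ ∙ x s′)))                  ≈⟨ ∙-congˡ (∙-congˡ (∙-cong (w-h q) (≈-sym (x-homo s₁ s′)))) ⟩
        x (- val v) ∙ (h v ∙ (h (recipᵘ q) ∙ w ∙ x (s₁ + s′)))           ≈⟨ MonoidSolver.solve monoid ⟩
        x (- val v) ∙ (h v ∙ h (recipᵘ q) ∙ (w ∙ x (s₁ + s′)))           ≈⟨ ∙-congˡ (∙-congʳ (h-h v (recipᵘ q))) ⟩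
        NF (- val v) (v *ᵘ recipᵘ q) (s₁ + s′)                           ∎)))
      (big _ _ _ ≈-refl)
      where
      v q : Unit
      v = recipᵘ (unitᵘ s s≉0)
      q = recipᵘ τ *ᵘ -1ᵘ
      s₁ : |K|
      s₁ = recip q * recip q * (- val v)
      collapse : w ∙ h τ ∙ w ≈ h q
      collapse = begin
        w ∙ h τ ∙ w                ≈⟨ ∙-congʳ (w-h τ) ⟩
        h (recipᵘ τ) ∙ w ∙ w       ≈⟨ assoc _ _ _ ⟩
        h (recipᵘ τ) ∙ (w ∙ w)     ≈⟨ ∙-congˡ ww ⟩
        h (recipᵘ τ) ∙ h -1ᵘ       ≈⟨ h-h (recipᵘ τ) -1ᵘ ⟩
        h q                        ∎

    normal-∙ : ∀ {e f} → Normal e → Normal f → Normal (e ∙ f)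
    normal-∙ (borel s τ e) g = normal-resp (≈-sym (≈-trans (∙-congʳ e) (assoc _ _ _))) (normal-x s (normal-h τ g))
    normal-∙ {e} {f} (big s τ s′ q) g = normal-resp (≈-sym (≈-trans (∙-congʳ q) reassoc))
        (normal-x s (normal-h τ (normal-w (normal-x s′ g))))
      where
      reassoc : x s ∙ (h τ ∙ (w ∙ x s′)) ∙ f ≈ x s ∙ (h τ ∙ (w ∙ (x s′ ∙ f)))
      reassoc = MonoidSolver.solve monoid

    μ-borel : ∀ s τ → μ (x s ∙ h τ) ≋ E₁₂ s ⊙ diag τ
    μ-borel s τ = S.trans (μ-homo _ _) (S.∙-cong (μ-x s) (matrix (h-inverted τ)))

    borel-c : ∀ s τ → SL.c (E₁₂ s ⊙ diag τ) ≈ᴷ 0#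
    borel-c s (unit a a′ e) = solve 1 (λ a → :0 :* a :+ :1 :* :0 := :0) refl a

    no-mixing : ∀ {s τ s₁ τ₁ s₁′} → ¬ μ (x s ∙ h τ) ≋ μ (NF s₁ τ₁ s₁′)
    no-mixing {s} {τ} {s₁} {τ₁} {s₁′} q = 0≉1 (modulo₂ 1# (eq τ₁) (val τ₁) τ₁′≈0 (solve 2 (λ t t′ → :0 := :1 :+ (:1 :* (t :* t′ :- :1) :+ (t :* (:- t′ :- :0)))) refl (val τ₁) (recip τ₁)))
      where
      τ₁′≈0 : - recip τ₁ ≈ᴷ 0#
      τ₁′≈0 = K.trans (K.sym (proj₁ (proj₂ (μ-NF s₁ τ₁ s₁′)))) (K.trans (K.sym (_≋_.c≈ q)) (K.trans (_≋_.c≈ (μ-borel s τ)) (borel-c s τ)))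

    borel-unique : ∀ {s τ s₁ τ₁} → μ (x s ∙ h τ) ≋ μ (x s₁ ∙ h τ₁) → x s ∙ h τ ≈ x s₁ ∙ h τ₁
    borel-unique {s} {τ@(unit a a′ e)} {s₁} {τ₁@(unit b b′ e′)} q with S.trans (S.sym (μ-borel s τ)) (S.trans q (μ-borel s₁ τ₁))
    ... | mk≋ qa qb _ qd = ∙-cong (x-cong (modulo₃ a sa (- (a * s₁)) a′≈b′ (- s + s₁) e (solve 6 (λ a a′ b b′ s s₁ → s := s₁ :+ (a :* (s :* a′ :- s₁ :* b′) :+ ((:- (a :* s₁)) :* (a′ :- b′) :+ ((:- s :+ s₁) :* (a :* a′ :- :1))))) refl a a′ b b′ s s₁)))
        (h-cong {τ} {τ₁} (recip-cong {recipᵘ τ} {recipᵘ τ₁} a′≈b′))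
      where
      a′≈b′ : a′ ≈ᴷ b′
      a′≈b′ = modulo₁ 1# qd (solve 2 (λ a′ b′ → a′ := b′ :+ (:1 :* (:0 :* :0 :+ :1 :* a′ :- (:0 :* :0 :+ :1 :* b′)))) refl a′ b′)
      sa : s * a′ ≈ᴷ s₁ * b′
      sa = modulo₁ 1# qb (solve 4 (λ a′ b′ s s₁ → s :* a′ := s₁ :* b′ :+ (:1 :* (:1 :* :0 :+ s :* a′ :- (:1 :* :0 :+ s₁ :* b′)))) refl a′ b′ s s₁)

  opaque
    normal-unique : ∀ {e f} → Normal e → Normal f → μ e ≋ μ f → e ≈ f
    normal-unique (borel s τ e) (borel s₁ τ₁ e₁) q = ≈-trans e (≈-trans (borel-unique {s} {τ} {s₁} {τ₁} (S.trans (S.sym (μ-cong e)) (S.trans q (μ-cong e₁)))) (≈-sym e₁))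
    normal-unique (borel s τ e) (big s₁ τ₁ s₁′ e₁) q = contradiction (S.trans (S.sym (μ-cong e)) (S.trans q (μ-cong e₁))) (no-mixing {s} {τ})
    normal-unique (big s τ s′ e) (borel s₁ τ₁ e₁) q = contradiction (S.trans (S.sym (μ-cong e₁)) (S.trans (S.sym q) (μ-cong e))) (no-mixing {s₁} {τ₁})
    normal-unique (big s τ s′ e) (big s₁ τ₁ s₁′ e₁) q = ≈-trans e (≈-trans (NF-cong {s} {τ} {s′} {s₁} {τ₁} {s₁′} (S.trans (S.sym (μ-cong e)) (S.trans q (μ-cong e₁)))) (≈-sym e₁))

  opaque
    normal-exists : ∀ e → ∃ λ f → Normal f × μ e ≋ μ f
    normal-exists e with SL.c (μ e) ≟ 0#
    ... | yes c≈0 = x (a * b) ∙ h τ , borel (a * b) τ ≈-refl , S.trans (mk≋ {h = E₁₂ (a * b) ⊙ diag τ}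
          (solve 2 (λ a b → a := :1 :* a :+ a :* b :* :0) refl a b) (modulo₁ (- b) ad≈1 (solve 3 (λ a b d → b := :1 :* :0 :+ a :* b :* d :+ ((:- b) :* (a :* d :- :1))) refl a b d))
          (K.trans c≈0 (solve 1 (λ a → :0 := :0 :* a :+ :1 :* :0) refl a)) (solve 1 (λ d → d := :0 :* :0 :+ :1 :* d) refl d)) (S.sym (μ-borel (a * b) τ))
      where
      open SL (μ e)
      ad≈1 : a * d ≈ᴷ 1#
      ad≈1 = modulo₂ 1# det b c≈0 (solve 4 (λ a b c d → a :* d := :1 :+ (:1 :* (a :* d :- b :* c :- :1) :+ (b :* (c :- :0)))) refl a b c d)
      τ : Unit
      τ = unit a d ad≈1
    ... | no  c≉0 = NF (a * c⁻¹) τ (d * c⁻¹) , big _ _ _ ≈-refl , S.trans (mk≋ {h = E₁₂ (a * c⁻¹) ⊙ (diag τ ⊙ (weyl 1ᵘ ⊙ E₁₂ (d * c⁻¹)))}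
          (modulo₁ (- a) ci (solve 3 (λ a c i → a := :1 :* ((:- i) :* (:0 :* :1 :+ :1 :* :0) :+ :0 :* ((:- :1) :* :1 :+ :0 :* :0)) :+ a :* i :* (:0 :* (:0 :* :1 :+ :1 :* :0) :+ (:- c) :* ((:- :1) :* :1 :+ :0 :* :0)) :+ ((:- a) :* (c :* i :- :1))) refl a c c⁻¹))
          (modulo₂ (- c⁻¹) det (- (a * d * c⁻¹) - b) ci (solve 5 (λ a b c d i → b := :1 :* ((:- i) :* (:0 :* (d :* i) :+ :1 :* :1) :+ :0 :* ((:- :1) :* (d :* i) :+ :0 :* :1)) :+ a :* i :* (:0 :* (:0 :* (d :* i) :+ :1 :* :1) :+ (:- c) :* ((:- :1) :* (d :* i) :+ :0 :* :1)) :+ ((:- i) :* (a :* d :- b :* c :- :1) :+ ((:- (a :* d :* i) :- b) :* (c :* i :- :1)))) refl a b c d c⁻¹))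
          (solve 2 (λ c i → c := :0 :* ((:- i) :* (:0 :* :1 :+ :1 :* :0) :+ :0 :* ((:- :1) :* :1 :+ :0 :* :0)) :+ :1 :* (:0 :* (:0 :* :1 :+ :1 :* :0) :+ (:- c) :* ((:- :1) :* :1 :+ :0 :* :0))) refl c c⁻¹)
          (modulo₁ (- d) ci (solve 3 (λ c d i → d := :0 :* ((:- i) :* (:0 :* (d :* i) :+ :1 :* :1) :+ :0 :* ((:- :1) :* (d :* i) :+ :0 :* :1)) :+ :1 :* (:0 :* (:0 :* (d :* i) :+ :1 :* :1) :+ (:- c) :* ((:- :1) :* (d :* i) :+ :0 :* :1)) :+ ((:- d) :* (c :* i :- :1))) refl c d c⁻¹)))
        (S.sym (S.trans (μ-homo _ _) (S.∙-cong (μ-x (a * c⁻¹)) (S.trans (μ-homo _ _) (S.∙-cong (matrix (h-inverted τ)) (S.trans (μ-homo _ _) (S.∙-cong (μ-W 1ᵘ) (μ-x (d * c⁻¹)))))))))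
      where
      open SL (μ e)
      c⁻¹ : |K|
      c⁻¹ = proj₁ (invert c c≉0)
      ci : c * c⁻¹ ≈ᴷ 1#
      ci = proj₂ (invert c c≉0)
      τ : Unit
      τ = unit (- c⁻¹) (- c) (K.trans (solve 2 (λ c i → (:- i) :* (:- c) := c :* i) refl c c⁻¹) ci)

  record Retraction : Set where
    field
      r      : Carrier → |M|
      r-cong : ∀ {e f} → e ≈ f → r e ≈ᴹ r f
      r-homo : ∀ e f → r (e ∙ f) ≈ᴹ r e ⊞ r f
      r-ι    : ∀ m → r (ι m) ≈ᴹ m

  private
    -- e = (normal form) · ι m
    Value : Carrier → |M| → Set
    Value e m = ∃ λ f → Normal f × e ≈[ m ] f

    value-unique : ∀ {e e′ m m′} → e ≈ e′ → Value e m → Value e′ m′ → m ≈ᴹ m′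
    value-unique q (f , nf , v) (f′ , nf′ , v′) = shift-unique v (≈-trans q (≈-trans v′
      (∙-congʳ (normal-unique nf′ nf (S.trans (S.sym (μ-shift v′)) (S.trans (S.sym (μ-cong q)) (μ-shift v)))))))

    value : ∀ e → ∃ (Value e)
    value e = let f , nf , q = normal-exists e
                  m , v = same-matrix q
              in m , f , nf , v

  opaque
    retraction : Retraction
    retraction = record
      { r      = λ e → proj₁ (value e)
      ; r-cong = λ {e} {f} q → value-unique q (proj₂ (value e)) (proj₂ (value f))
      ; r-homo = λ e f → let m , g , ng , v = value e
                             m′ , g′ , ng′ , v′ = value f
                         in value-unique ≈-refl (proj₂ (value (e ∙ f))) (g ∙ g′ , normal-∙ ng ng′ , shift-cong v v′)
      ; r-ι    = λ m → value-unique ≈-refl (proj₂ (value (ι m)))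
                   (ε , borel 0# 1ᵘ (≈-sym (≈-trans (∙-cong x-0 (h-1 {1ᵘ} refl)) (identityˡ ε))) , ≈-sym (identityˡ _))
      }

  -- E is generated by M and the p-torsion elements x s, y s.
  opaque
    killing-M⇒trivial : (D : Carrier → |M|) → (∀ {e f} → e ≈ f → D e ≈ᴹ D f) → (∀ e f → D (e ∙ f) ≈ᴹ D e ⊞ D f) →
                        (∀ m → D (ι m) ≈ᴹ 0ᴹ) → ∀ e → D e ≈ᴹ 0ᴹ
    killing-M⇒trivial D D-cong D-homo D-ι e =
      let m , f , nf , q = value e
      in M.trans (D-cong q) (zero-∙ (normal nf) (D-ι m))
      where
      zero-∙ : ∀ {e f} → D e ≈ᴹ 0ᴹ → D f ≈ᴹ 0ᴹ → D (e ∙ f) ≈ᴹ 0ᴹ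
      zero-∙ p q = M.trans (D-homo _ _) (M.trans (M.∙-cong p q) (M.identityˡ _))
      D-ε : D ε ≈ᴹ 0ᴹ
      D-ε = M.trans (D-cong (≈-sym ι-0)) (D-ι 0ᴹ)
      D-torsion : ∀ {e} → Torsion e → D e ≈ᴹ 0ᴹ
      D-torsion {e} t = p-free (M.trans (M.sym (go p)) (M.trans (D-cong t) D-ε))
        where
        go : ∀ k → D (k ✶ e) ≈ᴹ k ⊡ D e
        go zero    = D-ε
        go (suc k) = M.trans (D-homo _ _) (M.∙-congˡ (go k))
      D-W : ∀ u → D (W u) ≈ᴹ 0ᴹ
      D-W u = zero-∙ (D-torsion (x-torsion _)) (zero-∙ (D-torsion (y-torsion _)) (D-torsion (x-torsion _)))
      D-h : ∀ u → D (h u) ≈ᴹ 0ᴹ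
      D-h u = M.trans (M.sym (M.identityʳ _)) (M.trans (M.∙-congˡ (M.sym (D-W 1ᵘ))) (M.trans (M.sym (D-homo (h u) w))
        (M.trans (D-cong (≈-sym (W-h u))) (D-W u))))
      normal : ∀ {f} → Normal f → D f ≈ᴹ 0ᴹ
      normal (borel s τ q)  = M.trans (D-cong q) (zero-∙ (D-torsion (x-torsion s)) (D-h τ))
      normal (big s τ s′ q) = M.trans (D-cong q) (zero-∙ (D-torsion (x-torsion s)) (zero-∙ (D-h τ) (zero-∙ (D-W 1ᵘ) (D-torsion (x-torsion s′)))))

-- Extension of invariant homomorphisms

module Residues (𝔸 : Arithmetic) where

  open Arith 𝔸 hiding (unit) renaming (_≡_[_] to _≡_⟨mod_⟩)

  -- The carrier stays A and only equality changes. Reduction therefore leaves matrix entries as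
  -- they are and is multiplicative by reflexivity.
  residueRing : Carrier → CommutativeRing 0ℓ 0ℓ
  residueRing ρ = record
    { Carrier = Carrier ; _≈_ = λ a b → a ≡ b ⟨mod ρ ⟩ ; _+_ = _+_ ; _*_ = _*_ ; -_ = -_ ; 0# = 0# ; 1# = 1#
    ; isCommutativeRing = record
      { isRing = record
        { +-isAbelianGroup = record
          { isGroup = record
            { isMonoid = record
              { isSemigroup = record
                { isMagma = record
                  { isEquivalence = equivalence ; ∙-cong = ≡-+ }
                ; assoc = λ a b c → ≈⇒≡ (+-assoc a b c) }
              ; identity = (λ a → ≈⇒≡ (+-identityˡ a)) , (λ a → ≈⇒≡ (+-identityʳ a)) }
            ; inverse = (λ a → ≈⇒≡ (-‿inverseˡ a)) , (λ a → ≈⇒≡ (-‿inverseʳ a))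
            ; ⁻¹-cong = λ {a} {b} → ∣-lin₁ (- 1#) (solve 2 (λ a b → :- a :- (:- b) := (:- :1) :* (a :- b)) refl a b) }
          ; comm = λ a b → ≈⇒≡ (+-comm a b) }
        ; *-cong = ≡-*
        ; *-assoc = λ a b c → ≈⇒≡ (*-assoc a b c)
        ; *-identity = (λ a → ≈⇒≡ (*-identityˡ a)) , (λ a → ≈⇒≡ (*-identityʳ a))
        ; distrib = (λ a b c → ≈⇒≡ (distribˡ a b c)) , (λ a b c → ≈⇒≡ (distribʳ a b c)) }
      ; *-comm = λ a b → ≈⇒≡ (*-comm a b) }
    }
    where
    open import Relation.Binary using (IsEquivalence)
    equivalence : IsEquivalence (λ a b → a ≡ b ⟨mod ρ ⟩)
    equivalence = record { refl = ≈⇒≡ refl ; sym = ≡-sym ; trans = ≡-trans }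

  residueField : ∀ {ρ} → IsPrime ρ → Field
  residueField {ρ} ρ-prime = record
    { commRing = residueRing ρ
    ; p        = p
    ; p-prime  = p-prime
    ; p·1≈0    = ≡-trans (≈⇒≡ (reflexive (same p))) (≈⇒≡ p·1≈0)
    ; 0≉1      = λ d → ρ∤1 (∣-lin₁ (- 1#) (solve 0 (:1 := (:- :1) :* (:0 :- :1)) refl) d)
    ; _≟_      = λ a b → ρ ∣? (a - b)
    ; invert   = λ a a≢0 → [ (λ ρ∣a → contradiction (∣-respʳ (solve 1 (λ a → a := a :- :0) refl a) ρ∣a) a≢0)
                           , (λ cop → let α , q = coprime-inverse cop in α , ≡-trans (≈⇒≡ (*-comm a α)) q) ]′ (split a)
    ; periodic = pigeonhole ρ≉0
    }
    where
    open IsPrime ρ-prime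
    open Algebra.Properties.Semiring.Mult (CommutativeRing.semiring (residueRing ρ)) using () renaming (_×_ to _·ρ_)
    same : ∀ k → k ·ρ 1# ≡.≡ k · 1#
    same zero    = ≡.refl
    same (suc k) = ≡.cong (1# +_) (same k)

module Descent
  (𝔸 : Arithmetic) (M : AbelianGroup 0ℓ 0ℓ) (l : ℕ) (l-prime : Prime l)
  (l≢2 : l ≢ 2) (p≢l : Arithmetic.p 𝔸 ≢ l)
  (lM≈0 : ∀ m → AbelianGroup._≈_ M
                  (Algebra.Properties.Monoid.Mult._×_ (AbelianGroup.monoid M) l m) (AbelianGroup.ε M))
  where

  open Arith 𝔸 renaming (_≡_[_] to _≡_⟨mod_⟩)
  open Coefficients 𝔸 M l l-prime l≢2 p≢l lM≈0
  open Chains 𝔸 M l l-prime l≢2 p≢l lM≈0 using (Twist; conj-⊙)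
  open Invariance 𝔸 M l l-prime l≢2 p≢l lM≈0
  open Generation 𝔸
  open Residues 𝔸
  private
    module G = Group SLGroup
    module GP = Algebra.Properties.Group SLGroup
    module MP = Algebra.Properties.AbelianGroup M

  opaque
    congruent-quotient : ∀ {n} (s s′ : SL) → SL.a s ≡ SL.a s′ ⟨mod n ⟩ → SL.b s ≡ SL.b s′ ⟨mod n ⟩ →
      SL.c s ≡ SL.c s′ ⟨mod n ⟩ → SL.d s ≡ SL.d s′ ⟨mod n ⟩ →
      let open SL (s ⊙ inv s′) in (n ∣ a - 1#) × (n ∣ b) × (n ∣ c) × (n ∣ d - 1#)
    congruent-quotient (sl a b c d e) (sl a′ b′ c′ d′ e′) qa qb qc qd =
        ∣-lin₂ d′ (- c′) (modulo₁ 1# e′ (solve 6 (λ a b a′ b′ c′ d′ → a :* d′ :+ b :* (:- c′) :- :1 := d′ :* (a :- a′) :+ (:- c′) :* (b :- b′) :+ (:1 :* (a′ :* d′ :- b′ :* c′ :- :1))) refl a b a′ b′ c′ d′)) qa qb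
      , ∣-lin₂ (- b′) a′ (solve 4 (λ a b a′ b′ → a :* (:- b′) :+ b :* a′ := (:- b′) :* (a :- a′) :+ a′ :* (b :- b′)) refl a b a′ b′) qa qb
      , ∣-lin₂ d′ (- c′) (solve 4 (λ c d c′ d′ → c :* d′ :+ d :* (:- c′) := d′ :* (c :- c′) :+ (:- c′) :* (d :- d′)) refl c d c′ d′) qc qd
      , ∣-lin₂ (- b′) a′ (modulo₁ 1# e′ (solve 6 (λ c d a′ b′ c′ d′ → c :* (:- b′) :+ d :* a′ :- :1 := (:- b′) :* (c :- c′) :+ a′ :* (d :- d′) :+ (:1 :* (a′ :* d′ :- b′ :* c′ :- :1))) refl c d a′ b′ c′ d′)) qc qd

  Extends : ∀ {n n′} → Hom n → Hom n′ → Set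
  Extends {n} {n′} χ χ′ = ∀ (k : Γ n) (g : Γ n′) → Γ.el k ≋ Γ.el g → Hom.⟦_⟧ χ′ g ≈ᴹ Hom.⟦_⟧ χ k

  module _ {n n′ : Carrier} (n′∣n : n′ ∣ n) (χ : Hom n) (χ-inv : Invariant χ) where

    open Hom χ

    -- The quotient of Γ(n′) × M by the graph of −χ, an extension of Γ(n′)/Γ(n) by M.
    private
      infix 4 _∼_
      _∼_ : Γ n′ × |M| → Γ n′ × |M| → Set
      (g , m) ∼ (g′ , m′) = ∃ λ (k : Γ n) → (Γ.el g ≋ Γ.el k ⊙ Γ.el g′) × (m′ ≈ᴹ m ⊞ ⟦ k ⟧)

      embed : ∀ {g g′ : Γ n′} {m m′} → Γ.el g ≋ Γ.el g′ → m ≈ᴹ m′ → (g , m) ∼ (g′ , m′)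
      embed e q = 1Γ , G.trans e (G.sym (G.identityˡ _)) , M.trans (M.sym q) (M.sym (M.trans (M.∙-congˡ homo-1) (M.identityʳ _)))

      ∼-sym : ∀ {e f} → e ∼ f → f ∼ e
      ∼-sym {g , m} {g′ , m′} (k , q , r) = invΓ k
        , G.trans (G.sym (GP.\\-leftDividesʳ (Γ.el k) (Γ.el g′))) (G.∙-congˡ (G.sym q))
        , M.sym (M.trans (M.∙-cong r (homo-inv k)) (MP.//-rightDividesʳ ⟦ k ⟧ m))

      ∼-trans : ∀ {e f h} → e ∼ f → f ∼ h → e ∼ h
      ∼-trans (k , q , r) (k′ , q′ , r′) = k ∙Γ k′
        , G.trans q (G.trans (G.∙-congˡ q′) (G.sym (G.assoc _ _ _)))
        , M.trans r′ (M.trans (M.∙-congʳ r) (M.trans (M.assoc _ _ _) (M.∙-congˡ (M.sym (homo k k′)))))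

      infixl 7 _∗_
      _∗_ : Γ n′ × |M| → Γ n′ × |M| → Γ n′ × |M|
      (g , m) ∗ (g′ , m′) = g ∙Γ g′ , m ⊞ m′

      -- From k g₁ k′ h₁ = k (g₁ k′ g₁⁻¹) g₁ h₁ and the invariance of χ under conjugation by g₁:
      -- invariance is what makes the graph normal.
      ∗-cong : ∀ {e e₁ f f₁} → e ∼ e₁ → f ∼ f₁ → e ∗ f ∼ e₁ ∗ f₁
      ∗-cong {g , m} {g₁ , m₁} {h , o} {h₁ , o₁} (k , q , r) (k′ , q′ , r′) = k ∙Γ conj (Γ.el g₁) k′
        , G.trans (G.∙-cong q q′) matrices
        , M.trans (M.∙-cong r r′) (M.trans (MC.interchange _ _ _ _) (M.∙-congˡ (M.trans (M.∙-congˡ (M.sym (χ-inv (Γ.el g₁) k′))) (M.sym (homo _ _)))))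
        where
        import Algebra.Properties.CommutativeSemigroup
        module MC = Algebra.Properties.CommutativeSemigroup M.commutativeSemigroup
        open Relation.Binary.Reasoning.Setoid G.setoid
        K G₁ K′ H₁ : SL
        K = Γ.el k
        G₁ = Γ.el g₁
        K′ = Γ.el k′
        H₁ = Γ.el h₁
        matrices : K ⊙ G₁ ⊙ (K′ ⊙ H₁) ≋ K ⊙ (G₁ ⊙ K′ ⊙ inv G₁) ⊙ (G₁ ⊙ H₁)
        matrices = begin
          K ⊙ G₁ ⊙ (K′ ⊙ H₁)                        ≈⟨ G.assoc _ _ _ ⟩
          K ⊙ (G₁ ⊙ (K′ ⊙ H₁))                      ≈⟨ G.∙-congˡ (G.assoc _ _ _) ⟨
          K ⊙ (G₁ ⊙ K′ ⊙ H₁)                        ≈⟨ G.∙-congˡ (G.∙-congˡ (GP.\\-leftDividesʳ G₁ H₁)) ⟨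
          K ⊙ (G₁ ⊙ K′ ⊙ (inv G₁ ⊙ (G₁ ⊙ H₁)))      ≈⟨ G.∙-congˡ (G.assoc _ _ _) ⟨
          K ⊙ (G₁ ⊙ K′ ⊙ inv G₁ ⊙ (G₁ ⊙ H₁))        ≈⟨ G.assoc _ _ _ ⟨
          K ⊙ (G₁ ⊙ K′ ⊙ inv G₁) ⊙ (G₁ ⊙ H₁)        ∎

    extension : Group 0ℓ 0ℓ
    extension = record
      { Carrier = Γ n′ × |M| ; _≈_ = _∼_ ; _∙_ = _∗_ ; ε = 1Γ , 0ᴹ ; _⁻¹ = λ (g , m) → invΓ g , ⊟ m
      ; isGroup = record
        { isMonoid = record
          { isSemigroup = record
            { isMagma = record
              { isEquivalence = record
                { refl  = λ {e} → embed {proj₁ e} {proj₁ e} G.refl M.refl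
                ; sym   = λ {e} {f} → ∼-sym {e} {f}
                ; trans = λ {e} {f} {h} → ∼-trans {e} {f} {h} }
              ; ∙-cong = λ {e} {e₁} {f} {f₁} → ∗-cong {e} {e₁} {f} {f₁} }
            ; assoc = λ (g , m) (g′ , m′) (g″ , m″) → embed {(g ∙Γ g′) ∙Γ g″} {g ∙Γ (g′ ∙Γ g″)} (G.assoc _ _ _) (M.assoc _ _ _) }
          ; identity = (λ (g , m) → embed {1Γ ∙Γ g} {g} (G.identityˡ _) (M.identityˡ _))
                     , (λ (g , m) → embed {g ∙Γ 1Γ} {g} (G.identityʳ _) (M.identityʳ _)) }
        ; inverse = (λ (g , m) → embed {invΓ g ∙Γ g} {1Γ} (G.inverseˡ _) (M.inverseˡ _))
                  , (λ (g , m) → embed {g ∙Γ invΓ g} {1Γ} (G.inverseʳ _) (M.inverseʳ _))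
        ; ⁻¹-cong = λ {e} {f} → inverse-cong {e} {f} }
      }
      where
      inverse-cong : ∀ {e f} → e ∼ f → (invΓ (proj₁ e) , ⊟ proj₂ e) ∼ (invΓ (proj₁ f) , ⊟ proj₂ f)
      inverse-cong {g , m} {g′ , m′} (k , q , r) = conj (inv (Γ.el g′)) (invΓ k)
        , G.trans (G.⁻¹-cong q) (G.trans (GP.⁻¹-anti-homo-∙ _ _) (G.sym (G.trans (G.assoc _ _ _)
            (G.trans (G.∙-congˡ (G.inverseˡ _)) (G.identityʳ _)))))
        , M.trans (M.⁻¹-cong r) (M.trans (M.sym (MP.⁻¹-∙-comm _ _)) (M.∙-congˡ (M.trans (M.sym (homo-inv k)) (M.sym (χ-inv _ (invΓ k))))))

    private
      lift : |M| → Γ n′ × |M|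
      lift m = 1Γ , m

      on-kernel : ∀ (g : Γ n′) m (k : Γ n) → Γ.el g ≋ Γ.el k → (g , m) ∼ lift (m ⊞ ⟦ k ⟧)
      on-kernel g m k e = k , G.trans e (G.sym (G.identityʳ _)) , M.refl

      lift-injective : ∀ {m} → lift m ∼ lift 0ᴹ → m ≈ᴹ 0ᴹ
      lift-injective (k , q , r) = M.sym (M.trans r (M.trans (M.∙-congˡ (M.trans (cong {k} {1Γ} (G.trans (G.sym (G.identityʳ _)) (G.sym q))) homo-1)) (M.identityʳ _)))

    module _ {ρ : Carrier} (ρ-prime : IsPrime ρ) (n≈ : n ≈ ρ * n′) (n′⊥ρ : Coprime n′ ρ) where

      private
        K : Field
        K = residueField ρ-prime

        module SK = SpecialLinearGroup (residueRing ρ)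

        -- The Chinese remainder element: 0 modulo n′ and 1 modulo ρ. So E₁₂(ν s) lies in Γ(n′) and
        -- reduces to E₁₂(s) modulo ρ.
        ν : Carrier
        ν = proj₁ n′⊥ρ * n′

        opaque
          ν≡1 : ν ≡ 1# ⟨mod ρ ⟩
          ν≡1 = let α , β , e = n′⊥ρ in - β , (modulo₁ 1# e (solve 4 (λ α β u r → α :* u :- :1 := :- β :* r :+ (:1 :* (α :* u :+ β :* r :- :1))) refl α β n′ ρ))

        ρ∣n : ρ ∣ n
        ρ∣n = n′ , trans n≈ (*-comm ρ n′)

        opaque
          reduce-det : ∀ {z} → z ≈ 1# → z ≡ 1# ⟨mod ρ ⟩
          reduce-det = ≈⇒≡

        reduce : SL → SK.SL
        reduce (sl a b c d e) = SK.sl a b c d (reduce-det e)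

        reduce-k : ∀ (k : Γ n) (g : SL) → reduce (Γ.el k ⊙ g) SK.≋ reduce g
        reduce-k (γ (sl a b c d e) p q r s) (sl a′ b′ c′ d′ e′) = SK.mk≋
          (∣-trans ρ∣n (∣-lin₂ a′ c′ (solve 4 (λ a b a′ c′ → a :* a′ :+ b :* c′ :- a′ := a′ :* (a :- :1) :+ c′ :* b) refl a b a′ c′) p q))
          (∣-trans ρ∣n (∣-lin₂ b′ d′ (solve 4 (λ a b b′ d′ → a :* b′ :+ b :* d′ :- b′ := b′ :* (a :- :1) :+ d′ :* b) refl a b b′ d′) p q))
          (∣-trans ρ∣n (∣-lin₂ a′ c′ (solve 4 (λ c d a′ c′ → c :* a′ :+ d :* c′ :- c′ := a′ :* c :+ c′ :* (d :- :1)) refl c d a′ c′) r s))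
          (∣-trans ρ∣n (∣-lin₂ b′ d′ (solve 4 (λ c d b′ d′ → c :* b′ :+ d :* d′ :- d′ := b′ :* c :+ d′ :* (d :- :1)) refl c d b′ d′) r s))

        elementary₁₂ elementary₂₁ : Carrier → Γ n′
        elementary₁₂ s = γ (E₁₂ (ν * s)) (≈⇒≡ refl) (∣-*ʳ s (m∣km _)) ∣0 (≈⇒≡ refl)
        elementary₂₁ s = γ (E₂₁ (ν * s)) (≈⇒≡ refl) ∣0 (∣-*ʳ s (m∣km _)) (≈⇒≡ refl)

        opaque
          n∣ν : ∀ {s s′} → s ≡ s′ ⟨mod ρ ⟩ → n ∣ ν * s - ν * s′
          n∣ν {s} {s′} s≡s′ = ∣-respˡ (sym (trans n≈ (*-comm ρ n′))) (∣-respʳ (solve 3 (λ v s s′ → v :* (s :- s′) := v :* s :- v :* s′) refl ν s s′) (∣-* (m∣km (proj₁ n′⊥ρ)) s≡s′))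

        -- The two lifts differ by a unipotent of Γ(n), which χ kills; hence they depend on the
        -- residue of s only.
        shift₁₂ : ∀ {s s′} → s ≡ s′ ⟨mod ρ ⟩ → (elementary₁₂ s , 0ᴹ) ∼ (elementary₁₂ s′ , 0ᴹ)
        shift₁₂ {s} {s′} s≡s′ = unipotent 0# (ν * s - ν * s′) 0# nil ∣0 (n∣ν s≡s′) ∣0
          , mk≋ (solve 1 (λ z → :1 := (:1 :+ :0) :* :1 :+ z :* :0) refl (ν * s - ν * s′)) (solve 2 (λ u v → u := (:1 :+ :0) :* v :+ (u :- v) :* :1) refl (ν * s) (ν * s′))
              (solve 0 (:0 := :0 :* :1 :+ (:1 :- :0) :* :0) refl) (solve 1 (λ v → :1 := :0 :* v :+ (:1 :- :0) :* :1) refl (ν * s′))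
          , M.sym (M.trans (M.∙-congˡ (homo-unipotent 0# (ν * s - ν * s′) 0# nil ∣0 (n∣ν s≡s′) ∣0)) (M.identityʳ _))
          where
          nil : 0# * 0# + (ν * s - ν * s′) * 0# ≈ 0#
          nil = solve 1 (λ u → :0 :* :0 :+ u :* :0 := :0) refl (ν * s - ν * s′)

        shift₂₁ : ∀ {s s′} → s ≡ s′ ⟨mod ρ ⟩ → (elementary₂₁ s , 0ᴹ) ∼ (elementary₂₁ s′ , 0ᴹ)
        shift₂₁ {s} {s′} s≡s′ = unipotent 0# 0# (ν * s - ν * s′) nil ∣0 ∣0 (n∣ν s≡s′)
          , mk≋ (solve 1 (λ v → :1 := (:1 :+ :0) :* :1 :+ :0 :* v) refl (ν * s′)) (solve 0 (:0 := (:1 :+ :0) :* :0 :+ :0 :* :1) refl)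
              (solve 2 (λ u v → u := (u :- v) :* :1 :+ (:1 :- :0) :* v) refl (ν * s) (ν * s′)) (solve 1 (λ z → :1 := z :* :0 :+ (:1 :- :0) :* :1) refl (ν * s - ν * s′))
          , M.sym (M.trans (M.∙-congˡ (homo-unipotent 0# 0# (ν * s - ν * s′) nil ∣0 ∣0 (n∣ν s≡s′))) (M.identityʳ _))
          where
          nil : 0# * 0# + 0# * (ν * s - ν * s′) ≈ 0#
          nil = solve 1 (λ u → :0 :* :0 :+ :0 :* u := :0) refl (ν * s - ν * s′)

        opaque
          in-kernel : (g : Γ n′) → reduce (Γ.el g) SK.≋ SK.1SL → ∃ λ (k : Γ n) → Γ.el g ≋ Γ.el k
          in-kernel (γ s p q r t) (SK.mk≋ qa qb qc qd) = γ s (both p qa) (both q (minus-0 qb)) (both r (minus-0 qc)) (both t qd) , G.refl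
            where
            minus-0 : ∀ {z} → ρ ∣ z - 0# → ρ ∣ z
            minus-0 {z} = ∣-respʳ (solve 1 (λ z → z :- :0 := z) refl z)
            both : ∀ {z} → n′ ∣ z → ρ ∣ z → n ∣ z
            both p q = ∣-respˡ (sym (trans n≈ (*-comm ρ n′))) (coprime-∣-* n′⊥ρ p q)

        module SKG = Group SK.SLGroup

        reduce-cong : ∀ {s s′} → s ≋ s′ → reduce s SK.≋ reduce s′
        reduce-cong (mk≋ p q r s) = SK.mk≋ (≈⇒≡ p) (≈⇒≡ q) (≈⇒≡ r) (≈⇒≡ s)

        reduce-homo : ∀ s s′ → reduce (s ⊙ s′) SK.≋ reduce s SK.⊙ reduce s′
        reduce-homo s s′ = SK.mk≋ (≈⇒≡ refl) (≈⇒≡ refl) (≈⇒≡ refl) (≈⇒≡ refl)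

        ν-unit : ∀ s → ν * s ≡ s ⟨mod ρ ⟩
        ν-unit s = ∣-lin₁ s (solve 2 (λ v s → v :* s :- s := s :* (v :- :1)) refl ν s) ν≡1

        homo₁₂ : ∀ s s′ → (elementary₁₂ (s + s′) , 0ᴹ) ∼ (elementary₁₂ s , 0ᴹ) ∗ (elementary₁₂ s′ , 0ᴹ)
        homo₁₂ s s′ = embed {elementary₁₂ (s + s′)} {elementary₁₂ s ∙Γ elementary₁₂ s′} (mk≋
          (solve 1 (λ z → :1 := :1 :* :1 :+ z :* :0) refl (ν * s)) (solve 3 (λ v s s′ → v :* (s :+ s′) := :1 :* (v :* s′) :+ v :* s :* :1) refl ν s s′)
          (solve 0 (:0 := :0 :* :1 :+ :1 :* :0) refl) (solve 1 (λ z → :1 := :0 :* z :+ :1 :* :1) refl (ν * s′))) (M.sym (M.identityˡ 0ᴹ))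

        homo₂₁ : ∀ s s′ → (elementary₂₁ (s + s′) , 0ᴹ) ∼ (elementary₂₁ s , 0ᴹ) ∗ (elementary₂₁ s′ , 0ᴹ)
        homo₂₁ s s′ = embed {elementary₂₁ (s + s′)} {elementary₂₁ s ∙Γ elementary₂₁ s′} (mk≋
          (solve 1 (λ z → :1 := :1 :* :1 :+ :0 :* z) refl (ν * s′)) (solve 0 (:0 := :1 :* :0 :+ :0 :* :1) refl)
          (solve 3 (λ v s s′ → v :* (s :+ s′) := v :* s :* :1 :+ :1 :* (v :* s′)) refl ν s s′) (solve 1 (λ z → :1 := z :* :0 :+ :1 :* :1) refl (ν * s))) (M.sym (M.identityˡ 0ᴹ))

        μ′ : Γ n′ × |M| → SK.SL
        μ′ (g , m) = reduce (Γ.el g)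

        μ′-cong : ∀ {e f} → e ∼ f → μ′ e SK.≋ μ′ f
        μ′-cong {e} {f} (k , q , r) = SKG.trans {μ′ e} {reduce (Γ.el k ⊙ Γ.el (proj₁ f))} {μ′ f} (reduce-cong q) (reduce-k k (Γ.el (proj₁ f)))

        μ′-kernel : ∀ e → μ′ e SK.≋ SK.1SL → ∃ λ m → e ∼ lift m
        μ′-kernel (g , m) q = let k , e = in-kernel g q in m ⊞ ⟦ k ⟧ , on-kernel g m k e

        X : CentralExtension K M
        X = record
          { group       = extension
          ; ι           = lift
          ; ι-cong      = embed {1Γ} {1Γ} G.refl
          ; ι-homo      = λ m m′ → embed {1Γ} {1Γ ∙Γ 1Γ} (G.sym (G.identityˡ 1SL)) M.refl
          ; ι-injective = lift-injective
          ; ι-central   = λ m (g , m′) → embed {1Γ ∙Γ g} {g ∙Γ 1Γ} (G.trans (G.identityˡ _) (G.sym (G.identityʳ _))) (M.comm m m′)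
          ; μ           = μ′
          ; μ-cong      = λ {e} {f} → μ′-cong {e} {f}
          ; μ-homo      = λ e f → reduce-homo (Γ.el (proj₁ e)) (Γ.el (proj₁ f))
          ; μ-ι         = λ _ → SK.mk≋ (≈⇒≡ refl) (≈⇒≡ refl) (≈⇒≡ refl) (≈⇒≡ refl)
          ; kernel      = μ′-kernel
          ; x           = λ s → elementary₁₂ s , 0ᴹ
          ; y           = λ s → elementary₂₁ s , 0ᴹ
          ; x-cong      = shift₁₂
          ; y-cong      = shift₂₁
          ; x-homo      = homo₁₂
          ; y-homo      = homo₂₁
          ; μ-x         = λ s → SK.mk≋ (≈⇒≡ refl) (ν-unit s) (≈⇒≡ refl) (≈⇒≡ refl)
          ; μ-y         = λ s → SK.mk≋ (≈⇒≡ refl) (≈⇒≡ refl) (ν-unit s) (≈⇒≡ refl)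
          }

        module Sp = Splitting K M l l-prime l≢2 p≢l lM≈0 X
        open Sp.Retraction Sp.retraction

      extend-coprime : ∃ λ (χ′ : Hom n′) → Invariant χ′ × Extends χ χ′
      extend-coprime = χ′ , invariant , extends
        where
        χ′ : Hom n′
        χ′ = record
          { ⟦_⟧  = λ g → r (g , 0ᴹ)
          ; cong = λ {g} {h} e → r-cong (embed {g} {h} e M.refl)
          ; homo = λ g h → M.trans (r-cong (embed {g ∙Γ h} {g ∙Γ h} G.refl (M.sym (M.identityˡ 0ᴹ)))) (r-homo (g , 0ᴹ) (h , 0ᴹ))
          }
        extends : Extends χ χ′
        extends k g e = M.trans (r-cong (on-kernel g 0ᴹ k (G.sym e))) (M.trans (r-ι _) (M.identityˡ _))
        invariant : Invariant χ′
        -- D, the failure of invariance under s, is additive and vanishes on Γ(n), where it reduces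
        -- to the invariance of χ. So it descends to the extension, where it vanishes on M.
        invariant s g = MP.x∙y⁻¹≈ε⇒x≈y _ _ (Sp.killing-M⇒trivial D D-cong D-homo D-ι (g , 0ᴹ))
          where
          module χ′ = Hom χ′
          D : Γ n′ × |M| → |M|
          D (g , m) = χ′.⟦ conj s g ⟧ ⊞ ⊟ χ′.⟦ g ⟧
          interchange : ∀ a b c d → (a ⊞ b) ⊞ ⊟ (c ⊞ d) ≈ᴹ (a ⊞ ⊟ c) ⊞ (b ⊞ ⊟ d)
          interchange a b c d = M.trans (M.∙-congˡ (M.sym (MP.⁻¹-∙-comm c d))) (MC.interchange a b (⊟ c) (⊟ d))
            where
            import Algebra.Properties.CommutativeSemigroup
            module MC = Algebra.Properties.CommutativeSemigroup M.commutativeSemigroup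
          D-homo : ∀ e f → D (e ∗ f) ≈ᴹ D e ⊞ D f
          D-homo (g , _) (h , _) = M.trans (M.∙-cong (Hom.homo (Twist s χ′) g h) (M.⁻¹-cong (χ′.homo g h))) (interchange _ _ _ _)
          D-kernel : ∀ (k : Γ n) (g : Γ n′) m → Γ.el k ≋ Γ.el g → D (g , m) ≈ᴹ 0ᴹ
          D-kernel k g m e = M.trans (M.∙-cong (M.trans (extends (conj s k) (conj s g) (G.∙-congʳ (G.∙-congˡ e))) (χ-inv s k))
            (M.⁻¹-cong (extends k g e))) (M.inverseʳ _)
          weaken : Γ n → Γ n′
          weaken (γ s p q r t) = γ s (∣-trans n′∣n p) (∣-trans n′∣n q) (∣-trans n′∣n r) (∣-trans n′∣n t)
          D-cong : ∀ {e f} → e ∼ f → D e ≈ᴹ D f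
          D-cong {g , m} {g′ , m′} (k , q , _) = M.trans (M.∙-cong (χ′.cong {conj s g} {conj s (weaken k ∙Γ g′)} (G.∙-congʳ (G.∙-congˡ q))) (M.⁻¹-cong (χ′.cong {g} {weaken k ∙Γ g′} q)))
            (M.trans (D-homo (weaken k , 0ᴹ) (g′ , 0ᴹ)) (M.trans (M.∙-congʳ (D-kernel k (weaken k) 0ᴹ G.refl)) (M.identityˡ _)))
          D-ι : ∀ m → D (lift m) ≈ᴹ 0ᴹ
          D-ι m = D-kernel 1Γ 1Γ m G.refl

    -- If n ∣ n′², then Γ(n′)/Γ(n) is abelian of exponent p, and χ extends as (1/p) χ(gᵖ).
    module _ (n∣n′² : n ∣ n′ * n′) where

      private
        square : ∀ {u v} → n′ ∣ u → n′ ∣ v → n ∣ u * v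
        square p q = ∣-trans n∣n′² (∣-* p q)

        pow : ℕ → Γ n′ → Γ n′
        pow zero    g = 1Γ
        pow (suc k) g = g ∙Γ pow k g

        opaque
          -- The entries of g - 1 are divisible by n′, so (g - 1)² vanishes modulo n and the
          -- binomial expansion of gᵏ stops after the linear term.
          pow-congruent : ∀ k (g : Γ n′) → let open Γ in
            (a (pow k g) ≡ 1# + (k · 1#) * (a g - 1#) ⟨mod n ⟩) × (b (pow k g) ≡ (k · 1#) * b g ⟨mod n ⟩) ×
            (c (pow k g) ≡ (k · 1#) * c g ⟨mod n ⟩) × (d (pow k g) ≡ 1# + (k · 1#) * (d g - 1#) ⟨mod n ⟩)
          pow-congruent zero (γ (sl a b c d _) _ _ _ _) = ≈⇒≡ (solve 1 (λ a → :1 := :1 :+ :0 :* (a :- :1)) refl a) , ≈⇒≡ (solve 1 (λ b → :0 := :0 :* b) refl b)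
            , ≈⇒≡ (solve 1 (λ c → :0 := :0 :* c) refl c) , ≈⇒≡ (solve 1 (λ d → :1 := :1 :+ :0 :* (d :- :1)) refl d)
          pow-congruent (suc k) g@(γ (sl a b c d _) p q r s) with pow-congruent k g
          ... | qa , qb , qc , qd =
              ≡-trans (≡-+ (≡-* (≈⇒≡ {x = a} refl) qa) (≡-* (≈⇒≡ {x = b} refl) qc)) (∣-lin₂ κ κ (solve 4 (λ a b c κ → a :* (:1 :+ κ :* (a :- :1)) :+ b :* (κ :* c) :- (:1 :+ (:1 :+ κ) :* (a :- :1)) := κ :* ((a :- :1) :* (a :- :1)) :+ κ :* (b :* c)) refl a b c κ) (square p p) (square q r))
            , ≡-trans (≡-+ (≡-* (≈⇒≡ {x = a} refl) qb) (≡-* (≈⇒≡ {x = b} refl) qd)) (∣-lin₂ κ κ (solve 4 (λ a b d κ → a :* (κ :* b) :+ b :* (:1 :+ κ :* (d :- :1)) :- (:1 :+ κ) :* b := κ :* ((a :- :1) :* b) :+ κ :* (b :* (d :- :1))) refl a b d κ) (square p q) (square q s))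
            , ≡-trans (≡-+ (≡-* (≈⇒≡ {x = c} refl) qa) (≡-* (≈⇒≡ {x = d} refl) qc)) (∣-lin₂ κ κ (solve 4 (λ a c d κ → c :* (:1 :+ κ :* (a :- :1)) :+ d :* (κ :* c) :- (:1 :+ κ) :* c := κ :* (c :* (a :- :1)) :+ κ :* ((d :- :1) :* c)) refl a c d κ) (square r p) (square s r))
            , ≡-trans (≡-+ (≡-* (≈⇒≡ {x = c} refl) qb) (≡-* (≈⇒≡ {x = d} refl) qd)) (∣-lin₂ κ κ (solve 4 (λ b c d κ → c :* (κ :* b) :+ d :* (:1 :+ κ :* (d :- :1)) :- (:1 :+ (:1 :+ κ) :* (d :- :1)) := κ :* (c :* b) :+ κ :* ((d :- :1) :* (d :- :1))) refl b c d κ) (square r q) (square s s))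
            where
            κ : Carrier
            κ = k · 1#

        opaque
          p-power-congruent : ∀ (g : Γ n′) → let open Γ (pow p g) in (n ∣ a - 1#) × (n ∣ b) × (n ∣ c) × (n ∣ d - 1#)
          p-power-congruent g =
            let qa , qb , qc , qd = pow-congruent p g
            in ≡-trans qa (≈⇒≡ (modulo₁ ((Γ.a g) - 1#) p·1≈0 (solve 2 (λ k a → :1 :+ k :* (a :- :1) := :1 :+ ((a :- :1) :* (k :- :0))) refl (p · 1#) (Γ.a g))))
              , ≡⇒∣ qb (∣-respʳ (sym (trans (*-congʳ p·1≈0) (zeroˡ _))) ∣0)
              , ≡⇒∣ qc (∣-respʳ (sym (trans (*-congʳ p·1≈0) (zeroˡ _))) ∣0)
              , ≡-trans qd (≈⇒≡ (modulo₁ ((Γ.d g) - 1#) p·1≈0 (solve 2 (λ k d → :1 :+ k :* (d :- :1) := :1 :+ ((d :- :1) :* (k :- :0))) refl (p · 1#) (Γ.d g))))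

        p-power : Γ n′ → Γ n
        p-power g = mkΓ (Γ.el (pow p g)) (p-power-congruent g)

        opaque
          commutator-congruent : ∀ (g h : Γ n′) → let open SL (Γ.el (g ∙Γ h) ⊙ inv (Γ.el (h ∙Γ g))) in (n ∣ a - 1#) × (n ∣ b) × (n ∣ c) × (n ∣ d - 1#)
          commutator-congruent g@(γ (sl a b c d _) p q r s) h@(γ (sl a′ b′ c′ d′ _) p′ q′ r′ s′) = congruent-quotient (Γ.el (g ∙Γ h)) (Γ.el (h ∙Γ g))
            (∣-lin₂ 1# (- 1#) (solve 6 (λ a b c a′ b′ c′ → a :* a′ :+ b :* c′ :- (a′ :* a :+ b′ :* c) := :1 :* (b :* c′) :+ (:- :1) :* (b′ :* c)) refl a b c a′ b′ c′) (square q r′) (square q′ r))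
            (∣-lin₃ 1# 1# (- 1#) (solve 6 (λ a b d a′ b′ d′ → a :* b′ :+ b :* d′ :- (a′ :* b :+ b′ :* d) := :1 :* ((a :- :1) :* b′) :+ :1 :* (b :* ((d′ :- :1) :- (a′ :- :1))) :+ (:- :1) :* (b′ :* (d :- :1))) refl a b d a′ b′ d′)
              (square p q′) (square q (∣-sub s′ p′)) (square q′ s))
            (∣-lin₃ 1# 1# (- 1#) (solve 6 (λ a c d a′ c′ d′ → c :* a′ :+ d :* c′ :- (c′ :* a :+ d′ :* c) := :1 :* (c :* ((a′ :- :1) :- (d′ :- :1))) :+ :1 :* ((d :- :1) :* c′) :+ (:- :1) :* (c′ :* (a :- :1))) refl a c d a′ c′ d′)
              (square r (∣-sub p′ s′)) (square s r′) (square r′ p))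
            (∣-lin₂ 1# (- 1#) (solve 6 (λ b c d b′ c′ d′ → c :* b′ :+ d :* d′ :- (c′ :* b :+ d′ :* d) := :1 :* (c :* b′) :+ (:- :1) :* (c′ :* b)) refl b c d b′ c′ d′) (square r q′) (square r′ q))

        commutator : Γ n′ → Γ n′ → Γ n
        commutator g h = mkΓ (Γ.el (g ∙Γ h) ⊙ inv (Γ.el (h ∙Γ g))) (commutator-congruent g h)

        open Relation.Binary.Reasoning.Setoid G.setoid

        -- [f g, h] = f [g, h] f⁻¹ [f, h], and χ does not see the conjugation by f.
        commutator-∙ : ∀ f g h → ⟦ commutator (f ∙Γ g) h ⟧ ≈ᴹ ⟦ commutator f h ⟧ ⊞ ⟦ commutator g h ⟧
        commutator-∙ f g h = M.trans (cong {commutator (f ∙Γ g) h} {conj F (commutator g h) ∙Γ commutator f h} matrices)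
            (M.trans (homo _ _) (M.trans (M.∙-congʳ (χ-inv F (commutator g h))) (M.comm _ _)))
          where
          F G′ H : SL
          F = Γ.el f
          G′ = Γ.el g
          H = Γ.el h
          matrices : F ⊙ G′ ⊙ H ⊙ inv (H ⊙ (F ⊙ G′)) ≋ F ⊙ (G′ ⊙ H ⊙ inv (H ⊙ G′)) ⊙ inv F ⊙ (F ⊙ H ⊙ inv (H ⊙ F))
          matrices = GP.∙-cancelʳ (H ⊙ (F ⊙ G′)) _ _ (begin
            F ⊙ G′ ⊙ H ⊙ inv (H ⊙ (F ⊙ G′)) ⊙ (H ⊙ (F ⊙ G′))   ≈⟨ GP.//-rightDividesˡ (H ⊙ (F ⊙ G′)) (F ⊙ G′ ⊙ H) ⟩
            F ⊙ G′ ⊙ H                                         ≈⟨ G.assoc F G′ H ⟩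
            F ⊙ (G′ ⊙ H)                                       ≈⟨ G.∙-congˡ (GP.//-rightDividesˡ (H ⊙ G′) (G′ ⊙ H)) ⟨
            F ⊙ (C ⊙ (H ⊙ G′))                                 ≈⟨ G.assoc F C (H ⊙ G′) ⟨
            F ⊙ C ⊙ (H ⊙ G′)                                   ≈⟨ G.∙-congˡ (GP.\\-leftDividesʳ F (H ⊙ G′)) ⟨
            F ⊙ C ⊙ (inv F ⊙ (F ⊙ (H ⊙ G′)))                   ≈⟨ G.assoc (F ⊙ C) (inv F) _ ⟨
            F ⊙ C ⊙ inv F ⊙ (F ⊙ (H ⊙ G′))                     ≈⟨ G.∙-congˡ (G.assoc F H G′) ⟨
            F ⊙ C ⊙ inv F ⊙ (F ⊙ H ⊙ G′)                       ≈⟨ G.∙-congˡ (G.∙-congʳ (GP.//-rightDividesˡ (H ⊙ F) (F ⊙ H))) ⟨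
            F ⊙ C ⊙ inv F ⊙ (D ⊙ (H ⊙ F) ⊙ G′)                 ≈⟨ G.∙-congˡ (G.assoc D (H ⊙ F) G′) ⟩
            F ⊙ C ⊙ inv F ⊙ (D ⊙ (H ⊙ F ⊙ G′))                 ≈⟨ G.assoc (F ⊙ C ⊙ inv F) D _ ⟨
            F ⊙ C ⊙ inv F ⊙ D ⊙ (H ⊙ F ⊙ G′)                   ≈⟨ G.∙-congˡ (G.assoc H F G′) ⟩
            F ⊙ C ⊙ inv F ⊙ D ⊙ (H ⊙ (F ⊙ G′))                 ∎)
            where
            C D : SL
            C = G′ ⊙ H ⊙ inv (H ⊙ G′)
            D = F ⊙ H ⊙ inv (H ⊙ F)

        commutator-pow : ∀ k g h → ⟦ commutator (pow k g) h ⟧ ≈ᴹ k ⊡ ⟦ commutator g h ⟧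
        commutator-pow zero    g h = M.trans (cong {commutator 1Γ h} {1Γ} (G.trans (G.∙-cong (G.identityˡ _) (G.⁻¹-cong (G.identityʳ _))) (G.inverseʳ _))) homo-1
        commutator-pow (suc k) g h = M.trans (commutator-∙ g (pow k g) h) (M.∙-congˡ (commutator-pow k g h))

        commutator-kernel : ∀ (k : Γ n) g h → Γ.el g ≋ Γ.el k → ⟦ commutator g h ⟧ ≈ᴹ 0ᴹ
        commutator-kernel k g h e = M.trans (cong {commutator g h} {k ∙Γ conj (Γ.el h) (invΓ k)} matrices)
            (M.trans (homo k _) (M.trans (M.∙-congˡ (M.trans (χ-inv (Γ.el h) (invΓ k)) (homo-inv k))) (M.inverseʳ _)))
          where
          matrices : Γ.el g ⊙ Γ.el h ⊙ inv (Γ.el h ⊙ Γ.el g) ≋ Γ.el k ⊙ (Γ.el h ⊙ inv (Γ.el k) ⊙ inv (Γ.el h))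
          matrices = begin
            Γ.el g ⊙ Γ.el h ⊙ inv (Γ.el h ⊙ Γ.el g)            ≈⟨ G.∙-congˡ (GP.⁻¹-anti-homo-∙ (Γ.el h) (Γ.el g)) ⟩
            Γ.el g ⊙ Γ.el h ⊙ (inv (Γ.el g) ⊙ inv (Γ.el h))    ≈⟨ G.∙-cong (G.∙-congʳ e) (G.∙-congʳ (G.⁻¹-cong e)) ⟩
            Γ.el k ⊙ Γ.el h ⊙ (inv (Γ.el k) ⊙ inv (Γ.el h))    ≈⟨ G.assoc _ _ _ ⟩
            Γ.el k ⊙ (Γ.el h ⊙ (inv (Γ.el k) ⊙ inv (Γ.el h)))  ≈⟨ G.∙-congˡ (G.assoc _ _ _) ⟨
            Γ.el k ⊙ (Γ.el h ⊙ inv (Γ.el k) ⊙ inv (Γ.el h))    ∎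

        -- By additivity, p times the value is the value at [gᵖ, h]. As gᵖ lies in Γ(n), this
        -- vanishes by invariance, and M has no p-torsion.
        commutator-zero : ∀ g h → ⟦ commutator g h ⟧ ≈ᴹ 0ᴹ
        commutator-zero g h = p-torsion-free (M.trans (M.sym (commutator-pow p g h)) (commutator-kernel (p-power g) (pow p g) h G.refl))

        comm : ∀ e f → e ∗ f ∼ f ∗ e
        comm (g , m) (h , o) = commutator g h , G.sym (GP.//-rightDividesˡ (Γ.el (h ∙Γ g)) (Γ.el (g ∙Γ h)))
          , M.trans (M.comm o m) (M.sym (M.trans (M.∙-congˡ (commutator-zero g h)) (M.identityʳ _)))

        abelian : AbelianGroup 0ℓ 0ℓ
        abelian = record { isAbelianGroup = record { isGroup = Group.isGroup extension ; comm = comm } }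

        module E = AbelianGroup abelian
        open import Algebra.Properties.CommutativeMonoid.Mult E.commutativeMonoid using () renaming (_×_ to _✶_; ×-distrib-+ to ✶-distrib)

        ✶-pow : ∀ k g → E._≈_ (k ✶ (g , 0ᴹ)) (pow k g , 0ᴹ)
        ✶-pow zero    g = E.refl {1Γ , 0ᴹ}
        ✶-pow (suc k) g = E.trans {(g , 0ᴹ) ∗ (k ✶ (g , 0ᴹ))} {(g , 0ᴹ) ∗ (pow k g , 0ᴹ)} {pow (suc k) g , 0ᴹ}
          (E.∙-congˡ {g , 0ᴹ} {k ✶ (g , 0ᴹ)} {pow k g , 0ᴹ} (✶-pow k g)) (embed {pow (suc k) g} {pow (suc k) g} G.refl (M.identityˡ 0ᴹ))

        ψ : Γ n′ → |M|
        ψ g = ⟦ p-power g ⟧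

        ✶-ψ : ∀ g → E._≈_ (p ✶ (g , 0ᴹ)) (lift (ψ g))
        ✶-ψ g = E.trans {p ✶ (g , 0ᴹ)} {pow p g , 0ᴹ} {lift (ψ g)} (✶-pow p g)
          (E.trans {pow p g , 0ᴹ} {lift (0ᴹ ⊞ ψ g)} {lift (ψ g)} (on-kernel (pow p g) 0ᴹ (p-power g) G.refl) (embed {1Γ} {1Γ} G.refl (M.identityˡ _)))

        lift-cancel : ∀ {m o} → lift m ∼ lift o → m ≈ᴹ o
        lift-cancel {m} {o} q = MP.x∙y⁻¹≈ε⇒x≈y m o (lift-injective (E.trans {lift (m ⊞ ⊟ o)} {lift m ∗ lift (⊟ o)} {lift 0ᴹ}
          (embed {1Γ} {1Γ ∙Γ 1Γ} (G.sym (G.identityˡ 1SL)) M.refl)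
          (E.trans {lift m ∗ lift (⊟ o)} {lift o ∗ lift (⊟ o)} {lift 0ᴹ} (E.∙-congʳ {lift (⊟ o)} {lift m} {lift o} q)
            (embed {1Γ ∙Γ 1Γ} {1Γ} (G.identityˡ 1SL) (M.inverseʳ o)))))

        -- The extension is now abelian, so multiplication by p is additive on it; by `✶-ψ` it sends
        -- (g, 0) to ψ(g) in M.
        ψ-homo : ∀ g h → ψ (g ∙Γ h) ≈ᴹ ψ g ⊞ ψ h
        ψ-homo g h = lift-cancel (E.trans {lift (ψ (g ∙Γ h))} {p ✶ (g ∙Γ h , 0ᴹ)} {lift (ψ g ⊞ ψ h)} (E.sym {p ✶ (g ∙Γ h , 0ᴹ)} {lift (ψ (g ∙Γ h))} (✶-ψ (g ∙Γ h)))
          (E.trans {p ✶ (g ∙Γ h , 0ᴹ)} {p ✶ ((g , 0ᴹ) ∗ (h , 0ᴹ))} {lift (ψ g ⊞ ψ h)} (✶-cong p {g ∙Γ h , 0ᴹ} {(g , 0ᴹ) ∗ (h , 0ᴹ)} (embed {g ∙Γ h} {g ∙Γ h} G.refl (M.sym (M.identityˡ 0ᴹ))))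
          (E.trans {p ✶ ((g , 0ᴹ) ∗ (h , 0ᴹ))} {(p ✶ (g , 0ᴹ)) ∗ (p ✶ (h , 0ᴹ))} {lift (ψ g ⊞ ψ h)} (✶-distrib (g , 0ᴹ) (h , 0ᴹ) p)
          (E.trans {(p ✶ (g , 0ᴹ)) ∗ (p ✶ (h , 0ᴹ))} {lift (ψ g) ∗ lift (ψ h)} {lift (ψ g ⊞ ψ h)}
            (E.∙-cong {p ✶ (g , 0ᴹ)} {lift (ψ g)} {p ✶ (h , 0ᴹ)} {lift (ψ h)} (✶-ψ g) (✶-ψ h)) (embed {1Γ ∙Γ 1Γ} {1Γ} (G.identityˡ 1SL) M.refl)))))
          where
          ✶-cong : ∀ k {e f} → e ∼ f → E._≈_ (k ✶ e) (k ✶ f)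
          ✶-cong zero    q = E.refl {1Γ , 0ᴹ}
          ✶-cong (suc k) {e} {f} q = E.∙-cong {e} {f} {k ✶ e} {k ✶ f} q (✶-cong k {e} {f} q)

        p-cancel : ∀ {m o} → p ⊡ m ≈ᴹ p ⊡ o → m ≈ᴹ o
        p-cancel {m} {o} e = MP.x∙y⁻¹≈ε⇒x≈y m o (p-torsion-free (M.trans (⊡-distrib m (⊟ o) p) (M.trans (M.∙-cong e (·-⁻¹ M p o)) (M.inverseʳ _))))
          where open import Algebra.Properties.CommutativeMonoid.Mult M.commutativeMonoid using () renaming (×-distrib-+ to ⊡-distrib)

        pow-cong : ∀ k {g h : Γ n′} → Γ.el g ≋ Γ.el h → Γ.el (pow k g) ≋ Γ.el (pow k h)
        pow-cong zero    e = G.refl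
        pow-cong (suc k) e = G.∙-cong e (pow-cong k e)

        pow-kernel : ∀ j (k : Γ n) (g : Γ n′) → Γ.el k ≋ Γ.el g → ∃ λ (k′ : Γ n) → (Γ.el (pow j g) ≋ Γ.el k′) × (⟦ k′ ⟧ ≈ᴹ j ⊡ ⟦ k ⟧)
        pow-kernel zero    k g e = 1Γ , G.refl , homo-1
        pow-kernel (suc j) k g e = let k′ , q , r = pow-kernel j k g e in
          k ∙Γ k′ , G.∙-cong (G.sym e) q , M.trans (homo k k′) (M.∙-congˡ r)

        pow-conj : ∀ k s (g : Γ n′) → Γ.el (pow k (conj s g)) ≋ s ⊙ Γ.el (pow k g) ⊙ inv s
        pow-conj zero    s g = G.sym (G.trans (G.∙-congʳ (G.identityʳ s)) (G.inverseʳ s))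
        pow-conj (suc k) s g = G.trans (G.∙-congˡ (pow-conj k s g)) (G.sym (conj-⊙ s (Γ.el g) (Γ.el (pow k g))))

      extend-power : ∃ λ (χ′ : Hom n′) → Invariant χ′ × Extends χ χ′
      extend-power = χ′ , invariant , extends
        where
        root : ∀ g → ∃ λ m → p ⊡ m ≈ᴹ ψ g
        root g = coprime-divisible M (prime-coprime p-prime l-prime p≢l) lM≈0 (ψ g)
        ψ-cong : ∀ {g h : Γ n′} → Γ.el g ≋ Γ.el h → ψ g ≈ᴹ ψ h
        ψ-cong {g} {h} e = cong {p-power g} {p-power h} (pow-cong p {g} {h} e)
        χ′ : Hom n′
        χ′ = record
          { ⟦_⟧  = λ g → proj₁ (root g)
          ; cong = λ {g} {h} e → p-cancel (M.trans (proj₂ (root g)) (M.trans (ψ-cong {g} {h} e) (M.sym (proj₂ (root h)))))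
          ; homo = λ g h → p-cancel (M.trans (proj₂ (root (g ∙Γ h))) (M.trans (ψ-homo g h) (M.sym (M.trans (⊡-distrib _ _ p) (M.∙-cong (proj₂ (root g)) (proj₂ (root h)))))))
          }
          where open import Algebra.Properties.CommutativeMonoid.Mult M.commutativeMonoid using () renaming (×-distrib-+ to ⊡-distrib)
        extends : Extends χ χ′
        extends k g e = let k′ , q , r = pow-kernel p k g e in
          p-cancel (M.trans (proj₂ (root g)) (M.trans (cong {p-power g} {k′} q) r))
        invariant : Invariant χ′
        invariant s g = p-cancel (M.trans (proj₂ (root (conj s g))) (M.trans
          (M.trans (cong {p-power (conj s g)} {conj s (p-power g)} (pow-conj p s g)) (χ-inv s (p-power g))) (M.sym (proj₂ (root g)))))

  private
    -- Induction over elementary factors: at unit level all of them are unipotents in Γ(n). The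
    -- predicate ranges over all elements with a given matrix, since these also carry their
    -- congruences.
    trivial-unit : ∀ {n} → n ∣ 1# → (χ : Hom n) → ∀ g → Hom.⟦_⟧ χ g ≈ᴹ 0ᴹ
    trivial-unit {n} n∣1 χ g = elementary-generation P (λ e h k q → h k (G.trans q (G.sym e))) base₁ step₁₂ step₂₁ (Γ.el g) g G.refl
      where
      open Hom χ
      n∣_ : ∀ z → n ∣ z
      n∣ z = ∣-trans n∣1 (z , sym (*-identityʳ z))
      P : SL → Set
      P s = ∀ (k : Γ n) → Γ.el k ≋ s → ⟦ k ⟧ ≈ᴹ 0ᴹ
      into : SL → Γ n
      into s = γ s (n∣ _) (n∣ _) (n∣ _) (n∣ _)
      base₁ : P 1SL
      base₁ k e = M.trans (cong {k} {1Γ} e) homo-1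
      step₁₂ : ∀ x s → P s → P (E₁₂ x ⊙ s)
      step₁₂ x s h k e = M.trans (cong {k} {unipotent 0# x 0# nil (n∣ _) (n∣ _) (n∣ _) ∙Γ into s} (G.trans e (G.∙-congʳ (mk≋
          (solve 0 (:1 := :1 :+ :0) refl) refl refl (solve 0 (:1 := :1 :- :0) refl)))))
        (M.trans (unipotent-∙ 0# x 0# nil (n∣ _) (n∣ _) (n∣ _) (into s)) (h (into s) G.refl))
        where
        nil : 0# * 0# + x * 0# ≈ 0#
        nil = solve 1 (λ x → :0 :* :0 :+ x :* :0 := :0) refl x
      step₂₁ : ∀ x s → P s → P (E₂₁ x ⊙ s)
      step₂₁ x s h k e = M.trans (cong {k} {unipotent 0# 0# x nil (n∣ _) (n∣ _) (n∣ _) ∙Γ into s} (G.trans e (G.∙-congʳ (mk≋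
          (solve 0 (:1 := :1 :+ :0) refl) refl refl (solve 0 (:1 := :1 :- :0) refl)))))
        (M.trans (unipotent-∙ 0# 0# x nil (n∣ _) (n∣ _) (n∣ _) (into s)) (h (into s) G.refl))
        where
        nil : 0# * 0# + 0# * x ≈ 0#
        nil = solve 1 (λ x → :0 :* :0 :+ :0 :* x := :0) refl x

    extend-prime : ∀ {n n′ ρ} → IsPrime ρ → n ≈ ρ * n′ → (χ : Hom n) → Invariant χ → ∃ λ (χ′ : Hom n′) → Invariant χ′ × Extends χ χ′
    extend-prime {n} {n′} {ρ} ρ-prime n≈ χ χ-inv = [ power , extend-coprime (ρ , n≈) χ χ-inv ρ-prime n≈ ]′ (IsPrime.split ρ-prime n′)
      where
      power : ρ ∣ n′ → ∃ λ (χ′ : Hom n′) → Invariant χ′ × Extends χ χ′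
      power (j , e) = extend-power (ρ , n≈) χ χ-inv (j , (modulo₂ n′ e (- j) n≈ (solve 4 (λ n n′ ρ j → n′ :* n′ := j :* n :+ (n′ :* (n′ :- j :* ρ) :+ ((:- j) :* (n :- ρ :* n′)))) refl n n′ ρ j)))

  invariant⇒trivial : ∀ {n} → Factored n → (χ : Hom n) → Invariant χ → ∀ g → Hom.⟦_⟧ χ g ≈ᴹ 0ᴹ
  invariant⇒trivial (unit n∣1) χ χ-inv g = trivial-unit n∣1 χ g
  invariant⇒trivial {n} (_∷_by_ {ρ} {n′} ρ-prime factors n≈) χ χ-inv g@(γ s p q r t) =
    let χ′ , χ′-inv , extends = extend-prime ρ-prime n≈ χ χ-inv
        g′ = γ s (weaken p) (weaken q) (weaken r) (weaken t)
    in M.trans (M.sym (extends g g′ G.refl)) (invariant⇒trivial factors χ′ χ′-inv g′)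
    where
    weaken : ∀ {z} → n ∣ z → n′ ∣ z
    weaken = ∣-trans (ρ , n≈)

-- The cokernel of α

module AbelianQuotients (G : Group 0ℓ 0ℓ) where

  open Group G
  open Algebra.Properties.Group G

  -- A subgroup containing all commutators; normality follows, since a conjugate of x is a
  -- commutator times x.
  record AbelianKernel (N : Carrier → Set) : Set where
    field
      resp        : ∀ {x y} → x ≈ y → N x → N y
      ε∈          : N ε
      ∙∈          : ∀ {x y} → N x → N y → N (x ∙ y)
      ⁻¹∈         : ∀ {x} → N x → N (x ⁻¹)
      commutator∈ : ∀ x y → N (x ∙ y ∙ x ⁻¹ ∙ y ⁻¹)

  private
    contract : ∀ z x w → z ∙ x ⁻¹ ∙ (x ∙ w) ≈ z ∙ w
    contract z x w = trans (sym (assoc _ x w)) (∙-congʳ (//-rightDividesˡ x z))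

    commutator≈// : ∀ x y → (x ∙ y) ∙ (y ∙ x) ⁻¹ ≈ x ∙ y ∙ x ⁻¹ ∙ y ⁻¹
    commutator≈// x y = trans (∙-congˡ (⁻¹-anti-homo-∙ y x)) (sym (assoc _ _ _))

  module Quotient {N : Carrier → Set} (kernel : AbelianKernel N) where

    open AbelianKernel kernel

    private
      normal : ∀ g {x} → N x → N (g ∙ x ∙ g ⁻¹)
      normal g {x} x∈ = resp (//-rightDividesˡ x _) (∙∈ (commutator∈ g x) x∈)

    ≈⇒∼ : ∀ {x y} → x ≈ y → N (x ∙ y ⁻¹)
    ≈⇒∼ {x} {y} e = resp (trans (sym (inverseʳ y)) (∙-congʳ (sym e))) ε∈

    quotient : AbelianGroup 0ℓ 0ℓ
    quotient = record
      { Carrier = Carrier ; _≈_ = λ x y → N (x ∙ y ⁻¹) ; _∙_ = _∙_ ; ε = ε ; _⁻¹ = _⁻¹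
      ; isAbelianGroup = record
        { isGroup = record
          { isMonoid = record
            { isSemigroup = record
              { isMagma = record
                { isEquivalence = record
                  { refl  = ≈⇒∼ refl
                  ; sym   = λ {x} {y} e → resp (⁻¹-anti-homo-// x y) (⁻¹∈ e)
                  ; trans = λ {x} {y} {z} e e′ → resp (contract x y (z ⁻¹)) (∙∈ e e′)
                  }
                ; ∙-cong = λ {x} {x′} {y} {y′} e e′ → resp
                    (trans (contract _ x (x′ ⁻¹)) (trans (∙-congʳ (sym (assoc x y (y′ ⁻¹))))
                      (trans (assoc _ _ _) (∙-congˡ (sym (⁻¹-anti-homo-∙ x′ y′))))))
                    (∙∈ (normal x e′) e)
                }
              ; assoc = λ x y z → ≈⇒∼ (assoc x y z) }
            ; identity = (λ x → ≈⇒∼ (identityˡ x)) , (λ x → ≈⇒∼ (identityʳ x)) }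
          ; inverse = (λ x → ≈⇒∼ (inverseˡ x)) , (λ x → ≈⇒∼ (inverseʳ x))
          ; ⁻¹-cong = λ {x} {y} e → resp
              (trans (∙-congʳ (sym (assoc (x ⁻¹) y (x ⁻¹)))) (trans (//-rightDividesʳ (x ⁻¹) _) (∙-congˡ (sym (⁻¹-involutive y)))))
              (normal (x ⁻¹) (resp (⁻¹-anti-homo-// x y) (⁻¹∈ e)))
          }
        ; comm = λ x y → resp (sym (commutator≈// x y)) (commutator∈ x y)
        }
      }

  -- Bracketed exactly as `commProd`, so that a list of pairs can be carried over to matrices entry
  -- by entry.
  commutators : List (Carrier × Carrier) → Carrier
  commutators []             = ε
  commutators ((x , y) ∷ cs) = x ∙ y ∙ x ⁻¹ ∙ y ⁻¹ ∙ commutators cs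

  Derived : Carrier → Set
  Derived x = ∃ λ cs → x ≈ commutators cs

  derived : AbelianKernel Derived
  derived = record
    { resp        = λ x≈y (cs , e) → cs , trans (sym x≈y) e
    ; ε∈          = [] , refl
    ; ∙∈          = λ (cs , e) (ds , e′) → cs ++ ds , trans (∙-cong e e′) (sym (append cs ds))
    ; ⁻¹∈         = λ (cs , e) → let ds , e′ = inverse∈ cs in ds , trans (⁻¹-cong e) e′
    ; commutator∈ = λ x y → (x , y) ∷ [] , sym (identityʳ _)
    }
    where
    append : ∀ cs ds → commutators (cs ++ ds) ≈ commutators cs ∙ commutators ds
    append []       ds = sym (identityˡ _)
    append (c ∷ cs) ds = trans (∙-congˡ (append cs ds)) (sym (assoc _ _ _))
    swap : ∀ x y → (x ∙ y ∙ x ⁻¹ ∙ y ⁻¹) ⁻¹ ≈ y ∙ x ∙ y ⁻¹ ∙ x ⁻¹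
    swap x y = trans (⁻¹-cong (sym (commutator≈// x y))) (trans (⁻¹-anti-homo-// _ _) (commutator≈// y x))
    inverse∈ : ∀ cs → Derived (commutators cs ⁻¹)
    inverse∈ []             = [] , ε⁻¹≈ε
    inverse∈ ((x , y) ∷ cs) = let ds , e = inverse∈ cs in
      ds ++ (y , x) ∷ [] , trans (⁻¹-anti-homo-∙ _ _)
        (trans (∙-cong e (trans (swap x y) (sym (identityʳ _)))) (sym (append ds _)))

module QuotientByMultiples (A : AbelianGroup 0ℓ 0ℓ) (l : ℕ)
  (W : AbelianGroup.Carrier A → Set) (W-ε : W (AbelianGroup.ε A))
  (W-∙ : ∀ {x y} → W x → W y → W (AbelianGroup._∙_ A x y)) (W-⁻¹ : ∀ {x} → W x → W (AbelianGroup._⁻¹ A x)) where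

  open AbelianGroup A
  open Algebra.Properties.AbelianGroup A using (⁻¹-∙-comm; ε⁻¹≈ε; ⁻¹-involutive)
  open Algebra.Properties.CommutativeSemigroup commutativeSemigroup using (interchange; xy∙z≈xz∙y)
  open Algebra.Properties.CommutativeMonoid.Mult commutativeMonoid using (×-distrib-+; ×-congʳ) renaming (_×_ to _·_)
  open AbelianQuotients group

  -- Membership in W + l A. If W is the image of a homomorphism, the quotient is the cokernel of
  -- that homomorphism modulo l.
  Relation : Carrier → Set
  Relation x = ∃₂ λ w h → W w × x ≈ w ∙ l · h

  relations : AbelianKernel Relation
  relations = record
    { resp        = λ x≈y (w , h , w∈ , e) → w , h , w∈ , trans (sym x≈y) e
    ; ε∈          = trivial refl
    ; ∙∈          = λ (w , h , w∈ , e) (w′ , h′ , w′∈ , e′) → w ∙ w′ , h ∙ h′ , W-∙ w∈ w′∈ ,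
        trans (∙-cong e e′) (trans (interchange w _ w′ _) (∙-congˡ (sym (×-distrib-+ h h′ l))))
    ; ⁻¹∈         = λ (w , h , w∈ , e) → w ⁻¹ , h ⁻¹ , W-⁻¹ w∈ ,
        trans (⁻¹-cong e) (trans (sym (⁻¹-∙-comm w _)) (∙-congˡ (sym (·-⁻¹ A l h))))
    ; commutator∈ = λ x y → trivial (trans (∙-congʳ (trans (∙-congʳ (comm x y)) (trans (assoc y x _) (trans (∙-congˡ (inverseʳ x)) (identityʳ y))))) (inverseʳ y))
    }
    where
    trivial : ∀ {x} → x ≈ ε → Relation x
    trivial e = ε , ε , W-ε , trans e (sym (trans (identityˡ _) (n·ε≈ε monoid l)))

  open Quotient relations public

  private module Q = AbelianGroup quotient

  W-trivial : ∀ {x} → W x → x Q.≈ ε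
  W-trivial {x} x∈ = x , ε , x∈ , ∙-congˡ (trans ε⁻¹≈ε (sym (n·ε≈ε monoid l)))

  exponent : ∀ x → Algebra.Properties.Monoid.Mult._×_ Q.monoid l x Q.≈ ε
  exponent x = ε , x , W-ε , trans (∙-congˡ ε⁻¹≈ε) (trans (identityʳ _) (trans (reflexive (same l)) (sym (identityˡ _))))
    where
    same : ∀ k → Algebra.Properties.Monoid.Mult._×_ Q.monoid k x ≡ k · x
    same zero    = ≡.refl
    same (suc k) = ≡.cong (x ∙_) (same k)

  -- The element h is inverted so that the relation takes the form γ g⁻¹ (h⁻¹)^l in which the
  -- theorem expresses surjectivity modulo l.
  ≈ε⇒relation : ∀ {x} → x Q.≈ ε → ∃₂ λ w h → W w × w ∙ x ⁻¹ ∙ l · (h ⁻¹) ≈ ε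
  ≈ε⇒relation {x} (w , h , w∈ , e) = w , h ⁻¹ , w∈ ,
    trans (∙-congˡ (×-congʳ l (⁻¹-involutive h))) (trans (xy∙z≈xz∙y w (x ⁻¹) _)
      (trans (∙-congʳ (trans (sym e) (trans (∙-congˡ ε⁻¹≈ε) (identityʳ x)))) (inverseʳ x)))

-- The Atkin-Lehner involution and the vanishing of the cokernel

module AtkinLehner (𝔸 : Arithmetic) where

  open Arith 𝔸 hiding (unit; _·_)
  open SpecialLinear 𝔸

  -- h represents w(g) = S⁻¹ τ g τ⁻¹ S = (d −c/π; −πb a).
  record _↔[_]_ {n} (g : Γ n) (π : Carrier) (h : Γ n) : Set where
    constructor partners
    field
      a≈ : Γ.a g ≈ Γ.d h
      c≈ : Γ.c g ≈ π * (- Γ.b h)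
      c′≈ : Γ.c h ≈ - (π * Γ.b g)
      d≈ : Γ.d g ≈ Γ.a h

  module _ {n π : Carrier} where

    opaque
      ↔-sym : ∀ {g h : Γ n} → g ↔[ π ] h → h ↔[ π ] g
      ↔-sym {g} {h} (partners a≈ c≈ c′≈ d≈) = partners (sym d≈)
        (trans c′≈ (solve 2 (λ π b → :- (π :* b) := π :* (:- b)) refl π (Γ.b g))) (trans c≈ (solve 2 (λ π b → π :* (:- b) := :- (π :* b)) refl π (Γ.b h))) (sym a≈)

    opaque
      ↔-1 : 1Γ {n} ↔[ π ] 1Γ
      ↔-1 = partners refl (solve 1 (λ π → :0 := π :* (:- :0)) refl π) (solve 1 (λ π → :0 := :- (π :* :0)) refl π) refl

    opaque
      ↔-inv : ∀ {g h : Γ n} → g ↔[ π ] h → invΓ g ↔[ π ] invΓ h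
      ↔-inv {g} {h} (partners a≈ c≈ c′≈ d≈) = partners d≈
        (trans (-‿cong c≈) (solve 2 (λ π b → :- (π :* (:- b)) := π :* (:- (:- b))) refl π (Γ.b h)))
        (trans (-‿cong c′≈) (solve 2 (λ π b → :- (:- (π :* b)) := :- (π :* (:- b))) refl π (Γ.b g))) a≈

    opaque
      ↔-∙ : ∀ {g h g′ h′ : Γ n} → g ↔[ π ] h → g′ ↔[ π ] h′ → (g ∙Γ g′) ↔[ π ] (h ∙Γ h′)
      ↔-∙ {γ (sl a b c d _) _ _ _ _} {γ (sl x y z w _) _ _ _ _} {γ (sl a′ b′ c′ d′ _) _ _ _ _} {γ (sl x′ y′ z′ w′ _) _ _ _ _}
          (partners a≈ c≈ z≈ d≈) (partners a′≈ c′≈ z′≈ d′≈) = partners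
        (modulo₄ a′ a≈ w a′≈ b c′≈ (- y′) z≈ (solve 9 (λ a b a′ c′ z w y′ w′ π → a :* a′ :+ b :* c′ := z :* y′ :+ w :* w′ :+ (a′ :* (a :- w) :+ (w :* (a′ :- w′) :+ (b :* (c′ :- (π :* (:- y′))) :+ ((:- y′) :* (z :- (:- (π :* b)))))))) refl a b a′ c′ z w y′ w′ π))
        (modulo₄ a′ c≈ (π * (- y)) a′≈ c′ d≈ x c′≈ (solve 9 (λ c d a′ c′ x y y′ w′ π → c :* a′ :+ d :* c′ := π :* (:- (x :* y′ :+ y :* w′)) :+ (a′ :* (c :- (π :* (:- y))) :+ ((π :* (:- y)) :* (a′ :- w′) :+ (c′ :* (d :- x) :+ (x :* (c′ :- (π :* (:- y′)))))))) refl c d a′ c′ x y y′ w′ π))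
        (modulo₄ x′ z≈ (π * b) d′≈ w z′≈ (π * b′) a≈ (solve 9 (λ a b b′ d′ z w x′ z′ π → z :* x′ :+ w :* z′ := :- (π :* (a :* b′ :+ b :* d′)) :+ (x′ :* (z :- (:- (π :* b))) :+ ((π :* b) :* (d′ :- x′) :+ (w :* (z′ :- (:- (π :* b′))) :+ ((π :* b′) :* (a :- w)))))) refl a b b′ d′ z w x′ z′ π))
        (modulo₄ b′ c≈ d′ d≈ x d′≈ (- y) z′≈ (solve 9 (λ c d b′ d′ x y x′ z′ π → c :* b′ :+ d :* d′ := x :* x′ :+ y :* z′ :+ (b′ :* (c :- (π :* (:- y))) :+ (d′ :* (d :- x) :+ (x :* (d′ :- x′) :+ ((:- y) :* (z′ :- (:- (π :* b′)))))))) refl c d b′ d′ x y x′ z′ π))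

  module Trivial
    (M : AbelianGroup 0ℓ 0ℓ) (l : ℕ) (l-prime : Prime l) (l≢2 : l ≢ 2) (p≢l : p ≢ l)
    (lM≈0 : ∀ m → AbelianGroup._≈_ M
                    (Algebra.Properties.Monoid.Mult._×_ (AbelianGroup.monoid M) l m) (AbelianGroup.ε M))
    where

    open Coefficients 𝔸 M l l-prime l≢2 p≢l lM≈0 using (module M; Hom; _≈ᴹ_; _⊞_; 0ᴹ; ⊟_; inverseˡ-unique)
    open Chains 𝔸 M l l-prime l≢2 p≢l lM≈0
    open Invariance 𝔸 M l l-prime l≢2 p≢l lM≈0
    open Descent 𝔸 M l l-prime l≢2 p≢l lM≈0
    open Algebra.Properties.AbelianGroup M using (⁻¹-∙-comm)

    negate : ∀ {n} → Hom n → Hom n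
    negate χ = record
      { ⟦_⟧  = λ g → ⊟ ⟦ g ⟧
      ; cong = λ {g} {h} e → M.⁻¹-cong (cong {g} {h} e)
      ; homo = λ g h → M.trans (M.⁻¹-cong (homo g h)) (M.sym (⁻¹-∙-comm ⟦ g ⟧ ⟦ h ⟧))
      }
      where open Hom χ

    opposite⇒trivial : ∀ {n π} → NonZ n → Coprime π n → ¬ π ∣ 1# → NonZ π → (φ₁ φ₂ : Hom n) →
      (∀ g h → g ↔[ π ] h → Hom.⟦_⟧ φ₁ g ⊞ Hom.⟦_⟧ φ₂ h ≈ᴹ 0ᴹ) → ∀ g → Hom.⟦_⟧ φ₁ g ≈ᴹ 0ᴹ
    opposite⇒trivial {n} {π} n≉0 π⊥n π∤1 π≉0 φ₁ φ₂ opposite =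
      invariant⇒trivial (factor n n≉0) φ₁ (linked⇒invariant n≉0 π⊥n π∤1 π≉0 {negate (Twist S φ₂)} {φ₁} link)
      where
      link : Linked π (negate (Twist S φ₂)) φ₁
      link g h (slide a≈ b≈ c≈ d≈) = let a′ , b′ , c′ , d′ = S-entries h in
        inverseˡ-unique _ _ (opposite g (conj S h) (partners
          (trans a≈ (sym d′))
          (modulo₂ 1# c≈ π b′ (solve 4 (λ c c′ b′ π → c := π :* (:- b′) :+ (:1 :* (c :- π :* c′) :+ (π :* (b′ :- (:- c′))))) refl (Γ.c g) (Γ.c h) (Γ.b (conj S h)) π))
          (trans c′ (-‿cong b≈)) (trans d≈ (sym a′))))

    -- The linking argument reaches φ₁ only. For φ₂ it is repeated with the roles exchanged, which
    -- is legitimate because `_↔[_]_` is symmetric.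
    opposite⇒trivial₂ : ∀ {n π} → NonZ n → Coprime π n → ¬ π ∣ 1# → NonZ π → (φ₁ φ₂ : Hom n) →
      (∀ g h → g ↔[ π ] h → Hom.⟦_⟧ φ₁ g ⊞ Hom.⟦_⟧ φ₂ h ≈ᴹ 0ᴹ) → ∀ g h → Hom.⟦_⟧ φ₁ g ⊞ Hom.⟦_⟧ φ₂ h ≈ᴹ 0ᴹ
    opposite⇒trivial₂ n≉0 π⊥n π∤1 π≉0 φ₁ φ₂ opposite g h = M.trans
      (M.∙-cong (opposite⇒trivial n≉0 π⊥n π∤1 π≉0 φ₁ φ₂ opposite g)
                (opposite⇒trivial n≉0 π⊥n π∤1 π≉0 φ₂ φ₁ (λ h g e → M.trans (M.comm _ _) (opposite g h (↔-sym {g = h} {g} e))) h))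
      (M.identityʳ 0ᴹ)

  module Surjectivity {n π : Carrier} (n≉0 : NonZ n) (π⊥n : Coprime π n) (π∤1 : ¬ π ∣ 1#) (π≉0 : NonZ π)
    (l : ℕ) (l-prime : Prime l) (l≢2 : l ≢ 2) (p≢l : p ≢ l) where

    Γ² : Group 0ℓ 0ℓ
    Γ² = Algebra.Construct.DirectProduct.group (ΓGroup n) (ΓGroup n)

    module Γ² = Group Γ²
    open AbelianQuotients Γ² using (Derived; derived)

    private
      module Abelianised = AbelianQuotients.Quotient Γ² derived
      module A = AbelianGroup Abelianised.quotient
      module Γ-n = Group (ΓGroup n)

      W : Γ n × Γ n → Set
      W (g , h) = g ↔[ π ] h

      W-∙ : ∀ {x y} → W x → W y → W (x Γ².∙ y)
      W-∙ {g , h} {g′ , h′} = ↔-∙ {g = g} {h} {g′} {h′}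

      W-⁻¹ : ∀ {x} → W x → W (x Γ².⁻¹)
      W-⁻¹ {g , h} = ↔-inv {g = g} {h}

      module Q = QuotientByMultiples Abelianised.quotient l W (↔-1 {n}) (λ {x} {y} → W-∙ {x} {y}) (λ {x} → W-⁻¹ {x})

    open Algebra.Properties.Monoid.Mult A.monoid public using () renaming (_×_ to _·_)

    private
      module T = Trivial Q.quotient l l-prime l≢2 p≢l Q.exponent
      open Coefficients 𝔸 Q.quotient l l-prime l≢2 p≢l Q.exponent using (Hom)
      module M = AbelianGroup Q.quotient

      ≋⇒≈ : ∀ {x y} → x Γ².≈ y → x M.≈ y
      ≋⇒≈ {x} {y} e = Q.≈⇒∼ {x} {y} (Abelianised.≈⇒∼ {x} {y} e)

      φ₁ φ₂ : Hom n
      φ₁ = record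
        { ⟦_⟧  = λ g → g , 1Γ
        ; cong = λ {g} {h} e → ≋⇒≈ {g , 1Γ} {h , 1Γ} (e , Γ-n.refl {1Γ})
        ; homo = λ g h → ≋⇒≈ {g ∙Γ h , 1Γ} {g ∙Γ h , 1Γ ∙Γ 1Γ} (Γ-n.refl {g ∙Γ h} , Γ-n.sym {1Γ ∙Γ 1Γ} {1Γ} (Γ-n.identityˡ 1Γ))
        }
      φ₂ = record
        { ⟦_⟧  = λ g → 1Γ , g
        ; cong = λ {g} {h} e → ≋⇒≈ {1Γ , g} {1Γ , h} (Γ-n.refl {1Γ} , e)
        ; homo = λ g h → ≋⇒≈ {1Γ , g ∙Γ h} {1Γ ∙Γ 1Γ , g ∙Γ h} (Γ-n.sym {1Γ ∙Γ 1Γ} {1Γ} (Γ-n.identityˡ 1Γ) , Γ-n.refl {g ∙Γ h})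
        }

      sum≈pair : ∀ g h → (g ∙Γ 1Γ , 1Γ ∙Γ h) Γ².≈ (g , h)
      sum≈pair g h = Γ-n.identityʳ g , Γ-n.identityˡ h

      opposite : ∀ g h → g ↔[ π ] h → (g ∙Γ 1Γ , 1Γ ∙Γ h) M.≈ Γ².ε
      opposite g h e = M.trans {g ∙Γ 1Γ , 1Γ ∙Γ h} {g , h} {Γ².ε}
        (≋⇒≈ {g ∙Γ 1Γ , 1Γ ∙Γ h} {g , h} (sum≈pair g h)) (Q.W-trivial {g , h} e)

    -- The class of (g₁, g₂) in the cokernel is φ₁(g₁) + φ₂(g₂) = 0. Unfolding both quotients gives
    -- the relation in the product of two copies of Γ(n), up to commutators.
    surjective : ∀ g₁ g₂ → ∃₂ λ g h → g ↔[ π ] h × ∃ λ k →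
                 Derived ((g , h) Γ².∙ (g₁ , g₂) Γ².⁻¹ Γ².∙ l · (k Γ².⁻¹))
    surjective g₁ g₂ =
      let (g , h) , k , e , eq = Q.≈ε⇒relation {g₁ ∙Γ 1Γ , 1Γ ∙Γ g₂} (T.opposite⇒trivial₂ n≉0 π⊥n π∤1 π≉0 φ₁ φ₂ opposite g₁ g₂)
          x = (g , h) Γ².∙ (g₁ ∙Γ 1Γ , 1Γ ∙Γ g₂) Γ².⁻¹ Γ².∙ l · (k Γ².⁻¹)
          y = (g , h) Γ².∙ (g₁ , g₂) Γ².⁻¹ Γ².∙ l · (k Γ².⁻¹)
      in g , h , e , k , AbelianKernel.resp derived {x Γ².∙ Γ².ε Γ².⁻¹} {y}
           (Γ².trans {x Γ².∙ Γ².ε Γ².⁻¹} {x} {y} (Γ².trans {x Γ².∙ Γ².ε Γ².⁻¹} {x Γ².∙ Γ².ε} {x} (Γ².∙-congˡ {x} {Γ².ε Γ².⁻¹} {Γ².ε} ε⁻¹≈ε) (Γ².identityʳ x))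
             (Γ².∙-congʳ {l · (k Γ².⁻¹)} {(g , h) Γ².∙ (g₁ ∙Γ 1Γ , 1Γ ∙Γ g₂) Γ².⁻¹} {(g , h) Γ².∙ (g₁ , g₂) Γ².⁻¹}
               (Γ².∙-congˡ {g , h} {(g₁ ∙Γ 1Γ , 1Γ ∙Γ g₂) Γ².⁻¹} {(g₁ , g₂) Γ².⁻¹}
                 (Γ².⁻¹-cong {g₁ ∙Γ 1Γ , 1Γ ∙Γ g₂} {g₁ , g₂} (sum≈pair g₁ g₂))))) eq
      where
      open AbelianQuotients Γ² using (module AbelianKernel)
      open Algebra.Properties.Group Γ² using (ε⁻¹≈ε)

-- The ring F_q[t]

module Polynomials {q : ℕ} (K : FiniteField q) where

  open import Data.Fin.Base as Fin using (Fin; toℕ; funToFin; finToFun)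
  open import Data.Fin.Permutation using (permutation)
  open import Data.List.Base using ([]; _∷_; map; tabulate)
  open import Data.Nat.ListAction using (product)
  open import Data.Nat.Primality.Factorisation using (PrimeFactorisation; factorise)
  open import Relation.Binary using (IsEquivalence; Setoid; tri<; tri≈; tri>)
  import Algebra.Properties.CommutativeMonoid.Sum

  open WithField K using (F; Poly; coeff; _≈_; 0P; 1P; _+P_; -P_; _*P_)

  ring : CommutativeRing 0ℓ 0ℓ
  ring = record { isCommutativeRing = FiniteField.isCommutativeRing K }

  private
    module F = CommutativeRing ring
  open F using (_+_; _*_; -_; _-_; 0#; 1#; refl)
  open RingSolver ring
  open Divisibility ring using (modulo₁; modulo₂)
  open Algebra.Properties.Semiring.Mult F.semiring using (×1-homo-*) renaming (_×_ to _·_)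

  module FieldFacts where

    _≟F_ : ∀ (x y : F) → Dec (x ≡ y)
    _≟F_ = Fin._≟_

    no-zero-divisors : ∀ {x y} → x ≢ 0# → x * y ≡ 0# → y ≡ 0#
    no-zero-divisors {x} {y} x≢0 xy≡0 with FiniteField.inverse K x x≢0
    ... | z , e = modulo₂ (- y) e z xy≡0 (solve 3 (λ x y z → y := :0 :+ ((:- y) :* (x :* z :- :1) :+ (z :* (x :* y :- :0)))) refl x y z)

    -- Translation by 1 permutes the field, so q · 1 = 0.
    q·1≡0 : q · 1# ≡ 0#
    q·1≡0 = modulo₁ (- 1#) total (solve 2 (λ s u → u := :0 :+ ((:- :1) :* (s :- (s :+ u)))) refl (sum id) (q · 1#))
      where
      open Algebra.Properties.CommutativeMonoid.Sum F.+-commutativeMonoid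
      open import Function using (id)
      total : sum id ≡ sum id + q · 1#
      total = ≡.trans (sum-permute id (permutation (_+ 1#) (_- 1#) (λ x → solve 1 (λ x → x :- :1 :+ :1 := x) refl x) (λ x → solve 1 (λ x → x :+ :1 :- :1 := x) refl x)))
        (≡.trans (∑-distrib-+ id (λ _ → 1#)) (≡.cong (sum id +_) (sum-replicate q)))

    private
      prime-factor : ∀ {ps} → All Prime ps → product ps · 1# ≡ 0# → ∃ λ p → Prime p × p ℕ.∣ product ps × p · 1# ≡ 0#
      prime-factor {[]} [] e = contradiction (≡.trans (≡.sym e) (F.+-identityʳ 1#)) (FiniteField.0≢1 K)
      prime-factor {p ∷ ps} (pr ∷ prs) e with (p · 1#) ≟F 0#
      ... | yes p·1≡0 = p , pr , ℕ.m∣m*n (product ps) , p·1≡0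
      ... | no  p·1≢0 with prime-factor prs (no-zero-divisors p·1≢0 (≡.trans (≡.sym (×1-homo-* p (product ps))) e))
      ...   | p′ , pr′ , d , e′ = p′ , pr′ , ℕ.∣n⇒∣m*n p d , e′

      nonZero : ∀ {n} → Fin n → ℕ.NonZero n
      nonZero {suc n} _ = _

    -- Since q kills 1 and there are no zero divisors, some prime factor of q kills 1. That p
    -- divides q is what later yields p ≠ l.
    characteristic : ∃ λ p → Prime p × p ℕ.∣ q × p · 1# ≡ 0#
    characteristic = let p , pr , d , e = prime-factor factorsPrime (≡.subst (λ n → n · 1# ≡ 0#) isFactorisation q·1≡0)
                     in p , pr , ≡.subst (p ℕ.∣_) (≡.sym isFactorisation) d , e
      where open PrimeFactorisation (factorise q {{nonZero 0#}})

  open FieldFacts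

  infix 4 _≃_
  -- A record around the pointwise relation `_≈_`, so that f and g can be recovered from the type of
  -- an equation.
  record _≃_ (f g : Poly) : Set where
    constructor pointwise
    field at : f ≈ g
  open _≃_

  private
    coeff-+ : ∀ f g i → coeff (f +P g) i ≡ coeff f i + coeff g i
    coeff-+ [] g i = ≡.sym (F.+-identityˡ _)
    coeff-+ (x ∷ f) [] i = ≡.sym (F.+-identityʳ _)
    coeff-+ (x ∷ f) (y ∷ g) zero = refl
    coeff-+ (x ∷ f) (y ∷ g) (suc i) = coeff-+ f g i

    coeff-neg : ∀ f i → coeff (-P f) i ≡ - coeff f i
    coeff-neg [] i = ≡.sym (solve 0 (:- :0 := :0) refl)
    coeff-neg (x ∷ f) zero = refl
    coeff-neg (x ∷ f) (suc i) = coeff-neg f i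

    infixr 8 _⊛_
    _⊛_ : F → Poly → Poly
    c ⊛ f = map (c *_) f

    shift : Poly → Poly
    shift f = 0# ∷ f

    coeff-⊛ : ∀ c f i → coeff (c ⊛ f) i ≡ c * coeff f i
    coeff-⊛ c [] i = ≡.sym (F.zeroʳ c)
    coeff-⊛ c (x ∷ f) zero = refl
    coeff-⊛ c (x ∷ f) (suc i) = coeff-⊛ c f i

    ≃-equivalence : IsEquivalence _≃_
    ≃-equivalence = record { refl = pointwise λ i → refl ; sym = λ e → pointwise λ i → ≡.sym (at e i)
                           ; trans = λ e e′ → pointwise λ i → ≡.trans (at e i) (at e′ i) }

    poly-setoid : Setoid 0ℓ 0ℓ
    poly-setoid = record { isEquivalence = ≃-equivalence }

    module ≃ = Setoid poly-setoid
    open Relation.Binary.Reasoning.Setoid poly-setoid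

    +-cong : ∀ {f f′ g g′} → f ≃ f′ → g ≃ g′ → f +P g ≃ f′ +P g′
    +-cong {f} {f′} {g} {g′} e e′ = pointwise λ i → ≡.trans (coeff-+ f g i) (≡.trans (≡.cong₂ _+_ (at e i) (at e′ i)) (≡.sym (coeff-+ f′ g′ i)))

    +-congˡ : ∀ {f g g′} → g ≃ g′ → f +P g ≃ f +P g′
    +-congˡ = +-cong ≃.refl

    +-congʳ : ∀ {f f′ g} → f ≃ f′ → f +P g ≃ f′ +P g
    +-congʳ e = +-cong e ≃.refl

    +-assoc : ∀ f g h → (f +P g) +P h ≃ f +P (g +P h)
    +-assoc f g h = pointwise λ i → ≡.trans (≡.trans (coeff-+ (f +P g) h i) (≡.cong (_+ coeff h i) (coeff-+ f g i)))
      (≡.trans (F.+-assoc _ _ _) (≡.sym (≡.trans (coeff-+ f (g +P h) i) (≡.cong (coeff f i +_) (coeff-+ g h i)))))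

    +-comm : ∀ f g → f +P g ≃ g +P f
    +-comm f g = pointwise λ i → ≡.trans (coeff-+ f g i) (≡.trans (F.+-comm _ _) (≡.sym (coeff-+ g f i)))

    +-identityʳ : ∀ f → f +P [] ≃ f
    +-identityʳ f = ≃.trans (+-comm f []) ≃.refl

    interchange : ∀ f g h k → (f +P g) +P (h +P k) ≃ (f +P h) +P (g +P k)
    interchange f g h k = begin
      (f +P g) +P (h +P k)   ≈⟨ +-assoc f g _ ⟩
      f +P (g +P (h +P k))   ≈⟨ +-congˡ {f} (≃.trans (≃.sym (+-assoc g h k)) (≃.trans (+-congʳ (+-comm g h)) (+-assoc h g k))) ⟩
      f +P (h +P (g +P k))   ≈⟨ +-assoc f h _ ⟨
      (f +P h) +P (g +P k)   ∎

    ∷-cong : ∀ {x y f g} → x ≡ y → f ≃ g → (x ∷ f) ≃ (y ∷ g)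
    ∷-cong e e′ = pointwise λ { zero → e ; (suc i) → at e′ i }

    tail-≃ : ∀ {x y f g} → (x ∷ f) ≃ (y ∷ g) → f ≃ g
    tail-≃ e = pointwise λ i → at e (suc i)

    tail-[] : ∀ {x f} → (x ∷ f) ≃ [] → f ≃ []
    tail-[] e = pointwise λ i → at e (suc i)

    shift-[] : shift [] ≃ []
    shift-[] = pointwise λ { zero → refl ; (suc i) → refl }

    shift-zero : ∀ {f} → f ≃ [] → shift f ≃ []
    shift-zero e = ≃.trans (∷-cong refl e) shift-[]

    shift-+ : ∀ f g → shift (f +P g) ≃ shift f +P shift g
    shift-+ f g = ∷-cong (≡.sym (F.+-identityʳ 0#)) ≃.refl

    ⊛-cong : ∀ {c d f g} → c ≡ d → f ≃ g → c ⊛ f ≃ d ⊛ g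
    ⊛-cong {c} {d} {f} {g} e e′ = pointwise λ i → ≡.trans (coeff-⊛ c f i) (≡.trans (≡.cong₂ _*_ e (at e′ i)) (≡.sym (coeff-⊛ d g i)))

    ⊛-+ : ∀ c f g → c ⊛ (f +P g) ≃ c ⊛ f +P c ⊛ g
    ⊛-+ c f g = pointwise λ i → ≡.trans (≡.trans (coeff-⊛ c (f +P g) i) (≡.cong (c *_) (coeff-+ f g i)))
      (≡.trans (F.distribˡ c _ _) (≡.sym (≡.trans (coeff-+ (c ⊛ f) (c ⊛ g) i) (≡.cong₂ _+_ (coeff-⊛ c f i) (coeff-⊛ c g i)))))

    ⊛-⊛ : ∀ c d f → c ⊛ d ⊛ f ≃ (c * d) ⊛ f
    ⊛-⊛ c d f = pointwise λ i → ≡.trans (coeff-⊛ c (d ⊛ f) i) (≡.trans (≡.cong (c *_) (coeff-⊛ d f i))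
      (≡.trans (≡.sym (F.*-assoc c d _)) (≡.sym (coeff-⊛ (c * d) f i))))

    0⊛ : ∀ f → 0# ⊛ f ≃ []
    0⊛ f = pointwise λ i → ≡.trans (coeff-⊛ 0# f i) (F.zeroˡ _)

    1⊛ : ∀ f → 1# ⊛ f ≃ f
    1⊛ f = pointwise λ i → ≡.trans (coeff-⊛ 1# f i) (F.*-identityˡ _)

    ⊛-shift : ∀ c f → c ⊛ shift f ≃ shift (c ⊛ f)
    ⊛-shift c f = ∷-cong (F.zeroʳ c) ≃.refl

    *-zeroʳ : ∀ f → f *P [] ≃ []
    *-zeroʳ [] = ≃.refl
    *-zeroʳ (x ∷ f) = shift-zero (*-zeroʳ f)

    *-∷ : ∀ f y g → f *P (y ∷ g) ≃ y ⊛ f +P shift (f *P g)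
    *-∷ [] y g = ≃.sym shift-[]
    *-∷ (x ∷ f) y g = ∷-cong (≡.cong (_+ 0#) (F.*-comm x y)) (begin
      x ⊛ g +P f *P (y ∷ g)                   ≈⟨ +-congˡ (*-∷ f y g) ⟩
      x ⊛ g +P (y ⊛ f +P shift (f *P g))      ≈⟨ +-assoc (x ⊛ g) _ _ ⟨
      (x ⊛ g +P y ⊛ f) +P shift (f *P g)      ≈⟨ +-congʳ (+-comm (x ⊛ g) _) ⟩
      (y ⊛ f +P x ⊛ g) +P shift (f *P g)      ≈⟨ +-assoc (y ⊛ f) _ _ ⟩
      y ⊛ f +P (x ⊛ g +P shift (f *P g))      ∎)

    *-comm : ∀ f g → f *P g ≃ g *P f
    *-comm [] g = ≃.sym (*-zeroʳ g)
    *-comm (x ∷ f) g = ≃.sym (≃.trans (*-∷ g x f) (+-congˡ (∷-cong refl (*-comm g f))))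

    *-congˡ : ∀ f {g g′} → g ≃ g′ → f *P g ≃ f *P g′
    *-congˡ [] e = ≃.refl
    *-congˡ (x ∷ f) e = +-cong (⊛-cong refl e) (∷-cong refl (*-congˡ f e))

    *-cong : ∀ {f f′ g g′} → f ≃ f′ → g ≃ g′ → f *P g ≃ f′ *P g′
    *-cong {f} {f′} {g} {g′} e e′ = ≃.trans (*-congˡ f e′) (≃.trans (*-comm f g′) (≃.trans (*-congˡ g′ e) (*-comm g′ f′)))

    distribˡ : ∀ f g h → f *P (g +P h) ≃ f *P g +P f *P h
    distribˡ [] g h = ≃.refl
    distribˡ (x ∷ f) g h = ≃.trans (+-cong (⊛-+ x g h) (≃.trans (∷-cong refl (distribˡ f g h)) (shift-+ (f *P g) (f *P h))))
      (interchange (x ⊛ g) (x ⊛ h) _ _)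

    distribʳ : ∀ f g h → (g +P h) *P f ≃ g *P f +P h *P f
    distribʳ f g h = ≃.trans (*-comm (g +P h) f) (≃.trans (distribˡ f g h) (+-cong (*-comm f g) (*-comm f h)))

    ⊛-* : ∀ c f g → (c ⊛ f) *P g ≃ c ⊛ (f *P g)
    ⊛-* c [] g = ≃.refl
    ⊛-* c (x ∷ f) g = ≃.trans (+-cong (≃.sym (⊛-⊛ c x g)) (≃.trans (∷-cong refl (⊛-* c f g)) (≃.sym (⊛-shift c (f *P g))))) (≃.sym (⊛-+ c (x ⊛ g) _))

    shift-* : ∀ f g → shift f *P g ≃ shift (f *P g)
    shift-* f g = ≃.trans (+-congʳ (0⊛ g)) ≃.refl

    *-assoc : ∀ f g h → (f *P g) *P h ≃ f *P (g *P h)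
    *-assoc [] g h = ≃.refl
    *-assoc (x ∷ f) g h = ≃.trans (distribʳ h (x ⊛ g) (shift (f *P g)))
      (+-cong (⊛-* x g h) (≃.trans (shift-* (f *P g) h) (∷-cong refl (*-assoc f g h))))

    *-identityˡ : ∀ f → 1P *P f ≃ f
    *-identityˡ f = ≃.trans (+-cong (1⊛ f) shift-[]) (+-identityʳ f)

    neg-inverseʳ : ∀ f → f +P (-P f) ≃ []
    neg-inverseʳ f = pointwise λ i → ≡.trans (coeff-+ f (-P f) i) (≡.trans (≡.cong (coeff f i +_) (coeff-neg f i)) (F.-‿inverseʳ _))

  polyRing : CommutativeRing 0ℓ 0ℓ
  polyRing = record
    { Carrier = Poly ; _≈_ = _≃_ ; _+_ = _+P_ ; _*_ = _*P_ ; -_ = -P_ ; 0# = 0P ; 1# = 1P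
    ; isCommutativeRing = record
      { isRing = record
        { +-isAbelianGroup = record
          { isGroup = record
            { isMonoid = record
              { isSemigroup = record
                { isMagma = record { isEquivalence = ≃-equivalence ; ∙-cong = +-cong }
                ; assoc = +-assoc }
              ; identity = (λ f → ≃.refl) , +-identityʳ }
            ; inverse = (λ f → ≃.trans (+-comm (-P f) f) (neg-inverseʳ f)) , neg-inverseʳ
            ; ⁻¹-cong = λ {f} {g} e → pointwise λ i → ≡.trans (coeff-neg f i) (≡.trans (≡.cong -_ (at e i)) (≡.sym (coeff-neg g i))) }
          ; comm = +-comm }
        ; *-cong = *-cong
        ; *-assoc = *-assoc
        ; *-identity = *-identityˡ , (λ f → ≃.trans (*-comm f 1P) (*-identityˡ f))
        ; distrib = distribˡ , distribʳ }
      ; *-comm = *-comm }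
    }

  private
    HasDegree : Poly → ℕ → Set
    HasDegree f d = coeff f d ≢ 0# × (∀ i → d ℕ.< i → coeff f i ≡ 0#)

    degree : ∀ f → f ≃ [] ⊎ ∃ (HasDegree f)
    degree [] = inj₁ ≃.refl
    degree (x ∷ f) with degree f
    ... | inj₂ (d , n , z) = inj₂ (suc d , n , λ { (suc i) (ℕ.s≤s lt) → z i lt })
    ... | inj₁ f≃0 with x ≟F 0#
    ...   | yes x≡0 = inj₁ (pointwise λ { zero → x≡0 ; (suc i) → at f≃0 i })
    ...   | no  x≢0 = inj₂ (0 , x≢0 , λ { (suc i) _ → at f≃0 i })

    degree-unique : ∀ {f g d e} → f ≃ g → HasDegree f d → HasDegree g e → d ≡ e
    degree-unique {d = d} {e} q (n , z) (n′ , z′) with ℕ.<-cmp d e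
    ... | tri< d<e _ _ = contradiction (≡.trans (≡.sym (at q e)) (z e d<e)) n′
    ... | tri≈ _ d≡e _ = d≡e
    ... | tri> _ _ e<d = contradiction (≡.trans (at q d) (z′ d e<d)) n

    zero-no-degree : ∀ {f d} → f ≃ [] → ¬ HasDegree f d
    zero-no-degree {d = d} q (n , _) = n (at q d)

    degree-* : ∀ f g {d e} → HasDegree f d → HasDegree g e → HasDegree (f *P g) (d ℕ.+ e)
    degree-* [] g (n , _) _ = contradiction refl n
    degree-* (x ∷ f) g {zero} {e} (x≢0 , z) (n′ , z′) =
        (λ q → n′ (no-zero-divisors x≢0 (≡.trans (≡.sym (coeff-⊛ x g e)) (≡.trans (≡.sym (at product≃ e)) q))))
      , λ i lt → ≡.trans (at product≃ i) (≡.trans (coeff-⊛ x g i) (≡.trans (≡.cong (x *_) (z′ i lt)) (F.zeroʳ x)))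
      where
      f≃0 : f ≃ []
      f≃0 = pointwise λ i → z (suc i) (ℕ.s≤s ℕ.z≤n)
      product≃ : (x ∷ f) *P g ≃ x ⊛ g
      product≃ = ≃.trans (+-congˡ (shift-zero (*-cong f≃0 (≃.refl {g})))) (+-identityʳ (x ⊛ g))
    degree-* (x ∷ f) g {suc d} {e} (n , z) hg@(n′ , z′) =
        (λ q → proj₁ inner (≡.trans (≡.sym (high (d ℕ.+ e) (ℕ.s≤s (ℕ.m≤n+m e d)))) q))
      , λ { (suc i) (ℕ.s≤s lt) → ≡.trans (high i (ℕ.s≤s (ℕ.≤-trans (ℕ.m≤n+m e d) (ℕ.<⇒≤ lt)))) (proj₂ inner i lt) }
      where
      inner : HasDegree (f *P g) (d ℕ.+ e)
      inner = degree-* f g (n , λ i lt → z (suc i) (ℕ.s≤s lt)) hg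
      high : ∀ i → e ℕ.< suc i → coeff ((x ∷ f) *P g) (suc i) ≡ coeff (f *P g) i
      high i lt = ≡.trans (coeff-+ (x ⊛ g) (shift (f *P g)) (suc i))
        (≡.trans (≡.cong (_+ coeff (f *P g) i) (≡.trans (coeff-⊛ x g (suc i)) (≡.trans (≡.cong (x *_) (z′ (suc i) lt)) (F.zeroʳ x)))) (F.+-identityˡ _))

    deg : Poly → ℕ
    deg f with degree f
    ... | inj₁ _       = 0
    ... | inj₂ (d , _) = d

    deg-has : ∀ f → ¬ f ≃ [] → HasDegree f (deg f)
    deg-has f f≄0 with degree f
    ... | inj₁ f≃0     = contradiction f≃0 f≄0
    ... | inj₂ (d , h) = h

    zero? : ∀ f → Dec (f ≃ [])
    zero? f with degree f
    ... | inj₁ f≃0     = yes f≃0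
    ... | inj₂ (d , h) = no λ f≃0 → zero-no-degree f≃0 h

    deg-cong : ∀ {f g} → f ≃ g → deg f ≡ deg g
    deg-cong {f} {g} e with degree f | degree g
    ... | inj₁ _       | inj₁ _        = ≡.refl
    ... | inj₁ f≃0     | inj₂ (_ , h)  = contradiction h (zero-no-degree (≃.trans (≃.sym e) f≃0))
    ... | inj₂ (_ , h) | inj₁ g≃0      = contradiction h (zero-no-degree (≃.trans e g≃0))
    ... | inj₂ (_ , h) | inj₂ (_ , h′) = degree-unique e h h′

    product-nonzero : ∀ {f g} → ¬ f ≃ [] → ¬ g ≃ [] → ¬ f *P g ≃ []
    product-nonzero {f} {g} f≄0 g≄0 e = zero-no-degree e (degree-* f g (deg-has f f≄0) (deg-has g g≄0))

    deg-* : ∀ {f g} → ¬ f ≃ [] → ¬ g ≃ [] → deg (f *P g) ≡ deg f ℕ.+ deg g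
    deg-* {f} {g} f≄0 g≄0 = degree-unique (≃.refl {f *P g}) (deg-has (f *P g) (product-nonzero f≄0 g≄0)) (degree-* f g (deg-has f f≄0) (deg-has g g≄0))

    integral : ∀ f g → f *P g ≃ [] → f ≃ [] ⊎ g ≃ []
    integral f g e with zero? f | zero? g
    ... | yes f≃0 | _       = inj₁ f≃0
    ... | no  _   | yes g≃0 = inj₂ g≃0
    ... | no  f≄0 | no g≄0  = contradiction e (product-nonzero f≄0 g≄0)

    module PS = RingSolver polyRing
    module PD = Divisibility polyRing

    Bounded : Poly → ℕ → Set
    Bounded r e = ∀ i → e ℕ.≤ i → coeff r i ≡ 0#

    -- The constant term comes first, so the tail is divided before the head. If r is its remainder,
    -- x + t r has no coefficient above e, and subtracting c b clears the one at e.
    long-division : ∀ b {e} → HasDegree b e → ∀ a → ∃₂ λ s r → a ≃ s *P b +P r × Bounded r e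
    long-division b hb [] = [] , [] , ≃.refl , λ _ _ → refl
    long-division b {e} hb@(n , z) (x ∷ a) =
      let s , r , a≃ , small = long-division b hb a
          lead⁻¹ , inv = FiniteField.inverse K (coeff b e) n
          c = coeff (x ∷ r) e * lead⁻¹
      in c ∷ s , (x ∷ r) +P (-P (c ⊛ b)) , step s r c a≃ , bounded r c inv small
      where
      step : ∀ s r c → a ≃ s *P b +P r → (x ∷ a) ≃ (c ∷ s) *P b +P ((x ∷ r) +P (-P (c ⊛ b)))
      step s r c a≃ = begin
        x ∷ a                                            ≈⟨ ∷-cong (≡.sym (F.+-identityˡ x)) a≃ ⟩
        shift (s *P b) +P (x ∷ r)                        ≈⟨ PS.solve 3 (λ u v w → u PS.:+ v PS.:= (w PS.:+ u) PS.:+ (v PS.:+ PS.:- w)) ≃.refl (shift (s *P b)) (x ∷ r) (c ⊛ b) ⟩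
        (c ∷ s) *P b +P ((x ∷ r) +P (-P (c ⊛ b)))        ∎
      bounded : ∀ r c → coeff b e * proj₁ (FiniteField.inverse K (coeff b e) n) ≡ 1# → Bounded r e →
                Bounded ((x ∷ r) +P (-P ((coeff (x ∷ r) e * proj₁ (FiniteField.inverse K (coeff b e) n)) ⊛ b))) e
      bounded r _ inv small i e≤i = ≡.trans (≡.trans (coeff-+ (x ∷ r) (-P (c ⊛ b)) i) (≡.cong (coeff (x ∷ r) i +_)
          (≡.trans (coeff-neg (c ⊛ b) i) (≡.cong -_ (coeff-⊛ c b i))))) (vanish i e≤i (ℕ.m≤n⇒m<n∨m≡n e≤i))
        where
        lead⁻¹ c : F
        lead⁻¹ = proj₁ (FiniteField.inverse K (coeff b e) n)
        c = coeff (x ∷ r) e * lead⁻¹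
        vanish : ∀ i → e ℕ.≤ i → e ℕ.< i ⊎ e ≡ i → coeff (x ∷ r) i + - (c * coeff b i) ≡ 0#
        vanish i e≤i (inj₂ refl′) with refl′
        ... | ≡.refl = modulo₁ (- (coeff (x ∷ r) e)) inv (solve 3 (λ u v w → u :+ :- (u :* w :* v) := :0 :+ ((:- u) :* (v :* w :- :1))) refl (coeff (x ∷ r) e) (coeff b e) lead⁻¹)
        vanish (suc i) e≤i (inj₁ (ℕ.s≤s e≤i′)) = modulo₂ 1# (small i e≤i′) (- c) (z (suc i) (ℕ.s≤s e≤i′)) (solve 3 (λ u v c → u :+ :- (c :* v) := :0 :+ (:1 :* (u :- :0) :+ ((:- c) :* (v :- :0)))) refl (coeff r i) (coeff b (suc i)) c)

    division : ∀ a b → ¬ b ≃ [] → ∃₂ λ s r → a ≃ s *P b +P r × (r ≃ [] ⊎ deg r ℕ.< deg b)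
    division a b b≄0 = let s , r , e , small = long-division b (deg-has b b≄0) a in s , r , e , size r small
      where
      size : ∀ r → Bounded r (deg b) → r ≃ [] ⊎ deg r ℕ.< deg b
      size r small with degree r
      ... | inj₁ r≃0         = inj₁ r≃0
      ... | inj₂ (d , n , _) = inj₂ (ℕ.≰⇒> (λ le → n (small d le)))

    residues : ∀ D → ¬ D ≃ [] → ∃ λ N → Σ (Fin N → Poly) λ rep → Σ (Poly → Fin N) λ index → ∀ f → PD._≡_[_] f (rep (index f)) D
    residues D D≄0 = q ℕ.^ e , rep , index , ok
      where
      e : ℕ
      e = deg D
      rem : Poly → Poly
      rem f = proj₁ (proj₂ (long-division D (deg-has D D≄0) f))
      rep : Fin (q ℕ.^ e) → Poly
      rep i = tabulate (finToFun {q} {e} i)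
      index : Poly → Fin (q ℕ.^ e)
      index f = funToFin {e} {q} (λ j → coeff (rem f) (toℕ j))
      coeff-tabulate : ∀ {k} (g : Fin k → F) r → (∀ j → g j ≡ coeff r (toℕ j)) → Bounded r k → tabulate g ≈ r
      coeff-tabulate {zero} g r e b i = ≡.sym (b i ℕ.z≤n)
      coeff-tabulate {suc k} g [] e b zero = e Fin.zero
      coeff-tabulate {suc k} g (x ∷ r) e b zero = e Fin.zero
      coeff-tabulate {suc k} g [] e b (suc i) = coeff-tabulate (g ∘ Fin.suc) [] (λ j → e (Fin.suc j)) (λ _ _ → refl) i
      coeff-tabulate {suc k} g (x ∷ r) e b (suc i) = coeff-tabulate (g ∘ Fin.suc) r (λ j → e (Fin.suc j)) (λ i le → b (suc i) (ℕ.s≤s le)) i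
      ok : ∀ f → PD._≡_[_] f (rep (index f)) D
      ok f = let s , r , f≃ , small = long-division D (deg-has D D≄0) f
                 r≃ = pointwise (coeff-tabulate (finToFun {q} {e} (index f)) r (Fin.finToFun-funToFin {e} {q} (λ j → coeff r (toℕ j))) small)
             in s , (begin
               f +P (-P rep (index f))                ≈⟨ +-cong f≃ (CommutativeRing.-‿cong polyRing r≃) ⟩
               (s *P D +P r) +P (-P r)                ≈⟨ PS.solve 2 (λ u v → (u PS.:+ v) PS.:+ PS.:- v PS.:= u) ≃.refl (s *P D) r ⟩
               s *P D                                 ∎)

    -- (x + t f)′ = f + t f′
    ∂ : Poly → Poly
    ∂ []      = []
    ∂ (x ∷ f) = f +P shift (∂ f)

    ∂-zero : ∀ f → f ≃ [] → ∂ f ≃ []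
    ∂-zero [] e = ≃.refl
    ∂-zero (x ∷ f) e = +-cong (tail-[] e) (shift-zero (∂-zero f (tail-[] e)))

    ∂-cong : ∀ {f g} → f ≃ g → ∂ f ≃ ∂ g
    ∂-cong {[]} {g} e = ≃.sym (∂-zero g (≃.sym e))
    ∂-cong {x ∷ f} {[]} e = ∂-zero (x ∷ f) e
    ∂-cong {x ∷ f} {y ∷ g} e = +-cong (tail-≃ e) (∷-cong refl (∂-cong {f} {g} (tail-≃ e)))

    ∂-+ : ∀ f g → ∂ (f +P g) ≃ ∂ f +P ∂ g
    ∂-+ [] g = ≃.refl
    ∂-+ (x ∷ f) [] = ≃.sym (+-identityʳ _)
    ∂-+ (x ∷ f) (y ∷ g) = ≃.trans (+-congˡ {f +P g} (≃.trans (∷-cong refl (∂-+ f g)) (shift-+ (∂ f) (∂ g)))) (interchange f g _ _)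

    ∂-⊛ : ∀ c f → ∂ (c ⊛ f) ≃ c ⊛ ∂ f
    ∂-⊛ c [] = ≃.refl
    ∂-⊛ c (x ∷ f) = ≃.trans (+-congˡ {c ⊛ f} (≃.trans (∷-cong refl (∂-⊛ c f)) (≃.sym (⊛-shift c (∂ f))))) (≃.sym (⊛-+ c f (shift (∂ f))))

    ∂-* : ∀ f g → ∂ (f *P g) ≃ ∂ f *P g +P f *P ∂ g
    ∂-* [] g = ≃.refl
    ∂-* (x ∷ f) g = begin
      ∂ (x ⊛ g +P shift (f *P g))                                           ≈⟨ ∂-+ (x ⊛ g) (shift (f *P g)) ⟩
      ∂ (x ⊛ g) +P (f *P g +P shift (∂ (f *P g)))                           ≈⟨ +-cong (∂-⊛ x g) (+-congˡ {f *P g} (≃.trans (∷-cong refl (∂-* f g)) (shift-+ (∂ f *P g) (f *P ∂ g)))) ⟩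
      x ⊛ ∂ g +P (f *P g +P (shift (∂ f *P g) +P shift (f *P ∂ g)))
        ≈⟨ PS.solve 4 (λ u v w k → u PS.:+ (v PS.:+ (w PS.:+ k)) PS.:= (v PS.:+ w) PS.:+ (u PS.:+ k)) ≃.refl (x ⊛ ∂ g) (f *P g) (shift (∂ f *P g)) (shift (f *P ∂ g)) ⟩
      (f *P g +P shift (∂ f *P g)) +P (x ⊛ ∂ g +P shift (f *P ∂ g))         ≈⟨ +-congʳ (+-congˡ {f *P g} (≃.sym (shift-* (∂ f) g))) ⟩
      (f *P g +P shift (∂ f) *P g) +P (x ⊛ ∂ g +P shift (f *P ∂ g))         ≈⟨ +-congʳ (distribʳ g f (shift (∂ f))) ⟨
      (f +P shift (∂ f)) *P g +P (x ∷ f) *P ∂ g                             ∎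

    poly-·1 : ∀ k → Algebra.Properties.Semiring.Mult._×_ (CommutativeRing.semiring polyRing) k 1P ≃ (k · 1#) ∷ []
    poly-·1 zero    = ≃.sym shift-[]
    poly-·1 (suc k) = +-congˡ {1P} (poly-·1 k)

  polyArithmetic : Arithmetic
  polyArithmetic = record
    { commRing = polyRing
    ; p        = proj₁ characteristic
    ; p-prime  = proj₁ (proj₂ characteristic)
    ; p·1≈0    = ≃.trans (poly-·1 (proj₁ characteristic)) (≃.trans (∷-cong (proj₂ (proj₂ (proj₂ characteristic))) ≃.refl) shift-[])
    ; 0≉1      = λ e → FiniteField.0≢1 K (at e 0)
    ; _≟0      = zero?
    ; integral = integral
    ; deg      = deg
    ; deg-cong = deg-cong
    ; deg-*    = deg-*
    ; division = division
    ; residues = residues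
    ; ∂        = ∂
    ; ∂-cong   = λ {f} {g} → ∂-cong {f} {g}
    ; ∂-+      = ∂-+
    ; ∂-*      = ∂-*
    ; t        = 0# ∷ 1# ∷ []
    ; ∂t≈1     = pointwise λ { zero → F.+-identityʳ 1# ; (suc zero) → refl ; (suc (suc i)) → refl }
    }

open import Data.Nat using (_<_; _*_)
open import Data.Nat.Divisibility using (_∣_; m∣m*n; ∣n⇒∣m*n)

-- Transfer to the matrices of the statement

module Translation {q : ℕ} (K : FiniteField q) where

  open WithField K
  open Polynomials K using (_≃_; pointwise; polyArithmetic; polyRing; module FieldFacts)
  open _≃_
  open Arith polyArithmetic using (Coprime; coprime-if; p) renaming (_∣_ to _∣ᴬ_; ∣-trans to ∣ᴬ-trans)
  module A = CommutativeRing polyRing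
  open A using (1#)
  module SL₂ = SpecialLinear polyArithmetic
  open SL₂ using (sl; γ; _∙Γ_; 1Γ)
  module AL = AtkinLehner polyArithmetic

  element : ∀ {m} g → Γ m g → SL₂.Γ m
  element g (e , (k₁ , e₁) , (k₂ , e₂) , (k₃ , e₃) , (k₄ , e₄)) = γ (sl (a g) (b g) (c g) (d g) (pointwise e))
    (k₁ , pointwise e₁) (k₂ , pointwise e₂) (k₃ , pointwise e₃) (k₄ , pointwise e₄)

  matrix : ∀ {m} → SL₂.Γ m → Mat
  matrix g = mat (SL₂.Γ.a g) (SL₂.Γ.b g) (SL₂.Γ.c g) (SL₂.Γ.d g)

  matrix∈Γ : ∀ {m} (g : SL₂.Γ m) → Γ m (matrix g)
  matrix∈Γ (γ (sl _ _ _ _ e) (k₁ , e₁) (k₂ , e₂) (k₃ , e₃) (k₄ , e₄)) =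
    at e , (k₁ , at e₁) , (k₂ , at e₂) , (k₃ , at e₃) , (k₄ , at e₄)

  record _≋ₘ_ (g h : Mat) : Set where
    constructor mk≋ₘ
    field
      a≈ : a g ≃ a h
      b≈ : b g ≃ b h
      c≈ : c g ≃ c h
      d≈ : d g ≃ d h

  ≋ₘ-trans : ∀ {g h k} → g ≋ₘ h → h ≋ₘ k → g ≋ₘ k
  ≋ₘ-trans (mk≋ₘ p q r s) (mk≋ₘ p′ q′ r′ s′) = mk≋ₘ (A.trans p p′) (A.trans q q′) (A.trans r r′) (A.trans s s′)

  ≡⇒≋ₘ : ∀ {g h} → g ≡ h → g ≋ₘ h
  ≡⇒≋ₘ ≡.refl = mk≋ₘ A.refl A.refl A.refl A.refl

  ·-congʳ : ∀ {g g′} h → g ≋ₘ g′ → (g · h) ≋ₘ (g′ · h)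
  ·-congʳ {g} {g′} h (mk≋ₘ p q r s) = mk≋ₘ (row p q (a h) (c h)) (row p q (b h) (d h)) (row r s (a h) (c h)) (row r s (b h) (d h))
    where
    row : ∀ {x x′ y y′} → x ≃ x′ → y ≃ y′ → ∀ z w → (x *P z +P y *P w) ≃ (x′ *P z +P y′ *P w)
    row {x} {x′} {y} {y′} e e′ z w = A.+-cong {x *P z} {x′ *P z} {y *P w} {y′ *P w} (A.*-congʳ {z} {x} {x′} e) (A.*-congʳ {w} {y} {y′} e′)

  matrix-cong : ∀ {m} (g h : SL₂.Γ m) → SL₂.Γ.el g SL₂.≋ SL₂.Γ.el h → matrix g ≋ₘ matrix h
  matrix-cong g h (SL₂.mk≋ a≈ b≈ c≈ d≈) = mk≋ₘ a≈ b≈ c≈ d≈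

  inComm : ∀ {m g} cs → All (λ xy → Γ m (proj₁ xy) × Γ m (proj₂ xy)) cs → g ≋ₘ commProd cs → InComm (Γ m) g
  inComm cs members (mk≋ₘ p q r s) = cs , members , at p , at q , at r , at s

  irreducible⇒coprime : ∀ {n π} → Irreducible π → ¬ (π ∣P n) → Coprime π n
  irreducible⇒coprime {n} {π} (_ , _ , split) π∤n = coprime-if common
    where
    common : ∀ δ → δ ∣ᴬ π → δ ∣ᴬ n → δ ∣ᴬ 1#
    common δ (k , e) δ∣n = [ (λ (u , e′) → contradiction (divisor u e′) π∤n) , (λ (u , e′) → u , A.trans (A.sym (pointwise {δ *P u} {1P} e′)) (A.*-comm δ u)) ]′ (split k δ (at e))
      where
      divisor : ∀ u → k *P u ≈ 1P → π ∣P n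
      divisor u e′ = let j , e″ = ∣ᴬ-trans (u , δ≈) δ∣n in j , at e″
        where
        open A
        δ≈ : δ A.≈ u A.* π
        δ≈ = A.trans (A.sym (A.trans (A.*-congʳ {δ} (pointwise {k *P u} {1P} e′)) (A.*-identityˡ δ)))
               (A.trans (A.*-congʳ {δ} (A.*-comm k u)) (A.trans (A.*-assoc u k δ) (A.*-congˡ {u} (A.sym e))))

  module _ {n π : Poly} (n≉0 : ¬ n ≈ 0P) (irr : Irreducible π) (π∤n : ¬ (π ∣P n))
           (l : ℕ) (l-prime : Prime l) (l∤2q : ¬ (l ∣ 2 * q)) where

    private
      p∣q : p ∣ q
      p∣q = proj₁ (proj₂ (proj₂ FieldFacts.characteristic))

      l≢2 : l ≢ 2
      l≢2 ≡.refl = l∤2q (m∣m*n q)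

      p≢l : p ≢ l
      p≢l p≡l = l∤2q (≡.subst (_∣ 2 * q) p≡l (∣n⇒∣m*n 2 p∣q))

      π∤1 : ¬ π ∣ᴬ 1#
      π∤1 (k , e) = proj₁ (proj₂ irr) (k , at (A.trans (A.*-comm π k) (A.sym e)))

      module Surj = AL.Surjectivity {n} {π} (λ e → n≉0 (at e)) (irreducible⇒coprime irr π∤n) π∤1 (λ e → proj₁ irr (at e)) l l-prime l≢2 p≢l
      open Surj using (Γ²; module Γ²)
      open AbelianQuotients Γ² using (Derived; commutators)
      module G = Group (SL₂.ΓGroup n)

    module Projection (pr : SL₂.Γ n × SL₂.Γ n → SL₂.Γ n)
      (pr-cong : ∀ {x y} → x Γ².≈ y → pr x G.≈ pr y)
      (pr-ε : pr Γ².ε ≡ 1Γ) (pr-∙ : ∀ x y → pr (x Γ².∙ y) ≡ pr x ∙Γ pr y) (pr-⁻¹ : ∀ x → pr (x Γ².⁻¹) ≡ SL₂.invΓ (pr x)) where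

      matrices : List ((SL₂.Γ n × SL₂.Γ n) × (SL₂.Γ n × SL₂.Γ n)) → List (Mat × Mat)
      matrices = map (λ (x , y) → matrix (pr x) , matrix (pr y))

      commutator-product : ∀ cs → matrix (pr (commutators cs)) ≡ commProd (matrices cs)
      commutator-product []             = ≡.cong matrix pr-ε
      commutator-product ((x , y) ∷ cs) =
        ≡.trans (≡.cong matrix (≡.trans (pr-∙ _ (commutators cs)) (≡.cong (_∙Γ pr (commutators cs))
            (≡.trans (pr-∙ _ (y Γ².⁻¹)) (≡.cong₂ _∙Γ_ (≡.trans (pr-∙ _ (x Γ².⁻¹)) (≡.cong₂ _∙Γ_ (pr-∙ x y) (pr-⁻¹ x))) (pr-⁻¹ y))))))
          (≡.cong (λ m → matrix (pr x) · matrix (pr y) · matrix (pr x) ⁻¹ · matrix (pr y) ⁻¹ · m) (commutator-product cs))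

      members : ∀ cs → All (λ xy → Γ n (proj₁ xy) × Γ n (proj₂ xy)) (matrices cs)
      members []             = []
      members ((x , y) ∷ cs) = (matrix∈Γ (pr x) , matrix∈Γ (pr y)) ∷ members cs

      power : ∀ k x → matrix (pr (k Surj.· x)) ≡ matrix (pr x) ^ k
      power zero    x = ≡.cong matrix pr-ε
      power (suc k) x = ≡.trans (≡.cong matrix (pr-∙ x (k Surj.· x))) (≡.cong (λ m → matrix (pr x) · m) (power k x))

      trivial : ∀ x y k → Derived (x Γ².∙ y Γ².⁻¹ Γ².∙ l Surj.· (k Γ².⁻¹)) → ∀ g → g ≋ₘ matrix (pr x) →
                TrivialInBar (Γ n) (g · matrix (pr y) ⁻¹ · (matrix (pr k) ⁻¹) ^ l)
      -- The value 0 stands for the exponent 1: the relation already holds in Γ(n)^ab, before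
      -- torsion is divided out.
      trivial x y k (cs , e) g g≈ = 0 , inComm (matrices cs) (members cs)
          (≋ₘ-trans {h = matrix (pr z ∙Γ 1Γ)} (·-congʳ 1M (≋ₘ-trans {h = matrix (pr x) · matrix (pr y) ⁻¹ · h} (·-congʳ h (·-congʳ (matrix (pr y) ⁻¹) g≈)) (≡⇒≋ₘ same)))
            (≋ₘ-trans {h = matrix (pr z)} (matrix-cong (pr z ∙Γ 1Γ) (pr z) (G.identityʳ (pr z)))
              (≋ₘ-trans {h = matrix (pr (commutators cs))} (matrix-cong (pr z) (pr (commutators cs)) (pr-cong {z} {commutators cs} e))
                (≡⇒≋ₘ (commutator-product cs)))))
        where
        h : Mat
        h = (matrix (pr k) ⁻¹) ^ l
        z : SL₂.Γ n × SL₂.Γ n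
        z = x Γ².∙ y Γ².⁻¹ Γ².∙ l Surj.· (k Γ².⁻¹)
        same : matrix (pr x) · matrix (pr y) ⁻¹ · h ≡ matrix (pr z)
        same = ≡.sym (≡.trans (≡.cong matrix (≡.trans (pr-∙ _ (l Surj.· (k Γ².⁻¹))) (≡.cong (_∙Γ pr (l Surj.· (k Γ².⁻¹)))
                 (≡.trans (pr-∙ x (y Γ².⁻¹)) (≡.cong (λ u → pr x ∙Γ u) (pr-⁻¹ y))))))
                 (≡.cong (λ m → matrix (pr x) · matrix (pr y) ⁻¹ · m) (≡.trans (power l (k Γ².⁻¹)) (≡.cong (λ u → matrix u ^ l) (pr-⁻¹ k)))))

    private
      module P₁ = Projection proj₁ proj₁ ≡.refl (λ _ _ → ≡.refl) (λ _ → ≡.refl)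
      module P₂ = Projection proj₂ proj₂ ≡.refl (λ _ _ → ≡.refl) (λ _ → ≡.refl)

    mod-l-surjective : ∀ g₁ g₂ → Γ n g₁ → Γ n g₂ → ∃ λ g → ∃ λ c′ → ∃ λ h₁ → ∃ λ h₂ →
      Γ₀∩Γ π n g × c g ≈ π *P c′ × Γ n h₁ × Γ n h₂
      × TrivialInBar (Γ n) (g · g₁ ⁻¹ · (h₁ ⁻¹) ^ l) × TrivialInBar (Γ n) (wv π c′ g · g₂ ⁻¹ · (h₂ ⁻¹) ^ l)
    mod-l-surjective g₁ g₂ γ₁ γ₂ = conclude (Surj.surjective x₁ x₂)
      where
      open import Algebra.Properties.Ring A.ring using (-‿involutive)
      x₁ x₂ : SL₂.Γ n
      x₁ = element g₁ γ₁
      x₂ = element g₂ γ₂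
      conclude : (∃ λ g → ∃ λ h → g AL.↔[ π ] h × ∃ λ k → Derived ((g , h) Γ².∙ (x₁ , x₂) Γ².⁻¹ Γ².∙ l Surj.· (k Γ².⁻¹))) →
        ∃ λ g → ∃ λ c′ → ∃ λ h₁ → ∃ λ h₂ →
        Γ₀∩Γ π n g × c g ≈ π *P c′ × Γ n h₁ × Γ n h₂
        × TrivialInBar (Γ n) (g · g₁ ⁻¹ · (h₁ ⁻¹) ^ l) × TrivialInBar (Γ n) (wv π c′ g · g₂ ⁻¹ · (h₂ ⁻¹) ^ l)
      conclude (g , h , AL.partners a≈ c≈ c′≈ d≈ , k , e) =
          matrix g , c′ , matrix (proj₁ k) , matrix (proj₂ k)
        , (matrix∈Γ g , c′ , at (A.trans c≈ (A.*-comm π c′))) , at c≈ , matrix∈Γ (proj₁ k) , matrix∈Γ (proj₂ k)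
        , P₁.trivial (g , h) (x₁ , x₂) k e (matrix g) (≡⇒≋ₘ ≡.refl)
        , P₂.trivial (g , h) (x₁ , x₂) k e (wv π c′ (matrix g)) (mk≋ₘ d≈ (-‿involutive (SL₂.Γ.b h)) (A.sym c′≈) a≈)
        where
        -- The upper right entry -c/π of w(g) is the entry b of the partner h, so c/π is -b.
        c′ : Poly
        c′ = -P SL₂.Γ.b h

theorem2p2p1 : (q : ℕ) (K : FiniteField q) → 4 < q →
    let open WithField K in
    (n π : Poly) → ¬ (n ≈ 0P) → Monic π → Irreducible π → ¬ (π ∣P n) →
    (l : ℕ) → Prime l → ¬ (l ∣ 2 * q) →
    (g₁ g₂ : Mat) → Γ n g₁ → Γ n g₂ →
    ∃ λ γ → ∃ λ c' → ∃ λ h₁ → ∃ λ h₂ →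
      Γ₀∩Γ π n γ × c γ ≈ π *P c' × Γ n h₁ × Γ n h₂
      × TrivialInBar (Γ n) (γ · g₁ ⁻¹ · (h₁ ⁻¹) ^ l)
      × TrivialInBar (Γ n) (wv π c' γ · g₂ ⁻¹ · (h₂ ⁻¹) ^ l)
theorem2p2p1 q K _ n π n≉0 _ irr π∤n l l-prime l∤2q = Translation.mod-l-surjective K n≉0 irr π∤n l l-prime l∤2q
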